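{- Let $p$ be an odd prime. Then $$S_{p-1}\equiv\left(\frac{ -2}{p}\right)\pmod p,$$ and $$\chi'(K_{p-1})=\chi'_{\ell}(K_{p-1})=\chi'_{\mathrm P}(K_{p-1})=p-2.$$ Here $\left(\frac{\cdot}{p}\right)$ is the Legendre symbol, and $S_n$, $\chi'$, $\chi'_\ell$, $\chi'_{\mathrm P}$ are as defined in the context.
   Context: Signed count. Let $n$ be even and order the vertices of $K_n$ as $0<1<\dots<n-1$. For a perfect matching $M$ let $\operatorname{cr}(M)$ be the number of unordered pairs of edges $\{a,c\},\{b,d\}\in M$ with $a<b<c<d$ (crossing pairs), and put $\varepsilon(M)=(-1)^{\operatorname{cr}(M)}$. A one-factorization of a graph is a partition of its edge set into perfect matchings (an unordered collection, whose members are called factors). For a one-factorization $\mathcal F$ put $\varepsilon(\mathcal F)=\prod_{M\in\mathcal F}\varepsilon(M)$. Define $S_n=\sum_{\mathcal F}\varepsilon(\mathcal F)$, the sum over all one-factorizations of $K_n$. Coloring indices of a graph $G$. $\chi'(G)$ is the ordinary edge chromatic index. $\chi'_\ell(G)$ is the least integer $k$ such that whenever each edge is assigned a list of $k$ colors, the edges can be properly colored from their lists. The edge-paintability index $\chi'_{\mathrm P}(G)$ is the least $k$ for which Painter has a winning strategy in the following game: each edge starts with $k$ tokens; in each round Lister marks a nonempty set of uncolored edges and removes one token from each of them; Painter then colors a matching consisting of marked edges (these edges are then colored permanently). After Painter's move, Lister wins if some uncolored edge has no token left. Painter wins if every edge is eventually colored. -}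

module Defs where

open import Data.Bool.Base using (if_then_else_)
open import Data.Fin.Base using (Fin; toℕ; _<_)
open import Data.Fin.Properties using (_≟_; _<?_; all?; any?)
open import Data.Fin.Subset using (Subset; inside; outside; ⊤; _∈_; _⊆_; _∩_; _─_; Nonempty; Empty)
open import Data.Fin.Subset.Properties using (_∈?_; nonempty?)
open import Data.Integer.Base as ℤ using (ℤ; +_; 0ℤ; 1ℤ; -1ℤ)
open import Data.Integer.Divisibility.Signed using (_∣_; _∣?_)
open import Data.List.Base using (List; []; _∷_; _++_; map; filter; foldr; length; lookup; allFin; cartesianProduct)
import Data.List.Membership.Propositional as List
open import Data.List.Relation.Unary.All as All using (All)
open import Data.List.Relation.Unary.AllPairs as AllPairs using (AllPairs)
open import Data.List.Relation.Unary.Any as Any using (Any)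
open import Data.List.Relation.Unary.Unique.Propositional using (Unique)
open import Data.Nat.Base as ℕ using (ℕ; zero; suc; _∸_; _≤_)
open import Data.Product.Base using (Σ; ∃; _×_; _,_; proj₁; proj₂)
open import Data.Sum.Base using (_⊎_)
open import Data.Vec.Base as Vec using ()
open import Level using (0ℓ)
open import Relation.Binary.Core using (Rel)
open import Relation.Binary.Definitions using (Decidable; Symmetric; Irreflexive)
open import Relation.Binary.PropositionalEquality using (_≡_; _≢_; ≢-sym)
open import Relation.Nullary using (Dec; does; ¬_; ¬?; _×-dec_; _⊎-dec_; _→-dec_)
import Relation.Unary as Unary

-- Finite simple graphs

record Graph (n : ℕ) : Set₁ where
  field
    Adj    : Rel (Fin n) 0ℓ
    adj?   : Decidable Adj
    symm   : Symmetric Adj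
    irrefl : Irreflexive _≡_ Adj

K : ∀ n → Graph n
K n = record
  { Adj    = _≢_
  ; adj?   = λ u v → ¬? (u ≟ v)
  ; symm   = ≢-sym
  ; irrefl = λ u≡v u≢v → u≢v u≡v
  }

module _ {n : ℕ} (G : Graph n) where
  open Graph G

  -- Each edge {u , v} is listed once, as the pair with u < v.
  edges : List (Fin n × Fin n)
  edges = filter (λ (u , v) → (u <? v) ×-dec adj? u v)
                 (cartesianProduct (allFin n) (allFin n))

  Edge : Set
  Edge = Fin (length edges)

  EdgeSet : Set
  EdgeSet = Subset (length edges)

  lo hi : Edge → Fin n
  lo e = proj₁ (lookup edges e)
  hi e = proj₂ (lookup edges e)

  Incident : Fin n → Edge → Set
  Incident v e = v ≡ lo e ⊎ v ≡ hi e

  Incident? : Decidable Incident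
  Incident? v e = (v ≟ lo e) ⊎-dec (v ≟ hi e)

  AdjEdges : Rel Edge 0ℓ
  AdjEdges e f = e ≢ f × ∃ λ v → Incident v e × Incident v f

  AdjEdges? : Decidable AdjEdges
  AdjEdges? e f = ¬? (e ≟ f) ×-dec any? (λ v → Incident? v e ×-dec Incident? v f)

  IsMatching : EdgeSet → Set
  IsMatching M = ∀ e f → e ∈ M → f ∈ M → ¬ AdjEdges e f

  IsMatching? : Unary.Decidable IsMatching
  IsMatching? M = all? λ e → all? λ f →
    (e ∈? M) →-dec ((f ∈? M) →-dec ¬? (AdjEdges? e f))

  IsPerfectMatching : EdgeSet → Set
  IsPerfectMatching M = IsMatching M × (∀ v → ∃ λ e → e ∈ M × Incident v e)

  IsPerfectMatching? : Unary.Decidable IsPerfectMatching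
  IsPerfectMatching? M =
    IsMatching? M ×-dec all? (λ v → any? (λ e → (e ∈? M) ×-dec Incident? v e))

  -- The members of the list are the blocks of a partition of the edge set.
  IsOneFactorization : List EdgeSet → Set
  IsOneFactorization F =
      All IsPerfectMatching F
    × All Nonempty F
    × AllPairs (λ M N → Empty (M ∩ N)) F
    × (∀ e → Any (e ∈_) F)

  IsOneFactorization? : Unary.Decidable IsOneFactorization
  IsOneFactorization? F =
          All.all? IsPerfectMatching? F
    ×-dec All.all? nonempty? F
    ×-dec AllPairs.allPairs? (λ M N → ¬? (nonempty? (M ∩ N))) F
    ×-dec all? (λ e → Any.any? (e ∈?_) F)

subsets : ∀ m → List (Subset m)
subsets zero    = Vec.[] ∷ []
subsets (suc m) = map (outside Vec.∷_) (subsets m) ++ map (inside Vec.∷_) (subsets m)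

sublists : ∀ {A : Set} → List A → List (List A)
sublists []       = [] ∷ []
sublists (x ∷ xs) = sublists xs ++ map (x ∷_) (sublists xs)

module _ {n : ℕ} (G : Graph n) where

  perfectMatchings : List (EdgeSet G)
  perfectMatchings = filter (IsPerfectMatching? G) (subsets (length (edges G)))

  -- perfectMatchings has no repetitions, so its sublists correspond
  -- bijectively to sets of perfect matchings: every one-factorization, as an
  -- unordered collection, occurs exactly once here.
  oneFactorizations : List (List (EdgeSet G))
  oneFactorizations = filter (IsOneFactorization? G) (sublists perfectMatchings)

  -- Among the two orderings of a crossing pair {a,c}, {b,d} with a < b < c < d
  -- only (ac , bd) satisfies Crosses, so counting ordered pairs in cr counts
  -- each unordered crossing pair once.
  Crosses : Rel (Edge G) 0ℓ
  Crosses e f = lo G e < lo G f × lo G f < hi G e × hi G e < hi G f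

  Crosses? : Decidable Crosses
  Crosses? e f = (lo G e <? lo G f) ×-dec (lo G f <? hi G e) ×-dec (hi G e <? hi G f)

  cr : EdgeSet G → ℕ
  cr M = length (filter (λ (e , f) → (e ∈? M) ×-dec (f ∈? M) ×-dec Crosses? e f)
                        (cartesianProduct (allFin _) (allFin _)))

  ε : EdgeSet G → ℤ
  ε M = -1ℤ ℤ.^ cr M

  εF : List (EdgeSet G) → ℤ
  εF F = foldr ℤ._*_ 1ℤ (map ε F)

S : ℕ → ℤ
S n = foldr ℤ._+_ 0ℤ (map (εF (K n)) (oneFactorizations (K n)))

infix 4 _≡_[mod_]

_≡_[mod_] : ℤ → ℤ → ℕ → Set
a ≡ b [mod p ] = + p ∣ (a ℤ.- b)

-- The Legendre symbol (a/p); x ranges over the residues 0, …, p - 1.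
legendre : ℤ → ℕ → ℤ
legendre a p =
  if does (+ p ∣? a) then 0ℤ
  else if does (any? λ (x : Fin p) → + p ∣? (+ toℕ x ℤ.* + toℕ x ℤ.- a)) then 1ℤ
  else -1ℤ

IsLeast : (ℕ → Set) → ℕ → Set
IsLeast P k = P k × (∀ j → P j → k ≤ j)

module _ {n : ℕ} (G : Graph n) where

  Proper : {C : Set} → (Edge G → C) → Set
  Proper c = ∀ e f → AdjEdges G e f → c e ≢ c f

  EdgeColorable : ℕ → Set
  EdgeColorable k = Σ (Edge G → Fin k) Proper

  EdgeChoosable : ℕ → Set
  EdgeChoosable k =
    (L : Edge G → List ℕ) → (∀ e → Unique (L e) × length (L e) ≡ k) →
    Σ (Edge G → ℕ) λ c → (∀ e → c e List.∈ L e) × Proper c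

  removeTokens : EdgeSet G → (Edge G → ℕ) → (Edge G → ℕ)
  removeTokens R t e = if does (e ∈? R) then t e ∸ 1 else t e

  -- PainterWins U t: Painter has a winning strategy when a round is about to
  -- begin with the uncolored edges U and the token counts t.  Being inductive,
  -- it asserts that every play following the strategy reaches U = ∅.  Lister
  -- has won if some edge of U has no token; testing this before each round
  -- rather than after Painter's move differs only before the first round,
  -- where it says that edges starting with 0 tokens can never be colored.
  data PainterWins : EdgeSet G → (Edge G → ℕ) → Set where
    finished : ∀ {U t} → Empty U → PainterWins U t
    round    : ∀ {U t} →
      (∀ e → e ∈ U → 0 ℕ.< t e) →
      (∀ R → Nonempty R → R ⊆ U →
        ∃ λ M → M ⊆ R × IsMatching G M × PainterWins (U ─ M) (removeTokens R t)) →
      PainterWins U t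

  EdgePaintable : ℕ → Set
  EdgePaintable k = PainterWins ⊤ (λ _ → k)

  -- χ′≡ k says that the chromatic index exists and equals k; similarly below.
  χ′≡ χ′ℓ≡ χ′P≡ : ℕ → Set
  χ′≡  = IsLeast EdgeColorable
  χ′ℓ≡ = IsLeast EdgeChoosable
  χ′P≡ = IsLeast EdgePaintable

{-# OPTIONS --safe #-}
-- Put n = p - 1 = 2m and d = p - 2.  On words in the letters (v , i), v a vertex
-- and i < d a colour, let W be the fermionic Gaussian (Wick) functional whose
-- covariance joins letters of the same colour at the vertices 2j and 2j + 1.
-- Sum W over all edge colourings c of K n, evaluated at the word that lists
-- (lo e , c e) (hi e , c e) edge by edge.  Antisymmetry leaves only the
-- colourings that are ordered one-factorizations, each contributing its product
-- of crossing signs, so this moment is d! S n, and d! ≡ 1 by Wilson's theorem.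
--
-- Summing over colours turns Wick's rule into a recursion on lists of edges in
-- which d enters only as a scalar.  The same recursion with -2 in place of d
-- describes symplectic bosons with two indices.  As d ≡ -2, modulo p the moment
-- is the bosonic one, where the edges become the Vandermonde product
-- ∏ (z_v - z_u); its pairing with ∏ x! y! (-1)^y [x + y = d], over the exponents
-- x, y at 2j and 2j + 1, is 2^m m! ∏ (± x! (d - x)!) ≡ (-2)^m, and Euler's
-- criterion identifies this with the Legendre symbol.
--
-- So the moment is nonzero.  An alternating sum over the colours shows that a
-- nonzero multiple of it is a top coefficient of the graph polynomial of the
-- line graph, the one with all exponents d - 1.  The Alon-Tarsi argument in
-- Schauz's form then makes K n edge-paintable with d tokens.  Paintability
-- implies choosability, which implies colourability, which needs d colours at
-- any one vertex.
module Submission where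

open import Defs
open import Data.Bool.Base using (Bool; true; false; if_then_else_; not)
import Data.Bool.Properties as Boolₚ
open import Data.Empty using (⊥; ⊥-elim)
open import Data.Fin.Base as Fin using (Fin; zero; suc; toℕ)
open import Data.Fin.Properties as Fin using (any?)
open import Data.Fin.Subset as Subset using (Subset; inside; outside)
open import Data.Fin.Subset.Properties using (x∈p∩q⁺; x∈p∩q⁻; p─q⊆p; x∈p∧x∉q⇒x∈p─q; ∈⊤; nonempty?) renaming (_∈?_ to _∈?ˢ_)
open import Data.Integer.Base as ℤ hiding (+_; +0; suc; pred; _≤_; _<_; _⊔_; _⊓_)
open import Data.Integer.DivMod using (n%ℕd<d; a≡a%ℕn+[a/ℕn]*n)
open import Data.Integer.Divisibility.Signed as ℤ∣ using (divides; ∣⇒∣ᵤ; ∣ᵤ⇒∣; _∣?_)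
open import Data.Integer.Properties
open import Data.Integer.Tactic.RingSolver using (solve-∀)
open import Data.List.Base using (List; []; _∷_; _++_; map; filter; foldr; length; lookup; allFin; cartesianProduct; upTo; replicate)
open import Data.List.Membership.Propositional using (_∈_)
open import Data.List.Membership.Propositional.Properties using (∈-∃++; ∈-allFin; ∈-lookup; ∈-map⁺; ∈-map⁻; ∈-++⁺ˡ; ∈-++⁺ʳ; ∈-++⁻; ∈-filter⁺; ∈-filter⁻; ∈-upTo⁻; ∈-cartesianProduct⁺)
open import Data.List.Properties using (map-tabulate; length-tabulate; length-map; length-++; map-∘; map-++; ∷-injectiveˡ; ∷-injectiveʳ)
import Data.List.Properties as Listₚ
open import Data.List.Relation.Binary.Permutation.Propositional as Perm using (_↭_; prep; swap; ↭-sym)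
import Data.List.Relation.Binary.Permutation.Propositional.Properties as Permₚ
open import Data.List.Relation.Unary.All as All using (All; []; _∷_)
open import Data.List.Relation.Unary.All.Properties using (¬Any⇒All¬; All¬⇒¬Any)
import Data.List.Relation.Unary.All.Properties as Allₚ
open import Data.List.Relation.Unary.AllPairs as AllPairs using (AllPairs; []; _∷_)
import Data.List.Relation.Unary.AllPairs.Properties as AllPairsₚ
open import Data.List.Relation.Unary.Any as Any using (Any; here; there)
import Data.List.Relation.Unary.Any.Properties as Anyₚ
open import Data.List.Relation.Unary.Unique.Propositional using (Unique)
import Data.List.Relation.Unary.Unique.Propositional.Properties as Uniqueₚ
open import Data.Nat.Base as ℕ using (ℕ; zero; suc; _∸_; _≤_; _<_; z≤n; s≤s)
open import Data.Nat.Coprimality using (coprime-Bézout; prime⇒coprime)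
import Data.Nat.Divisibility as ℕ∣
open import Data.Nat.GCD using (module Bézout)
open import Data.Nat.Primality using (Prime; euclidsLemma; prime⇒nonZero; prime⇒irreducible; ¬prime[1])
import Data.Nat.Properties as ℕₚ
open import Data.Nat.Tactic.RingSolver using () renaming (solve-∀ to ℕ-solve-∀)
open import Data.Product.Base using (Σ; ∃; _×_; _,_; proj₁; proj₂)
import Data.Product.Properties as ×ₚ
open import Data.Sum.Base using (_⊎_; inj₁; inj₂)
open import Data.Unit.Base using (⊤; tt)
open import Data.Vec.Base as Vec using (Vec; []; _∷_)
open import Data.Vec.Properties using (lookup-replicate; length-toList; lookup-map; []=⇒lookup; lookup⇒[]=; toList-map; lookup∘tabulate)
open import Function.Base using (_∘_; id)
open import Relation.Binary.Definitions using (DecidableEquality; Tri; tri<; tri≈; tri>)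
open import Relation.Binary.PropositionalEquality
open import Relation.Nullary using (Dec; yes; no; does; ¬_; ¬?; _×-dec_; contradiction)
open import Relation.Nullary.Decidable using (dec-true)

-- The recursion sees the number of colours only where a contraction stays inside one edge: there an
-- index loop closes and contributes that number. A contraction between two edges merely reconnects
-- them. For bosons with an antisymmetric index form the loop has the opposite sign relative to the
-- reconnections; this is the duality between O(-2) and Sp(2). Two bosonic indices are the tractable
-- case because the invariant of an edge is then the linear form z_v - z_u, and d = p - 2 is the
-- number of colours that reaches it modulo p.
--
-- The other lever is that a colouring has d n letters, as many as the alphabet. Antisymmetric
-- functions of such words are proportional, so the Wick functional can be exchanged for others:
-- comparing letters by colour first yields the crossing signs, comparing them by vertex first
-- yields the graph polynomial of the line graph. For the same reason the covariance B affects the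
-- fermionic moment only through its normalization, and its block form is chosen so that the bosonic
-- value factors over pairs of vertices.

private
  variable
    A C : Set

-- Finite sums and products.

∑ ∏ : List A → (A → ℤ) → ℤ
∑ []       f = 0ℤ
∑ (x ∷ xs) f = f x + ∑ xs f
∏ []       f = 1ℤ
∏ (x ∷ xs) f = f x * ∏ xs f

syntax ∑ xs (λ x → e) = ∑[ x ← xs ] e
syntax ∏ xs (λ x → e) = ∏[ x ← xs ] e

infix 5 ∑ ∏

𝟙 : {P : Set} → Dec P → ℤ
𝟙 P? = if does P? then 1ℤ else 0ℤ

𝟙-yes : {P : Set} (P? : Dec P) → P → 𝟙 P? ≡ 1ℤ
𝟙-yes (yes _) _ = refl
𝟙-yes (no ¬p) p = contradiction p ¬p

𝟙-no : {P : Set} (P? : Dec P) → ¬ P → 𝟙 P? ≡ 0ℤ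
𝟙-no (yes p) ¬p = contradiction p ¬p
𝟙-no (no _)  _  = refl

𝟙-⇔ : {P Q : Set} (P? : Dec P) (Q? : Dec Q) → (P → Q) → (Q → P) → 𝟙 P? ≡ 𝟙 Q?
𝟙-⇔ (yes p) Q? f g = sym (𝟙-yes Q? (f p))
𝟙-⇔ (no ¬p) Q? f g = sym (𝟙-no Q? (¬p ∘ g))

𝟙-× : {P Q : Set} (P? : Dec P) (Q? : Dec Q) → 𝟙 (P? ×-dec Q?) ≡ 𝟙 P? * 𝟙 Q?
𝟙-× (no _)  _       = refl
𝟙-× (yes _) (no _)  = refl
𝟙-× (yes _) (yes _) = refl

private
  interchange-+ : ∀ a b c d → (a + b) + (c + d) ≡ (a + c) + (b + d)
  interchange-+ = solve-∀
  interchange-* : ∀ a b c d → (a * b) * (c * d) ≡ (a * c) * (b * d)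
  interchange-* = solve-∀

∑-cong : {f g : A → ℤ} (xs : List A) → (∀ x → f x ≡ g x) → ∑ xs f ≡ ∑ xs g
∑-cong []       eq = refl
∑-cong (x ∷ xs) eq = cong₂ _+_ (eq x) (∑-cong xs eq)

∏-cong : {f g : A → ℤ} (xs : List A) → (∀ x → f x ≡ g x) → ∏ xs f ≡ ∏ xs g
∏-cong []       eq = refl
∏-cong (x ∷ xs) eq = cong₂ _*_ (eq x) (∏-cong xs eq)

∑-zero : {f : A → ℤ} (xs : List A) → (∀ x → f x ≡ 0ℤ) → ∑ xs f ≡ 0ℤ
∑-zero []       eq = refl
∑-zero (x ∷ xs) eq = cong₂ _+_ (eq x) (∑-zero xs eq)

∏-one : {f : A → ℤ} (xs : List A) → (∀ x → f x ≡ 1ℤ) → ∏ xs f ≡ 1ℤ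
∏-one []       eq = refl
∏-one (x ∷ xs) eq = cong₂ _*_ (eq x) (∏-one xs eq)

∑-+ : (xs : List A) (f g : A → ℤ) → ∑ xs (λ x → f x + g x) ≡ ∑ xs f + ∑ xs g
∑-+ []       f g = refl
∑-+ (x ∷ xs) f g = trans (cong (f x + g x +_) (∑-+ xs f g)) (interchange-+ (f x) (g x) _ _)

∏-* : (xs : List A) (f g : A → ℤ) → ∏ xs (λ x → f x * g x) ≡ ∏ xs f * ∏ xs g
∏-* []       f g = refl
∏-* (x ∷ xs) f g = trans (cong (f x * g x *_) (∏-* xs f g)) (interchange-* (f x) (g x) _ _)

∑-*ˡ : (xs : List A) (a : ℤ) (f : A → ℤ) → ∑ xs (λ x → a * f x) ≡ a * ∑ xs f
∑-*ˡ []       a f = sym (*-zeroʳ a)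
∑-*ˡ (x ∷ xs) a f = trans (cong (a * f x +_) (∑-*ˡ xs a f)) (sym (*-distribˡ-+ a (f x) _))

∑-*ʳ : (xs : List A) (f : A → ℤ) (a : ℤ) → ∑ xs (λ x → f x * a) ≡ ∑ xs f * a
∑-*ʳ xs f a = trans (∑-cong xs λ x → *-comm (f x) a) (trans (∑-*ˡ xs a f) (*-comm a _))

∑-comm : (xs : List A) (ys : List C) (f : A → C → ℤ) →
         ∑[ x ← xs ] ∑[ y ← ys ] f x y ≡ ∑[ y ← ys ] ∑[ x ← xs ] f x y
∑-comm []       ys f = sym (∑-zero ys λ _ → refl)
∑-comm (x ∷ xs) ys f = trans (cong (∑ ys (f x) +_) (∑-comm xs ys f)) (sym (∑-+ ys (f x) _))

∏-comm : (xs : List A) (ys : List C) (f : A → C → ℤ) →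
         ∏[ x ← xs ] ∏[ y ← ys ] f x y ≡ ∏[ y ← ys ] ∏[ x ← xs ] f x y
∏-comm []       ys f = sym (∏-one ys λ _ → refl)
∏-comm (x ∷ xs) ys f = trans (cong (∏ ys (f x) *_) (∏-comm xs ys f)) (sym (∏-* ys (f x) _))

∑-++ : (xs ys : List A) (f : A → ℤ) → ∑ (xs ++ ys) f ≡ ∑ xs f + ∑ ys f
∑-++ []       ys f = sym (+-identityˡ _)
∑-++ (x ∷ xs) ys f = trans (cong (f x +_) (∑-++ xs ys f)) (sym (+-assoc (f x) _ _))

∏-++ : (xs ys : List A) (f : A → ℤ) → ∏ (xs ++ ys) f ≡ ∏ xs f * ∏ ys f
∏-++ []       ys f = sym (*-identityˡ _)
∏-++ (x ∷ xs) ys f = trans (cong (f x *_) (∏-++ xs ys f)) (sym (*-assoc (f x) _ _))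

∑-map : (h : C → A) (xs : List C) (f : A → ℤ) → ∑ (map h xs) f ≡ ∑ xs (f ∘ h)
∑-map h []       f = refl
∑-map h (x ∷ xs) f = cong (f (h x) +_) (∑-map h xs f)

∏-map : (h : C → A) (xs : List C) (f : A → ℤ) → ∏ (map h xs) f ≡ ∏ xs (f ∘ h)
∏-map h []       f = refl
∏-map h (x ∷ xs) f = cong (f (h x) *_) (∏-map h xs f)

∏-↭ : {xs ys : List A} → xs ↭ ys → (f : A → ℤ) → ∏ xs f ≡ ∏ ys f
∏-↭ _↭_.refl          f = refl
∏-↭ (prep x p)        f = cong (f x *_) (∏-↭ p f)
∏-↭ (swap x y p) f = trans (cong (λ z → f x * (f y * z)) (∏-↭ p f)) (lemma (f x) (f y) _)
  where
  lemma : ∀ a b c → a * (b * c) ≡ b * (a * c)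
  lemma = solve-∀
∏-↭ (_↭_.trans p q)   f = trans (∏-↭ p f) (∏-↭ q f)

∑-↭ : {xs ys : List A} → xs ↭ ys → (f : A → ℤ) → ∑ xs f ≡ ∑ ys f
∑-↭ _↭_.refl          f = refl
∑-↭ (prep x p)        f = cong (f x +_) (∑-↭ p f)
∑-↭ (swap x y p) f = trans (cong (λ z → f x + (f y + z)) (∑-↭ p f)) (lemma (f x) (f y) _)
  where
  lemma : ∀ a b c → a + (b + c) ≡ b + (a + c)
  lemma = solve-∀
∑-↭ (_↭_.trans p q)   f = trans (∑-↭ p f) (∑-↭ q f)

∑-filter : {P : A → Set} (P? : ∀ x → Dec (P x)) (xs : List A) (f : A → ℤ) →
           ∑ (filter P? xs) f ≡ ∑ xs (λ x → 𝟙 (P? x) * f x)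
∑-filter P? []       f = refl
∑-filter P? (x ∷ xs) f with P? x
... | yes _ = cong₂ _+_ (sym (*-identityˡ (f x))) (∑-filter P? xs f)
... | no _  = trans (∑-filter P? xs f) (sym (+-identityˡ _))

∏-filter : {P : A → Set} (P? : ∀ x → Dec (P x)) (xs : List A) (f : A → ℤ) →
           ∏ (filter P? xs) f ≡ ∏ xs (λ x → if does (P? x) then f x else 1ℤ)
∏-filter P? []       f = refl
∏-filter P? (x ∷ xs) f with P? x
... | yes _ = cong (f x *_) (∏-filter P? xs f)
... | no _  = trans (∏-filter P? xs f) (sym (*-identityˡ _))

∑-nonzero : (xs : List A) (f : A → ℤ) → ∑ xs f ≢ 0ℤ → ∃ λ x → f x ≢ 0ℤ
∑-nonzero []       f ≢0 = contradiction refl ≢0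
∑-nonzero (x ∷ xs) f ≢0 with f x ≟ 0ℤ
... | no fx≢0 = x , fx≢0
... | yes fx≡0 = ∑-nonzero xs f λ eq → ≢0 (cong₂ _+_ fx≡0 eq)

*-≢0 : ∀ {a b} → a ≢ 0ℤ → b ≢ 0ℤ → a * b ≢ 0ℤ
*-≢0 {a} a≢0 b≢0 ab≡0 with i*j≡0⇒i≡0∨j≡0 a ab≡0
... | inj₁ a≡0 = a≢0 a≡0
... | inj₂ b≡0 = b≢0 b≡0

≢0-*ˡ : ∀ {a b} → a * b ≢ 0ℤ → a ≢ 0ℤ
≢0-*ˡ ≢0 refl = ≢0 refl

≢0-*ʳ : ∀ {a b} → a * b ≢ 0ℤ → b ≢ 0ℤ
≢0-*ʳ {a} ≢0 refl = ≢0 (*-zeroʳ a)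

∏-≢0 : (xs : List A) {f : A → ℤ} → (∀ x → f x ≢ 0ℤ) → ∏ xs f ≢ 0ℤ
∏-≢0 []       f≢0 ()
∏-≢0 (x ∷ xs) f≢0 = *-≢0 (f≢0 x) (∏-≢0 xs f≢0)

∏-const : (xs : List A) (a : ℤ) → ∏[ _ ← xs ] a ≡ a ^ length xs
∏-const []       a = refl
∏-const (x ∷ xs) a = cong (a *_) (∏-const xs a)

-- Word sums come in two forms: lists can be cut, permuted and fed to antisymmetric functions, while
-- vectors allow the colour of an edge to be looked up.
module Words (xs : List A) where

  ∑ʷ : (N : ℕ) → (List A → ℤ) → ℤ
  ∑ʷ zero    F = F []
  ∑ʷ (suc N) F = ∑[ x ← xs ] ∑ʷ N (F ∘ (x ∷_))

  ∑ᵛ : (N : ℕ) → (Vec A N → ℤ) → ℤ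
  ∑ᵛ zero    F = F []
  ∑ᵛ (suc N) F = ∑[ x ← xs ] ∑ᵛ N (F ∘ (x ∷_))

  ∑ʷ-cong : ∀ N {F G} → (∀ w → length w ≡ N → F w ≡ G w) → ∑ʷ N F ≡ ∑ʷ N G
  ∑ʷ-cong zero    eq = eq [] refl
  ∑ʷ-cong (suc N) eq = ∑-cong xs λ x → ∑ʷ-cong N λ w l → eq (x ∷ w) (cong suc l)

  ∑ᵛ-cong : ∀ N {F G} → (∀ w → F w ≡ G w) → ∑ᵛ N F ≡ ∑ᵛ N G
  ∑ᵛ-cong zero    eq = eq []
  ∑ᵛ-cong (suc N) eq = ∑-cong xs λ x → ∑ᵛ-cong N λ w → eq (x ∷ w)

  ∑ʷ-*ˡ : ∀ N a F → ∑ʷ N (λ w → a * F w) ≡ a * ∑ʷ N F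
  ∑ʷ-*ˡ zero    a F = refl
  ∑ʷ-*ˡ (suc N) a F = trans (∑-cong xs λ x → ∑ʷ-*ˡ N a _) (∑-*ˡ xs a _)

  ∑ᵛ-*ˡ : ∀ N a F → ∑ᵛ N (λ w → a * F w) ≡ a * ∑ᵛ N F
  ∑ᵛ-*ˡ zero    a F = refl
  ∑ᵛ-*ˡ (suc N) a F = trans (∑-cong xs λ x → ∑ᵛ-*ˡ N a _) (∑-*ˡ xs a _)

  ∑ʷ-zero : ∀ N {F} → (∀ w → F w ≡ 0ℤ) → ∑ʷ N F ≡ 0ℤ
  ∑ʷ-zero zero    eq = eq []
  ∑ʷ-zero (suc N) eq = ∑-zero xs λ x → ∑ʷ-zero N λ w → eq (x ∷ w)

  ∑ᵛ-nonzero : ∀ N F → ∑ᵛ N F ≢ 0ℤ → ∃ λ w → F w ≢ 0ℤ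
  ∑ᵛ-nonzero zero    F ≢0 = [] , ≢0
  ∑ᵛ-nonzero (suc N) F ≢0 with ∑-nonzero xs _ ≢0
  ... | x , ≢0′ with ∑ᵛ-nonzero N _ ≢0′
  ...   | w , ≢0″ = x ∷ w , ≢0″

open Words public

-- Wick's rule

-- The sign `s` covers both statistics: -1 for fermions, 1 for bosons.
module Wick {A : Set} (β : A → A → ℤ) (s : ℤ) (s² : s * s ≡ 1ℤ) (β-sym : ∀ x y → β x y ≡ s * β y x) where

  -- The annihilation operator of x: x is paired with one letter, which is deleted, at the cost of a
  -- factor `s` for each letter passed. Acting on functions of words instead of words avoids formal
  -- sums.
  D : A → (List A → ℤ) → List A → ℤ
  D x F []      = 0ℤ
  D x F (z ∷ w) = β x z * F w + s * D x (F ∘ (z ∷_)) w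

  D-cong : ∀ x {F G : List A → ℤ} → (∀ w → F w ≡ G w) → ∀ w → D x F w ≡ D x G w
  D-cong x eq []      = refl
  D-cong x eq (z ∷ w) = cong₂ (λ a b → β x z * a + s * b) (eq w) (D-cong x (eq ∘ (z ∷_)) w)

  D-zero : ∀ x {F : List A → ℤ} → (∀ w → F w ≡ 0ℤ) → ∀ w → D x F w ≡ 0ℤ
  D-zero x eq []      = refl
  D-zero x eq (z ∷ w) = trans (cong₂ (λ a b → β x z * a + s * b) (eq w) (D-zero x (eq ∘ (z ∷_)) w))
                              (cong₂ _+_ (*-zeroʳ (β x z)) (*-zeroʳ s))

  D-linear : ∀ x a b (F G : List A → ℤ) w → D x (λ u → a * F u + b * G u) w ≡ a * D x F w + b * D x G w
  D-linear x a b F G []      = sym (cong₂ _+_ (*-zeroʳ a) (*-zeroʳ b))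
  D-linear x a b F G (z ∷ w) =
    trans (cong (λ y → β x z * (a * F w + b * G w) + s * y) (D-linear x a b _ _ w))
          (lemma a b (β x z) (F w) (G w) s _ _)
    where
    lemma : ∀ a b e f g s y z → e * (a * f + b * g) + s * (a * y + b * z) ≡ a * (e * f + s * y) + b * (e * g + s * z)
    lemma = solve-∀

  D-scale : ∀ x a (F : List A → ℤ) w → D x (λ u → a * F u) w ≡ a * D x F w
  D-scale x a F []      = sym (*-zeroʳ a)
  D-scale x a F (z ∷ w) =
    trans (cong (λ y → β x z * (a * F w) + s * y) (D-scale x a _ w)) (lemma a (β x z) (F w) s _)
    where
    lemma : ∀ a e f s y → e * (a * f) + s * (a * y) ≡ a * (e * f + s * y)
    lemma = solve-∀

  s²* : ∀ a → s * (s * a) ≡ a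
  s²* a = trans (sym (*-assoc s s a)) (trans (cong (_* a) s²) (*-identityˡ a))

  -- The canonical (anti)commutation relation: in either order the same two letters are deleted, but
  -- one order passes one letter more. The induction compares the cases where the first letter is
  -- taken by x, by y or by neither.
  D-comm : ∀ x y (F : List A → ℤ) w → D x (D y F) w ≡ s * D y (D x F) w
  D-comm x y F []      = sym (*-zeroʳ s)
  D-comm x y F (z ∷ w) =
    trans (cong (λ e → β x z * D y F w + s * e) (trans (D-linear x (β y z) s F (D y (F ∘ (z ∷_))) w)
                                                        (cong (λ e → β y z * D x F w + s * e) (D-comm x y _ w))))
    (trans (cong (_+ s * (β y z * D x F w + s * (s * D y (D x (F ∘ (z ∷_))) w))) (sym (s²* (β x z * D y F w))))
    (trans (lemma (β x z) (β y z) s (D x F w) (D y F w) _)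
           (cong (λ e → s * (β y z * D x F w + s * e)) (sym (D-linear y (β x z) s F (D x (F ∘ (z ∷_))) w)))))
    where
    lemma : ∀ a b s e f g → s * (s * (a * f)) + s * (b * e + s * (s * g)) ≡ s * (b * e + s * (a * f + s * g))
    lemma = solve-∀

  SSym : (List A → ℤ) → Set
  SSym F = ∀ pre x y w → F (pre ++ x ∷ y ∷ w) ≡ s * F (pre ++ y ∷ x ∷ w)

  -- Under the swap the terms pairing z with x and with y trade places, and the one letter passed
  -- supplies the factor `s`; every other term inherits the symmetry of F.
  D-ssym : ∀ z {F} → SSym F → SSym (D z F)
  D-ssym z {F} F-sym []        x y w =
    trans (cong (λ e → β z x * F (y ∷ w) + s * (β z y * F (x ∷ w) + s * e))
                (trans (D-cong z (F-sym [] x y) w) (D-scale z s _ w)))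
    (trans (cong (_+ s * (β z y * F (x ∷ w) + s * (s * D z (λ u → F (y ∷ x ∷ u)) w))) (sym (s²* (β z x * F (y ∷ w)))))
           (lemma (β z x) (β z y) s (F (y ∷ w)) (F (x ∷ w)) _))
    where
    lemma : ∀ a b s e f g → s * (s * (a * e)) + s * (b * f + s * (s * g)) ≡ s * (b * f + s * (a * e + s * g))
    lemma = solve-∀
  D-ssym z {F} F-sym (p ∷ pre) x y w =
    trans (cong₂ (λ e f → β z p * e + s * f) (F-sym pre x y w) (D-ssym z (λ q → F-sym (p ∷ q)) pre x y w))
          (lemma (β z p) s _ _)
    where
    lemma : ∀ a s e f → a * (s * e) + s * (s * f) ≡ s * (a * e + s * f)
    lemma = solve-∀

  -- The first argument is fuel; the value is meaningful once it is at least
  -- the length of the word.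
  wick : ℕ → List A → ℤ
  wick f       []      = 1ℤ
  wick zero    (x ∷ w) = 0ℤ
  wick (suc f) (x ∷ w) = D x (wick f) w

  private
    -- Swapping the two leading letters exchanges the two outermost contractions, so `D-comm` and
    -- the symmetry of the covariance settle it; swaps further back are left to `D-ssym`. With fuel
    -- one, only the pairing of x with y survives.
    double : ∀ f x y w → wick (suc f) (x ∷ y ∷ w) ≡ s * wick (suc f) (y ∷ x ∷ w)
    double zero    x y w = trans (head x y) (trans (cong (_* wick zero w) (β-sym x y))
                             (trans (*-assoc s _ _) (cong (s *_) (sym (head y x)))))
      where
      head : ∀ x y → D x (wick zero) (y ∷ w) ≡ β x y * wick zero w
      head x y = trans (cong (λ e → β x y * wick zero w + s * e) (D-zero x (λ _ → refl) w))
                       (trans (cong (β x y * wick zero w +_) (*-zeroʳ s)) (+-identityʳ _))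
    double (suc f) x y w =
      trans (cong₂ (λ e e′ → e * wick (suc f) w + s * e′) (β-sym x y) (D-comm x y (wick f) w))
            (lemma s (β y x) (wick (suc f) w) _)
      where
      lemma : ∀ s b g d → s * b * g + s * (s * d) ≡ s * (b * g + s * d)
      lemma = solve-∀

  wick-ssym : ∀ f → SSym (wick f)
  wick-ssym zero    []        x y w = sym (*-zeroʳ s)
  wick-ssym (suc f) []        x y w = double f x y w
  wick-ssym zero    (_ ∷ _)   x y w = sym (*-zeroʳ s)
  wick-ssym (suc f) (z ∷ pre) x y w = D-ssym z (wick-ssym f) pre x y w

-- Letters are pairs (vertex, index); an edge {v , x} contributes the two
-- adjacent letters (v , j), (x , bar j), summed with weight over the index j.
module EdgeWick {V I : Set} (B : V → V → ℤ) (γ : I → I → ℤ) (bar : I → I)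
                (idx : List (ℤ × I)) (s : ℤ) (s² : s * s ≡ 1ℤ)
                (β-sym : ∀ (x y : V × I) → B (proj₁ x) (proj₁ y) * γ (proj₂ x) (proj₂ y)
                                     ≡ s * (B (proj₁ y) (proj₁ x) * γ (proj₂ y) (proj₂ x)))
                -- Completeness: summed over its index, an edge carries the inverse of the form γ.
                -- Contracting one end of it with a letter of index j leaves the other end with
                -- index j.
                (γ-dual : ∀ j (X : I → ℤ) → ∑ idx (λ ηi → proj₁ ηi * (γ (proj₂ ηi) j * X (bar (proj₂ ηi)))) ≡ X j)
                where

  open Wick {V × I} (λ x y → B (proj₁ x) (proj₁ y) * γ (proj₂ x) (proj₂ y)) s s² β-sym public

  σ : List (V × V) → (List (V × I) → ℤ) → ℤ
  σ []             H = H []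
  σ ((v , x) ∷ es) H = ∑ idx λ ηj → proj₁ ηj * σ es (λ u → H ((v , proj₂ ηj) ∷ (x , bar (proj₂ ηj)) ∷ u))

  σ-cong : ∀ es {F G} → (∀ w → F w ≡ G w) → σ es F ≡ σ es G
  σ-cong []       eq = eq []
  σ-cong (e ∷ es) eq = ∑-cong idx λ ηj → cong (proj₁ ηj *_) (σ-cong es λ u → eq _)

  σ-+ : ∀ es F G → σ es (λ w → F w + G w) ≡ σ es F + σ es G
  σ-+ []       F G = refl
  σ-+ (e ∷ es) F G = trans (∑-cong idx λ ηj → trans (cong (proj₁ ηj *_) (σ-+ es _ _)) (*-distribˡ-+ (proj₁ ηj) _ _))
                           (∑-+ idx _ _)

  private
    swap-* : ∀ a b c → a * (b * c) ≡ b * (a * c)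
    swap-* = solve-∀

  σ-* : ∀ es a F → σ es (λ w → a * F w) ≡ a * σ es F
  σ-* []       a F = refl
  σ-* (e ∷ es) a F = trans (∑-cong idx λ ηj → trans (cong (proj₁ ηj *_) (σ-* es a _)) (swap-* (proj₁ ηj) a _))
                           (∑-*ˡ idx a _)

  σ-zero : ∀ es {F} → (∀ w → F w ≡ 0ℤ) → σ es F ≡ 0ℤ
  σ-zero []       eq = eq []
  σ-zero (e ∷ es) eq = ∑-zero idx λ ηj → trans (cong (proj₁ ηj *_) (σ-zero es λ w → eq _)) (*-zeroʳ (proj₁ ηj))

  -- Reconnection: once the end a of an edge {a , w} has been contracted with an end of another
  -- edge, the two letters left over have matching indices and form an edge again, with w in place
  -- of the end consumed.
  Rep : V → V → List (V × V) → (List (V × V) → ℤ) → ℤ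
  Rep a w []             Ψ = 0ℤ
  Rep a w ((v , x) ∷ es) Ψ = B a v * Ψ ((w , x) ∷ es) + (B a x * Ψ ((v , w) ∷ es) + Rep a w es (Ψ ∘ ((v , x) ∷_)))

  Rep-zero : ∀ a w es → Rep a w es (λ _ → 0ℤ) ≡ 0ℤ
  Rep-zero a w []             = refl
  Rep-zero a w ((v , x) ∷ es) = cong₂ _+_ (*-zeroʳ (B a v)) (cong₂ _+_ (*-zeroʳ (B a x)) (Rep-zero a w es))

  Rep-linear : ∀ a w es η Ψ Φ → Rep a w es (λ fs → η * Ψ fs + Φ fs) ≡ η * Rep a w es Ψ + Rep a w es Φ
  Rep-linear a w []             η Ψ Φ = sym (trans (+-identityʳ _) (*-zeroʳ η))
  Rep-linear a w ((v , x) ∷ es) η Ψ Φ =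
    trans (cong (λ e → B a v * (η * Ψ ((w , x) ∷ es) + Φ ((w , x) ∷ es)) + (B a x * (η * Ψ ((v , w) ∷ es) + Φ ((v , w) ∷ es)) + e))
                (Rep-linear a w es η _ _))
          (lemma η (B a v) (B a x) (Ψ ((w , x) ∷ es)) (Φ ((w , x) ∷ es)) (Ψ ((v , w) ∷ es)) (Φ ((v , w) ∷ es)) _ _)
    where
    lemma : ∀ η b c p q p′ q′ r t → b * (η * p + q) + (c * (η * p′ + q′) + (η * r + t)) ≡ η * (b * p + (c * p′ + r)) + (b * q + (c * q′ + t))
    lemma = solve-∀

  Rep-∑ : ∀ a w es (is : List (ℤ × I)) (Ψ : I → List (V × V) → ℤ) →
          Rep a w es (λ fs → ∑ is λ ηj → proj₁ ηj * Ψ (proj₂ ηj) fs) ≡ ∑ is λ ηj → proj₁ ηj * Rep a w es (Ψ (proj₂ ηj))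
  Rep-∑ a w es []             Ψ = Rep-zero a w es
  Rep-∑ a w es ((η , j) ∷ is) Ψ = trans (Rep-linear a w es η (Ψ j) _) (cong (η * Rep a w es (Ψ j) +_) (Rep-∑ a w es is Ψ))

  private
    swap³ : ∀ {H} → SSym H → ∀ a b c u → H (a ∷ b ∷ c ∷ u) ≡ H (b ∷ c ∷ a ∷ u)
    swap³ H-sym a b c u = trans (H-sym [] a b (c ∷ u)) (trans (cong (s *_) (H-sym (b ∷ []) a c u)) (s²* _))

    tail : ∀ {H} → SSym H → ∀ z → SSym (H ∘ (z ∷_))
    tail H-sym z pre = H-sym (z ∷ pre)

  -- If a is paired with v, `γ-dual` hands the index of v to w. If it is paired with x, the factor
  -- `s` for passing v is cancelled by the swap that puts w behind v. If it skips this edge, both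
  -- the contraction and the letter of w pass two letters, which costs nothing because s squared is
  -- 1.
  contract : ∀ a w es {H} → SSym H →
    ∑ idx (λ ηi → proj₁ ηi * σ es (D (a , proj₂ ηi) (H ∘ ((w , bar (proj₂ ηi)) ∷_)))) ≡ Rep a w es (λ fs → σ fs H)
  contract a w []             H-sym = ∑-zero idx λ ηi → *-zeroʳ (proj₁ ηi)
  contract a w ((v , x) ∷ es) {H} H-sym = begin
    ∑ idx (λ ηi → proj₁ ηi * ∑ idx λ ηj → proj₁ ηj * σ es (λ u → D (a , proj₂ ηi) (H ∘ ((w , bar (proj₂ ηi)) ∷_)) ((v , proj₂ ηj) ∷ (x , bar (proj₂ ηj)) ∷ u)))
      ≡⟨ ∑-cong idx (λ ηi → cong (proj₁ ηi *_) (∑-cong idx λ ηj → cong (proj₁ ηj *_) (expand (proj₂ ηi) (proj₂ ηj)))) ⟩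
    ∑ idx (λ ηi → proj₁ ηi * ∑ idx λ ηj → proj₁ ηj * (T₁ (proj₂ ηi) (proj₂ ηj) + (T₂ (proj₂ ηi) (proj₂ ηj) + T₃ (proj₂ ηi) (proj₂ ηj))))
      ≡⟨ ∑-cong idx (λ ηi → sym (∑-*ˡ idx (proj₁ ηi) _)) ⟩
    ∑ idx (λ ηi → ∑ idx λ ηj → proj₁ ηi * (proj₁ ηj * (T₁ (proj₂ ηi) (proj₂ ηj) + (T₂ (proj₂ ηi) (proj₂ ηj) + T₃ (proj₂ ηi) (proj₂ ηj)))))
      ≡⟨ ∑-comm idx idx _ ⟩
    ∑ idx (λ ηj → ∑ idx λ ηi → proj₁ ηi * (proj₁ ηj * (T₁ (proj₂ ηi) (proj₂ ηj) + (T₂ (proj₂ ηi) (proj₂ ηj) + T₃ (proj₂ ηi) (proj₂ ηj)))))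
      ≡⟨ ∑-cong idx (λ ηj → column (proj₁ ηj) (proj₂ ηj)) ⟩
    ∑ idx (λ ηj → proj₁ ηj * (B a v * U₁ (proj₂ ηj)) + (proj₁ ηj * (B a x * U₂ (proj₂ ηj)) + proj₁ ηj * R (proj₂ ηj)))
      ≡⟨ trans (∑-+ idx (λ ηj → proj₁ ηj * (B a v * U₁ (proj₂ ηj))) (λ ηj → proj₁ ηj * (B a x * U₂ (proj₂ ηj)) + proj₁ ηj * R (proj₂ ηj)))
               (cong (∑ idx (λ ηj → proj₁ ηj * (B a v * U₁ (proj₂ ηj))) +_)
                     (∑-+ idx (λ ηj → proj₁ ηj * (B a x * U₂ (proj₂ ηj))) (λ ηj → proj₁ ηj * R (proj₂ ηj)))) ⟩
    ∑ idx (λ ηj → proj₁ ηj * (B a v * U₁ (proj₂ ηj))) + (∑ idx (λ ηj → proj₁ ηj * (B a x * U₂ (proj₂ ηj))) + ∑ idx (λ ηj → proj₁ ηj * R (proj₂ ηj)))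
      ≡⟨ cong₂ _+_ (pull (B a v) U₁) (cong₂ _+_ (pull (B a x) U₂) (sym (Rep-∑ a w es idx _))) ⟩
    Rep a w ((v , x) ∷ es) (λ fs → σ fs H) ∎
    where
    open ≡-Reasoning
    T₁ T₂ T₃ : I → I → ℤ
    T₁ i j = (B a v * γ i j) * σ es (λ u → H ((w , bar i) ∷ (x , bar j) ∷ u))
    T₂ i j = (B a x * γ i (bar j)) * σ es (λ u → H ((v , j) ∷ (w , bar i) ∷ u))
    T₃ i j = σ es (D (a , i) (λ u → H ((v , j) ∷ (x , bar j) ∷ (w , bar i) ∷ u)))
    U₁ U₂ R : I → ℤ
    U₁ j = σ es (λ u → H ((w , j) ∷ (x , bar j) ∷ u))
    U₂ j = σ es (λ u → H ((v , j) ∷ (w , bar j) ∷ u))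
    R j = Rep a w es (λ fs → σ fs (λ u → H ((v , j) ∷ (x , bar j) ∷ u)))
    expand : ∀ i j → σ es (λ u → D (a , i) (H ∘ ((w , bar i) ∷_)) ((v , j) ∷ (x , bar j) ∷ u)) ≡ T₁ i j + (T₂ i j + T₃ i j)
    expand i j =
      trans (σ-cong es pointwise)
      (trans (σ-+ es (λ u → (B a v * γ i j) * H₁ u) (λ u → (B a x * γ i (bar j)) * H₂ u + H₃ u))
             (cong₂ _+_ (σ-* es (B a v * γ i j) H₁)
                        (trans (σ-+ es (λ u → (B a x * γ i (bar j)) * H₂ u) H₃)
                               (cong (_+ σ es H₃) (σ-* es (B a x * γ i (bar j)) H₂)))))
      where
      H₁ H₂ H₃ : List (V × I) → ℤ
      H₁ u = H ((w , bar i) ∷ (x , bar j) ∷ u)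
      H₂ u = H ((v , j) ∷ (w , bar i) ∷ u)
      H₃ = D (a , i) (λ u → H ((v , j) ∷ (x , bar j) ∷ (w , bar i) ∷ u))
      pointwise : ∀ u → D (a , i) (H ∘ ((w , bar i) ∷_)) ((v , j) ∷ (x , bar j) ∷ u) ≡ (B a v * γ i j) * H ((w , bar i) ∷ (x , bar j) ∷ u)
                          + ((B a x * γ i (bar j)) * H ((v , j) ∷ (w , bar i) ∷ u)
                          + D (a , i) (λ u → H ((v , j) ∷ (x , bar j) ∷ (w , bar i) ∷ u)) u)
      pointwise u = cong ((B a v * γ i j) * H ((w , bar i) ∷ (x , bar j) ∷ u) +_)
        (trans (*-distribˡ-+ s _ _)
        (cong₂ _+_ (trans (cong (λ e → s * ((B a x * γ i (bar j)) * e)) (H-sym [] _ _ u))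
                   (trans (cong (s *_) (swap-* (B a x * γ i (bar j)) s _)) (s²* _)))
                   (trans (s²* _) (D-cong (a , i) (swap³ {H} H-sym (w , bar i) (v , j) (x , bar j)) u))))
    merge : ∀ η b γ x → η * ((b * γ) * x) ≡ b * (η * (γ * x))
    merge = solve-∀
    column : ∀ η j → ∑ idx (λ ηi → proj₁ ηi * (η * (T₁ (proj₂ ηi) j + (T₂ (proj₂ ηi) j + T₃ (proj₂ ηi) j))))
                   ≡ η * (B a v * U₁ j) + (η * (B a x * U₂ j) + η * R j)
    column η j =
      trans (∑-cong idx λ ηi → distr (proj₁ ηi) η (T₁ (proj₂ ηi) j) (T₂ (proj₂ ηi) j) (T₃ (proj₂ ηi) j))
      (trans (∑-+ idx _ _) (cong₂ _+_ (trans (∑-*ˡ idx η _) (cong (η *_) t₁))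
      (trans (∑-+ idx _ _) (cong₂ _+_ (trans (∑-*ˡ idx η _) (cong (η *_) t₂)) (trans (∑-*ˡ idx η _) (cong (η *_) t₃))))))
      where
      distr : ∀ a b c d e → a * (b * (c + (d + e))) ≡ b * (a * c) + (b * (a * d) + b * (a * e))
      distr = solve-∀
      t₁ : ∑ idx (λ ηi → proj₁ ηi * T₁ (proj₂ ηi) j) ≡ B a v * U₁ j
      t₁ = trans (∑-cong idx λ ηi → merge (proj₁ ηi) (B a v) (γ (proj₂ ηi) j) _)
           (trans (∑-*ˡ idx (B a v) _)
                  (cong (B a v *_) (γ-dual j λ i → σ es (λ u → H ((w , i) ∷ (x , bar j) ∷ u)))))
      t₂ : ∑ idx (λ ηi → proj₁ ηi * T₂ (proj₂ ηi) j) ≡ B a x * U₂ j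
      t₂ = trans (∑-cong idx λ ηi → merge (proj₁ ηi) (B a x) (γ (proj₂ ηi) (bar j)) _)
           (trans (∑-*ˡ idx (B a x) _)
                  (cong (B a x *_) (γ-dual (bar j) λ i → σ es (λ u → H ((v , j) ∷ (w , i) ∷ u)))))
      t₃ : ∑ idx (λ ηi → proj₁ ηi * T₃ (proj₂ ηi) j) ≡ R j
      t₃ = contract a w es (tail {H ∘ ((v , j) ∷_)} (tail {H} H-sym (v , j)) (x , bar j))
    pull : ∀ b (U : I → ℤ) → ∑ idx (λ ηj → proj₁ ηj * (b * U (proj₂ ηj))) ≡ b * ∑ idx (λ ηj → proj₁ ηj * U (proj₂ ηj))
    pull b U = trans (∑-cong idx λ ηj → swap-* (proj₁ ηj) b _) (∑-*ˡ idx b _)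

  moment : ℕ → List (V × V) → ℤ
  moment f es = σ es (wick f)

  moment-zero : ∀ e es → moment zero (e ∷ es) ≡ 0ℤ
  moment-zero e es = ∑-zero idx λ ηj → trans (cong (proj₁ ηj *_) (σ-zero es λ _ → refl)) (*-zeroʳ (proj₁ ηj))

  -- A contraction inside the first edge leaves an index sum that no remaining letter depends on.
  -- This loop is κ, the only trace of the number of indices; all other contractions are
  -- reconnections by `contract`.
  moment-suc : ∀ κ → ∑ idx (λ ηi → proj₁ ηi * γ (proj₂ ηi) (bar (proj₂ ηi))) ≡ κ → ∀ f a w es →
    moment (suc f) ((a , w) ∷ es) ≡ (κ * B a w) * moment f es + s * Rep a w es (moment f)
  moment-suc κ κ-eq f a w es = begin
    ∑ idx (λ ηi → proj₁ ηi * σ es (λ u → (B a w * γ (proj₂ ηi) (bar (proj₂ ηi))) * wick f u + s * D (a , proj₂ ηi) (wick f ∘ ((w , bar (proj₂ ηi)) ∷_)) u))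
      ≡⟨ ∑-cong idx (λ ηi → trans (cong (proj₁ ηi *_) (trans (σ-+ es (λ u → (B a w * γ (proj₂ ηi) (bar (proj₂ ηi))) * wick f u) (λ u → s * D (a , proj₂ ηi) (wick f ∘ ((w , bar (proj₂ ηi)) ∷_)) u))
                                                              (cong₂ _+_ (σ-* es (B a w * γ (proj₂ ηi) (bar (proj₂ ηi))) (wick f)) (σ-* es s (D (a , proj₂ ηi) (wick f ∘ ((w , bar (proj₂ ηi)) ∷_)))))))
                                  (distr (proj₁ ηi) (B a w) (γ (proj₂ ηi) (bar (proj₂ ηi))) (moment f es) s _)) ⟩
    ∑ idx (λ ηi → proj₁ ηi * γ (proj₂ ηi) (bar (proj₂ ηi)) * (B a w * moment f es) + s * (proj₁ ηi * σ es (D (a , proj₂ ηi) (wick f ∘ ((w , bar (proj₂ ηi)) ∷_)))))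
      ≡⟨ trans (∑-+ idx (λ ηi → proj₁ ηi * γ (proj₂ ηi) (bar (proj₂ ηi)) * (B a w * moment f es)) (λ ηi → s * (proj₁ ηi * σ es (D (a , proj₂ ηi) (wick f ∘ ((w , bar (proj₂ ηi)) ∷_))))))
               (cong₂ _+_ (∑-*ʳ idx (λ ηi → proj₁ ηi * γ (proj₂ ηi) (bar (proj₂ ηi))) (B a w * moment f es)) (∑-*ˡ idx s _)) ⟩
    ∑ idx (λ ηi → proj₁ ηi * γ (proj₂ ηi) (bar (proj₂ ηi))) * (B a w * moment f es) + s * ∑ idx (λ ηi → proj₁ ηi * σ es (D (a , proj₂ ηi) (wick f ∘ ((w , bar (proj₂ ηi)) ∷_))))
      ≡⟨ cong₂ (λ e e′ → e * (B a w * moment f es) + s * e′) κ-eq (contract a w es (wick-ssym f)) ⟩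
    κ * (B a w * moment f es) + s * Rep a w es (moment f)
      ≡⟨ cong (_+ s * Rep a w es (moment f)) (sym (*-assoc κ (B a w) _)) ⟩
    (κ * B a w) * moment f es + s * Rep a w es (moment f) ∎
    where
    open ≡-Reasoning
    distr : ∀ η b g m s x → η * ((b * g) * m + s * x) ≡ η * g * (b * m) + s * (η * x)
    distr = solve-∀

-- Congruences modulo p.

module Mod (p : ℕ) where

  infix 4 _≈_
  -- A record, because the bare congruence unfolds to a divisibility of the difference, from which a
  -- and b cannot be inferred.
  record _≈_ (a b : ℤ) : Set where
    constructor mod
    field unmod : a ≡ b [mod p ]
  open _≈_ public

  ≡⇒≈ : ∀ {a b} → a ≡ b → a ≈ b
  ≡⇒≈ {a} refl = mod (divides 0ℤ (+-inverseʳ a))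

  ≈-refl : ∀ {a} → a ≈ a
  ≈-refl = ≡⇒≈ refl

  ≈-sym : ∀ {a b} → a ≈ b → b ≈ a
  ≈-sym {a} {b} (mod (divides q eq)) = mod (divides (- q) (trans (lemma a b) (trans (cong -_ eq) (neg-distribˡ-* q (ℤ.+ p)))))
    where
    lemma : ∀ a b → b - a ≡ - (a - b)
    lemma = solve-∀

  ≈-trans : ∀ {a b c} → a ≈ b → b ≈ c → a ≈ c
  ≈-trans {a} {b} {c} (mod (divides q eq)) (mod (divides r eq′)) =
    mod (divides (q + r) (trans (lemma a b c) (trans (cong₂ _+_ eq eq′) (sym (*-distribʳ-+ (ℤ.+ p) q r)))))
    where
    lemma : ∀ a b c → a - c ≡ (a - b) + (b - c)
    lemma = solve-∀

  ≈-+ : ∀ {a b c d} → a ≈ b → c ≈ d → a + c ≈ b + d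
  ≈-+ {a} {b} {c} {d} (mod (divides q eq)) (mod (divides r eq′)) =
    mod (divides (q + r) (trans (lemma a b c d) (trans (cong₂ _+_ eq eq′) (sym (*-distribʳ-+ (ℤ.+ p) q r)))))
    where
    lemma : ∀ a b c d → (a + c) - (b + d) ≡ (a - b) + (c - d)
    lemma = solve-∀

  ≈-* : ∀ {a b c d} → a ≈ b → c ≈ d → a * c ≈ b * d
  ≈-* {a} {b} {c} {d} (mod (divides q eq)) (mod (divides r eq′)) =
    mod (divides (q * c + b * r)
            (trans (lemma a b c d) (trans (cong₂ (λ x y → x * c + b * y) eq eq′) (lemma′ q r b c (ℤ.+ p)))))
    where
    lemma : ∀ a b c d → a * c - b * d ≡ (a - b) * c + b * (c - d)
    lemma = solve-∀
    lemma′ : ∀ q r b c p → (q * p) * c + b * (r * p) ≡ (q * c + b * r) * p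
    lemma′ = solve-∀

  ≈-*ʳ : ∀ a {b c} → b ≈ c → a * b ≈ a * c
  ≈-*ʳ a = ≈-* (≈-refl {a})

  ≈-neg : ∀ {a b} → a ≈ b → - a ≈ - b
  ≈-neg {a} {b} (mod (divides q eq)) = mod (divides (- q) (trans (lemma a b) (trans (cong -_ eq) (neg-distribˡ-* q (ℤ.+ p)))))
    where
    lemma : ∀ a b → - a - - b ≡ - (a - b)
    lemma = solve-∀

  ≈-reflect : ∀ {a b c d} → a ≡ c → b ≡ d → a ≈ b → c ≈ d
  ≈-reflect refl refl a≈b = a≈b

  ≈-∏ : (xs : List A) {f g : A → ℤ} → (∀ x → f x ≈ g x) → ∏ xs f ≈ ∏ xs g
  ≈-∏ []       eq = ≈-refl
  ≈-∏ (x ∷ xs) eq = ≈-* (eq x) (≈-∏ xs eq)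

-- Fermions with k colours against bosons with two indices.

γᶠ : ∀ {k} → Fin k → Fin k → ℤ
γᶠ i j = 𝟙 (i Fin.≟ j)

γᵇ : Bool → Bool → ℤ
γᵇ false true  = 1ℤ
γᵇ true  false = -1ℤ
γᵇ _     _     = 0ℤ

∑-𝟙-Fin : ∀ n (j : Fin n) (X : Fin n → ℤ) → ∑[ i ← allFin n ] 𝟙 (i Fin.≟ j) * X i ≡ X j
∑-𝟙-Fin (suc n) zero X =
  trans (cong (1ℤ * X zero +_) (trans (cong (λ l → ∑ l (λ i → 𝟙 (i Fin.≟ zero) * X i)) (sym (map-tabulate id suc)))
                               (trans (∑-map suc (allFin n) (λ i → 𝟙 (i Fin.≟ zero) * X i)) (∑-zero (allFin n) λ _ → refl))))
        (trans (+-identityʳ (1ℤ * X zero)) (*-identityˡ (X zero)))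
∑-𝟙-Fin (suc n) (suc j) X =
  trans (+-identityˡ _)
  (trans (cong (λ l → ∑ l (λ i → 𝟙 (i Fin.≟ suc j) * X i)) (sym (map-tabulate id suc)))
  (trans (∑-map suc (allFin n) (λ i → 𝟙 (i Fin.≟ suc j) * X i)) (∑-𝟙-Fin n j (X ∘ suc))))

∑-one : (xs : List A) → ∑ xs (λ _ → 1ℤ) ≡ ℤ.+ length xs
∑-one []       = refl
∑-one (x ∷ xs) = cong (1ℤ +_) (∑-one xs)

module Moments {V : Set} (B : V → V → ℤ) (B-alt : ∀ u v → B u v ≡ - B v u) (k : ℕ) where

  private
    idxᶠ : List (ℤ × Fin k)
    idxᶠ = map (1ℤ ,_) (allFin k)

    idxᵇ : List (ℤ × Bool)
    idxᵇ = (1ℤ , false) ∷ (-1ℤ , true) ∷ []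

    γᶠ-sym : ∀ (i j : Fin k) → γᶠ i j ≡ γᶠ j i
    γᶠ-sym i j = 𝟙-⇔ (i Fin.≟ j) (j Fin.≟ i) sym sym

    γᵇ-alt : ∀ i j → γᵇ i j ≡ - γᵇ j i
    γᵇ-alt false false = refl
    γᵇ-alt false true  = refl
    γᵇ-alt true  false = refl
    γᵇ-alt true  true  = refl

  private
    βᶠ-sym : ∀ (x y : V × Fin k) → B (proj₁ x) (proj₁ y) * γᶠ (proj₂ x) (proj₂ y)
                                 ≡ -1ℤ * (B (proj₁ y) (proj₁ x) * γᶠ (proj₂ y) (proj₂ x))
    βᶠ-sym (u , i) (v , j) = trans (cong₂ _*_ (B-alt u v) (γᶠ-sym i j)) (lemma (B v u) (γᶠ j i))
      where
      lemma : ∀ a b → - a * b ≡ -1ℤ * (a * b)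
      lemma = solve-∀

    βᵇ-sym : ∀ (x y : V × Bool) → - B (proj₁ x) (proj₁ y) * γᵇ (proj₂ x) (proj₂ y)
                                ≡ 1ℤ * (- B (proj₁ y) (proj₁ x) * γᵇ (proj₂ y) (proj₂ x))
    βᵇ-sym (u , i) (v , j) = trans (cong₂ (λ a b → - a * b) (B-alt u v) (γᵇ-alt i j)) (lemma (B v u) (γᵇ j i))
      where
      lemma : ∀ a b → - - a * - b ≡ 1ℤ * (- a * b)
      lemma = solve-∀

    γᶠ-dual : ∀ j (X : Fin k → ℤ) → ∑ idxᶠ (λ ηi → proj₁ ηi * (γᶠ (proj₂ ηi) j * X (proj₂ ηi))) ≡ X j
    γᶠ-dual j X = trans (∑-map (1ℤ ,_) (allFin k) (λ ηi → proj₁ ηi * (γᶠ (proj₂ ηi) j * X (proj₂ ηi))))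
                  (trans (∑-cong (allFin k) λ i → *-identityˡ (γᶠ i j * X i)) (∑-𝟙-Fin k j X))

    γᵇ-dual : ∀ j (X : Bool → ℤ) → ∑ idxᵇ (λ ηi → proj₁ ηi * (γᵇ (proj₂ ηi) j * X (not (proj₂ ηi)))) ≡ X j
    γᵇ-dual false X = lemma (X true) (X false)
      where
      lemma : ∀ a b → 1ℤ * (0ℤ * a) + (-1ℤ * (-1ℤ * b) + 0ℤ) ≡ b
      lemma = solve-∀
    γᵇ-dual true X = lemma (X true) (X false)
      where
      lemma : ∀ a b → 1ℤ * (1ℤ * a) + (-1ℤ * (0ℤ * b) + 0ℤ) ≡ a
      lemma = solve-∀

    γᶠ-trace : ∑ idxᶠ (λ ηi → proj₁ ηi * γᶠ (proj₂ ηi) (proj₂ ηi)) ≡ ℤ.+ k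
    γᶠ-trace = trans (∑-map (1ℤ ,_) (allFin k) (λ (ηi : ℤ × Fin k) → proj₁ ηi * γᶠ (proj₂ ηi) (proj₂ ηi)))
               (trans (∑-cong (allFin k) λ i → trans (*-identityˡ (γᶠ i i)) (𝟙-yes (i Fin.≟ i) refl))
               (trans (∑-one (allFin k)) (cong ℤ.+_ (length-tabulate id))))

  module Fermi = EdgeWick B γᶠ id idxᶠ -1ℤ refl βᶠ-sym γᶠ-dual
  -- The covariance is -B because the sign of the statistics is now 1: reconnections through -B then
  -- agree with -1 times reconnections through B, and the loop of value 2 contributes 2 (-B) = -2 B.
  module Bose  = EdgeWick (λ u v → - B u v) γᵇ not idxᵇ 1ℤ refl βᵇ-sym γᵇ-dual

  -- Fermions of k colours and the symplectic bosons satisfy the same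
  -- recursion as soon as k ≡ -2.
  module _ (p : ℕ) (k≈-2 : Mod._≈_ p (ℤ.+ k) -[1+ 1 ]) where
    open Mod p

    private
      Rep-≈ : ∀ a w es {Ψ Φ} → (∀ fs → Ψ fs ≈ Φ fs) → -1ℤ * Fermi.Rep a w es Ψ ≈ 1ℤ * Bose.Rep a w es Φ
      Rep-≈ a w []             eq = ≈-refl
      Rep-≈ a w ((v , x) ∷ es) {Ψ} {Φ} eq =
        ≈-reflect (lemma (B a v) (B a x) (Ψ ((w , x) ∷ es)) (Ψ ((v , w) ∷ es)) (Fermi.Rep a w es (Ψ ∘ ((v , x) ∷_))))
                  (lemma′ (- B a v) (- B a x) (Φ ((w , x) ∷ es)) (Φ ((v , w) ∷ es)) (Bose.Rep a w es (Φ ∘ ((v , x) ∷_))))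
          (≈-+ (≈-*ʳ (- B a v) (eq _)) (≈-+ (≈-*ʳ (- B a x) (eq _)) (Rep-≈ a w es λ fs → eq _)))
        where
        lemma : ∀ b c p q r → - b * p + (- c * q + -1ℤ * r) ≡ -1ℤ * (b * p + (c * q + r))
        lemma = solve-∀
        lemma′ : ∀ b c p q r → b * p + (c * q + 1ℤ * r) ≡ 1ℤ * (b * p + (c * q + r))
        lemma′ = solve-∀

    moment-≈ : ∀ f es → Fermi.moment f es ≈ Bose.moment f es
    moment-≈ zero    []             = ≈-refl
    moment-≈ (suc f) []             = ≈-refl
    moment-≈ zero    (e ∷ es)       = ≡⇒≈ (trans (Fermi.moment-zero e es) (sym (Bose.moment-zero e es)))
    moment-≈ (suc f) ((a , w) ∷ es) =
      ≈-reflect (sym (Fermi.moment-suc (ℤ.+ k) γᶠ-trace f a w es)) (sym (Bose.moment-suc (ℤ.+ 2) refl f a w es))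
        (≈-+ (≈-* (≈-trans (≈-* k≈-2 ≈-refl) (≡⇒≈ (lemma (B a w)))) (moment-≈ f es)) (Rep-≈ a w es (moment-≈ f)))
      where
      lemma : ∀ b → -[1+ 1 ] * b ≡ ℤ.+ 2 * - b
      lemma = solve-∀

-- Antisymmetric functions of words

AntiSym : (List A → ℤ) → Set _
AntiSym F = ∀ pre x y w → F (pre ++ x ∷ y ∷ w) ≡ - F (pre ++ y ∷ x ∷ w)

Symm : (List A → ℤ) → Set _
Symm F = ∀ {xs ys} → xs ↭ ys → F xs ≡ F ys

anti-∷ : {F : List A → ℤ} → AntiSym F → ∀ z → AntiSym (F ∘ (z ∷_))
anti-∷ F-anti z pre = F-anti (z ∷ pre)

-- The sign of a permutation serves all antisymmetric functions at once.
↭-sign : {xs ys : List A} → xs ↭ ys → ∃ λ ε → ε * ε ≡ 1ℤ × (∀ F → AntiSym F → F xs ≡ ε * F ys)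
↭-sign Perm.refl = 1ℤ , refl , λ F _ → sym (*-identityˡ _)
↭-sign (prep x p) with ε , ε² , eq ← ↭-sign p = ε , ε² , λ F F-anti → eq (F ∘ (x ∷_)) (anti-∷ {F = F} F-anti x)
↭-sign (swap x y p) with ε , ε² , eq ← ↭-sign p =
  - ε , trans (lemma ε) ε² , λ F F-anti →
    trans (F-anti [] x y _) (trans (cong -_ (eq (λ w → F (y ∷ x ∷ w)) λ pre → F-anti (y ∷ x ∷ pre))) (neg-distribˡ-* ε _))
  where
  lemma : ∀ a → - a * - a ≡ a * a
  lemma = solve-∀
↭-sign (Perm.trans p q) with ε , ε² , eq ← ↭-sign p | ε′ , ε′² , eq′ ← ↭-sign q =
  ε * ε′ , trans (lemma ε ε′) (cong₂ _*_ ε² ε′²) , λ F F-anti →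
    trans (eq F F-anti) (trans (cong (ε *_) (eq′ F F-anti)) (sym (*-assoc ε ε′ _)))
  where
  lemma : ∀ a b → (a * b) * (a * b) ≡ (a * a) * (b * b)
  lemma = solve-∀

private
  self-neg : ∀ a → a ≡ - a → a ≡ 0ℤ
  self-neg (ℤ.+ zero)  _  = refl
  self-neg (ℤ.+ suc n) ()
  self-neg -[1+ n ]    ()

anti-repeat : (F : List A → ℤ) → AntiSym F → ∀ {w x r} → w ↭ x ∷ x ∷ r → F w ≡ 0ℤ
anti-repeat F F-anti {x = x} {r} p with ε , _ , eq ← ↭-sign p =
  trans (eq F F-anti) (trans (cong (ε *_) (self-neg _ (F-anti [] x x r))) (*-zeroʳ ε))

anti-proportional : (F G : List A → ℤ) → AntiSym F → AntiSym G → ∀ {xs ys} → xs ↭ ys → F xs * G ys ≡ G xs * F ys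
anti-proportional F G F-anti G-anti {xs} {ys} p with ε , _ , eq ← ↭-sign p =
  trans (cong (_* G ys) (eq F F-anti)) (trans (lemma ε (F ys) (G ys)) (cong (_* F ys) (sym (eq G G-anti))))
  where
  lemma : ∀ a b c → (a * b) * c ≡ (a * c) * b
  lemma = solve-∀

∈⇒↭∷ : ∀ {x : A} {xs} → x ∈ xs → ∃ λ ys → xs ↭ x ∷ ys
∈⇒↭∷ {x = x} x∈xs with as , bs , refl ← ∈-∃++ x∈xs = as ++ bs , Permₚ.shift x as bs

module _ (_≟ᴬ_ : DecidableEquality A) where
  open import Data.List.Membership.DecPropositional _≟ᴬ_ using (_∈?_)

  repeat-or-unique : (w : List A) → Unique w ⊎ (∃ λ x → ∃ λ r → w ↭ x ∷ x ∷ r)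
  repeat-or-unique []      = inj₁ []
  repeat-or-unique (x ∷ w) with x ∈? w | repeat-or-unique w
  ... | yes x∈w | _ = inj₂ (x , _ , prep x (proj₂ (∈⇒↭∷ x∈w)))
  ... | no  x∉w | inj₁ u = inj₁ (¬Any⇒All¬ w x∉w ∷ u)
  ... | no  x∉w | inj₂ (y , r , p) =
    inj₂ (y , x ∷ r , Perm.trans (prep x p) (Perm.trans (swap x y Perm.refl) (prep y (swap x y Perm.refl))))

unique-↭ : ∀ (w : List A) {all} → Unique w → (∀ {x} → x ∈ w → x ∈ all) → length all ≤ length w → w ↭ all
unique-↭ []      {[]}    _         _  _  = Perm.refl
unique-↭ (x ∷ w) {all} (x∉w ∷ u) w⊆ len with ∈⇒↭∷ (w⊆ (here refl))
... | all′ , p = Perm.trans (prep x (unique-↭ w u w⊆all′ (ℕ.s≤s⁻¹ (subst (_≤ suc (length w)) (Permₚ.↭-length p) len)))) (↭-sym p)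
  where
  w⊆all′ : ∀ {y} → y ∈ w → y ∈ all′
  w⊆all′ y∈w with Permₚ.∈-resp-↭ p (w⊆ (there y∈w))
  ... | here refl  = ⊥-elim (All¬⇒¬Any x∉w y∈w)
  ... | there y∈a = y∈a

-- Pigeonhole: a word that is at least as long as the alphabet and has no repetition uses every
-- letter exactly once.
full-or-repeat : DecidableEquality A → (all : List A) → (∀ x → x ∈ all) → ∀ w → length all ≤ length w →
                 w ↭ all ⊎ (∃ λ x → ∃ λ r → w ↭ x ∷ x ∷ r)
full-or-repeat _≟_ all complete w len with repeat-or-unique _≟_ w
... | inj₁ u = inj₁ (unique-↭ w u (λ _ → complete _) len)
... | inj₂ r = inj₂ r

-- An antisymmetric function of words as long as the alphabet has only one degree of freedom.
anti-unique : DecidableEquality A → (all : List A) → (∀ x → x ∈ all) → (F G : List A → ℤ) → AntiSym F → AntiSym G →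
              ∀ w → length all ≤ length w → F w * G all ≡ G w * F all
anti-unique _≟_ all complete F G F-anti G-anti w len with full-or-repeat _≟_ all complete w len
... | inj₁ p = anti-proportional F G F-anti G-anti p
... | inj₂ (x , r , p) = trans (cong (_* G all) (anti-repeat F F-anti p)) (cong (_* F all) (sym (anti-repeat G G-anti p)))

-- Sums and products over pairs of positions.

pairs : List A → List (A × A)
pairs []       = []
pairs (x ∷ xs) = map (x ,_) xs ++ pairs xs

pairs-map : (h : A → C) (xs : List A) → pairs (map h xs) ≡ map (λ (x , y) → h x , h y) (pairs xs)
pairs-map h []       = refl
pairs-map h (x ∷ xs) = trans (cong₂ _++_ (trans (sym (map-∘ xs)) (map-∘ xs)) (pairs-map h xs)) (sym (map-++ _ (map (x ,_) xs) (pairs xs)))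

∏ₚ : (A → A → ℤ) → List A → ℤ
∏ₚ t []       = 1ℤ
∏ₚ t (x ∷ xs) = ∏ xs (t x) * ∏ₚ t xs

∑ₚ : (A → A → ℤ) → List A → ℤ
∑ₚ t []       = 0ℤ
∑ₚ t (x ∷ xs) = ∑ xs (t x) + ∑ₚ t xs

∏-pairs : (t : A → A → ℤ) (xs : List A) → ∏ (pairs xs) (λ xy → t (proj₁ xy) (proj₂ xy)) ≡ ∏ₚ t xs
∏-pairs t []       = refl
∏-pairs t (x ∷ xs) = trans (∏-++ (map (x ,_) xs) (pairs xs) _) (cong₂ _*_ (∏-map (x ,_) xs _) (∏-pairs t xs))

∑-pairs : (t : A → A → ℤ) (xs : List A) → ∑ (pairs xs) (λ xy → t (proj₁ xy) (proj₂ xy)) ≡ ∑ₚ t xs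
∑-pairs t []       = refl
∑-pairs t (x ∷ xs) = trans (∑-++ (map (x ,_) xs) (pairs xs) _) (cong₂ _+_ (∑-map (x ,_) xs _) (∑-pairs t xs))

∏ₚ-anti : (t : A → A → ℤ) → (∀ x y → t x y ≡ - t y x) → AntiSym (∏ₚ t)
∏ₚ-anti t t-anti []        x y w =
  trans (cong (λ e → (e * ∏ w (t x)) * (∏ w (t y) * ∏ₚ t w)) (t-anti x y)) (lemma (t y x) (∏ w (t x)) (∏ w (t y)) (∏ₚ t w))
  where
  lemma : ∀ a b c d → (- a * b) * (c * d) ≡ - ((a * c) * (b * d))
  lemma = solve-∀
∏ₚ-anti t t-anti (z ∷ pre) x y w =
  trans (cong₂ _*_ (∏-↭ (Permₚ.++⁺ˡ pre (swap x y Perm.refl)) (t z)) (∏ₚ-anti t t-anti pre x y w))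
        (sym (neg-distribʳ-* (∏ (pre ++ y ∷ x ∷ w) (t z)) _))

∑ₚ-↭ : (t : A → A → ℤ) → (∀ x y → t x y ≡ t y x) → ∀ {xs ys} → xs ↭ ys → ∑ₚ t xs ≡ ∑ₚ t ys
∑ₚ-↭ t t-sym Perm.refl        = refl
∑ₚ-↭ t t-sym (prep x p)       = cong₂ _+_ (∑-↭ p (t x)) (∑ₚ-↭ t t-sym p)
∑ₚ-↭ t t-sym (swap {xs} {ys} x y p) =
  trans (cong₂ _+_ (cong₂ _+_ (t-sym x y) (∑-↭ p (t x))) (cong₂ _+_ (∑-↭ p (t y)) (∑ₚ-↭ t t-sym p)))
        (lemma (t y x) (∑ ys (t x)) (∑ ys (t y)) (∑ₚ t ys))
  where
  lemma : ∀ a b c d → (a + b) + (c + d) ≡ (a + c) + (b + d)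
  lemma = solve-∀
∑ₚ-↭ t t-sym (Perm.trans p q) = trans (∑ₚ-↭ t t-sym p) (∑ₚ-↭ t t-sym q)

∏ₚ-* : (t u : A → A → ℤ) (xs : List A) → ∏ₚ (λ x y → t x y * u x y) xs ≡ ∏ₚ t xs * ∏ₚ u xs
∏ₚ-* t u []       = refl
∏ₚ-* t u (x ∷ xs) = trans (cong₂ _*_ (∏-* xs (t x) (u x)) (∏ₚ-* t u xs)) (lemma (∏ xs (t x)) (∏ xs (u x)) (∏ₚ t xs) (∏ₚ u xs))
  where
  lemma : ∀ a b c d → (a * b) * (c * d) ≡ (a * c) * (b * d)
  lemma = solve-∀

∏ₚ-map : (t : C → C → ℤ) (h : A → C) (xs : List A) → ∏ₚ t (map h xs) ≡ ∏ₚ (λ x y → t (h x) (h y)) xs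
∏ₚ-map t h []       = refl
∏ₚ-map t h (x ∷ xs) = cong₂ _*_ (∏-map h xs (t (h x))) (∏ₚ-map t h xs)

∑ₚ-map : (t : C → C → ℤ) (h : A → C) (xs : List A) → ∑ₚ t (map h xs) ≡ ∑ₚ (λ x y → t (h x) (h y)) xs
∑ₚ-map t h []       = refl
∑ₚ-map t h (x ∷ xs) = cong₂ _+_ (∑-map h xs (t (h x))) (∑ₚ-map t h xs)

∏-congᴬ : {f g : A → ℤ} {xs : List A} → All (λ x → f x ≡ g x) xs → ∏ xs f ≡ ∏ xs g
∏-congᴬ []         = refl
∏-congᴬ (eq ∷ eqs) = cong₂ _*_ eq (∏-congᴬ eqs)

∑-congᴬ : {f g : A → ℤ} {xs : List A} → All (λ x → f x ≡ g x) xs → ∑ xs f ≡ ∑ xs g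
∑-congᴬ []         = refl
∑-congᴬ (eq ∷ eqs) = cong₂ _+_ eq (∑-congᴬ eqs)

∏ₚ-cong : {t u : A → A → ℤ} {xs : List A} → AllPairs (λ x y → t x y ≡ u x y) xs → ∏ₚ t xs ≡ ∏ₚ u xs
∏ₚ-cong []         = refl
∏ₚ-cong (eq ∷ eqs) = cong₂ _*_ (∏-congᴬ eq) (∏ₚ-cong eqs)

∑ₚ-cong : {t u : A → A → ℤ} {xs : List A} → AllPairs (λ x y → t x y ≡ u x y) xs → ∑ₚ t xs ≡ ∑ₚ u xs
∑ₚ-cong []         = refl
∑ₚ-cong (eq ∷ eqs) = cong₂ _+_ (∑-congᴬ eq) (∑ₚ-cong eqs)

∏-≢0ᴬ : {f : A → ℤ} {xs : List A} → All (λ x → f x ≢ 0ℤ) xs → ∏ xs f ≢ 0ℤ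
∏-≢0ᴬ []       ()
∏-≢0ᴬ (≢0 ∷ a) = *-≢0 ≢0 (∏-≢0ᴬ a)

∏ₚ-≢0 : {t : A → A → ℤ} {xs : List A} → AllPairs (λ x y → t x y ≢ 0ℤ) xs → ∏ₚ t xs ≢ 0ℤ
∏ₚ-≢0 []       ()
∏ₚ-≢0 (≢0 ∷ a) = *-≢0 (∏-≢0ᴬ ≢0) (∏ₚ-≢0 a)

∏ₚ-one : {t : A → A → ℤ} {xs : List A} → AllPairs (λ x y → t x y ≡ 1ℤ) xs → ∏ₚ t xs ≡ 1ℤ
∏ₚ-one {xs = xs} eq = trans (∏ₚ-cong eq) (ones xs)
  where
  ones : (xs : List A) → ∏ₚ (λ _ _ → 1ℤ) xs ≡ 1ℤ
  ones []       = refl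
  ones (x ∷ xs) = cong₂ _*_ (∏-one xs λ _ → refl) (ones xs)

-- Words without repetitions and sublists.

-- A new letter x can be chosen at most once without killing the term; chosen once, it sits in one
-- of N + 1 places, and by symmetry each place may be taken to be the first.
∑ʷ-∷ : {f : List A → ℤ} → Symm f → (∀ x w → f (x ∷ x ∷ w) ≡ 0ℤ) → ∀ x xs N →
       ∑ʷ (x ∷ xs) (suc N) f ≡ ∑ʷ xs (suc N) f + ℤ.+ suc N * ∑ʷ xs N (f ∘ (x ∷_))
∑ʷ-∷ {f = f} f-symm f-repeat x xs zero    =
  trans (+-comm (f (x ∷ [])) _) (cong (∑ʷ xs 1 f +_) (sym (*-identityˡ (f (x ∷ [])))))
∑ʷ-∷ {f = f} f-symm f-repeat x xs (suc N) = begin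
  ∑ʷ (x ∷ xs) (suc N) (f ∘ (x ∷_)) + (∑[ y ← xs ] ∑ʷ (x ∷ xs) (suc N) (f ∘ (y ∷_)))
    ≡⟨ cong₂ _+_ (∑ʷ-∷ (f-symm ∘ prep x) (repeat-∷ x) x xs N)
                 (∑-cong xs λ y → ∑ʷ-∷ (f-symm ∘ prep y) (repeat-∷ y) x xs N) ⟩
  X + suc-N * ∑ʷ xs N (λ w → f (x ∷ x ∷ w)) + (∑[ y ← xs ] (∑ʷ xs (suc N) (f ∘ (y ∷_)) + suc-N * ∑ʷ xs N (λ w → f (y ∷ x ∷ w))))
    ≡⟨ cong₂ (λ a b → X + suc-N * a + b) (∑ʷ-zero xs N (f-repeat x))
         (trans (∑-+ xs _ _) (cong (Y +_) (trans (∑-*ˡ xs suc-N _)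
            (cong (suc-N *_) (∑-cong xs λ y → ∑ʷ-cong xs N λ w _ → f-symm (swap y x Perm.refl)))))) ⟩
  X + suc-N * 0ℤ + (Y + suc-N * X)
    ≡⟨ lemma X Y suc-N ⟩
  Y + (1ℤ + suc-N) * X ∎
  where
  open ≡-Reasoning
  suc-N X Y : ℤ
  suc-N = ℤ.+ suc N
  X = ∑ʷ xs (suc N) (f ∘ (x ∷_))
  Y = ∑ʷ xs (suc (suc N)) f
  repeat-∷ : ∀ z y w → f (z ∷ y ∷ y ∷ w) ≡ 0ℤ
  repeat-∷ z y w = trans (f-symm (Perm.trans (swap z y Perm.refl) (prep y (swap z y Perm.refl)))) (f-repeat y (z ∷ w))
  lemma : ∀ x y n → x + n * 0ℤ + (y + n * x) ≡ y + (1ℤ + n) * x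
  lemma = solve-∀

-- Repetitions contribute zero and the N! orderings of a sublist contribute equally. This is how
-- ordered choices become the unordered collections counted by `sublists`.
∑ʷ-sublists : {f : List A → ℤ} → Symm f → (∀ x w → f (x ∷ x ∷ w) ≡ 0ℤ) → ∀ xs N →
              ∑ʷ xs N f ≡ ℤ.+ (N ℕ.!) * (∑[ F ← sublists xs ] 𝟙 (length F ℕₚ.≟ N) * f F)
∑ʷ-sublists {f = f} f-symm f-repeat []       zero    = lemma (f [])
  where
  lemma : ∀ a → a ≡ 1ℤ * (1ℤ * a + 0ℤ)
  lemma = solve-∀
∑ʷ-sublists f-symm f-repeat []       (suc N) = sym (*-zeroʳ (ℤ.+ (suc N ℕ.!)))
∑ʷ-sublists {f = f} f-symm f-repeat (x ∷ xs) zero    =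
  trans (∑ʷ-sublists f-symm f-repeat xs zero)
        (cong (1ℤ *_) (sym (trans (∑-++ (sublists xs) _ _)
          (trans (cong (old +_) (trans (∑-map (x ∷_) (sublists xs) _) (∑-zero (sublists xs) λ _ → refl))) (+-identityʳ old)))))
  where
  old : ℤ
  old = ∑[ F ← sublists xs ] 𝟙 (length F ℕₚ.≟ zero) * f F
∑ʷ-sublists {f = f} f-symm f-repeat (x ∷ xs) (suc N) = begin
  ∑ʷ (x ∷ xs) (suc N) f
    ≡⟨ ∑ʷ-∷ f-symm f-repeat x xs N ⟩
  ∑ʷ xs (suc N) f + ℤ.+ suc N * ∑ʷ xs N (f ∘ (x ∷_))
    ≡⟨ cong₂ (λ a b → a + ℤ.+ suc N * b) (∑ʷ-sublists f-symm f-repeat xs (suc N))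
         (∑ʷ-sublists (f-symm ∘ prep x) (λ y w → trans (f-symm (Perm.trans (swap x y Perm.refl) (prep y (swap x y Perm.refl)))) (f-repeat y (x ∷ w))) xs N) ⟩
  ℤ.+ (suc N ℕ.!) * old + ℤ.+ suc N * (ℤ.+ (N ℕ.!) * new)
    ≡⟨ cong (ℤ.+ (suc N ℕ.!) * old +_) (trans (sym (*-assoc (ℤ.+ suc N) (ℤ.+ (N ℕ.!)) new)) (cong (_* new) (sym (pos-* (suc N) (N ℕ.!))))) ⟩
  ℤ.+ (suc N ℕ.!) * old + ℤ.+ (suc N ℕ.!) * new
    ≡⟨ sym (*-distribˡ-+ (ℤ.+ (suc N ℕ.!)) old new) ⟩
  ℤ.+ (suc N ℕ.!) * (old + new)
    ≡⟨ cong (ℤ.+ (suc N ℕ.!) *_) (sym (trans (∑-++ (sublists xs) _ _) (cong (old +_) (trans (∑-map (x ∷_) (sublists xs) _)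
         (∑-cong (sublists xs) λ F → cong (_* f (x ∷ F)) (𝟙-⇔ (suc (length F) ℕₚ.≟ suc N) (length F ℕₚ.≟ N) ℕₚ.suc-injective (cong suc))))))) ⟩
  ℤ.+ (suc N ℕ.!) * (∑[ F ← sublists (x ∷ xs) ] 𝟙 (length F ℕₚ.≟ suc N) * f F) ∎
  where
  open ≡-Reasoning
  old new : ℤ
  old = ∑[ F ← sublists xs ] 𝟙 (length F ℕₚ.≟ suc N) * f F
  new = ∑[ F ← sublists xs ] 𝟙 (length F ℕₚ.≟ N) * f (x ∷ F)

∑-sublists-all : (f : List A → ℤ) (xs : List A) → ∑[ F ← sublists xs ] 𝟙 (length F ℕₚ.≟ length xs) * f F ≡ f xs
∑-sublists-all f xs = go f xs
  where
  long : (f : List _ → ℤ) (xs : List _) (N : ℕ) → length xs < N → ∑[ F ← sublists xs ] 𝟙 (length F ℕₚ.≟ N) * f F ≡ 0ℤ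
  long f []       (suc N) _ = refl
  long f (x ∷ xs) (suc N) (s≤s l) =
    trans (∑-++ (sublists xs) _ _) (cong₂ _+_ (long f xs (suc N) (ℕₚ.m≤n⇒m≤1+n l))
      (trans (∑-map (x ∷_) (sublists xs) _)
      (trans (∑-cong (sublists xs) λ F → cong (_* f (x ∷ F)) (𝟙-⇔ (suc (length F) ℕₚ.≟ suc N) (length F ℕₚ.≟ N) ℕₚ.suc-injective (cong suc)))
             (long (f ∘ (x ∷_)) xs N l))))
  go : (f : List _ → ℤ) (xs : List _) → ∑[ F ← sublists xs ] 𝟙 (length F ℕₚ.≟ length xs) * f F ≡ f xs
  go f []       = lemma (f [])
    where
    lemma : ∀ a → 1ℤ * a + 0ℤ ≡ a
    lemma = solve-∀
  go f (x ∷ xs) =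
    trans (∑-++ (sublists xs) _ _) (trans (cong₂ _+_ (long f xs (suc (length xs)) ℕₚ.≤-refl)
      (trans (∑-map (x ∷_) (sublists xs) _)
      (trans (∑-cong (sublists xs) λ F → cong (_* f (x ∷ F)) (𝟙-⇔ (suc (length F) ℕₚ.≟ suc (length xs)) (length F ℕₚ.≟ length xs) ℕₚ.suc-injective (cong suc)))
             (go (f ∘ (x ∷_)) xs)))) (+-identityˡ (f (x ∷ xs))))

-- Symplectic bosons

-- The standard symplectic pairing of the vertices 2i and 2i + 1.
B : ∀ {n} → Fin n → Fin n → ℤ
B zero          (suc zero)    = 1ℤ
B (suc zero)    zero          = -1ℤ
B (suc (suc i)) (suc (suc j)) = B i j
B _             _             = 0ℤ

B-alt : ∀ {n} (i j : Fin n) → B i j ≡ - B j i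
B-alt zero          zero          = refl
B-alt zero          (suc zero)    = refl
B-alt zero          (suc (suc j)) = refl
B-alt (suc zero)    zero          = refl
B-alt (suc zero)    (suc zero)    = refl
B-alt (suc zero)    (suc (suc j)) = refl
B-alt (suc (suc i)) zero          = refl
B-alt (suc (suc i)) (suc zero)    = refl
B-alt (suc (suc i)) (suc (suc j)) = B-alt i j

module _ (_≟ᴬ_ : DecidableEquality A) where

  # : A → List A → ℕ
  # y []      = 0
  # y (z ∷ w) = (if does (y ≟ᴬ z) then 1 else 0) ℕ.+ # y w

  #-here : ∀ {y z} w → y ≡ z → # y (z ∷ w) ≡ suc (# y w)
  #-here {y} {z} w eq with y ≟ᴬ z
  ... | yes _  = refl
  ... | no neq = contradiction eq neq

  #-there : ∀ {y z} w → y ≢ z → # y (z ∷ w) ≡ # y w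
  #-there {y} {z} w neq with y ≟ᴬ z
  ... | yes eq = contradiction eq neq
  ... | no _   = refl

  #-insert : ∀ {y z} → y ≢ z → ∀ pre w → # y (pre ++ z ∷ w) ≡ # y (pre ++ w)
  #-insert neq []        w = #-there w neq
  #-insert {y} neq (q ∷ pre) w = cong ((if does (y ≟ᴬ q) then 1 else 0) ℕ.+_) (#-insert neq pre w)

Letter : ℕ → Set
Letter m = Fin (m ℕ.* 2) × Bool

βᵇ : ∀ {n} → Fin n × Bool → Fin n × Bool → ℤ
βᵇ x y = - B (proj₁ x) (proj₁ y) * γᵇ (proj₂ x) (proj₂ y)

-- The only letter with which a given letter has a nonzero pairing.
hat : ∀ m → Letter m → Letter m
hat (suc m) (zero        , s) = suc zero , not s
hat (suc m) (suc zero    , s) = zero , not s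
hat (suc m) (suc (suc v) , s) = suc (suc (proj₁ (hat m (v , s)))) , proj₂ (hat m (v , s))

private
  *0 : ∀ a → a * 0ℤ ≡ 0ℤ
  *0 = *-zeroʳ

βᵇ-hat : ∀ m (x y : Letter m) → y ≢ hat m x → βᵇ x y ≡ 0ℤ
βᵇ-hat (suc m) (zero , s)     (zero , t)       neq = refl
βᵇ-hat (suc m) (zero , false) (suc zero , false) neq = refl
βᵇ-hat (suc m) (zero , false) (suc zero , true)  neq = contradiction refl neq
βᵇ-hat (suc m) (zero , true)  (suc zero , false) neq = contradiction refl neq
βᵇ-hat (suc m) (zero , true)  (suc zero , true)  neq = refl
βᵇ-hat (suc m) (zero , s)     (suc (suc w) , t) neq = refl
βᵇ-hat (suc m) (suc zero , false) (zero , false) neq = refl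
βᵇ-hat (suc m) (suc zero , false) (zero , true)  neq = contradiction refl neq
βᵇ-hat (suc m) (suc zero , true)  (zero , false) neq = contradiction refl neq
βᵇ-hat (suc m) (suc zero , true)  (zero , true)  neq = refl
βᵇ-hat (suc m) (suc zero , s) (suc zero , t)   neq = refl
βᵇ-hat (suc m) (suc zero , s) (suc (suc w) , t) neq = refl
βᵇ-hat (suc m) (suc (suc v) , s) (zero , t)     neq = refl
βᵇ-hat (suc m) (suc (suc v) , s) (suc zero , t) neq = refl
βᵇ-hat (suc m) (suc (suc v) , s) (suc (suc w) , t) neq =
  βᵇ-hat m (v , s) (w , t) λ eq → neq (cong₂ (λ a b → suc (suc a) , b) (cong proj₁ eq) (cong proj₂ eq))

-- The Gaussian moment of a copies of one letter and b copies of another whose only nonzero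
-- covariance is the mutual one, c: all a! bijections between the copies count c ^ a.
channel : ℤ → ℕ → ℕ → ℤ
channel c a b = 𝟙 (a ℕₚ.≟ b) * (ℤ.+ (a ℕ.!) * c ^ a)

-- The four letters at the vertices 2j and 2j + 1 form two independent channels: (2j , false) with
-- (2j + 1 , true) has covariance -1, and (2j + 1 , false) with (2j , true) has covariance 1.
val : ∀ m → (Letter m → ℕ) → ℤ
val zero    g = 1ℤ
val (suc m) g = channel -1ℤ (g (zero , false)) (g (suc zero , true))
              * (channel 1ℤ (g (suc zero , false)) (g (zero , true))
              * val m (λ (v , s) → g (suc (suc v) , s)))

val-cong : ∀ m {f g : Letter m → ℕ} → (∀ x → f x ≡ g x) → val m f ≡ val m g
val-cong zero    eq = refl
val-cong (suc m) eq =
  cong₂ _*_ (cong₂ (channel -1ℤ) (eq _) (eq _)) (cong₂ _*_ (cong₂ (channel 1ℤ) (eq _) (eq _)) (val-cong m λ _ → eq _))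

private
  channel-≡ : ∀ c a → channel c a a ≡ ℤ.+ (a ℕ.!) * c ^ a
  channel-≡ c a = trans (cong (_* (ℤ.+ (a ℕ.!) * c ^ a)) (𝟙-yes (a ℕₚ.≟ a) refl)) (*-identityˡ _)

  channel-≢ : ∀ c {a b} → a ≢ b → channel c a b ≡ 0ℤ
  channel-≢ c {a} {b} neq = cong (_* (ℤ.+ (a ℕ.!) * c ^ a)) (𝟙-no (a ℕₚ.≟ b) neq)

  step : ∀ c a → c * (ℤ.+ suc a * (ℤ.+ (a ℕ.!) * c ^ a)) ≡ ℤ.+ (suc a ℕ.!) * c ^ suc a
  step c a = trans (lemma c (ℤ.+ suc a) (ℤ.+ (a ℕ.!)) (c ^ a)) (cong (_* (c * c ^ a)) (sym (pos-* (suc a) (a ℕ.!))))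
    where
    lemma : ∀ c s f e → c * (s * (f * e)) ≡ (s * f) * (c * e)
    lemma = solve-∀

-- One further letter on the left chooses among b partners and leaves b - 1 of them. For b = 0 the
-- value of `pred` is harmless, since it is multiplied by 0.
channel-left : ∀ c a b → c * (ℤ.+ b * channel c a (ℕ.pred b)) ≡ channel c (suc a) b
channel-left c a zero    = trans (cong (c *_) (*-zeroˡ (channel c a zero))) (*0 c)
channel-left c a (suc b) with a ℕₚ.≟ b
... | yes refl = trans (cong (λ e → c * (ℤ.+ suc a * e)) (channel-≡ c a)) (trans (step c a) (sym (channel-≡ c (suc a))))
... | no neq   = trans (cong (λ e → c * (ℤ.+ suc b * e)) (channel-≢ c neq))
                       (trans (cong (c *_) (*0 (ℤ.+ suc b))) (trans (*0 c) (sym (channel-≢ c (neq ∘ ℕₚ.suc-injective)))))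

channel-right : ∀ c a b → c * (ℤ.+ a * channel c (ℕ.pred a) b) ≡ channel c a (suc b)
channel-right c zero    b = trans (cong (c *_) (*-zeroˡ (channel c zero b))) (*0 c)
channel-right c (suc a) b with a ℕₚ.≟ b
... | yes refl = trans (cong (λ e → c * (ℤ.+ suc a * e)) (channel-≡ c a)) (trans (step c a) (sym (channel-≡ c (suc a))))
... | no neq   = trans (cong (λ e → c * (ℤ.+ suc a * e)) (channel-≢ c neq))
                       (trans (cong (c *_) (*0 (ℤ.+ suc a))) (trans (*0 c) (sym (channel-≢ c (neq ∘ ℕₚ.suc-injective)))))

private
  swap-in : ∀ b k x y → b * (k * (x * y)) ≡ x * (b * (k * y))
  swap-in = solve-∀
  assoc-in : ∀ b k x y → b * (k * (x * y)) ≡ (b * (k * x)) * y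
  assoc-in = solve-∀

-- Wick's rule on multiplicities: a new letter x chooses one of the copies of its partner, counted
-- by g, and g₁ is what remains. The counts are specified pointwise so that the letter counts of
-- words fit directly. The clauses only locate the channel of x and the side on which it stands.
val-update : ∀ m (x : Letter m) {g g₁ g₂ : Letter m → ℕ} →
  g₁ (hat m x) ≡ ℕ.pred (g (hat m x)) → (∀ y → y ≢ hat m x → g₁ y ≡ g y) →
  g₂ x ≡ suc (g x) → (∀ y → y ≢ x → g₂ y ≡ g y) →
  βᵇ x (hat m x) * (ℤ.+ g (hat m x) * val m g₁) ≡ val m g₂
val-update (suc m) (zero , false) {g} {g₁} {g₂} h₁ k₁ h₂ k₂ =
  trans (assoc-in -1ℤ (ℤ.+ g (suc zero , true)) (channel -1ℤ (g₁ (zero , false)) (g₁ (suc zero , true))) _)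
  (cong₂ _*_ (trans (cong₂ (λ a b → -1ℤ * (ℤ.+ g (suc zero , true) * channel -1ℤ a b)) (k₁ _ λ ()) h₁)
              (trans (channel-left -1ℤ (g (zero , false)) (g (suc zero , true))) (sym (cong₂ (channel -1ℤ) h₂ (k₂ _ λ ())))))
   (cong₂ _*_ (cong₂ (channel 1ℤ) (trans (k₁ _ λ ()) (sym (k₂ _ λ ()))) (trans (k₁ _ λ ()) (sym (k₂ _ λ ()))))
              (val-cong m λ _ → trans (k₁ _ λ ()) (sym (k₂ _ λ ())))))
val-update (suc m) (suc zero , true) {g} {g₁} {g₂} h₁ k₁ h₂ k₂ =
  trans (assoc-in -1ℤ (ℤ.+ g (zero , false)) (channel -1ℤ (g₁ (zero , false)) (g₁ (suc zero , true))) _)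
  (cong₂ _*_ (trans (cong₂ (λ a b → -1ℤ * (ℤ.+ g (zero , false) * channel -1ℤ a b)) h₁ (k₁ _ λ ()))
              (trans (channel-right -1ℤ (g (zero , false)) (g (suc zero , true))) (sym (cong₂ (channel -1ℤ) (k₂ _ λ ()) h₂))))
   (cong₂ _*_ (cong₂ (channel 1ℤ) (trans (k₁ _ λ ()) (sym (k₂ _ λ ()))) (trans (k₁ _ λ ()) (sym (k₂ _ λ ()))))
              (val-cong m λ _ → trans (k₁ _ λ ()) (sym (k₂ _ λ ())))))
val-update (suc m) (suc zero , false) {g} {g₁} {g₂} h₁ k₁ h₂ k₂ =
  trans (swap-in 1ℤ (ℤ.+ g (zero , true)) (channel -1ℤ (g₁ (zero , false)) (g₁ (suc zero , true))) _)
  (cong₂ _*_ (cong₂ (channel -1ℤ) (trans (k₁ _ λ ()) (sym (k₂ _ λ ()))) (trans (k₁ _ λ ()) (sym (k₂ _ λ ()))))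
   (trans (assoc-in 1ℤ (ℤ.+ g (zero , true)) (channel 1ℤ (g₁ (suc zero , false)) (g₁ (zero , true))) _)
   (cong₂ _*_ (trans (cong₂ (λ a b → 1ℤ * (ℤ.+ g (zero , true) * channel 1ℤ a b)) (k₁ _ λ ()) h₁)
              (trans (channel-left 1ℤ (g (suc zero , false)) (g (zero , true))) (sym (cong₂ (channel 1ℤ) h₂ (k₂ _ λ ())))))
              (val-cong m λ _ → trans (k₁ _ λ ()) (sym (k₂ _ λ ()))))))
val-update (suc m) (zero , true) {g} {g₁} {g₂} h₁ k₁ h₂ k₂ =
  trans (swap-in 1ℤ (ℤ.+ g (suc zero , false)) (channel -1ℤ (g₁ (zero , false)) (g₁ (suc zero , true))) _)
  (cong₂ _*_ (cong₂ (channel -1ℤ) (trans (k₁ _ λ ()) (sym (k₂ _ λ ()))) (trans (k₁ _ λ ()) (sym (k₂ _ λ ()))))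
   (trans (assoc-in 1ℤ (ℤ.+ g (suc zero , false)) (channel 1ℤ (g₁ (suc zero , false)) (g₁ (zero , true))) _)
   (cong₂ _*_ (trans (cong₂ (λ a b → 1ℤ * (ℤ.+ g (suc zero , false) * channel 1ℤ a b)) h₁ (k₁ _ λ ()))
              (trans (channel-right 1ℤ (g (suc zero , false)) (g (zero , true))) (sym (cong₂ (channel 1ℤ) (k₂ _ λ ()) h₂))))
              (val-cong m λ _ → trans (k₁ _ λ ()) (sym (k₂ _ λ ()))))))
val-update (suc m) (suc (suc v) , s) {g} {g₁} {g₂} h₁ k₁ h₂ k₂ =
  trans (swap-in b k (channel -1ℤ (g₁ (zero , false)) (g₁ (suc zero , true))) _)
  (cong₂ _*_ (cong₂ (channel -1ℤ) (trans (k₁ _ λ ()) (sym (k₂ _ λ ()))) (trans (k₁ _ λ ()) (sym (k₂ _ λ ()))))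
  (trans (swap-in b k (channel 1ℤ (g₁ (suc zero , false)) (g₁ (zero , true))) _)
  (cong₂ _*_ (cong₂ (channel 1ℤ) (trans (k₁ _ λ ()) (sym (k₂ _ λ ()))) (trans (k₁ _ λ ()) (sym (k₂ _ λ ()))))
    (val-update m (v , s) {λ (v , s) → g (suc (suc v) , s)} {λ (v , s) → g₁ (suc (suc v) , s)} {λ (v , s) → g₂ (suc (suc v) , s)}
      h₁ (λ y neq → k₁ _ λ eq → neq (suc²-injective eq)) h₂ (λ y neq → k₂ _ λ eq → neq (suc²-injective eq))))))
  where
  b k : ℤ
  b = βᵇ (v , s) (hat m (v , s))
  k = ℤ.+ g (suc (suc (proj₁ (hat m (v , s)))) , proj₂ (hat m (v , s)))
  suc²-injective : ∀ {x y : Letter m} → (Fin.suc (Fin.suc (proj₁ x)) , proj₂ x) ≡ (Fin.suc (Fin.suc (proj₁ y)) , proj₂ y) → x ≡ y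
  suc²-injective refl = refl

module BosonValue (m : ℕ) where

  open Moments (B {m ℕ.* 2}) B-alt 0 using (module Bose)
  open Bose

  _≟ᴸ_ : DecidableEquality (Letter m)
  _≟ᴸ_ = ×ₚ.≡-dec Fin._≟_ Boolₚ._≟_

  count : Letter m → List (Letter m) → ℕ
  count = # _≟ᴸ_

  private
    D-congᴸ : ∀ x {F G : List (Letter m) → ℤ} w → (∀ u → suc (length u) ≡ length w → F u ≡ G u) → D x F w ≡ D x G w
    D-congᴸ x []      eq = refl
    D-congᴸ x (z ∷ w) eq = cong₂ (λ a b → βᵇ x z * a + 1ℤ * b) (eq w refl) (D-congᴸ x w λ u l → eq (z ∷ u) (cong suc l))

    -- Contraction of x annihilates every letter except `hat m x`, and all copies of that letter
    -- yield the same term. The separate argument k of G carries their number, so that deleting a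
    -- copy changes k and nothing else.
    D-count : ∀ x (G : ℕ → List (Letter m) → ℤ) → (∀ k pre u → G k (pre ++ hat m x ∷ u) ≡ G k (pre ++ u)) → ∀ w →
              D x (λ u → G (count (hat m x) u) u) w
            ≡ βᵇ x (hat m x) * (ℤ.+ count (hat m x) w * G (ℕ.pred (count (hat m x) w)) w)
    D-count x G G-ignores []      = sym (trans (cong (βᵇ x (hat m x) *_) (*-zeroˡ (G 0 []))) (*-zeroʳ (βᵇ x (hat m x))))
    D-count x G G-ignores (z ∷ w) = by-cases (hat m x ≟ᴸ z)
     where
     by-cases : Dec (hat m x ≡ z) → D x (λ u → G (count (hat m x) u) u) (z ∷ w)
                ≡ βᵇ x (hat m x) * (ℤ.+ count (hat m x) (z ∷ w) * G (ℕ.pred (count (hat m x) (z ∷ w))) (z ∷ w))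
     by-cases (yes refl) = begin
      b * G c w + 1ℤ * D x (λ u → G (count (hat m x) (hat m x ∷ u)) (hat m x ∷ u)) w
        ≡⟨ cong (λ e → b * G c w + 1ℤ * e) (trans (D-cong x (λ u → trans (cong (λ k → G k (hat m x ∷ u)) (#-here _≟ᴸ_ u refl)) (G-ignores _ [] u)) w)
                                                  (D-count x (λ k → G (suc k)) (λ k → G-ignores (suc k)) w)) ⟩
      b * G c w + 1ℤ * (b * (ℤ.+ c * G (suc (ℕ.pred c)) w))
        ≡⟨ cong (λ e → b * G c w + 1ℤ * (b * e)) (restore c) ⟩
      b * G c w + 1ℤ * (b * (ℤ.+ c * G c w))
        ≡⟨ lemma b (G c w) (ℤ.+ c) ⟩
      b * ((1ℤ + ℤ.+ c) * G c w)
        ≡⟨ cong (λ e → b * (ℤ.+ suc c * e)) (sym (G-ignores c [] w)) ⟩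
      b * (ℤ.+ suc c * G c (hat m x ∷ w))
        ≡⟨ cong (λ k → b * (ℤ.+ k * G (ℕ.pred k) (hat m x ∷ w))) (sym (#-here _≟ᴸ_ w refl)) ⟩
      b * (ℤ.+ count (hat m x) (hat m x ∷ w) * G (ℕ.pred (count (hat m x) (hat m x ∷ w))) (hat m x ∷ w)) ∎
      where
      open ≡-Reasoning
      b : ℤ
      b = βᵇ x (hat m x)
      c : ℕ
      c = count (hat m x) w
      -- For c = 0 the two arguments of G differ, but the factor c is then 0.
      restore : ∀ c → ℤ.+ c * G (suc (ℕ.pred c)) w ≡ ℤ.+ c * G c w
      restore zero    = refl
      restore (suc c) = refl
      lemma : ∀ b g c → b * g + 1ℤ * (b * (c * g)) ≡ b * ((1ℤ + c) * g)
      lemma = solve-∀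
     by-cases (no neq) = begin
      βᵇ x z * G (count (hat m x) w) w + 1ℤ * D x (λ u → G (count (hat m x) (z ∷ u)) (z ∷ u)) w
        ≡⟨ cong₂ (λ b e → b * G (count (hat m x) w) w + 1ℤ * e) (βᵇ-hat m x z (neq ∘ sym))
             (trans (D-cong x (λ u → cong (λ k → G k (z ∷ u)) (#-there _≟ᴸ_ u neq)) w)
                    (D-count x (λ k u → G k (z ∷ u)) (λ k pre → G-ignores k (z ∷ pre)) w)) ⟩
      0ℤ * G (count (hat m x) w) w + 1ℤ * (βᵇ x (hat m x) * (ℤ.+ count (hat m x) w * G (ℕ.pred (count (hat m x) w)) (z ∷ w)))
        ≡⟨ lemma (G (count (hat m x) w) w) _ ⟩
      βᵇ x (hat m x) * (ℤ.+ count (hat m x) w * G (ℕ.pred (count (hat m x) w)) (z ∷ w))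
        ≡⟨ cong (λ k → βᵇ x (hat m x) * (ℤ.+ k * G (ℕ.pred k) (z ∷ w))) (sym (#-there _≟ᴸ_ w neq)) ⟩
      βᵇ x (hat m x) * (ℤ.+ count (hat m x) (z ∷ w) * G (ℕ.pred (count (hat m x) (z ∷ w))) (z ∷ w)) ∎
      where
      open ≡-Reasoning
      lemma : ∀ g e → 0ℤ * g + 1ℤ * e ≡ e
      lemma = solve-∀

    val-zero : ∀ m → val m (λ _ → 0) ≡ 1ℤ
    val-zero zero    = refl
    val-zero (suc m) = cong (λ e → 1ℤ * (1ℤ * e)) (val-zero m)

  wick-val : ∀ f w → length w ≤ f → wick f w ≡ val m (λ y → count y w)
  wick-val zero    []      _ = sym (val-zero m)
  wick-val (suc f) []      _ = sym (val-zero m)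
  wick-val (suc f) (x ∷ w) (s≤s l) = begin
    D x (wick f) w
      ≡⟨ D-congᴸ x w (λ u l′ → trans (wick-val f u (ℕₚ.≤-trans (ℕₚ.≤-trans (ℕₚ.n≤1+n _) (ℕₚ.≤-reflexive l′)) l))
                                     (val-cong m λ y → override y u)) ⟩
    D x (λ u → G (count (hat m x) u) u) w
      ≡⟨ D-count x G G-ignores w ⟩
    βᵇ x (hat m x) * (ℤ.+ count (hat m x) w * G (ℕ.pred (count (hat m x) w)) w)
      ≡⟨ val-update m x {λ y → count y w} {λ y → if does (y ≟ᴸ hat m x) then ℕ.pred (count (hat m x) w) else count y w} {λ y → count y (x ∷ w)}
           (if-yes _ _) (λ y → if-no _ _) (#-here _≟ᴸ_ w refl) (λ y → #-there _≟ᴸ_ w) ⟩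
    val m (λ y → count y (x ∷ w)) ∎
    where
    open ≡-Reasoning
    -- The multiplicity of `hat m x`, which a contraction lowers, is detached from the
    -- multiplicities that it keeps.
    G : ℕ → List (Letter m) → ℤ
    G k u = val m (λ y → if does (y ≟ᴸ hat m x) then k else count y u)
    if-yes : ∀ a b → (if does (hat m x ≟ᴸ hat m x) then a else b) ≡ a
    if-yes a b with hat m x ≟ᴸ hat m x
    ... | yes _ = refl
    ... | no ne = contradiction refl ne
    if-no : ∀ a b {y} → y ≢ hat m x → (if does (y ≟ᴸ hat m x) then a else b) ≡ b
    if-no a b {y} ne with y ≟ᴸ hat m x
    ... | yes e = contradiction e ne
    ... | no _  = refl
    override : ∀ y u → count y u ≡ (if does (y ≟ᴸ hat m x) then count (hat m x) u else count y u)
    override y u with y ≟ᴸ hat m x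
    ... | yes refl = refl
    ... | no _     = refl
    G-ignores : ∀ k pre u → G k (pre ++ hat m x ∷ u) ≡ G k (pre ++ u)
    G-ignores k pre u = val-cong m λ y → aux y
      where
      aux : ∀ y → (if does (y ≟ᴸ hat m x) then k else count y (pre ++ hat m x ∷ u)) ≡ (if does (y ≟ᴸ hat m x) then k else count y (pre ++ u))
      aux y with y ≟ᴸ hat m x
      ... | yes _ = refl
      ... | no ne = #-insert _≟ᴸ_ ne pre u

-- Linear functionals on graph polynomials

inc : ∀ {n} → Fin n → Vec ℕ n → Vec ℕ n
inc v b = Vec.updateAt b v suc

inc-comm : ∀ {n} (u v : Fin n) b → inc u (inc v b) ≡ inc v (inc u b)
inc-comm zero    zero    (x ∷ b) = refl
inc-comm zero    (suc v) (x ∷ b) = refl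
inc-comm (suc u) zero    (x ∷ b) = refl
inc-comm (suc u) (suc v) (x ∷ b) = cong (x ∷_) (inc-comm u v b)

-- The linear functional L applied to the polynomial z^b ∏ (z_v - z_u), the
-- product being over the edges (u , v); L is given by its values on monomials.
Li : ∀ {n} → List (Fin n × Fin n) → (Vec ℕ n → ℤ) → Vec ℕ n → ℤ
Li []             L b = L b
Li ((u , v) ∷ es) L b = Li es L (inc v b) - Li es L (inc u b)

module _ {n : ℕ} where

  Li-cong : ∀ (es : List (Fin n × Fin n)) {L M} → (∀ b → L b ≡ M b) → ∀ b → Li es L b ≡ Li es M b
  Li-cong []             eq b = eq b
  Li-cong ((u , v) ∷ es) eq b = cong₂ _-_ (Li-cong es eq _) (Li-cong es eq _)

  Li-inc : ∀ (es : List (Fin n × Fin n)) L w b → Li es L (inc w b) ≡ Li es (L ∘ inc w) b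
  Li-inc []             L w b = refl
  Li-inc ((u , v) ∷ es) L w b =
    cong₂ _-_ (trans (cong (Li es L) (inc-comm v w b)) (Li-inc es L w _)) (trans (cong (Li es L) (inc-comm u w b)) (Li-inc es L w _))

  Li-++ : ∀ (es fs : List (Fin n × Fin n)) L b → Li (es ++ fs) L b ≡ Li es (Li fs L) b
  Li-++ []             fs L b = refl
  Li-++ ((u , v) ∷ es) fs L b = cong₂ _-_ (Li-++ es fs L _) (Li-++ es fs L _)

  Li-↭ : ∀ {es fs : List (Fin n × Fin n)} → es ↭ fs → ∀ L b → Li es L b ≡ Li fs L b
  Li-↭ Perm.refl L b = refl
  Li-↭ (prep (u , v) p) L b = cong₂ _-_ (Li-↭ p L _) (Li-↭ p L _)
  Li-↭ (swap {xs} {ys} (u , v) (x , y) p) L b =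
    trans (cong₂ _-_ (cong₂ _-_ (eq y v) (eq x v)) (cong₂ _-_ (eq y u) (eq x u)))
          (lemma (Li ys L (inc v (inc y b))) (Li ys L (inc v (inc x b))) (Li ys L (inc u (inc y b))) _)
    where
    eq : ∀ s t → Li xs L (inc s (inc t b)) ≡ Li ys L (inc t (inc s b))
    eq s t = trans (Li-↭ p L _) (cong (Li ys L) (inc-comm s t b))
    lemma : ∀ a b c d → (a - b) - (c - d) ≡ (a - c) - (b - d)
    lemma = solve-∀
  Li-↭ (Perm.trans p q) L b = trans (Li-↭ p L b) (Li-↭ q L b)

  Li-flip : ∀ u v (es : List (Fin n × Fin n)) L b → Li ((u , v) ∷ es) L b ≡ - Li ((v , u) ∷ es) L b
  Li-flip u v es L b = lemma (Li es L (inc v b)) (Li es L (inc u b))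
    where
    lemma : ∀ x y → x - y ≡ - (y - x)
    lemma = solve-∀

  Li-- : ∀ (es : List (Fin n × Fin n)) L M b → Li es (λ b → L b - M b) b ≡ Li es L b - Li es M b
  Li-- []             L M b = refl
  Li-- ((u , v) ∷ es) L M b = trans (cong₂ _-_ (Li-- es L M _) (Li-- es L M _)) (lemma (Li es L (inc v b)) _ (Li es L (inc u b)) _)
    where
    lemma : ∀ a b c d → (a - b) - (c - d) ≡ (a - c) - (b - d)
    lemma = solve-∀

  Li-+ : ∀ (es : List (Fin n × Fin n)) L M b → Li es (λ b → L b + M b) b ≡ Li es L b + Li es M b
  Li-+ []             L M b = refl
  Li-+ ((u , v) ∷ es) L M b = trans (cong₂ _-_ (Li-+ es L M _) (Li-+ es L M _)) (lemma (Li es L (inc v b)) _ (Li es L (inc u b)) _)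
    where
    lemma : ∀ a b c d → (a + b) - (c + d) ≡ (a - c) + (b - d)
    lemma = solve-∀

  Li-* : ∀ (es : List (Fin n × Fin n)) a L b → Li es (λ b → a * L b) b ≡ a * Li es L b
  Li-* []             a L b = refl
  Li-* ((u , v) ∷ es) a L b = trans (cong₂ _-_ (Li-* es a L _) (Li-* es a L _)) (lemma a (Li es L (inc v b)) (Li es L (inc u b)))
    where
    lemma : ∀ a x y → a * x - a * y ≡ a * (x - y)
    lemma = solve-∀

  Li-zero : ∀ (P : Vec ℕ n → Set) → (∀ v {b} → P b → P (inc v b)) →
            ∀ (es : List (Fin n × Fin n)) {L} → (∀ b → P b → L b ≡ 0ℤ) → ∀ b → P b → Li es L b ≡ 0ℤ
  Li-zero P P-inc []             L0 b Pb = L0 b Pb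
  Li-zero P P-inc ((u , v) ∷ es) L0 b Pb =
    cong₂ _-_ (Li-zero P P-inc es L0 _ (P-inc v Pb)) (Li-zero P P-inc es L0 _ (P-inc u Pb))

  Li-∑ : ∀ (es : List (Fin n × Fin n)) (xs : List A) (L : A → Vec ℕ n → ℤ) b →
         Li es (λ b → ∑[ x ← xs ] L x b) b ≡ ∑[ x ← xs ] Li es (L x) b
  Li-∑ es []       L b = Li-zero (λ _ → ⊤) (λ _ _ → tt) es (λ _ _ → refl) b tt
  Li-∑ es (x ∷ xs) L b = trans (Li-+ es (L x) (λ b → ∑[ x ← xs ] L x b) b) (cong (Li es (L x) b +_) (Li-∑ es xs L b))

  Li-∑ᵛ : ∀ (es : List (Fin n × Fin n)) (xs : List A) N (L : Vec A N → Vec ℕ n → ℤ) b →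
          Li es (λ b → ∑ᵛ xs N (λ w → L w b)) b ≡ ∑ᵛ xs N (λ w → Li es (L w) b)
  Li-∑ᵛ es xs zero    L b = refl
  Li-∑ᵛ es xs (suc N) L b = trans (Li-∑ es xs (λ x b → ∑ᵛ xs N (λ w → L (x ∷ w) b)) b) (∑-cong xs λ x → Li-∑ᵛ es xs N _ b)

ι : {P : Set} → Dec P → ℕ
ι P? = if does P? then 1 else 0

ι-yes : {P : Set} (P? : Dec P) → P → ι P? ≡ 1
ι-yes (yes _) _ = refl
ι-yes (no ¬p) p = contradiction p ¬p

ι-no : {P : Set} (P? : Dec P) → ¬ P → ι P? ≡ 0
ι-no (yes p) ¬p = contradiction p ¬p
ι-no (no _)  _  = refl

deg : ∀ {n} → Fin n → List (Fin n × Fin n) → ℕ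
deg z []             = 0
deg z ((u , v) ∷ es) = ι (z Fin.≟ u) ℕ.+ (ι (z Fin.≟ v) ℕ.+ deg z es)

-- The bosonic value of a word in which each vertex v occurs b v times with one
-- index and d - b v times with the other.
pairing : ∀ m → ℕ → Vec ℕ (m ℕ.* 2) → ℤ
pairing zero    d []          = 1ℤ
pairing (suc m) d (x ∷ y ∷ b) = 𝟙 (x ℕ.+ y ℕₚ.≟ d) * (ℤ.+ (y ℕ.!) * -1ℤ ^ y * ℤ.+ (x ℕ.!)) * pairing m d b

-- When every vertex has d letters, the two channel conditions d - x = y and d - y = x coincide, and
-- the channels supply (-1)^y y! and x!.
val-pairing : ∀ m d (g : Letter m → ℕ) b → (∀ v → g (v , true) ≡ Vec.lookup b v) →
              (∀ v → g (v , false) ℕ.+ g (v , true) ≡ d) → val m g ≡ pairing m d b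
val-pairing zero    d g []          h₁ h₂ = refl
val-pairing (suc m) d g (x ∷ y ∷ b) h₁ h₂ =
  trans (sym (*-assoc (channel -1ℤ a (g (suc zero , true))) (channel 1ℤ e (g (zero , true))) _))
        (cong₂ _*_ channels (val-pairing m d (λ (v , s) → g (suc (suc v) , s)) b (λ v → h₁ _) (λ v → h₂ _)))
  where
  a e : ℕ
  a = g (zero , false)
  e = g (suc zero , false)
  a+x : a ℕ.+ x ≡ d
  a+x = subst (λ t → a ℕ.+ t ≡ d) (h₁ zero) (h₂ zero)
  e+y : e ℕ.+ y ≡ d
  e+y = subst (λ t → e ℕ.+ t ≡ d) (h₁ (suc zero)) (h₂ (suc zero))
  channels : channel -1ℤ a (g (suc zero , true)) * channel 1ℤ e (g (zero , true)) ≡ 𝟙 (x ℕ.+ y ℕₚ.≟ d) * (ℤ.+ (y ℕ.!) * -1ℤ ^ y * ℤ.+ (x ℕ.!))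
  channels = by-cases (x ℕ.+ y ℕₚ.≟ d)
   where
   weight : ℤ
   weight = ℤ.+ (y ℕ.!) * -1ℤ ^ y * ℤ.+ (x ℕ.!)
   by-cases : Dec (x ℕ.+ y ≡ d) → channel -1ℤ a (g (suc zero , true)) * channel 1ℤ e (g (zero , true)) ≡ 𝟙 (x ℕ.+ y ℕₚ.≟ d) * weight
   by-cases (yes x+y) = begin
    channel -1ℤ a (g (suc zero , true)) * channel 1ℤ e (g (zero , true))
      ≡⟨ cong₂ (λ s t → channel -1ℤ a s * channel 1ℤ e t) (h₁ (suc zero)) (h₁ zero) ⟩
    channel -1ℤ a y * channel 1ℤ e x
      ≡⟨ cong₂ (λ s t → channel -1ℤ s y * channel 1ℤ t x)
               (ℕₚ.+-cancelʳ-≡ x a y (trans a+x (trans (sym x+y) (ℕₚ.+-comm x y)))) (ℕₚ.+-cancelʳ-≡ y e x (trans e+y (sym x+y))) ⟩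
    channel -1ℤ y y * channel 1ℤ x x
      ≡⟨ cong₂ (λ s t → s * (ℤ.+ (y ℕ.!) * -1ℤ ^ y) * (t * (ℤ.+ (x ℕ.!) * 1ℤ ^ x))) (𝟙-yes (y ℕₚ.≟ y) refl) (𝟙-yes (x ℕₚ.≟ x) refl) ⟩
    1ℤ * (ℤ.+ (y ℕ.!) * -1ℤ ^ y) * (1ℤ * (ℤ.+ (x ℕ.!) * 1ℤ ^ x))
      ≡⟨ cong (λ t → 1ℤ * (ℤ.+ (y ℕ.!) * -1ℤ ^ y) * (1ℤ * (ℤ.+ (x ℕ.!) * t))) (^-zeroˡ x) ⟩
    1ℤ * (ℤ.+ (y ℕ.!) * -1ℤ ^ y) * (1ℤ * (ℤ.+ (x ℕ.!) * 1ℤ))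
      ≡⟨ lemma (ℤ.+ (y ℕ.!)) (-1ℤ ^ y) (ℤ.+ (x ℕ.!)) ⟩
    1ℤ * weight
      ≡⟨ cong (_* weight) (sym (𝟙-yes (x ℕ.+ y ℕₚ.≟ d) x+y)) ⟩
    𝟙 (x ℕ.+ y ℕₚ.≟ d) * weight ∎
    where
    open ≡-Reasoning
    lemma : ∀ p q r → 1ℤ * (p * q) * (1ℤ * (r * 1ℤ)) ≡ 1ℤ * (p * q * r)
    lemma = solve-∀
   by-cases (no ≢d) = trans (cong (λ s → s * (ℤ.+ (a ℕ.!) * -1ℤ ^ a) * channel 1ℤ e (g (zero , true)))
      (𝟙-no (a ℕₚ.≟ g (suc zero , true)) λ a≡y → ≢d (trans (ℕₚ.+-comm x y) (subst (λ t → t ℕ.+ x ≡ d) (trans a≡y (h₁ (suc zero))) a+x))))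
      (cong (_* weight) (sym (𝟙-no (x ℕ.+ y ℕₚ.≟ d) ≢d)))

module BoseLi (m : ℕ) where

  open Moments (B {m ℕ.* 2}) B-alt 0 using (module Bose)
  open Bose
  open BosonValue m

  private
    count-same : ∀ z v s w → count (z , s) ((v , s) ∷ w) ≡ ι (z Fin.≟ v) ℕ.+ count (z , s) w
    count-same z v s w = by-cases (z Fin.≟ v)
      where
      by-cases : Dec (z ≡ v) → count (z , s) ((v , s) ∷ w) ≡ ι (z Fin.≟ v) ℕ.+ count (z , s) w
      by-cases (yes refl) = trans (#-here _≟ᴸ_ w refl) (cong (ℕ._+ count (z , s) w) (sym (ι-yes (z Fin.≟ z) refl)))
      by-cases (no neq)   = trans (#-there _≟ᴸ_ w λ eq → neq (cong proj₁ eq)) (cong (ℕ._+ count (z , s) w) (sym (ι-no (z Fin.≟ v) neq)))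

    count-other : ∀ z v {s t} w → s ≢ t → count (z , s) ((v , t) ∷ w) ≡ count (z , s) w
    count-other z v w neq = #-there _≟ᴸ_ w λ eq → neq (cong proj₂ eq)

    lookup-inc : ∀ {n} (z v : Fin n) b → Vec.lookup (inc v b) z ≡ ι (z Fin.≟ v) ℕ.+ Vec.lookup b z
    lookup-inc zero    zero    (x ∷ b) = refl
    lookup-inc zero    (suc v) (x ∷ b) = refl
    lookup-inc (suc z) zero    (x ∷ b) = refl
    lookup-inc (suc z) (suc v) (x ∷ b) = lookup-inc z v b

  module _ (L : Vec ℕ (m ℕ.* 2) → ℤ) (d : ℕ)
           (L-spec : ∀ g b → (∀ v → g (v , true) ≡ Vec.lookup b v) → (∀ v → g (v , false) ℕ.+ g (v , true) ≡ d) → val m g ≡ L b) where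

    -- The two index choices for an edge (v , x) place the letter `true` at x with weight 1 or at v
    -- with weight -1. Recording the number of letters `true` as exponents turns this into the
    -- factor z_x - z_v. The last hypothesis keeps letters already placed plus edges still to come
    -- at d for each vertex, so at the end the exponents determine the letter counts.
    σ-Li : ∀ es u b → (∀ v → count (v , true) u ≡ Vec.lookup b v) →
           (∀ v → count (v , false) u ℕ.+ count (v , true) u ℕ.+ deg v es ≡ d) →
           σ es (λ w → val m (λ y → count y u ℕ.+ count y w)) ≡ Li es L b
    σ-Li []             u b h₁ h₂ =
      trans (val-cong m λ y → ℕₚ.+-identityʳ (count y u)) (L-spec _ b h₁ λ v → trans (sym (ℕₚ.+-identityʳ _)) (h₂ v))
    σ-Li ((v , x) ∷ es) u b h₁ h₂ =
      trans (cong₂ (λ s t → 1ℤ * s + (-1ℤ * t + 0ℤ)) (branch v x (v , false) (x , true) hi-picked (λ z → hi-deg z))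
                                                    (branch x v (v , true) (x , false) lo-picked (λ z → lo-deg z)))
            (lemma (Li es L (inc x b)) (Li es L (inc v b)))
      where
      lemma : ∀ s t → 1ℤ * s + (-1ℤ * t + 0ℤ) ≡ s - t
      lemma = solve-∀
      branch : ∀ v x l₁ l₂ → (∀ z → count (z , true) (l₁ ∷ l₂ ∷ u) ≡ Vec.lookup (inc x b) z) →
               (∀ z → count (z , false) (l₁ ∷ l₂ ∷ u) ℕ.+ count (z , true) (l₁ ∷ l₂ ∷ u) ℕ.+ deg z es ≡ d) →
               σ es (λ w → val m (λ y → count y u ℕ.+ count y (l₁ ∷ l₂ ∷ w))) ≡ Li es L (inc x b)
      branch v x l₁ l₂ k₁ k₂ = trans (σ-cong es λ w → val-cong m λ y → move (count y u) (ι (y ≟ᴸ l₁)) (ι (y ≟ᴸ l₂)) (count y w)) (σ-Li es (l₁ ∷ l₂ ∷ u) (inc x b) k₁ k₂)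
        where
        move : ∀ a b c e → a ℕ.+ (b ℕ.+ (c ℕ.+ e)) ≡ b ℕ.+ (c ℕ.+ a) ℕ.+ e
        move = ℕ-solve-∀
      rearrange : ∀ a b c e f → a ℕ.+ c ℕ.+ (b ℕ.+ e) ℕ.+ f ≡ c ℕ.+ e ℕ.+ (a ℕ.+ (b ℕ.+ f))
      rearrange = ℕ-solve-∀
      hi-picked : ∀ z → count (z , true) ((v , false) ∷ (x , true) ∷ u) ≡ Vec.lookup (inc x b) z
      hi-picked z = trans (count-other z v ((x , true) ∷ u) λ ()) (trans (count-same z x true u) (trans (cong (ι (z Fin.≟ x) ℕ.+_) (h₁ z)) (sym (lookup-inc z x b))))
      hi-deg : ∀ z → count (z , false) ((v , false) ∷ (x , true) ∷ u) ℕ.+ count (z , true) ((v , false) ∷ (x , true) ∷ u) ℕ.+ deg z es ≡ d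
      hi-deg z = trans (cong₂ (λ s t → s ℕ.+ t ℕ.+ deg z es)
                         (trans (count-same z v false ((x , true) ∷ u)) (cong (ι (z Fin.≟ v) ℕ.+_) (count-other z x u λ ())))
                         (trans (count-other z v ((x , true) ∷ u) λ ()) (count-same z x true u)))
                 (trans (rearrange (ι (z Fin.≟ v)) (ι (z Fin.≟ x)) (count (z , false) u) (count (z , true) u) (deg z es)) (h₂ z))
      lo-picked : ∀ z → count (z , true) ((v , true) ∷ (x , false) ∷ u) ≡ Vec.lookup (inc v b) z
      lo-picked z = trans (count-same z v true ((x , false) ∷ u)) (trans (cong (ι (z Fin.≟ v) ℕ.+_) (trans (count-other z x u λ ()) (h₁ z))) (sym (lookup-inc z v b)))
      rearrange′ : ∀ a b c e f → b ℕ.+ c ℕ.+ (a ℕ.+ e) ℕ.+ f ≡ c ℕ.+ e ℕ.+ (a ℕ.+ (b ℕ.+ f))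
      rearrange′ = ℕ-solve-∀
      lo-deg : ∀ z → count (z , false) ((v , true) ∷ (x , false) ∷ u) ℕ.+ count (z , true) ((v , true) ∷ (x , false) ∷ u) ℕ.+ deg z es ≡ d
      lo-deg z = trans (cong₂ (λ s t → s ℕ.+ t ℕ.+ deg z es)
                         (trans (count-other z v ((x , false) ∷ u) λ ()) (count-same z x false u))
                         (trans (count-same z v true ((x , false) ∷ u)) (cong (ι (z Fin.≟ v) ℕ.+_) (count-other z x u λ ()))))
                 (trans (rearrange′ (ι (z Fin.≟ v)) (ι (z Fin.≟ x)) (count (z , false) u) (count (z , true) u) (deg z es)) (h₂ z))

  moment-Li : ∀ d es f → length es ℕ.* 2 ≤ f → (∀ v → deg v es ≡ d) → moment f es ≡ Li es (pairing m d) (Vec.replicate _ 0)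
  moment-Li d es f len degs =
    trans (σ-congᴸ es λ w l → wick-val f w (ℕₚ.≤-trans (ℕₚ.≤-reflexive l) len)) (σ-Li (pairing m d) d (val-pairing m d) es [] (Vec.replicate _ 0) (λ v → sym (lookup-replicate v 0)) degs)
    where
    σ-congᴸ : ∀ es {F G} → (∀ w → length w ≡ length es ℕ.* 2 → F w ≡ G w) → σ es F ≡ σ es G
    σ-congᴸ []       eq = eq [] refl
    σ-congᴸ (e ∷ es) eq =
      cong₂ (λ a b → 1ℤ * a + (-1ℤ * b + 0ℤ)) (σ-congᴸ es λ w l → eq _ (cong (λ k → suc (suc k)) l))
                                            (σ-congᴸ es λ w l → eq _ (cong (λ k → suc (suc k)) l))

-- The Vandermonde polynomial

-- Each occurrence of v is joined to all entries but itself; the count added on the left replaces a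
-- subtraction on the right.
deg-pairs : ∀ {n} (v : Fin n) (xs : List (Fin n)) → deg v (pairs xs) ℕ.+ # Fin._≟_ v xs ≡ # Fin._≟_ v xs ℕ.* length xs
deg-pairs v []       = refl
deg-pairs v (x ∷ xs) =
  trans (cong (ℕ._+ (ι (v Fin.≟ x) ℕ.+ # Fin._≟_ v xs)) (deg-star x xs (pairs xs)))
  (trans (regroup (ι (v Fin.≟ x)) (length xs) (# Fin._≟_ v xs) (deg v (pairs xs)))
  (trans (cong (λ e → ι (v Fin.≟ x) ℕ.* suc (length xs) ℕ.+ (# Fin._≟_ v xs ℕ.+ e)) (deg-pairs v xs))
         (collect (ι (v Fin.≟ x)) (length xs) (# Fin._≟_ v xs))))
  where
  regroup : ∀ i l c d → i ℕ.* l ℕ.+ c ℕ.+ d ℕ.+ (i ℕ.+ c) ≡ i ℕ.* (1 ℕ.+ l) ℕ.+ (c ℕ.+ (d ℕ.+ c))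
  regroup = ℕ-solve-∀
  collect : ∀ i l c → i ℕ.* (1 ℕ.+ l) ℕ.+ (c ℕ.+ c ℕ.* l) ≡ (i ℕ.+ c) ℕ.* (1 ℕ.+ l)
  collect = ℕ-solve-∀
  deg-star : ∀ x ys es → deg v (map (x ,_) ys ++ es) ≡ ι (v Fin.≟ x) ℕ.* length ys ℕ.+ # Fin._≟_ v ys ℕ.+ deg v es
  deg-star x []       es = cong (λ e → e ℕ.+ 0 ℕ.+ deg v es) (sym (ℕₚ.*-zeroʳ (ι (v Fin.≟ x))))
  deg-star x (y ∷ ys) es = trans (cong (λ e → ι (v Fin.≟ x) ℕ.+ (ι (v Fin.≟ y) ℕ.+ e)) (deg-star x ys es))
                                 (shuffle (ι (v Fin.≟ x)) (ι (v Fin.≟ y)) (length ys) (# Fin._≟_ v ys) (deg v es))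
    where
    shuffle : ∀ i j l c d → i ℕ.+ (j ℕ.+ (i ℕ.* l ℕ.+ c ℕ.+ d)) ≡ i ℕ.* (1 ℕ.+ l) ℕ.+ (j ℕ.+ c) ℕ.+ d
    shuffle = ℕ-solve-∀

allFin-suc : ∀ n → allFin (suc n) ≡ zero ∷ map suc (allFin n)
allFin-suc n = cong (zero ∷_) (sym (map-tabulate id suc))

#-allFin : ∀ n (v : Fin n) → # Fin._≟_ v (allFin n) ≡ 1
#-allFin (suc n) zero    = trans (cong (# Fin._≟_ zero) (allFin-suc n)) (cong suc (none (allFin n)))
  where
  none : ∀ xs → # Fin._≟_ zero (map suc xs) ≡ 0
  none []       = refl
  none (x ∷ xs) = none xs
#-allFin (suc n) (suc v) = trans (cong (# Fin._≟_ (suc v)) (allFin-suc n)) (trans (shift (allFin n)) (#-allFin n v))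
  where
  shift : ∀ xs → # Fin._≟_ (suc v) (map suc xs) ≡ # Fin._≟_ v xs
  shift []       = refl
  shift (x ∷ xs) = cong (ι (v Fin.≟ x) ℕ.+_) (shift xs)

length-allFin : ∀ n → length (allFin n) ≡ n
length-allFin n = length-tabulate id

deg-complete : ∀ n (v : Fin (suc n)) → deg v (pairs (allFin (suc n))) ≡ n
deg-complete n v = ℕₚ.+-cancelʳ-≡ 1 _ n
  (trans (cong (deg v (pairs (allFin (suc n))) ℕ.+_) (sym (#-allFin (suc n) v)))
  (trans (deg-pairs v (allFin (suc n)))
  (trans (cong₂ ℕ._*_ (#-allFin (suc n) v) (length-allFin (suc n))) (trans (ℕₚ.*-identityˡ (suc n)) (ℕₚ.+-comm 1 n)))))

-- Of all factors only the one of x and y changes sign; the others are permuted.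
Li-pairs-anti : ∀ {n} L b → AntiSym (λ vs → Li {n} (pairs vs) L b)
Li-pairs-anti L b []        x y w =
  trans (Li-flip x y (map (x ,_) w ++ pairs (y ∷ w)) L b)
        (cong -_ (Li-↭ (prep (y , x) (Permₚ.shifts (map (x ,_) w) (map (y ,_) w))) L b))
Li-pairs-anti L b (z ∷ pre) x y w = begin
  Li (map (z ,_) (pre ++ x ∷ y ∷ w) ++ pairs (pre ++ x ∷ y ∷ w)) L b
    ≡⟨ Li-++ (map (z ,_) (pre ++ x ∷ y ∷ w)) _ L b ⟩
  Li (map (z ,_) (pre ++ x ∷ y ∷ w)) (Li (pairs (pre ++ x ∷ y ∷ w)) L) b
    ≡⟨ Li-↭ (Permₚ.map⁺ (z ,_) (Permₚ.++⁺ˡ pre (swap x y Perm.refl))) _ b ⟩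
  Li (map (z ,_) (pre ++ y ∷ x ∷ w)) (Li (pairs (pre ++ x ∷ y ∷ w)) L) b
    ≡⟨ Li-cong (map (z ,_) (pre ++ y ∷ x ∷ w)) (λ c → trans (Li-pairs-anti L c pre x y w) (sym (-1*i≡-i _))) b ⟩
  Li (map (z ,_) (pre ++ y ∷ x ∷ w)) (λ c → -1ℤ * Li (pairs (pre ++ y ∷ x ∷ w)) L c) b
    ≡⟨ Li-* (map (z ,_) (pre ++ y ∷ x ∷ w)) -1ℤ _ b ⟩
  -1ℤ * Li (map (z ,_) (pre ++ y ∷ x ∷ w)) (Li (pairs (pre ++ y ∷ x ∷ w)) L) b
    ≡⟨ -1*i≡-i _ ⟩
  - Li (map (z ,_) (pre ++ y ∷ x ∷ w)) (Li (pairs (pre ++ y ∷ x ∷ w)) L) b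
    ≡⟨ cong -_ (sym (Li-++ (map (z ,_) (pre ++ y ∷ x ∷ w)) _ L b)) ⟩
  - Li (map (z ,_) (pre ++ y ∷ x ∷ w) ++ pairs (pre ++ y ∷ x ∷ w)) L b ∎
  where open ≡-Reasoning

-- The transposition of k and k + 1; the identity if k + 1 is out of range.
τ : ∀ {n} → ℕ → Fin n → Fin n
τ         (suc k) zero          = zero
τ         (suc k) (suc i)       = suc (τ k i)
τ {suc zero}    zero    i             = i
τ {suc (suc n)} zero    zero          = suc zero
τ {suc (suc n)} zero    (suc zero)    = zero
τ {suc (suc n)} zero    (suc (suc i)) = suc (suc i)

exchange : ∀ {n} → ℕ → Vec A n → Vec A n
exchange zero    (x ∷ y ∷ b) = y ∷ x ∷ b
exchange zero    (x ∷ [])    = x ∷ []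
exchange zero    []          = []
exchange (suc k) (x ∷ b)     = x ∷ exchange k b
exchange (suc k) []          = []

exchange-inc : ∀ {n} k (v : Fin n) b → exchange k (inc v b) ≡ inc (τ k v) (exchange k b)
exchange-inc zero    zero          (x ∷ y ∷ b) = refl
exchange-inc zero    (suc zero)    (x ∷ y ∷ b) = refl
exchange-inc zero    (suc (suc v)) (x ∷ y ∷ b) = refl
exchange-inc zero    zero          (x ∷ [])    = refl
exchange-inc (suc k) zero          (x ∷ b)     = refl
exchange-inc (suc k) (suc v)       (x ∷ b)     = cong (x ∷_) (exchange-inc k v b)

exchange-zeros : ∀ k n → exchange k (Vec.replicate n 0) ≡ Vec.replicate n 0
exchange-zeros zero    zero          = refl
exchange-zeros zero    (suc zero)    = refl
exchange-zeros zero    (suc (suc n)) = refl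
exchange-zeros (suc k) zero          = refl
exchange-zeros (suc k) (suc n)       = cong (0 ∷_) (exchange-zeros k n)

toList-exchange : ∀ {n} (b : Vec A n) pre {x y w} → Vec.toList b ≡ pre ++ x ∷ y ∷ w →
                  Vec.toList (exchange (length pre) b) ≡ pre ++ y ∷ x ∷ w
toList-exchange (_ ∷ _ ∷ b) []        refl = refl
toList-exchange (_ ∷ b)     (z ∷ pre) eq   = cong₂ _∷_ (∷-injectiveˡ eq) (toList-exchange b pre (∷-injectiveʳ eq))

exchange-involutive : ∀ {n} k (b : Vec A n) → exchange k (exchange k b) ≡ b
exchange-involutive zero    (x ∷ y ∷ b) = refl
exchange-involutive zero    (x ∷ [])    = refl
exchange-involutive zero    []          = refl
exchange-involutive (suc k) (x ∷ b)     = cong (x ∷_) (exchange-involutive k b)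
exchange-involutive (suc k) []          = refl

map-τ-allFin : ∀ {n} k → k ℕ.+ 2 ≤ n → ∃ λ pre → ∃ λ x → ∃ λ y → ∃ λ w →
               allFin n ≡ pre ++ x ∷ y ∷ w × map (τ k) (allFin n) ≡ pre ++ y ∷ x ∷ w
map-τ-allFin {suc (suc n)} zero    _ = [] , zero , suc zero , _ , refl , cong (λ l → suc zero ∷ zero ∷ l) (trans (map-tabulate _ (τ 0)) refl)
map-τ-allFin {suc zero}    zero    (s≤s ())
map-τ-allFin {suc n}       (suc k) (s≤s k+2≤n) with map-τ-allFin k k+2≤n
... | pre , x , y , w , eq , eq′ =
  zero ∷ map suc pre , suc x , suc y , map suc w ,
  trans (allFin-suc n) (cong (zero ∷_) (trans (cong (map suc) eq) (map-++ suc pre _))) ,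
  trans (cong (map (τ (suc k))) (allFin-suc n))
    (cong (zero ∷_) (trans (trans (sym (map-∘ (allFin n))) (map-∘ (allFin n))) (trans (cong (map suc) eq′) (map-++ suc pre _))))

Li-relabel : ∀ {n} k (es : List (Fin n × Fin n)) L b →
             Li es (L ∘ exchange k) b ≡ Li (map (λ (u , v) → τ k u , τ k v) es) L (exchange k b)
Li-relabel k []             L b = refl
Li-relabel k ((u , v) ∷ es) L b =
  cong₂ _-_ (trans (Li-relabel k es L _) (cong (Li es′ L) (exchange-inc k v b)))
            (trans (Li-relabel k es L _) (cong (Li es′ L) (exchange-inc k u b)))
  where
  es′ : List (Fin _ × Fin _)
  es′ = map (λ (u , v) → τ k u , τ k v) es

complete : ∀ n → List (Fin n × Fin n)
complete n = pairs (allFin n)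

-- Antisymmetry of the product is transferred from the list of vertices to the functional:
-- exchanging exponents amounts to renaming vertices.
Li-exchange : ∀ {n} k → k ℕ.+ 2 ≤ n → ∀ L → Li (complete n) (L ∘ exchange k) (Vec.replicate n 0) ≡ - Li (complete n) L (Vec.replicate n 0)
Li-exchange {n} k k+2≤n L with map-τ-allFin k k+2≤n
... | pre , x , y , w , eq , eq′ = begin
  Li (complete n) (L ∘ exchange k) 0s
    ≡⟨ Li-relabel k (complete n) L 0s ⟩
  Li (map (λ (u , v) → τ k u , τ k v) (complete n)) L (exchange k 0s)
    ≡⟨ cong₂ (λ es b → Li es L b) (trans (sym (pairs-map (τ k) (allFin n))) (cong pairs eq′)) (exchange-zeros k n) ⟩
  Li (pairs (pre ++ y ∷ x ∷ w)) L 0s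
    ≡⟨ Li-pairs-anti L 0s pre y x w ⟩
  - Li (pairs (pre ++ x ∷ y ∷ w)) L 0s
    ≡⟨ cong (λ l → - Li (pairs l) L 0s) (sym eq) ⟩
  - Li (complete n) L 0s ∎
  where
  open ≡-Reasoning
  0s : Vec ℕ n
  0s = Vec.replicate n 0

sign< : ∀ {n} → Fin n → Fin n → ℤ
sign< x y = 𝟙 (x Fin.<? y) - 𝟙 (y Fin.<? x)

sign<-anti : ∀ {n} (x y : Fin n) → sign< x y ≡ - sign< y x
sign<-anti x y = lemma (𝟙 (x Fin.<? y)) (𝟙 (y Fin.<? x))
  where
  lemma : ∀ a b → a - b ≡ - (b - a)
  lemma = solve-∀

sign<-1 : ∀ {n} {x y : Fin n} → x Fin.< y → sign< x y ≡ 1ℤ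
sign<-1 {x = x} {y} x<y = cong₂ _-_ (𝟙-yes (x Fin.<? y) x<y) (𝟙-no (y Fin.<? x) (ℕₚ.<-asym x<y))

sign<-neg : ∀ {n} {x y : Fin n} → y Fin.< x → sign< x y ≡ -1ℤ
sign<-neg {x = x} {y} y<x = cong₂ _-_ (𝟙-no (x Fin.<? y) (ℕₚ.<-asym y<x)) (𝟙-yes (y Fin.<? x) y<x)

-- The Levi-Civita symbol: as `sign< x x` is 0, words with a repeated letter get 0.
sgn : ∀ {n} → List (Fin n) → ℤ
sgn = ∏ₚ sign<

sgn-allFin : ∀ n → sgn (allFin n) ≡ 1ℤ
sgn-allFin n = ∏ₚ-one {t = sign<} {xs = allFin n} (AllPairsₚ.tabulate⁺-< {f = id} λ i<j → sign<-1 i<j)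

private
  incs : ∀ {n} → List (Fin n) → Vec ℕ n → Vec ℕ n
  incs []       b = b
  incs (x ∷ xs) b = incs xs (inc x b)

  incs-map-suc : ∀ {n} (xs : List (Fin n)) x b → incs (map suc xs) (x ∷ b) ≡ x ∷ incs xs b
  incs-map-suc []       x b = refl
  incs-map-suc (y ∷ xs) x b = incs-map-suc xs x (inc y b)

  incs-allFin : ∀ n k → incs (allFin n) (Vec.replicate n k) ≡ Vec.map suc (Vec.replicate n k)
  incs-allFin zero    k = refl
  incs-allFin (suc n) k = trans (cong (λ l → incs l (Vec.replicate (suc n) k)) (allFin-suc n))
                          (trans (incs-map-suc (allFin n) (suc k) _) (cong (suc k ∷_) (incs-allFin n k)))

  map-suc-inc : ∀ {n} (v : Fin n) b → Vec.map suc (inc v b) ≡ inc v (Vec.map suc b)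
  map-suc-inc zero    (x ∷ b) = refl
  map-suc-inc (suc v) (x ∷ b) = cong (suc x ∷_) (map-suc-inc v b)

  Li-map-suc : ∀ {n} (es : List (Fin n × Fin n)) L b → Li es L (Vec.map suc b) ≡ Li es (L ∘ Vec.map suc) b
  Li-map-suc []             L b = refl
  Li-map-suc ((u , v) ∷ es) L b =
    cong₂ _-_ (trans (cong (Li es L) (sym (map-suc-inc v b))) (Li-map-suc es L _))
              (trans (cong (Li es L) (sym (map-suc-inc u b))) (Li-map-suc es L _))

  Li-shift : ∀ {n} (es : List (Fin n × Fin n)) L x b → Li (map (λ (u , v) → Fin.suc u , Fin.suc v) es) L (x ∷ b) ≡ Li es (L ∘ (x ∷_)) b
  Li-shift []             L x b = refl
  Li-shift ((u , v) ∷ es) L x b = cong₂ _-_ (Li-shift es L x _) (Li-shift es L x _)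

  HeadPositive : ∀ {n} → Vec ℕ (suc n) → Set
  HeadPositive b = 0 < Vec.head b

  head-inc : ∀ {n} (v : Fin (suc n)) {b} → HeadPositive b → HeadPositive (inc v b)
  head-inc zero    {x ∷ b} p = s≤s z≤n
  head-inc (suc v) {x ∷ b} p = p

  -- M kills every monomial divisible by z_0, so each factor z_x - z_0 may be replaced by z_x.
  Li-star : ∀ {n} (xs : List (Fin n)) M → (∀ b → HeadPositive b → M b ≡ 0ℤ) → ∀ b →
            Li (map (zero ,_) (map suc xs)) M (0 ∷ b) ≡ M (0 ∷ incs xs b)
  Li-star []       M M0 b = refl
  Li-star (x ∷ xs) M M0 b =
    trans (cong₂ _-_ (Li-star xs M M0 (inc x b)) (Li-zero HeadPositive head-inc (map (zero ,_) (map suc xs)) M0 (1 ∷ b) (s≤s z≤n)))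
          (+-identityʳ _)

_≟ˡ_ : DecidableEquality (List ℕ)
_≟ˡ_ = Listₚ.≡-dec ℕₚ._≟_

module Vandermonde (n : ℕ) where

  private
    0s : Vec ℕ n
    0s = Vec.replicate n 0

  -- Exponent vectors are read as words over the vertices, so that `anti-unique` can compare this
  -- function with `sgn`.
  coefficient : List (Fin n) → ℤ
  coefficient l = Li (complete n) (λ b → 𝟙 (map toℕ l ≟ˡ Vec.toList b)) 0s

  coefficient-length : ∀ l → length l ≢ n → coefficient l ≡ 0ℤ
  coefficient-length l neq = Li-zero (λ _ → ⊤) (λ _ _ → tt) (complete n) (λ b _ → 𝟙-no (map toℕ l ≟ˡ Vec.toList b)
    λ eq → neq (trans (sym (length-map toℕ l)) (trans (cong length eq) (length-toList b)))) 0s tt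

  coefficient-anti : AntiSym coefficient
  coefficient-anti pre x y w with length (pre ++ x ∷ y ∷ w) ℕₚ.≟ n
  ... | no neq = trans (coefficient-length (pre ++ x ∷ y ∷ w) neq)
                       (cong -_ (sym (coefficient-length (pre ++ y ∷ x ∷ w) (neq ∘ trans (Permₚ.↭-length (Permₚ.++⁺ˡ pre (swap x y Perm.refl)))))))
  ... | yes len =
    trans (Li-cong (complete n) (λ b → 𝟙-⇔ (map toℕ (pre ++ x ∷ y ∷ w) ≟ˡ Vec.toList b) (map toℕ (pre ++ y ∷ x ∷ w) ≟ˡ Vec.toList (exchange k b)) (to b) (from b)) 0s)
          (Li-exchange k k+2≤n (λ b → 𝟙 (map toℕ (pre ++ y ∷ x ∷ w) ≟ˡ Vec.toList b)))
    where
    k : ℕ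
    k = length (map toℕ pre)
    k+2≤n : k ℕ.+ 2 ≤ n
    k+2≤n = ℕₚ.≤-trans (ℕₚ.+-mono-≤ (ℕₚ.≤-reflexive (length-map toℕ pre)) (s≤s (s≤s z≤n)))
                       (ℕₚ.≤-reflexive (trans (sym (length-++ pre)) len))
    split : ∀ x y → map toℕ (pre ++ x ∷ y ∷ w) ≡ map toℕ pre ++ toℕ x ∷ toℕ y ∷ map toℕ w
    split x y = map-++ toℕ pre (x ∷ y ∷ w)
    to : ∀ b → map toℕ (pre ++ x ∷ y ∷ w) ≡ Vec.toList b → map toℕ (pre ++ y ∷ x ∷ w) ≡ Vec.toList (exchange k b)
    to b eq = trans (split y x) (sym (toList-exchange b (map toℕ pre) (trans (sym eq) (split x y))))
    from : ∀ b → map toℕ (pre ++ y ∷ x ∷ w) ≡ Vec.toList (exchange k b) → map toℕ (pre ++ x ∷ y ∷ w) ≡ Vec.toList b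
    from b eq = trans (split x y) (sym (trans (cong Vec.toList (sym (exchange-involutive k b)))
                  (toList-exchange (exchange k b) (map toℕ pre) (trans (sym eq) (split y x)))))

-- Writes a functional with bounded exponents as a finite combination of coefficient extractions,
-- which can then be evaluated one at a time.
expansion-indicator : ∀ B N (F : Vec ℕ N → ℤ) b → (∀ i → B ≤ Vec.lookup b i → F b ≡ 0ℤ) →
  F b ≡ ∑ᵛ (allFin B) N (λ w → F (Vec.map toℕ w) * 𝟙 (map toℕ (Vec.toList w) ≟ˡ Vec.toList b))
expansion-indicator B zero    F []      F0 = sym (*-identityʳ (F []))
expansion-indicator B (suc N) F (x ∷ b) F0 = sym (begin
  ∑[ x′ ← allFin B ] ∑ᵛ (allFin B) N (λ w → F (toℕ x′ ∷ Vec.map toℕ w) * 𝟙 ((toℕ x′ ∷ map toℕ (Vec.toList w)) ≟ˡ (x ∷ Vec.toList b)))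
    ≡⟨ ∑-cong (allFin B) (λ x′ → trans (∑ᵛ-cong (allFin B) N λ w → trans (cong (F (toℕ x′ ∷ Vec.map toℕ w) *_) (factor x′ w))
          (swap-* (F (toℕ x′ ∷ Vec.map toℕ w)) (𝟙 (toℕ x′ ℕₚ.≟ x)) (𝟙 (map toℕ (Vec.toList w) ≟ˡ Vec.toList b))))
          (∑ᵛ-*ˡ (allFin B) N (𝟙 (toℕ x′ ℕₚ.≟ x)) _)) ⟩
  ∑[ x′ ← allFin B ] 𝟙 (toℕ x′ ℕₚ.≟ x) * ∑ᵛ (allFin B) N (λ w → F (toℕ x′ ∷ Vec.map toℕ w) * 𝟙 (map toℕ (Vec.toList w) ≟ˡ Vec.toList b))
    ≡⟨ head-sum (x ℕₚ.<? B) ⟩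
  F (x ∷ b) ∎)
  where
  open ≡-Reasoning
  swap-* : ∀ a b c → a * (b * c) ≡ b * (a * c)
  swap-* = solve-∀
  factor : ∀ x′ (w : Vec (Fin B) N) → 𝟙 ((toℕ x′ ∷ map toℕ (Vec.toList w)) ≟ˡ (x ∷ Vec.toList b)) ≡ 𝟙 (toℕ x′ ℕₚ.≟ x) * 𝟙 (map toℕ (Vec.toList w) ≟ˡ Vec.toList b)
  factor x′ w = trans (𝟙-⇔ ((toℕ x′ ∷ map toℕ (Vec.toList w)) ≟ˡ (x ∷ Vec.toList b)) (toℕ x′ ℕₚ.≟ x ×-dec map toℕ (Vec.toList w) ≟ˡ Vec.toList b)
                            (λ eq → ∷-injectiveˡ eq , ∷-injectiveʳ eq) (λ (e , e′) → cong₂ _∷_ e e′))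
                      (𝟙-× (toℕ x′ ℕₚ.≟ x) (map toℕ (Vec.toList w) ≟ˡ Vec.toList b))
  G : Fin B → ℤ
  G x′ = ∑ᵛ (allFin B) N (λ w → F (toℕ x′ ∷ Vec.map toℕ w) * 𝟙 (map toℕ (Vec.toList w) ≟ˡ Vec.toList b))
  head-sum : Dec (x < B) → ∑[ x′ ← allFin B ] 𝟙 (toℕ x′ ℕₚ.≟ x) * G x′ ≡ F (x ∷ b)
  head-sum (yes x<B) =
    trans (∑-cong (allFin B) λ x′ → cong (_* G x′) (𝟙-⇔ (toℕ x′ ℕₚ.≟ x) (x′ Fin.≟ Fin.fromℕ< x<B)
            (λ eq → Fin.toℕ-injective (trans eq (sym (Fin.toℕ-fromℕ< x<B)))) (λ eq → trans (cong toℕ eq) (Fin.toℕ-fromℕ< x<B))))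
    (trans (∑-𝟙-Fin B (Fin.fromℕ< x<B) G)
    (trans (cong (λ y → ∑ᵛ (allFin B) N (λ w → F (y ∷ Vec.map toℕ w) * 𝟙 (map toℕ (Vec.toList w) ≟ˡ Vec.toList b))) (Fin.toℕ-fromℕ< x<B))
           (sym (expansion-indicator B N (F ∘ (x ∷_)) b (λ i → F0 (suc i))))))
  head-sum (no x≮B) =
    trans (∑-zero (allFin B) λ x′ → cong (_* G x′) (𝟙-no (toℕ x′ ℕₚ.≟ x) λ { refl → x≮B (Fin.toℕ<n x′) }))
          (sym (F0 zero (ℕₚ.≮⇒≥ x≮B)))

-- In the monomial with exponents 0, 1, ..., n the variable of vertex 0 does not occur, so the star
-- at that vertex contributes each other variable once. Lowering the remaining exponents by one
-- leaves the same question for n vertices.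
coefficient-allFin : ∀ n → Vandermonde.coefficient n (allFin n) ≡ 1ℤ
coefficient-allFin zero    = refl
coefficient-allFin (suc n) = begin
  Li (complete (suc n)) L (Vec.replicate _ 0)
    ≡⟨ cong (λ l → Li (pairs l) L (Vec.replicate _ 0)) (allFin-suc n) ⟩
  Li (map (zero ,_) (map suc (allFin n)) ++ pairs (map suc (allFin n))) L (Vec.replicate _ 0)
    ≡⟨ Li-++ (map (zero ,_) (map suc (allFin n))) _ L _ ⟩
  Li (map (zero ,_) (map suc (allFin n))) (Li (pairs (map suc (allFin n))) L) (Vec.replicate _ 0)
    ≡⟨ Li-star (allFin n) _ (λ b → Li-zero HeadPositive head-inc (pairs (map suc (allFin n))) L0 b) _ ⟩
  Li (pairs (map suc (allFin n))) L (0 ∷ incs (allFin n) (Vec.replicate n 0))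
    ≡⟨ cong₂ (λ es b → Li es L (0 ∷ b)) (pairs-map suc (allFin n)) (incs-allFin n 0) ⟩
  Li (map (λ (u , v) → suc u , suc v) (complete n)) L (0 ∷ Vec.map suc (Vec.replicate n 0))
    ≡⟨ Li-shift (complete n) L 0 _ ⟩
  Li (complete n) (L ∘ (0 ∷_)) (Vec.map suc (Vec.replicate n 0))
    ≡⟨ Li-map-suc (complete n) _ _ ⟩
  Li (complete n) (λ b → L (0 ∷ Vec.map suc b)) (Vec.replicate n 0)
    ≡⟨ Li-cong (complete n) (λ b → 𝟙-⇔ (map toℕ (allFin (suc n)) ≟ˡ (0 ∷ Vec.toList (Vec.map suc b))) (map toℕ (allFin n) ≟ˡ Vec.toList b) (to b) (from b)) _ ⟩
  Vandermonde.coefficient n (allFin n)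
    ≡⟨ coefficient-allFin n ⟩
  1ℤ ∎
  where
  open ≡-Reasoning
  L : Vec ℕ (suc n) → ℤ
  L b = 𝟙 (map toℕ (allFin (suc n)) ≟ˡ Vec.toList b)
  L0 : ∀ b → HeadPositive b → L b ≡ 0ℤ
  L0 (x ∷ b) p = 𝟙-no (map toℕ (allFin (suc n)) ≟ˡ (x ∷ Vec.toList b)) λ eq → ℕₚ.<⇒≢ p (∷-injectiveˡ eq)
  word : map toℕ (allFin (suc n)) ≡ 0 ∷ map suc (map toℕ (allFin n))
  word = trans (cong (map toℕ) (allFin-suc n)) (cong (0 ∷_) (trans (sym (map-∘ (allFin n))) (map-∘ (allFin n))))
  to : ∀ b → map toℕ (allFin (suc n)) ≡ 0 ∷ Vec.toList (Vec.map suc b) → map toℕ (allFin n) ≡ Vec.toList b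
  to b eq = Listₚ.map-injective ℕₚ.suc-injective (trans (∷-injectiveʳ (trans (sym word) eq)) (toList-map suc b))
  from : ∀ b → map toℕ (allFin n) ≡ Vec.toList b → map toℕ (allFin (suc n)) ≡ 0 ∷ Vec.toList (Vec.map suc b)
  from b eq = trans word (cong (0 ∷_) (trans (cong (map suc) eq) (sym (toList-map suc b))))

-- The Leibniz expansion. Its coefficients form an antisymmetric function of exponent words of full
-- length, hence are fixed by their value at the identity.
vandermonde : ∀ n L → (∀ b i → n ≤ Vec.lookup b i → L b ≡ 0ℤ) →
              Li (complete n) L (Vec.replicate n 0) ≡ ∑ᵛ (allFin n) n (λ w → L (Vec.map toℕ w) * sgn (Vec.toList w))
vandermonde n L L0 = begin
  Li (complete n) L (Vec.replicate n 0)
    ≡⟨ Li-cong (complete n) (λ b → expansion-indicator n n L b (L0 b)) _ ⟩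
  Li (complete n) (λ b → ∑ᵛ (allFin n) n (λ w → L (Vec.map toℕ w) * 𝟙 (map toℕ (Vec.toList w) ≟ˡ Vec.toList b))) (Vec.replicate n 0)
    ≡⟨ Li-∑ᵛ (complete n) (allFin n) n _ _ ⟩
  ∑ᵛ (allFin n) n (λ w → Li (complete n) (λ b → L (Vec.map toℕ w) * 𝟙 (map toℕ (Vec.toList w) ≟ˡ Vec.toList b)) (Vec.replicate n 0))
    ≡⟨ ∑ᵛ-cong (allFin n) n (λ w → trans (Li-* (complete n) (L (Vec.map toℕ w)) _ _) (cong (L (Vec.map toℕ w) *_) (coefficient-sgn w))) ⟩
  ∑ᵛ (allFin n) n (λ w → L (Vec.map toℕ w) * sgn (Vec.toList w)) ∎
  where
  open ≡-Reasoning
  open Vandermonde n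
  coefficient-sgn : ∀ w → coefficient (Vec.toList w) ≡ sgn (Vec.toList w)
  coefficient-sgn w = begin
    coefficient (Vec.toList w)                     ≡⟨ sym (*-identityʳ _) ⟩
    coefficient (Vec.toList w) * 1ℤ                ≡⟨ cong (coefficient (Vec.toList w) *_) (sym (sgn-allFin n)) ⟩
    coefficient (Vec.toList w) * sgn (allFin n)    ≡⟨ anti-unique Fin._≟_ (allFin n) ∈-allFin coefficient sgn coefficient-anti (∏ₚ-anti sign< sign<-anti)
                                                        (Vec.toList w) (ℕₚ.≤-reflexive (trans (length-allFin n) (sym (length-toList w)))) ⟩
    sgn (Vec.toList w) * coefficient (allFin n)    ≡⟨ cong (sgn (Vec.toList w) *_) (coefficient-allFin n) ⟩
    sgn (Vec.toList w) * 1ℤ                        ≡⟨ *-identityʳ _ ⟩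
    sgn (Vec.toList w)                             ∎

-- The pairing applied to the Vandermonde product.

double : (A → C) → (A → C) → List A → List C
double f g []       = []
double f g (x ∷ xs) = f x ∷ g x ∷ double f g xs

double-++ : (f g : A → C) (xs ys : List A) → double f g (xs ++ ys) ≡ double f g xs ++ double f g ys
double-++ f g []       ys = refl
double-++ f g (x ∷ xs) ys = cong (λ l → f x ∷ g x ∷ l) (double-++ f g xs ys)

∏-double : (f g : A → C) (xs : List A) (t : C → ℤ) → ∏ (double f g xs) t ≡ ∏ xs (λ x → t (f x) * t (g x))
∏-double f g []       t = refl
∏-double f g (x ∷ xs) t = trans (cong (λ e → t (f x) * (t (g x) * e)) (∏-double f g xs t)) (sym (*-assoc (t (f x)) (t (g x)) _))

∏ₚ-double : (t : C → C → ℤ) (f g : A → C) (xs : List A) →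
  ∏ₚ t (double f g xs) ≡ ∏ xs (λ x → t (f x) (g x)) * ∏ₚ (λ x y → (t (f x) (f y) * t (f x) (g y)) * (t (g x) (f y) * t (g x) (g y))) xs
∏ₚ-double t f g []       = refl
∏ₚ-double t f g (x ∷ xs) = begin
  (t (f x) (g x) * ∏ (double f g xs) (t (f x))) * (∏ (double f g xs) (t (g x)) * ∏ₚ t (double f g xs))
    ≡⟨ cong₂ _*_ (cong (t (f x) (g x) *_) (∏-double f g xs (t (f x)))) (cong₂ _*_ (∏-double f g xs (t (g x))) (∏ₚ-double t f g xs)) ⟩
  (t (f x) (g x) * F) * (G * (P * R))
    ≡⟨ lemma (t (f x) (g x)) F G P R ⟩
  (t (f x) (g x) * P) * ((F * G) * R)
    ≡⟨ cong (λ e → (t (f x) (g x) * P) * (e * R)) (sym (∏-* xs _ _)) ⟩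
  (t (f x) (g x) * P) * (∏ xs (λ y → (t (f x) (f y) * t (f x) (g y)) * (t (g x) (f y) * t (g x) (g y))) * R) ∎
  where
  open ≡-Reasoning
  F G P R : ℤ
  F = ∏ xs (λ y → t (f x) (f y) * t (f x) (g y))
  G = ∏ xs (λ y → t (g x) (f y) * t (g x) (g y))
  P = ∏ xs (λ x → t (f x) (g x))
  R = ∏ₚ (λ x y → (t (f x) (f y) * t (f x) (g y)) * (t (g x) (f y) * t (g x) (g y))) xs
  lemma : ∀ a f g p r → (a * f) * (g * (p * r)) ≡ (a * p) * ((f * g) * r)
  lemma = solve-∀

-- The alphabet is a half together with its image under `op`, and Q does not distinguish a letter
-- from its image, so each position gains a factor 2.
∑ʷ-flip : (op : A → A) (xs : List A) (Q : List A → ℤ) → (∀ pre x post → Q (pre ++ op x ∷ post) ≡ Q (pre ++ x ∷ post)) →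
          ∀ {all} → all ↭ xs ++ map op xs → ∀ N → ∑ʷ all N Q ≡ (ℤ.+ 2) ^ N * ∑ʷ xs N Q
∑ʷ-flip op xs Q Q-flip {all} p zero    = sym (*-identityˡ (Q []))
∑ʷ-flip op xs Q Q-flip {all} p (suc N) = begin
  ∑[ x ← all ] ∑ʷ all N (Q ∘ (x ∷_))
    ≡⟨ ∑-cong all (λ x → ∑ʷ-flip op xs (Q ∘ (x ∷_)) (λ pre → Q-flip (x ∷ pre)) p N) ⟩
  ∑[ x ← all ] T x
    ≡⟨ trans (∑-↭ p T) (trans (∑-++ xs (map op xs) T) (cong (∑ xs T +_) (∑-map op xs T))) ⟩
  ∑ xs T + ∑ xs (T ∘ op)
    ≡⟨ cong (∑ xs T +_) (∑-cong xs λ x → cong ((ℤ.+ 2) ^ N *_) (∑ʷ-cong xs N λ w _ → Q-flip [] x w)) ⟩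
  ∑ xs T + ∑ xs T
    ≡⟨ cong (λ e → e + e) (∑-*ˡ xs ((ℤ.+ 2) ^ N) _) ⟩
  (ℤ.+ 2) ^ N * ∑ʷ xs (suc N) Q + (ℤ.+ 2) ^ N * ∑ʷ xs (suc N) Q
    ≡⟨ lemma ((ℤ.+ 2) ^ N) _ ⟩
  (ℤ.+ 2) ^ suc N * ∑ʷ xs (suc N) Q ∎
  where
  open ≡-Reasoning
  T : _ → ℤ
  T x = (ℤ.+ 2) ^ N * ∑ʷ xs N (Q ∘ (x ∷_))
  lemma : ∀ a b → a * b + a * b ≡ (ℤ.+ 2 * a) * b
  lemma = solve-∀

-1^-square : ∀ k → -1ℤ ^ k * -1ℤ ^ k ≡ 1ℤ
-1^-square zero    = refl
-1^-square (suc k) = trans (lemma (-1ℤ ^ k)) (-1^-square k)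
  where
  lemma : ∀ a → (-1ℤ * a) * (-1ℤ * a) ≡ a * a
  lemma = solve-∀

-1^-even : ∀ k → -1ℤ ^ (k ℕ.* 2) ≡ 1ℤ
-1^-even zero    = refl
-1^-even (suc k) = trans (lemma (-1ℤ ^ (k ℕ.* 2))) (-1^-even k)
  where
  lemma : ∀ a → -1ℤ * (-1ℤ * a) ≡ a
  lemma = solve-∀

-1^-odd : ∀ k {a b} → a ℕ.+ b ≡ suc (k ℕ.* 2) → -1ℤ ^ a ≡ - -1ℤ ^ b
-1^-odd k {a} {b} eq = begin
  -1ℤ ^ a                          ≡⟨ sym (*-identityʳ (-1ℤ ^ a)) ⟩
  -1ℤ ^ a * 1ℤ                     ≡⟨ cong (-1ℤ ^ a *_) (sym (-1^-square b)) ⟩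
  -1ℤ ^ a * (-1ℤ ^ b * -1ℤ ^ b)    ≡⟨ sym (*-assoc (-1ℤ ^ a) (-1ℤ ^ b) (-1ℤ ^ b)) ⟩
  (-1ℤ ^ a * -1ℤ ^ b) * -1ℤ ^ b    ≡⟨ cong (_* -1ℤ ^ b) (trans (sym (^-distribˡ-+-* -1ℤ a b)) (trans (cong (-1ℤ ^_) eq) (cong (-1ℤ *_) (-1^-even k)))) ⟩
  -1ℤ * -1ℤ ^ b                    ≡⟨ -1*i≡-i (-1ℤ ^ b) ⟩
  - -1ℤ ^ b                        ∎
  where open ≡-Reasoning

module PairingSum (k : ℕ) where

  private
    m n d : ℕ
    m = suc k
    n = m ℕ.* 2
    d = suc (k ℕ.* 2)

    op : Fin n → Fin n
    op = Fin.opposite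

    op-+ : ∀ (x : Fin n) → toℕ x ℕ.+ toℕ (op x) ≡ d
    op-+ x = trans (cong (toℕ x ℕ.+_) (Fin.opposite-prop x)) (ℕₚ.m+[n∸m]≡n (ℕ.s≤s⁻¹ (Fin.toℕ<n x)))

    op-involutive : ∀ x → op (op x) ≡ x
    op-involutive = Fin.opposite-involutive

  weight : Fin n → ℤ
  weight x = ℤ.+ (toℕ (op x) ℕ.!) * -1ℤ ^ toℕ (op x) * ℤ.+ (toℕ x ℕ.!)

  private
    weight-op : ∀ x → weight (op x) ≡ - weight x
    weight-op x = begin
      ℤ.+ (toℕ (op (op x)) ℕ.!) * -1ℤ ^ toℕ (op (op x)) * ℤ.+ (toℕ (op x) ℕ.!)
        ≡⟨ cong (λ y → ℤ.+ (toℕ y ℕ.!) * -1ℤ ^ toℕ y * ℤ.+ (toℕ (op x) ℕ.!)) (op-involutive x) ⟩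
      ℤ.+ (toℕ x ℕ.!) * -1ℤ ^ toℕ x * ℤ.+ (toℕ (op x) ℕ.!)
        ≡⟨ cong (λ s → ℤ.+ (toℕ x ℕ.!) * s * ℤ.+ (toℕ (op x) ℕ.!)) (-1^-odd k {toℕ x} {toℕ (op x)} (op-+ x)) ⟩
      ℤ.+ (toℕ x ℕ.!) * - -1ℤ ^ toℕ (op x) * ℤ.+ (toℕ (op x) ℕ.!)
        ≡⟨ lemma (ℤ.+ (toℕ x ℕ.!)) (-1ℤ ^ toℕ (op x)) (ℤ.+ (toℕ (op x) ℕ.!)) ⟩
      - weight x ∎
      where
      open ≡-Reasoning
      lemma : ∀ a b c → a * - b * c ≡ - (c * b * a)
      lemma = solve-∀

    weave : List (Fin n) → List (Fin n)
    weave = double id op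

    -- The condition x + y = d leaves only y = `op x`, so the first letter of each pair determines
    -- the word.
    fold : ∀ m′ (G : List (Fin n) → ℤ) →
           ∑ᵛ (allFin n) (m′ ℕ.* 2) (λ w → pairing m′ d (Vec.map toℕ w) * G (Vec.toList w))
         ≡ ∑ʷ (allFin n) m′ (λ xs → ∏ xs weight * G (weave xs))
    fold zero     G = refl
    fold (suc m′) G = ∑-cong (allFin n) λ x → begin
      ∑[ y ← allFin n ] ∑ᵛ (allFin n) (m′ ℕ.* 2) (λ w → 𝟙 (toℕ x ℕ.+ toℕ y ℕₚ.≟ d) * h x y * pairing m′ d (Vec.map toℕ w) * G (x ∷ y ∷ Vec.toList w))
        ≡⟨ ∑-cong (allFin n) (λ y → trans
             (∑ᵛ-cong (allFin n) (m′ ℕ.* 2) λ w → trans (cong (λ e → e * h x y * pairing m′ d (Vec.map toℕ w) * G (x ∷ y ∷ Vec.toList w)) (indicator x y))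
                                                        (regroup (𝟙 (y Fin.≟ op x)) (h x y) (pairing m′ d (Vec.map toℕ w)) (G (x ∷ y ∷ Vec.toList w))))
             (∑ᵛ-*ˡ (allFin n) (m′ ℕ.* 2) (𝟙 (y Fin.≟ op x)) _)) ⟩
      ∑[ y ← allFin n ] 𝟙 (y Fin.≟ op x) * X x y
        ≡⟨ ∑-𝟙-Fin n (op x) (X x) ⟩
      X x (op x)
        ≡⟨ trans (∑ᵛ-*ˡ (allFin n) (m′ ℕ.* 2) (weight x) _) (cong (weight x *_) (fold m′ (λ l → G (x ∷ op x ∷ l)))) ⟩
      weight x * ∑ʷ (allFin n) m′ (λ xs → ∏ xs weight * G (x ∷ op x ∷ weave xs))
        ≡⟨ sym (trans (∑ʷ-cong (allFin n) m′ λ xs _ → *-assoc (weight x) (∏ xs weight) (G (x ∷ op x ∷ weave xs)))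
                      (∑ʷ-*ˡ (allFin n) m′ (weight x) _)) ⟩
      ∑ʷ (allFin n) m′ (λ xs → weight x * ∏ xs weight * G (x ∷ op x ∷ weave xs)) ∎
      where
      open ≡-Reasoning
      h : Fin n → Fin n → ℤ
      h x y = ℤ.+ (toℕ y ℕ.!) * -1ℤ ^ toℕ y * ℤ.+ (toℕ x ℕ.!)
      X : Fin n → Fin n → ℤ
      X x y = ∑ᵛ (allFin n) (m′ ℕ.* 2) (λ w → h x y * (pairing m′ d (Vec.map toℕ w) * G (x ∷ y ∷ Vec.toList w)))
      regroup : ∀ a b c e → a * b * c * e ≡ a * (b * (c * e))
      regroup = solve-∀
      indicator : ∀ x y → 𝟙 (toℕ x ℕ.+ toℕ y ℕₚ.≟ d) ≡ 𝟙 (y Fin.≟ op x)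
      indicator x y = 𝟙-⇔ (toℕ x ℕ.+ toℕ y ℕₚ.≟ d) (y Fin.≟ op x)
        (λ eq → Fin.toℕ-injective (ℕₚ.+-cancelˡ-≡ (toℕ x) (toℕ y) (toℕ (op x)) (trans eq (sym (op-+ x)))))
        (λ eq → trans (cong (λ z → toℕ x ℕ.+ toℕ z) eq) (op-+ x))

    Q : List (Fin n) → ℤ
    Q xs = ∏ xs weight * sgn (weave xs)

    sgn-anti : AntiSym (sgn {n})
    sgn-anti = ∏ₚ-anti sign< sign<-anti

    -- Two signs cancel: x and d - x have opposite parity because d is odd, which negates the
    -- weight, and exchanging the two adjacent letters negates the sign of the woven word.
    Q-flip : ∀ pre x post → Q (pre ++ op x ∷ post) ≡ Q (pre ++ x ∷ post)
    Q-flip pre x post = begin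
      ∏ (pre ++ op x ∷ post) weight * sgn (weave (pre ++ op x ∷ post))
        ≡⟨ cong₂ _*_ (∏-++ pre (op x ∷ post) weight) (cong sgn (double-++ id op pre (op x ∷ post))) ⟩
      ∏ pre weight * (weight (op x) * ∏ post weight) * sgn (weave pre ++ op x ∷ op (op x) ∷ weave post)
        ≡⟨ cong₂ (λ a b → ∏ pre weight * (a * ∏ post weight) * b) (weight-op x)
             (trans (cong (λ y → sgn (weave pre ++ op x ∷ y ∷ weave post)) (op-involutive x)) (sgn-anti (weave pre) (op x) x (weave post))) ⟩
      ∏ pre weight * (- weight x * ∏ post weight) * - sgn (weave pre ++ x ∷ op x ∷ weave post)
        ≡⟨ lemma (∏ pre weight) (weight x) (∏ post weight) _ ⟩
      ∏ pre weight * (weight x * ∏ post weight) * sgn (weave pre ++ x ∷ op x ∷ weave post)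
        ≡⟨ cong₂ _*_ (sym (∏-++ pre (x ∷ post) weight)) (cong sgn (sym (double-++ id op pre (x ∷ post)))) ⟩
      Q (pre ++ x ∷ post) ∎
      where
      open ≡-Reasoning
      lemma : ∀ a b c e → a * (- b * c) * - e ≡ a * (b * c) * e
      lemma = solve-∀

    four-swap : ∀ {F : List (Fin n) → ℤ} → AntiSym F → ∀ a b c e w → F (a ∷ b ∷ c ∷ e ∷ w) ≡ F (c ∷ e ∷ a ∷ b ∷ w)
    four-swap {F} F-anti a b c e w = begin
      F (a ∷ b ∷ c ∷ e ∷ w)        ≡⟨ F-anti (a ∷ []) b c (e ∷ w) ⟩
      - F (a ∷ c ∷ b ∷ e ∷ w)      ≡⟨ cong -_ (F-anti [] a c (b ∷ e ∷ w)) ⟩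
      - - F (c ∷ a ∷ b ∷ e ∷ w)    ≡⟨ neg-involutive _ ⟩
      F (c ∷ a ∷ b ∷ e ∷ w)        ≡⟨ F-anti (c ∷ a ∷ []) b e w ⟩
      - F (c ∷ a ∷ e ∷ b ∷ w)      ≡⟨ cong -_ (F-anti (c ∷ []) a e (b ∷ w)) ⟩
      - - F (c ∷ e ∷ a ∷ b ∷ w)    ≡⟨ neg-involutive _ ⟩
      F (c ∷ e ∷ a ∷ b ∷ w)        ∎
      where open ≡-Reasoning

    -- Blocks of two letters move past each other by an even permutation.
    weave-symm : ∀ {F : List (Fin n) → ℤ} → AntiSym F → Symm (F ∘ weave)
    weave-symm F-anti Perm.refl = refl
    weave-symm {F} F-anti (prep x p) = weave-symm {λ w → F (x ∷ op x ∷ w)} (λ pre → F-anti (x ∷ op x ∷ pre)) p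
    weave-symm {F} F-anti (swap x y p) =
      trans (four-swap {F} F-anti x (op x) y (op y) _) (weave-symm {λ w → F (y ∷ op y ∷ x ∷ op x ∷ w)} (λ pre → F-anti (y ∷ op y ∷ x ∷ op x ∷ pre)) p)
    weave-symm {F} F-anti (Perm.trans p q) = trans (weave-symm {F} F-anti p) (weave-symm {F} F-anti q)

    Q-symm : Symm Q
    Q-symm p = cong₂ _*_ (∏-↭ p weight) (weave-symm {sgn} sgn-anti p)

    Q-repeat : ∀ x w → Q (x ∷ x ∷ w) ≡ 0ℤ
    Q-repeat x w = trans (cong (∏ (x ∷ x ∷ w) weight *_)
      (anti-repeat sgn sgn-anti {weave (x ∷ x ∷ w)} {x} {op x ∷ op x ∷ weave w} (prep x (swap (op x) x Perm.refl)))) (*-zeroʳ (∏ (x ∷ x ∷ w) weight))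

    m≤n : m ≤ n
    m≤n = ℕₚ.m≤m*n m 2

  -- Representatives of the pairs {x , d - x}: the lower half of the exponents.
  low : Fin m → Fin n
  low i = Fin.inject≤ i m≤n

  toℕ-low : ∀ i → toℕ (low i) ≡ toℕ i
  toℕ-low i = Fin.toℕ-inject≤ i m≤n

  private
    low<m : ∀ i → toℕ (low i) < m
    low<m i = subst (_< m) (sym (toℕ-low i)) (Fin.toℕ<n i)

    m≤op-low : ∀ i → m ≤ toℕ (op (low i))
    m≤op-low i = ℕₚ.+-cancelˡ-≤ (toℕ (low i)) m (toℕ (op (low i)))
      (ℕₚ.≤-trans (ℕₚ.+-monoˡ-≤ m (ℕ.s≤s⁻¹ (low<m i))) (ℕₚ.≤-reflexive (trans (twice k) (sym (op-+ (low i))))))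
      where
      twice : ∀ k → k ℕ.+ suc k ≡ suc (k ℕ.* 2)
      twice = ℕ-solve-∀

    lows : List (Fin n)
    lows = map low (allFin m)

    lows-unique : Unique (lows ++ map op lows)
    lows-unique = Uniqueₚ.++⁺ lows! (Uniqueₚ.map⁺ (λ {x} {y} eq → trans (sym (op-involutive x)) (trans (cong op eq) (op-involutive y))) lows!) disjoint
      where
      lows! : Unique lows
      lows! = Uniqueₚ.map⁺ (λ {i} {j} eq → Fin.toℕ-injective (trans (sym (toℕ-low i)) (trans (cong toℕ eq) (toℕ-low j)))) (Uniqueₚ.allFin⁺ m)
      disjoint : ∀ {x} → ¬ (x ∈ lows × x ∈ map op lows)
      disjoint (x∈ , x∈′) with ∈-map⁻ low {xs = allFin m} x∈ | ∈-map⁻ op {xs = lows} x∈′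
      ... | i , _ , refl | y , y∈ , eq with ∈-map⁻ low {xs = allFin m} y∈
      ...   | j , _ , refl = ℕₚ.<⇒≱ (low<m i) (subst (λ z → m ≤ toℕ z) (sym eq) (m≤op-low j))

    length-lows : length lows ≡ m
    length-lows = trans (length-map low (allFin m)) (length-allFin m)

    lows-all : allFin n ↭ lows ++ map op lows
    lows-all = ↭-sym (unique-↭ (lows ++ map op lows) lows-unique (λ _ → ∈-allFin _) (ℕₚ.≤-reflexive
      (trans (length-allFin n) (sym (trans (length-++ lows) (trans (cong₂ ℕ._+_ length-lows (trans (length-map op lows) length-lows)) (twice m)))))))
      where
      twice : ∀ m → m ℕ.+ m ≡ m ℕ.* 2
      twice = ℕ-solve-∀

    -- The word is 0, d, 1, d - 1, and so on. Between two of its blocks exactly two of the four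
    -- comparisons are inversions: the larger letter of the earlier block exceeds both letters of
    -- the later one.
    sgn-lows : sgn (weave lows) ≡ 1ℤ
    sgn-lows = trans (∏ₚ-double sign< id op lows)
      (cong₂ _*_ (trans (∏-map low (allFin m) (λ x → sign< x (op x))) (∏-one (allFin m) λ i → sign<-1 (low<op i i)))
                 (trans (∏ₚ-map t₄ low (allFin m)) (∏ₚ-one {t = λ i j → t₄ (low i) (low j)} {xs = allFin m} (AllPairsₚ.tabulate⁺-< {f = id} λ {i} {j} i<j →
                    cong₂ _*_ (cong₂ _*_ (sign<-1 (lows< i j i<j)) (sign<-1 (low<op i j)))
                              (cong₂ _*_ (sign<-neg (low<op j i)) (sign<-neg (op> i j i<j)))))))
      where
      t₄ : Fin n → Fin n → ℤ
      t₄ x y = (sign< x y * sign< x (op y)) * (sign< (op x) y * sign< (op x) (op y))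
      low<op : ∀ i j → low i Fin.< op (low j)
      low<op i j = ℕₚ.<-≤-trans (low<m i) (m≤op-low j)
      lows< : ∀ i j → i Fin.< j → low i Fin.< low j
      lows< i j i<j = subst₂ _<_ (sym (toℕ-low i)) (sym (toℕ-low j)) i<j
      op> : ∀ i j → i Fin.< j → op (low j) Fin.< op (low i)
      op> i j i<j = ℕₚ.+-cancelˡ-< (toℕ (low i)) _ _ (ℕₚ.<-≤-trans (ℕₚ.+-monoˡ-< (toℕ (op (low j))) (lows< i j i<j))
                      (ℕₚ.≤-reflexive (trans (op-+ (low j)) (sym (op-+ (low i))))))

  pairing-sum : Li (complete n) (pairing m d) (Vec.replicate n 0) ≡ (ℤ.+ 2) ^ m * (ℤ.+ (m ℕ.!) * ∏ (allFin m) (weight ∘ low))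
  pairing-sum = begin
    Li (complete n) (pairing m d) (Vec.replicate n 0)
      ≡⟨ vandermonde n (pairing m d) (pairing-support m) ⟩
    ∑ᵛ (allFin n) n (λ w → pairing m d (Vec.map toℕ w) * sgn (Vec.toList w))
      ≡⟨ fold m sgn ⟩
    ∑ʷ (allFin n) m Q
      ≡⟨ ∑ʷ-flip op lows Q Q-flip lows-all m ⟩
    (ℤ.+ 2) ^ m * ∑ʷ lows m Q
      ≡⟨ cong ((ℤ.+ 2) ^ m *_) (trans (∑ʷ-sublists Q-symm Q-repeat lows m)
           (cong (ℤ.+ (m ℕ.!) *_) (trans (cong (λ l → ∑[ F ← sublists lows ] 𝟙 (length F ℕₚ.≟ l) * Q F) (sym length-lows)) (∑-sublists-all Q lows)))) ⟩
    (ℤ.+ 2) ^ m * (ℤ.+ (m ℕ.!) * (∏ lows weight * sgn (weave lows)))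
      ≡⟨ cong (λ e → (ℤ.+ 2) ^ m * (ℤ.+ (m ℕ.!) * e)) (trans (cong (∏ lows weight *_) sgn-lows) (trans (*-identityʳ _) (∏-map low (allFin m) weight))) ⟩
    (ℤ.+ 2) ^ m * (ℤ.+ (m ℕ.!) * ∏ (allFin m) (weight ∘ low)) ∎
    where
    open ≡-Reasoning
    pairing-support : ∀ m′ (b : Vec ℕ (m′ ℕ.* 2)) i → n ≤ Vec.lookup b i → pairing m′ d b ≡ 0ℤ
    pairing-support (suc m′) (x ∷ y ∷ b) zero       n≤x =
      cong (λ e → e * (ℤ.+ (y ℕ.!) * -1ℤ ^ y * ℤ.+ (x ℕ.!)) * pairing m′ d b) (𝟙-no (x ℕ.+ y ℕₚ.≟ d) λ eq → ℕₚ.<⇒≱ n≤x (subst (x ≤_) eq (ℕₚ.m≤m+n x y)))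
    pairing-support (suc m′) (x ∷ y ∷ b) (suc zero) n≤y =
      cong (λ e → e * (ℤ.+ (y ℕ.!) * -1ℤ ^ y * ℤ.+ (x ℕ.!)) * pairing m′ d b) (𝟙-no (x ℕ.+ y ℕₚ.≟ d) λ eq → ℕₚ.<⇒≱ n≤y (subst (y ≤_) eq (ℕₚ.m≤n+m y x)))
    pairing-support (suc m′) (x ∷ y ∷ b) (suc (suc i)) n≤ =
      trans (cong (𝟙 (x ℕ.+ y ℕₚ.≟ d) * (ℤ.+ (y ℕ.!) * -1ℤ ^ y * ℤ.+ (x ℕ.!)) *_) (pairing-support m′ b i n≤))
            (*-zeroʳ (𝟙 (x ℕ.+ y ℕₚ.≟ d) * (ℤ.+ (y ℕ.!) * -1ℤ ^ y * ℤ.+ (x ℕ.!))))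

-- Arithmetic modulo p

fromℕ : ℕ → ℤ
fromℕ n = ℤ.+ n

AllPairs-↭ : {R : A → A → Set} → (∀ {x y} → R x y → R y x) → ∀ {xs ys} → xs ↭ ys → AllPairs R xs → AllPairs R ys
AllPairs-↭ R-sym Perm.refl        rs                            = rs
AllPairs-↭ R-sym (prep x p)       (r ∷ rs)                      = Permₚ.All-resp-↭ p r ∷ AllPairs-↭ R-sym p rs
AllPairs-↭ R-sym (swap x y p)     ((xy ∷ rx) ∷ (ry ∷ rs))       = (R-sym xy ∷ Permₚ.All-resp-↭ p ry) ∷ (Permₚ.All-resp-↭ p rx ∷ AllPairs-↭ R-sym p rs)
AllPairs-↭ R-sym (Perm.trans p q) rs                            = AllPairs-↭ R-sym q (AllPairs-↭ R-sym p rs)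

Unique-↭ : {xs ys : List A} → xs ↭ ys → Unique xs → Unique ys
Unique-↭ = AllPairs-↭ (λ neq eq → neq (sym eq))

∷-unique : ∀ {x : A} {xs} → Unique (x ∷ xs) → ¬ x ∈ xs
∷-unique (x∉ ∷ _) = All¬⇒¬Any x∉

-- Wilson's theorem and square roots modulo p.

module PrimeField (p m : ℕ) (p-prime : Prime p) (p≡1+2m : p ≡ suc (m ℕ.* 2)) where

  open Mod p

  private
    0<p : 0 < p
    0<p = subst (0 <_) (sym p≡1+2m) (s≤s z≤n)

    instance
      p-nonZero : ℕ.NonZero p
      p-nonZero = prime⇒nonZero p-prime

  p≈0 : ℤ.+ p ≈ 0ℤ
  p≈0 = mod (divides 1ℤ (trans (+-identityʳ (ℤ.+ p)) (sym (*-identityˡ (ℤ.+ p)))))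

  small-≈ : ∀ {a b} → a < p → b < p → ℤ.+ a ≈ ℤ.+ b → a ≡ b
  small-≈ {a} {b} a<p b<p (mod p∣a-b) =
    +-injective (i-j≡0⇒i≡j (ℤ.+ a) (ℤ.+ b) (∣i∣≡0⇒i≡0 (multiple-zero bound (∣⇒∣ᵤ p∣a-b))))
    where
    bound : ∣ ℤ.+ a - ℤ.+ b ∣ < p
    bound = subst (λ i → ∣ i ∣ < p) (sym (m-n≡m⊖n a b)) (ℕₚ.≤-<-trans (∣m⊝n∣≤m⊔n a b) (ℕₚ.⊔-lub a<p b<p))
    multiple-zero : ∀ {k} → k < p → p ℕ∣.∣ k → k ≡ 0
    multiple-zero {zero}  _   _   = refl
    multiple-zero {suc k} k<p p∣k = contradiction p∣k (ℕ∣.>⇒∤ k<p)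

  integral : ∀ a b → a * b ≈ 0ℤ → a ≈ 0ℤ ⊎ b ≈ 0ℤ
  integral a b (mod p∣ab)
    with euclidsLemma ∣ a ∣ ∣ b ∣ p-prime (subst (p ℕ∣.∣_) (trans (cong ∣_∣ (+-identityʳ (a * b))) (abs-* a b)) (∣⇒∣ᵤ p∣ab))
  ... | inj₁ p∣a = inj₁ (mod (subst (ℤ.+ p ℤ∣.∣_) (sym (+-identityʳ a)) (∣ᵤ⇒∣ p∣a)))
  ... | inj₂ p∣b = inj₂ (mod (subst (ℤ.+ p ℤ∣.∣_) (sym (+-identityʳ b)) (∣ᵤ⇒∣ p∣b)))

  Unit : ℕ → Set
  Unit x = 0 < x × x < p

  ≈-from-diff : ∀ {a b} → a - b ≈ 0ℤ → a ≈ b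
  ≈-from-diff {a} {b} eq = ≈-trans (≡⇒≈ (lemma a b)) (≈-trans (≈-+ eq (≈-refl {b})) (≡⇒≈ (+-identityˡ b)))
    where
    lemma : ∀ a b → a ≡ a - b + b
    lemma = solve-∀

  unit-≉0 : ∀ {x} → Unit x → ¬ ℤ.+ x ≈ 0ℤ
  unit-≉0 (0<x , x<p) eq = ℕₚ.<⇒≢ 0<x (sym (small-≈ x<p 0<p eq))

  cancel : ∀ {x} → Unit x → ∀ {a b} → ℤ.+ x * a ≈ ℤ.+ x * b → a ≈ b
  cancel {x} ux {a} {b} eq = by-cases (integral (ℤ.+ x) (a - b) zero-product)
    where
    lemma : ∀ x a b → x * (a - b) ≡ x * a - x * b
    lemma = solve-∀
    zero-product : ℤ.+ x * (a - b) ≈ 0ℤ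
    zero-product = ≈-trans (≡⇒≈ (lemma (ℤ.+ x) a b)) (≈-trans (≈-+ eq (≈-refl { - (ℤ.+ x * b)})) (≡⇒≈ (+-inverseʳ (ℤ.+ x * b))))
    by-cases : ℤ.+ x ≈ 0ℤ ⊎ a - b ≈ 0ℤ → a ≈ b
    by-cases (inj₁ x≈0)  = contradiction x≈0 (unit-≉0 ux)
    by-cases (inj₂ diff) = ≈-from-diff diff

  inverse : ∀ {x} → Unit x → ∃ λ z → ℤ.+ x * z ≈ 1ℤ
  inverse {x@(suc _)} (_ , x<p) = by-cases (coprime-Bézout (prime⇒coprime p-prime x<p))
    where
    multiple : ∀ a → a * ℤ.+ p ≈ 0ℤ
    multiple a = ≈-trans (≈-*ʳ a p≈0) (≡⇒≈ (*-zeroʳ a))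
    lemma : ∀ b x → x * - b ≡ 1ℤ + - (1ℤ + b * x)
    lemma = solve-∀
    by-cases : Bézout.Identity 1 p x → ∃ λ z → ℤ.+ x * z ≈ 1ℤ
    by-cases (Bézout.+- a b eq) = - ℤ.+ b ,
      ≈-trans (≡⇒≈ (trans (lemma (ℤ.+ b) (ℤ.+ x)) (cong (λ e → 1ℤ + - e) int)))
              (≈-+ (≈-refl {1ℤ}) (≈-neg (multiple (ℤ.+ a))))
      where
      int : 1ℤ + ℤ.+ b * ℤ.+ x ≡ ℤ.+ a * ℤ.+ p
      int = trans (cong (1ℤ +_) (sym (pos-* b x))) (trans (cong ℤ.+_ eq) (pos-* a p))
    by-cases (Bézout.-+ a b eq) = ℤ.+ b ,
      ≈-trans (≡⇒≈ (trans (*-comm (ℤ.+ x) (ℤ.+ b)) (sym int))) (≈-+ (≈-refl {1ℤ}) (multiple (ℤ.+ a)))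
      where
      int : 1ℤ + ℤ.+ a * ℤ.+ p ≡ ℤ.+ b * ℤ.+ x
      int = trans (cong (1ℤ +_) (sym (pos-* a p))) (trans (cong ℤ.+_ eq) (pos-* b x))

  residue : ∀ a → ∃ λ y → y < p × ℤ.+ y ≈ a
  residue a = a %ℕ p , n%ℕd<d a p , ≈-sym
    (≈-trans (≡⇒≈ (a≡a%ℕn+[a/ℕn]*n a p))
    (≈-trans (≈-+ (≈-refl {ℤ.+ (a %ℕ p)}) (≈-trans (≈-*ʳ (a /ℕ p) p≈0) (≡⇒≈ (*-zeroʳ (a /ℕ p)))))
             (≡⇒≈ (+-identityʳ (ℤ.+ (a %ℕ p))))))

  partner : ∀ a → ¬ a ≈ 0ℤ → ∀ {x} → Unit x → ∃ λ y → Unit y × ℤ.+ x * ℤ.+ y ≈ a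
  partner a a≉0 {x} ux = y , (ℕₚ.n≢0⇒n>0 y≢0 , proj₁ (proj₂ (residue (z * a)))) , xy≈a
    where
    z : ℤ
    z = proj₁ (inverse ux)
    y : ℕ
    y = proj₁ (residue (z * a))
    xy≈a : ℤ.+ x * ℤ.+ y ≈ a
    xy≈a = ≈-trans (≈-*ʳ (ℤ.+ x) (proj₂ (proj₂ (residue (z * a)))))
           (≈-trans (≡⇒≈ (sym (*-assoc (ℤ.+ x) z a))) (≈-trans (≈-* (proj₂ (inverse ux)) (≈-refl {a})) (≡⇒≈ (*-identityˡ a))))
    y≢0 : y ≢ 0
    y≢0 eq = a≉0 (≈-trans (≈-sym xy≈a) (≡⇒≈ (trans (cong (λ y → ℤ.+ x * ℤ.+ y) eq) (*-zeroʳ (ℤ.+ x)))))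

  partner-unique : ∀ {a x y z} → Unit x → Unit y → Unit z → ℤ.+ x * ℤ.+ y ≈ a → ℤ.+ x * ℤ.+ z ≈ a → y ≡ z
  partner-unique ux (_ , y<p) (_ , z<p) xy xz = small-≈ y<p z<p (cancel ux (≈-trans xy (≈-sym xz)))

  Closed : ℤ → List ℕ → Set
  Closed a L = ∀ {x} → x ∈ L → ∃ λ y → y ∈ L × y ≢ x × ℤ.+ x * ℤ.+ y ≈ a

  private
    ≈-comm : ∀ {a} x y → ℤ.+ x * ℤ.+ y ≈ a → ℤ.+ y * ℤ.+ x ≈ a
    ≈-comm x y = ≈-trans (≡⇒≈ (*-comm (ℤ.+ y) (ℤ.+ x)))

  -- Wilson's argument: the product over a set on which x ↦ a / x is an involution without fixed points.
  pairing-product : ∀ a k L → length L ≡ k ℕ.* 2 → Unique L → (∀ {x} → x ∈ L → Unit x) → Closed a L → ∏ L fromℕ ≈ a ^ k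
  pairing-product a zero    []      _   _  _     _      = ≈-refl
  pairing-product a (suc k) (x ∷ L) len un units closed with closed (here refl)
  ... | y , here y≡x , y≢x , _ = contradiction y≡x y≢x
  ... | y , there y∈L , y≢x , xy≈a with ∈⇒↭∷ y∈L
  ...   | L′ , L↭ = ≈-trans (≡⇒≈ (trans (cong (ℤ.+ x *_) (∏-↭ L↭ fromℕ)) (sym (*-assoc (ℤ.+ x) (ℤ.+ y) _))))
                            (≈-* xy≈a (pairing-product a k L′ len′ (AllPairs.tail un′) (units ∘ there ∘ sub) closed′))
    where
    un′ : Unique (y ∷ L′)
    un′ = Unique-↭ L↭ (AllPairs.tail un)
    sub : ∀ {z} → z ∈ L′ → z ∈ L
    sub z∈ = Permₚ.∈-resp-↭ (↭-sym L↭) (there z∈)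
    len′ : length L′ ≡ k ℕ.* 2
    len′ = ℕₚ.suc-injective (trans (sym (Permₚ.↭-length L↭)) (ℕₚ.suc-injective len))
    closed′ : Closed a L′
    closed′ {z} z∈ with closed (there (sub z∈))
    ... | w , here refl , w≢z , zw≈a =
      contradiction (subst (_∈ L′) (partner-unique (units (here refl)) (units (there (sub z∈))) (units (there y∈L)) (≈-comm z w zw≈a) xy≈a) z∈) (∷-unique un′)
    ... | w , there w∈L , w≢z , zw≈a with Permₚ.∈-resp-↭ L↭ w∈L
    ...   | here refl = contradiction (subst (_∈ L) (partner-unique (units (there y∈L)) (units (there (sub z∈))) (units (here refl)) (≈-comm z w zw≈a) (≈-comm x w xy≈a)) (sub z∈)) (∷-unique un)
    ...   | there w∈  = w , w∈ , w≢z , zw≈a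

  units : List ℕ
  units = map (suc ∘ toℕ) (allFin (m ℕ.* 2))

  private
    ∈-units : ∀ {x} → Unit x → x ∈ units
    ∈-units {suc x} (_ , x<p) with s≤s x< ← subst (suc x <_) p≡1+2m x<p = subst (_∈ units) (cong suc (Fin.toℕ-fromℕ< x<)) (∈-map⁺ (suc ∘ toℕ) (∈-allFin (Fin.fromℕ< x<)))

    units-∈ : ∀ {x} → x ∈ units → Unit x
    units-∈ x∈ with ∈-map⁻ (suc ∘ toℕ) {xs = allFin (m ℕ.* 2)} x∈
    ... | i , _ , refl = s≤s z≤n , subst (suc (toℕ i) <_) (sym p≡1+2m) (s≤s (Fin.toℕ<n i))

    units-unique : Unique units
    units-unique = Uniqueₚ.map⁺ (Fin.toℕ-injective ∘ ℕₚ.suc-injective) (Uniqueₚ.allFin⁺ (m ℕ.* 2))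

    length-units : length units ≡ m ℕ.* 2
    length-units = trans (length-map (suc ∘ toℕ) (allFin (m ℕ.* 2))) (length-allFin (m ℕ.* 2))

  -- Without a square root of a, the map x to a / x pairs off all units. Here and in
  -- `residue-product` the product of all units is expressed through a ^ m; comparison with Wilson's
  -- theorem gives Euler's criterion.
  nonresidue : ∀ a → ¬ a ≈ 0ℤ → (∀ {x} → Unit x → ¬ ℤ.+ x * ℤ.+ x ≈ a) → ∏ units fromℕ ≈ a ^ m
  nonresidue a a≉0 no-root = pairing-product a m units length-units units-unique units-∈ closed
    where
    closed : Closed a units
    closed {x} x∈ = found (partner a a≉0 (units-∈ x∈))
      where
      found : (∃ λ y → Unit y × ℤ.+ x * ℤ.+ y ≈ a) → ∃ λ y → y ∈ units × y ≢ x × ℤ.+ x * ℤ.+ y ≈ a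
      found (y , uy , xy≈a) = y , ∈-units uy , (λ { refl → no-root uy xy≈a }) , xy≈a

  private
    opp : ∀ {x} → Unit x → ∃ λ y → Unit y × ℤ.+ y ≈ - ℤ.+ x × y ≢ x
    opp {x} (0<x , x<p) = p ∸ x , (ℕₚ.m<n⇒0<n∸m x<p , ℕₚ.∸-monoʳ-< 0<x (ℕₚ.<⇒≤ x<p)) ,
      ≈-trans (≡⇒≈ (sym (trans (m-n≡m⊖n p x) (⊖-≥ (ℕₚ.<⇒≤ x<p))))) (≈-trans (≈-+ p≈0 (≈-refl { - ℤ.+ x})) (≡⇒≈ (+-identityˡ (- ℤ.+ x)))) ,
      λ eq → odd m x (trans (sym p≡1+2m) (trans (sym (ℕₚ.m∸n+n≡m (ℕₚ.<⇒≤ x<p))) (cong (ℕ._+ x) eq)))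
      where
      odd : ∀ m x → suc (m ℕ.* 2) ≢ x ℕ.+ x
      odd m       zero    ()
      odd zero    (suc x) eq with () ← trans (ℕₚ.suc-injective eq) (ℕₚ.+-suc x x)
      odd (suc m) (suc x) eq = odd m x (ℕₚ.suc-injective (trans (ℕₚ.suc-injective eq) (ℕₚ.+-suc x x)))

  private
   module Residue (a : ℤ) {x x′ : ℕ} {L L′ : List ℕ} (ux : Unit x) (x²≈a : ℤ.+ x * ℤ.+ x ≈ a)
                  (ux′ : Unit x′) (x′≈-x : ℤ.+ x′ ≈ - ℤ.+ x) (units↭ : units ↭ x ∷ L) (L↭ : L ↭ x′ ∷ L′) where
    un₁ : Unique (x ∷ L)
    un₁ = Unique-↭ units↭ units-unique
    un₂ : Unique (x′ ∷ L′)
    un₂ = Unique-↭ L↭ (AllPairs.tail un₁)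
    sub : ∀ {z} → z ∈ L′ → z ∈ L
    sub z∈ = Permₚ.∈-resp-↭ (↭-sym L↭) (there z∈)
    unit : ∀ {z} → z ∈ L′ → Unit z
    unit z∈ = units-∈ (Permₚ.∈-resp-↭ (↭-sym units↭) (there (sub z∈)))
    a≉0 : ¬ a ≈ 0ℤ
    a≉0 a≈0 = by-cases (integral (ℤ.+ x) (ℤ.+ x) (≈-trans x²≈a a≈0))
      where
      by-cases : ℤ.+ x ≈ 0ℤ ⊎ ℤ.+ x ≈ 0ℤ → ⊥
      by-cases (inj₁ x≈0) = unit-≉0 ux x≈0
      by-cases (inj₂ x≈0) = unit-≉0 ux x≈0
    x′²≈a : ℤ.+ x′ * ℤ.+ x′ ≈ a
    x′²≈a = ≈-trans (≈-* x′≈-x x′≈-x) (≈-trans (≡⇒≈ (lemma (ℤ.+ x))) x²≈a)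
      where
      lemma : ∀ a → - a * - a ≡ a * a
      lemma = solve-∀
    roots : ∀ {z} → Unit z → ℤ.+ z * ℤ.+ z ≈ a → z ≡ x ⊎ z ≡ x′
    roots {z} uz z²≈a = by-cases (integral (ℤ.+ z - ℤ.+ x) (ℤ.+ z + ℤ.+ x)
                                   (≈-trans (≡⇒≈ (lemma (ℤ.+ z) (ℤ.+ x))) (≈-trans (≈-+ z²≈a (≈-neg x²≈a)) (≡⇒≈ (+-inverseʳ a)))))
      where
      lemma : ∀ a b → (a - b) * (a + b) ≡ a * a + - (b * b)
      lemma = solve-∀
      lemma′ : ∀ a b → a - - b ≡ a + b
      lemma′ = solve-∀
      by-cases : ℤ.+ z - ℤ.+ x ≈ 0ℤ ⊎ ℤ.+ z + ℤ.+ x ≈ 0ℤ → z ≡ x ⊎ z ≡ x′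
      by-cases (inj₁ e) = inj₁ (small-≈ (proj₂ uz) (proj₂ ux) (≈-from-diff e))
      by-cases (inj₂ e) = inj₂ (small-≈ (proj₂ uz) (proj₂ ux′) (≈-trans (≈-from-diff (≈-trans (≡⇒≈ (lemma′ (ℤ.+ z) (ℤ.+ x))) e)) (≈-sym x′≈-x)))
    closed : Closed a L′
    closed {z} z∈ = found (partner a a≉0 (unit z∈))
      where
      in-L : ∀ {w} → Unit w → w ≢ z → ℤ.+ z * ℤ.+ w ≈ a → w ∈ x ∷ L → w ∈ L
      in-L uw w≢z zw≈a (here refl) =
        contradiction (subst (_∈ L) (partner-unique ux (unit z∈) ux (≈-comm z x zw≈a) x²≈a) (sub z∈)) (∷-unique un₁)
      in-L uw w≢z zw≈a (there w∈L) = w∈L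
      in-L′ : ∀ {w} → Unit w → w ≢ z → ℤ.+ z * ℤ.+ w ≈ a → w ∈ x′ ∷ L′ → w ∈ L′
      in-L′ uw w≢z zw≈a (here refl) =
        contradiction (subst (_∈ L′) (partner-unique ux′ (unit z∈) ux′ (≈-comm z x′ zw≈a) x′²≈a) z∈) (∷-unique un₂)
      in-L′ uw w≢z zw≈a (there w∈) = w∈
      not-root : ¬ ℤ.+ z * ℤ.+ z ≈ a
      not-root z²≈a = by-cases (roots (unit z∈) z²≈a)
        where
        by-cases : z ≡ x ⊎ z ≡ x′ → ⊥
        by-cases (inj₁ refl) = ∷-unique un₁ (sub z∈)
        by-cases (inj₂ refl) = ∷-unique un₂ z∈
      found : (∃ λ w → Unit w × ℤ.+ z * ℤ.+ w ≈ a) → ∃ λ w → w ∈ L′ × w ≢ z × ℤ.+ z * ℤ.+ w ≈ a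
      found (w , uw , zw≈a) = w , in-L′ uw w≢z zw≈a (Permₚ.∈-resp-↭ L↭ (in-L uw w≢z zw≈a (Permₚ.∈-resp-↭ units↭ (∈-units uw)))) , w≢z , zw≈a
        where
        w≢z : w ≢ z
        w≢z refl = not-root zw≈a
    go : ∀ k → k ≡ m → ∏ units fromℕ ≈ - (a ^ k)
    go zero    refl = contradiction (proj₁ ux) (ℕₚ.<⇒≱ (subst (x <_) p≡1+2m (proj₂ ux)))
    go (suc k) refl =
      ≈-trans (≡⇒≈ (trans (∏-↭ units↭ fromℕ) (cong (ℤ.+ x *_) (∏-↭ L↭ fromℕ))))
      (≈-trans (≈-*ʳ (ℤ.+ x) (≈-* x′≈-x (pairing-product a k L′ len (AllPairs.tail un₂) unit closed)))
      (≈-trans (≡⇒≈ (lemma (ℤ.+ x) (a ^ k))) (≈-neg (≈-* x²≈a (≈-refl {a ^ k})))))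
      where
      len : length L′ ≡ k ℕ.* 2
      len = ℕₚ.suc-injective (ℕₚ.suc-injective (trans (cong suc (sym (Permₚ.↭-length L↭))) (trans (sym (Permₚ.↭-length units↭)) length-units)))
      lemma : ∀ x b → x * (- x * b) ≡ - ((x * x) * b)
      lemma = solve-∀

  -- The only fixed points of x to a / x are the two roots x and -x, distinct because p is odd.
  -- Their product is -a, and the other units form m - 1 pairs of product a.
  residue-product : ∀ a {x} → Unit x → ℤ.+ x * ℤ.+ x ≈ a → ∏ units fromℕ ≈ - (a ^ m)
  residue-product a {x} ux x²≈a = removed (opp ux) (∈⇒↭∷ (∈-units ux))
    where
    removed : (∃ λ y → Unit y × ℤ.+ y ≈ - ℤ.+ x × y ≢ x) → (∃ λ L → units ↭ x ∷ L) → ∏ units fromℕ ≈ - (a ^ m)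
    removed (x′ , ux′ , x′≈-x , x′≢x) (L , units↭) = by-cases (Permₚ.∈-resp-↭ units↭ (∈-units ux′))
      where
      by-cases : x′ ∈ x ∷ L → ∏ units fromℕ ≈ - (a ^ m)
      by-cases (here x′≡x)   = contradiction x′≡x x′≢x
      by-cases (there x′∈L) = Residue.go a ux x²≈a ux′ x′≈-x units↭ (proj₂ (∈⇒↭∷ x′∈L)) m refl

  wilson : 0 < m → ∏ units fromℕ ≈ -1ℤ
  wilson 0<m = ≈-trans (residue-product 1ℤ {1} (s≤s z≤n , subst (1 <_) (sym p≡1+2m) (s≤s (ℕₚ.≤-trans 0<m (ℕₚ.m≤m*n m 2)))) ≈-refl) (≡⇒≈ (cong -_ (^-zeroˡ m)))

if-yes : {P : Set} (P? : Dec P) {x y : A} → P → (if does P? then x else y) ≡ x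
if-yes (yes _) _ = refl
if-yes (no ¬p) p = contradiction p ¬p

if-no : {P : Set} (P? : Dec P) {x y : A} → ¬ P → (if does P? then x else y) ≡ y
if-no (yes p) ¬p = contradiction p ¬p
if-no (no _)  _  = refl

∏-factorial : ∀ n c → ∏ (allFin n) (λ i → fromℕ (suc (c ℕ.+ toℕ i))) * fromℕ (c ℕ.!) ≡ fromℕ ((c ℕ.+ n) ℕ.!)
∏-factorial zero    c = trans (*-identityˡ (fromℕ (c ℕ.!))) (cong (λ k → fromℕ (k ℕ.!)) (sym (ℕₚ.+-identityʳ c)))
∏-factorial (suc n) c = begin
  ∏ (allFin (suc n)) (λ i → fromℕ (suc (c ℕ.+ toℕ i))) * fromℕ (c ℕ.!)
    ≡⟨ cong (λ l → ∏ l (λ i → fromℕ (suc (c ℕ.+ toℕ i))) * fromℕ (c ℕ.!)) (allFin-suc n) ⟩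
  fromℕ (suc (c ℕ.+ 0)) * ∏ (map suc (allFin n)) (λ i → fromℕ (suc (c ℕ.+ toℕ i))) * fromℕ (c ℕ.!)
    ≡⟨ cong₂ (λ a b → fromℕ (suc a) * b * fromℕ (c ℕ.!)) (ℕₚ.+-identityʳ c)
         (trans (∏-map suc (allFin n) _) (∏-cong (allFin n) λ i → cong (fromℕ ∘ suc) (ℕₚ.+-suc c (toℕ i)))) ⟩
  fromℕ (suc c) * P * fromℕ (c ℕ.!)
    ≡⟨ lemma (fromℕ (suc c)) P (fromℕ (c ℕ.!)) ⟩
  P * (fromℕ (suc c) * fromℕ (c ℕ.!))
    ≡⟨ cong (P *_) (sym (pos-* (suc c) (c ℕ.!))) ⟩
  P * fromℕ (suc c ℕ.!)
    ≡⟨ ∏-factorial n (suc c) ⟩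
  fromℕ ((suc c ℕ.+ n) ℕ.!)
    ≡⟨ cong (λ k → fromℕ (k ℕ.!)) (sym (ℕₚ.+-suc c n)) ⟩
  fromℕ ((c ℕ.+ suc n) ℕ.!) ∎
  where
  open ≡-Reasoning
  P : ℤ
  P = ∏ (allFin n) (λ i → fromℕ (suc (suc c ℕ.+ toℕ i)))
  lemma : ∀ a b c → a * b * c ≡ b * (a * c)
  lemma = solve-∀

-- The moment modulo p.

module Evaluation (k p : ℕ) (p-prime : Prime p) (p≡ : p ≡ suc (suc k ℕ.* 2)) where

  private
    m n d : ℕ
    m = suc k
    n = m ℕ.* 2
    d = suc (k ℕ.* 2)

  open Mod p
  open PrimeField p m p-prime p≡

  private
    factorial : ∀ n → ∏ (allFin n) (λ i → fromℕ (suc (toℕ i))) ≡ fromℕ (n ℕ.!)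
    factorial n = trans (sym (*-identityʳ _)) (∏-factorial n 0)

    units-factorial : ∏ units fromℕ ≡ fromℕ (n ℕ.!)
    units-factorial = trans (∏-map (suc ∘ toℕ) (allFin n) fromℕ) (factorial n)

    sum-p : ∀ a b → a ℕ.+ b ≡ p → fromℕ a ≈ - fromℕ b
    sum-p a b eq = ≈-from-diff (≈-trans (≡⇒≈ (lemma (fromℕ a) (fromℕ b))) (≈-trans (≡⇒≈ (cong fromℕ eq)) p≈0))
      where
      lemma : ∀ a b → a - - b ≡ a + b
      lemma = solve-∀

  d!≈1 : fromℕ (d ℕ.!) ≈ 1ℤ
  d!≈1 = ≈-trans (≡⇒≈ (sym (neg-involutive (fromℕ (d ℕ.!))))) (≈-neg (≈-trans (≈-sym n!≈-d!) n!≈-1))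
    where
    n!≈-1 : fromℕ (n ℕ.!) ≈ -1ℤ
    n!≈-1 = ≈-trans (≡⇒≈ (sym units-factorial)) (wilson (s≤s z≤n))
    n!≈-d! : fromℕ (n ℕ.!) ≈ - fromℕ (d ℕ.!)
    n!≈-d! = ≈-trans (≡⇒≈ (pos-* n (d ℕ.!)))
             (≈-trans (≈-* (sum-p n 1 (trans (ℕₚ.+-comm n 1) (sym p≡))) (≈-refl {fromℕ (d ℕ.!)})) (≡⇒≈ (-1*i≡-i (fromℕ (d ℕ.!)))))

  private
    -- Passing from (x , y + 1) to (x + 1 , y) replaces the factor y + 1 by x + 2. These add up to
    -- p, so they are opposite modulo p, which the change of (-1)^x compensates; the start x = 0 is
    -- d! ≈ 1.
    binomial : ∀ x y → x ℕ.+ y ≡ d → fromℕ (suc x ℕ.!) * (fromℕ (y ℕ.!) * -1ℤ ^ x) ≈ 1ℤ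
    binomial zero    y eq = ≈-trans (≡⇒≈ (trans (*-identityˡ _) (*-identityʳ (fromℕ (y ℕ.!))))) (≈-trans (≡⇒≈ (cong (λ e → fromℕ (e ℕ.!)) eq)) d!≈1)
    binomial (suc x) y eq = ≈-trans (≡⇒≈ (trans (cong (_* (fromℕ (y ℕ.!) * -1ℤ ^ suc x)) (pos-* (suc (suc x)) (suc x ℕ.!)))
                                                (lemma (fromℕ (suc (suc x))) (fromℕ (suc x ℕ.!)) (fromℕ (y ℕ.!)) (-1ℤ ^ x))))
      (≈-trans (≈-* (≈-sym (sum-p (suc y) (suc (suc x)) total)) (≈-refl {fromℕ (suc x ℕ.!) * (fromℕ (y ℕ.!) * -1ℤ ^ x)}))
      (≈-trans (≡⇒≈ (trans (lemma′ (fromℕ (suc y)) (fromℕ (suc x ℕ.!)) (fromℕ (y ℕ.!)) (-1ℤ ^ x))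
                           (cong (λ e → fromℕ (suc x ℕ.!) * (e * -1ℤ ^ x)) (sym (pos-* (suc y) (y ℕ.!))))))
               (binomial x (suc y) (trans (ℕₚ.+-suc x y) eq))))
      where
      total : suc y ℕ.+ suc (suc x) ≡ p
      total = trans (rearrange x y) (trans (cong (ℕ._+ 2) eq) (trans (ℕₚ.+-comm d 2) (sym p≡)))
        where
        rearrange : ∀ x y → suc y ℕ.+ suc (suc x) ≡ suc x ℕ.+ y ℕ.+ 2
        rearrange = ℕ-solve-∀
      lemma : ∀ s f y e → (s * f) * (y * (-1ℤ * e)) ≡ - s * (f * (y * e))
      lemma = solve-∀
      lemma′ : ∀ s f y e → s * (f * (y * e)) ≡ f * ((s * y) * e)
      lemma′ = solve-∀

  open PairingSum k

  private
    -- The m! of `pairing-sum` is spent here, one factor i + 1 for each weight: it completes i! to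
    -- (i + 1)!, the shape that `binomial` evaluates.
    weight≈ : ∀ i → fromℕ (suc (toℕ i)) * weight (low i) ≈ -1ℤ
    weight≈ i = ≈-trans (≡⇒≈ (trans (cong₂ (λ x s → fromℕ (suc (toℕ i)) * (fromℕ (y ℕ.!) * s * fromℕ (x ℕ.!))) (toℕ-low i) sign-y)
                  (trans (lemma (fromℕ (suc x)) (fromℕ (y ℕ.!)) (-1ℤ ^ x) (fromℕ (x ℕ.!)))
                         (cong (λ e → - (e * (fromℕ (y ℕ.!) * -1ℤ ^ x))) (sym (pos-* (suc x) (x ℕ.!)))))))
                (≈-neg (binomial x y x+y))
      where
      x y : ℕ
      x = toℕ i
      y = toℕ (Fin.opposite (low i))
      x+y : x ℕ.+ y ≡ d
      x+y = trans (cong (ℕ._+ y) (sym (toℕ-low i))) (trans (cong (toℕ (low i) ℕ.+_) (Fin.opposite-prop (low i))) (ℕₚ.m+[n∸m]≡n (ℕ.s≤s⁻¹ (Fin.toℕ<n (low i)))))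
      sign-y : -1ℤ ^ y ≡ - -1ℤ ^ x
      sign-y = -1^-odd k {y} {x} (trans (ℕₚ.+-comm y x) x+y)
      lemma : ∀ s y e f → s * (y * - e * f) ≡ - ((s * f) * (y * e))
      lemma = solve-∀

    ^-* : ∀ a b n → a ^ n * b ^ n ≡ (a * b) ^ n
    ^-* a b zero    = refl
    ^-* a b (suc n) = trans (lemma a (a ^ n) b (b ^ n)) (cong (a * b *_) (^-* a b n))
      where
      lemma : ∀ a x b y → (a * x) * (b * y) ≡ (a * b) * (x * y)
      lemma = solve-∀

  pairing≈ : Li (complete n) (pairing m d) (Vec.replicate n 0) ≈ -[1+ 1 ] ^ m
  pairing≈ = ≈-trans (≡⇒≈ pairing-sum)
    (≈-trans (≈-*ʳ ((ℤ.+ 2) ^ m) (≈-trans (≡⇒≈ (trans (cong (_* ∏ (allFin m) (weight ∘ low)) (sym (factorial m))) (sym (∏-* (allFin m) (λ i → fromℕ (suc (toℕ i))) (weight ∘ low)))))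
                                 (≈-trans (≈-∏ (allFin m) weight≈) (≡⇒≈ (trans (∏-const (allFin m) -1ℤ) (cong (-1ℤ ^_) (length-allFin m)))))))
             (≡⇒≈ (^-* (ℤ.+ 2) -1ℤ m)))

  private
    -2≉0 : ¬ -[1+ 1 ] ≈ 0ℤ
    -2≉0 eq = unit-≉0 {2} (s≤s z≤n , subst (2 <_) (sym p≡) (s≤s (s≤s (s≤s z≤n)))) (≈-neg eq)

  euler : legendre -[1+ 1 ] p ≈ -[1+ 1 ] ^ m
  euler = by-cases (any? λ (x : Fin p) → ℤ.+ p ∣? (ℤ.+ toℕ x * ℤ.+ toℕ x - -[1+ 1 ]))
    where
    Root : Set
    Root = ∃ λ (x : Fin p) → ℤ.+ p ℤ∣.∣ (ℤ.+ toℕ x * ℤ.+ toℕ x - -[1+ 1 ])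
    root? : Dec Root
    root? = any? λ (x : Fin p) → ℤ.+ p ∣? (ℤ.+ toℕ x * ℤ.+ toℕ x - -[1+ 1 ])
    not-zero : legendre -[1+ 1 ] p ≡ (if does root? then 1ℤ else -1ℤ)
    not-zero = if-no (ℤ.+ p ∣? -[1+ 1 ]) (λ p∣-2 → -2≉0 (mod p∣-2))
    by-cases : Dec Root → legendre -[1+ 1 ] p ≈ -[1+ 1 ] ^ m
    by-cases (yes root@(x , p∣)) =
      ≈-trans (≡⇒≈ (trans not-zero (if-yes root? root)))
      (≈-trans (≈-neg (≈-trans (≈-sym (wilson (s≤s z≤n))) (residue-product -[1+ 1 ] (ℕₚ.n≢0⇒n>0 x≢0 , Fin.toℕ<n x) (mod p∣))))
               (≡⇒≈ (neg-involutive (-[1+ 1 ] ^ m))))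
      where
      x≢0 : toℕ x ≢ 0
      x≢0 eq = -2≉0 (≈-sym (subst (λ t → ℤ.+ t * ℤ.+ t ≈ -[1+ 1 ]) eq (mod p∣)))
    by-cases (no ¬root) =
      ≈-trans (≡⇒≈ (trans not-zero (if-no root? ¬root)))
      (≈-trans (≈-sym (wilson (s≤s z≤n))) (nonresidue -[1+ 1 ] -2≉0 λ {x} (_ , x<p) x²≈-2 →
        ¬root (Fin.fromℕ< x<p , unmod (subst (λ t → ℤ.+ t * ℤ.+ t ≈ -[1+ 1 ]) (sym (Fin.toℕ-fromℕ< x<p)) x²≈-2))))

  k≈-2 : fromℕ d ≈ -[1+ 1 ]
  k≈-2 = sum-p d 2 (trans (ℕₚ.+-comm d 2) (sym p≡))

  open Moments (B {n}) B-alt d using (module Fermi)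

  fermi≈legendre : ∀ f → length (complete n) ℕ.* 2 ≤ f → Fermi.moment f (complete n) ≈ legendre -[1+ 1 ] p
  fermi≈legendre f len =
    ≈-trans (Moments.moment-≈ (B {n}) B-alt d p k≈-2 f (complete n))
    (≈-trans (≡⇒≈ (BoseLi.moment-Li m d (complete n) f len (deg-complete d)))
    (≈-trans pairing≈ (≈-sym euler)))

  legendre≉0 : ¬ legendre -[1+ 1 ] p ≈ 0ℤ
  legendre≉0 eq = power m (≈-trans (≈-sym euler) eq)
    where
    power : ∀ j → ¬ -[1+ 1 ] ^ j ≈ 0ℤ
    power zero    1≈0 = unit-≉0 {1} (s≤s z≤n , subst (1 <_) (sym p≡) (s≤s (s≤s z≤n))) 1≈0
    power (suc j) eq  = by-cases (integral -[1+ 1 ] (-[1+ 1 ] ^ j) eq)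
      where
      by-cases : -[1+ 1 ] ≈ 0ℤ ⊎ -[1+ 1 ] ^ j ≈ 0ℤ → ⊥
      by-cases (inj₁ e) = -2≉0 e
      by-cases (inj₂ e) = power j e

-- One-factorizations and the fermionic moment

length-pairs : (xs : List A) → length (pairs xs) ℕ.* 2 ℕ.+ length xs ≡ length xs ℕ.* length xs
length-pairs []       = refl
length-pairs (x ∷ xs) =
  trans (cong (λ l → l ℕ.* 2 ℕ.+ suc (length xs)) (trans (length-++ (map (x ,_) xs)) (cong (ℕ._+ length (pairs xs)) (length-map (x ,_) xs))))
  (trans (lemma (length xs) (length (pairs xs))) (trans (cong (λ e → 2 ℕ.* length xs ℕ.+ e ℕ.+ 1) (length-pairs xs)) (lemma′ (length xs))))
  where
  lemma : ∀ l q → (l ℕ.+ q) ℕ.* 2 ℕ.+ suc l ≡ 2 ℕ.* l ℕ.+ (q ℕ.* 2 ℕ.+ l) ℕ.+ 1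
  lemma = ℕ-solve-∀
  lemma′ : ∀ l → 2 ℕ.* l ℕ.+ l ℕ.* l ℕ.+ 1 ≡ suc l ℕ.* suc l
  lemma′ = ℕ-solve-∀

-- Generalized over a prefix `zs`: the first component runs down the list while the second still
-- ranges over all of it. The entries already passed come earlier in the order, so their pairs are
-- rejected.
filter-cartesianProduct : {Q : A × A → Set} (Q? : ∀ x → Dec (Q x)) → (∀ x → ¬ Q (x , x)) →
  ∀ zs xs → AllPairs (λ x y → Q (x , y) × ¬ Q (y , x)) (zs ++ xs) → filter Q? (cartesianProduct xs (zs ++ xs)) ≡ pairs xs
filter-cartesianProduct Q? Q-irr zs []       _    = refl
filter-cartesianProduct {Q = Q} Q? Q-irr zs (x ∷ xs) sorted =
  trans (Listₚ.filter-++ Q? (map (x ,_) (zs ++ x ∷ xs)) _)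
        (cong₂ _++_ (row zs sorted)
                    (trans (cong (λ l → filter Q? (cartesianProduct xs l)) (sym (Listₚ.++-assoc zs (x ∷ []) xs)))
                           (filter-cartesianProduct Q? Q-irr (zs ++ x ∷ []) xs (subst (AllPairs _) (sym (Listₚ.++-assoc zs (x ∷ []) xs)) sorted))))
  where
  row : ∀ zs → AllPairs (λ x y → Q (x , y) × ¬ Q (y , x)) (zs ++ x ∷ xs) → filter Q? (map (x ,_) (zs ++ x ∷ xs)) ≡ map (x ,_) xs
  row []       (xs> ∷ _) = trans (Listₚ.filter-reject Q? (Q-irr x)) (Listₚ.filter-all Q? (Allₚ.map⁺ (All.map proj₁ xs>)))
  row (z ∷ zs) (z< ∷ s)  = trans (Listₚ.filter-reject Q? (proj₂ (All.lookup z< (∈-++⁺ʳ zs (here refl))))) (row zs s)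

allFin-sorted : ∀ n → AllPairs Fin._<_ (allFin n)
allFin-sorted n = AllPairsₚ.tabulate⁺-< id

edges-K : ∀ n → edges (K n) ≡ complete n
edges-K n = filter-cartesianProduct (λ (u , v) → (u Fin.<? v) ×-dec (¬? (u Fin.≟ v))) (λ u (u<u , _) → ℕₚ.<-irrefl refl u<u) [] (allFin n)
              (AllPairs.map (λ u<v → (u<v , λ { refl → ℕₚ.<-irrefl refl u<v }) , λ (v<u , _) → ℕₚ.<-asym u<v v<u) (allFin-sorted n))

_<ₑ_ : ∀ {n} → Fin n × Fin n → Fin n × Fin n → Set
(a , b) <ₑ (c , d) = a Fin.< c ⊎ (a ≡ c × b Fin.< d)

pairs-sorted : ∀ {n} (xs : List (Fin n)) → AllPairs Fin._<_ xs → AllPairs _<ₑ_ (pairs xs) × All (λ (a , b) → a Fin.< b) (pairs xs)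
pairs-sorted []       []        = [] , []
pairs-sorted (x ∷ xs) (x< ∷ s) =
  AllPairsₚ.++⁺ (AllPairsₚ.map⁺ (AllPairs.map (λ b<d → inj₂ (refl , b<d)) s)) (proj₁ rest) (Allₚ.map⁺ (All.universal (λ _ → firsts) xs)) ,
  Allₚ.++⁺ (Allₚ.map⁺ x<) (proj₂ rest)
  where
  rest : AllPairs _<ₑ_ (pairs xs) × All (λ (a , b) → a Fin.< b) (pairs xs)
  rest = pairs-sorted xs s
  firsts : ∀ {b} → All (λ e → (x , b) <ₑ e) (pairs xs)
  firsts {b} = go xs x<
    where
    go : ∀ ys → All (x Fin.<_) ys → All (λ e → (x , b) <ₑ e) (pairs ys)
    go []       []           = []
    go (y ∷ ys) (x<y ∷ x<ys) = Allₚ.++⁺ (Allₚ.map⁺ (All.universal (λ _ → inj₁ x<y) ys)) (go ys x<ys)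

AllPairs-lookup : {R : A → A → Set} {xs : List A} → AllPairs R xs → ∀ {i j} → i Fin.< j → R (lookup xs i) (lookup xs j)
AllPairs-lookup (r ∷ rs) {zero}  {suc j} _         = All.lookup r (∈-lookup j)
AllPairs-lookup (r ∷ rs) {suc i} {suc j} (s≤s i<j) = AllPairs-lookup rs i<j

All-lookup : {P : A → Set} {xs : List A} → All P xs → ∀ i → P (lookup xs i)
All-lookup ps i = All.lookup ps (∈-lookup i)

allFin-map-lookup : (xs : List A) → map (lookup xs) (allFin (length xs)) ≡ xs
allFin-map-lookup xs = trans (map-tabulate id (lookup xs)) (Listₚ.tabulate-lookup xs)

∑-lookup : (xs : List A) (f : A → ℤ) → ∑[ i ← allFin (length xs) ] f (lookup xs i) ≡ ∑ xs f
∑-lookup xs f = trans (sym (∑-map (lookup xs) (allFin (length xs)) f)) (cong (λ l → ∑ l f) (allFin-map-lookup xs))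

double-map : {E : Set} (f g : A → C) (h : E → A) (xs : List E) → double f g (map h xs) ≡ double (f ∘ h) (g ∘ h) xs
double-map f g h []       = refl
double-map f g h (x ∷ xs) = cong (λ l → f (h x) ∷ g (h x) ∷ l) (double-map f g h xs)

length-double : (f g : A → C) (xs : List A) → length (double f g xs) ≡ length xs ℕ.* 2
length-double f g []       = refl
length-double f g (x ∷ xs) = cong (λ l → suc (suc l)) (length-double f g xs)

module Words₂ {V : Set} {d : ℕ} (es : List (V × V)) where

  word : Vec (Fin d) (length es) → List (V × Fin d)
  word c = double (λ e → proj₁ (lookup es e) , Vec.lookup c e) (λ e → proj₂ (lookup es e) , Vec.lookup c e) (allFin (length es))

open Words₂ public

module _ {V : Set} (B : V → V → ℤ) (B-alt : ∀ u v → B u v ≡ - B v u) (d : ℕ) where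
  open Moments B B-alt d using (module Fermi)
  open Fermi using (σ; moment)

  fermi-words : ∀ es H → σ es H ≡ ∑ᵛ (allFin d) (length es) (λ c → H (word es c))
  fermi-words []             H = refl
  fermi-words ((u , v) ∷ es) H =
    trans (∑-map (1ℤ ,_) (allFin d) (λ (ηj : ℤ × Fin d) → proj₁ ηj * σ es (λ w → H ((u , proj₂ ηj) ∷ (v , proj₂ ηj) ∷ w))))
    (∑-cong (allFin d) λ i → trans (*-identityˡ _) (trans (fermi-words es _) (∑ᵛ-cong (allFin d) (length es) λ c → cong H (sym (word-∷ i c)))))
    where
    word-∷ : ∀ i c → word ((u , v) ∷ es) (i ∷ c) ≡ (u , i) ∷ (v , i) ∷ word es c
    word-∷ i c = trans (cong (double _ _) (allFin-suc (length es))) (cong (λ l → (u , i) ∷ (v , i) ∷ l) (double-map _ _ suc (allFin (length es))))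

-- The number of vertices is both one more than the number of colours and even. The two shapes do
-- not agree by computation, so both are kept as equations.
module Letters (n d m : ℕ) (n≡1+d : n ≡ suc d) (n≡2m : n ≡ m ℕ.* 2) where

  open Moments (B {n}) B-alt d using (module Fermi)
  open Fermi using (moment; wick; wick-ssym; D; SSym)

  letters : List (Fin d) → List (Fin n × Fin d)
  letters []       = []
  letters (i ∷ is) = map (_, i) (allFin n) ++ letters is

  alphabet : List (Fin n × Fin d)
  alphabet = letters (allFin d)

  ∈-alphabet : ∀ x → x ∈ alphabet
  ∈-alphabet (v , i) = go (allFin d) (∈-allFin i)
    where
    go : ∀ is → i ∈ is → (v , i) ∈ letters is
    go (i ∷ is) (here refl) = ∈-++⁺ˡ (∈-map⁺ (_, i) (∈-allFin v))
    go (j ∷ is) (there i∈)  = ∈-++⁺ʳ (map (_, j) (allFin n)) (go is i∈)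

  length-alphabet : length alphabet ≡ d ℕ.* n
  length-alphabet = trans (go (allFin d)) (cong (ℕ._* n) (length-allFin d))
    where
    go : ∀ is → length (letters is) ≡ length is ℕ.* n
    go []       = refl
    go (i ∷ is) = trans (length-++ (map (_, i) (allFin n))) (cong₂ ℕ._+_ (trans (length-map (_, i) (allFin n)) (length-allFin n)) (go is))

  _≟ₗ_ : DecidableEquality (Fin n × Fin d)
  _≟ₗ_ = ×ₚ.≡-dec Fin._≟_ Fin._≟_

  private
    β : Fin n × Fin d → Fin n × Fin d → ℤ
    β x y = B (proj₁ x) (proj₁ y) * γᶠ (proj₂ x) (proj₂ y)

  -- Words on which Wick's rule has a single surviving term, of value 1: the first letter pairs with
  -- its neighbour and with nothing later, and so on. The alphabet is one, which normalizes the Wick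
  -- functional.
  data Paired : List (Fin n × Fin d) → Set where
    []   : Paired []
    pair : ∀ {x y w} → β x y ≡ 1ℤ → All (λ z → β x z ≡ 0ℤ) w → Paired w → Paired (x ∷ y ∷ w)

  private
    D-unpaired : ∀ x F {w} → All (λ z → β x z ≡ 0ℤ) w → D x F w ≡ 0ℤ
    D-unpaired x F []       = refl
    D-unpaired x F {z ∷ w} (β0 ∷ a) = trans (cong₂ (λ b e → b * F w + -1ℤ * e) β0 (D-unpaired x (F ∘ (z ∷_)) a)) (cong (_+ 0ℤ) (*-zeroˡ (F w)))

  wick-paired : ∀ f {w} → length w ≤ f → Paired w → wick f w ≡ 1ℤ
  wick-paired zero    _        []                   = refl
  wick-paired (suc f) _        []                   = refl
  wick-paired (suc f) (s≤s l) (pair {x} {y} {w} β1 unpaired rest) =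
    trans (cong₂ (λ b e → b * wick f w + -1ℤ * e) β1 (D-unpaired x _ unpaired))
          (trans (+-identityʳ (1ℤ * wick f w)) (trans (*-identityˡ (wick f w)) (wick-paired f (ℕₚ.≤-trans (ℕₚ.n≤1+n (length w)) l) rest)))

  private
    data PairedV {N : ℕ} : List (Fin N) → Set where
      []   : PairedV []
      pair : ∀ {u v w} → B u v ≡ 1ℤ → All (λ z → B u z ≡ 0ℤ) w → PairedV w → PairedV (u ∷ v ∷ w)

    pairedV-map : ∀ {N} {vs : List (Fin N)} → PairedV vs → PairedV {suc (suc N)} (map (λ v → suc (suc v)) vs)
    pairedV-map []            = []
    pairedV-map (pair b1 b0 r) = pair b1 (Allₚ.map⁺ b0) (pairedV-map r)

    pairedV-allFin : ∀ m → PairedV (allFin (m ℕ.* 2))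
    pairedV-allFin zero    = []
    pairedV-allFin (suc m) = subst PairedV (sym eq) (pair refl (Allₚ.map⁺ (All.universal (λ _ → refl) (allFin (m ℕ.* 2)))) (pairedV-map (pairedV-allFin m)))
      where
      eq : allFin (suc m ℕ.* 2) ≡ zero ∷ suc zero ∷ map (λ v → suc (suc v)) (allFin (m ℕ.* 2))
      eq = cong (λ l → zero ∷ suc zero ∷ l) (sym (map-tabulate id (λ v → suc (suc v))))

    other-colour : ∀ i is → All (i ≢_) is → ∀ u → All (λ z → β (u , i) z ≡ 0ℤ) (letters is)
    other-colour i []       []         u = []
    other-colour i (j ∷ is) (i≢j ∷ ne) u =
      Allₚ.++⁺ (Allₚ.map⁺ (All.universal (λ v → trans (cong (B u v *_) (𝟙-no (i Fin.≟ j) i≢j)) (*-zeroʳ (B u v))) (allFin n))) (other-colour i is ne u)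

    paired-block : ∀ i {vs rest} → PairedV vs → (∀ u → All (λ z → β (u , i) z ≡ 0ℤ) rest) → Paired rest → Paired (map (_, i) vs ++ rest)
    paired-block i []                          un r = r
    paired-block i (pair {u} {v} {w} b1 b0 vs) un r =
      pair (trans (cong₂ _*_ b1 (𝟙-yes (i Fin.≟ i) refl)) refl)
           (Allₚ.++⁺ (Allₚ.map⁺ (All.map (λ {z} e → trans (cong (_* γᶠ i i) e) (*-zeroˡ (γᶠ i i))) b0)) (un u))
           (paired-block i vs un r)

    paired-letters : ∀ is → Unique is → Paired (letters is)
    paired-letters []       []        = []
    paired-letters (i ∷ is) (ne ∷ un) = paired-block i (subst (λ n → PairedV (allFin n)) (sym n≡2m) (pairedV-allFin m)) (other-colour i is ne) (paired-letters is un)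

  wick-alphabet : ∀ f → d ℕ.* n ≤ f → wick f alphabet ≡ 1ℤ
  wick-alphabet f l = wick-paired f (ℕₚ.≤-trans (ℕₚ.≤-reflexive length-alphabet) l) (paired-letters (allFin d) (Uniqueₚ.allFin⁺ d))

  wick-anti : ∀ f → AntiSym (wick f)
  wick-anti f pre x y w = trans (wick-ssym f pre x y w) (-1*i≡-i _)

  es : List (Fin n × Fin n)
  es = edges (K n)

  N : ℕ
  N = length es

  2N : N ℕ.* 2 ≡ d ℕ.* n
  2N = ℕₚ.+-cancelʳ-≡ n (N ℕ.* 2) (d ℕ.* n)
    (trans (cong (λ l → length l ℕ.* 2 ℕ.+ n) (edges-K n)) (trans (subst (λ l → length (complete n) ℕ.* 2 ℕ.+ l ≡ l ℕ.* l) (length-allFin n) (length-pairs (allFin n))) square))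
    where
    square : n ℕ.* n ≡ d ℕ.* n ℕ.+ n
    square = trans (cong (ℕ._* n) n≡1+d) (ℕₚ.+-comm n (d ℕ.* n))

  length-word : ∀ (c : Vec (Fin d) N) → length (word es c) ≡ d ℕ.* n
  length-word c = trans (length-double _ _ (allFin N)) (trans (cong (ℕ._* 2) (length-allFin N)) 2N)

  word-full-or-repeat : ∀ (c : Vec (Fin d) N) → word es c ↭ alphabet ⊎ (∃ λ x → ∃ λ r → word es c ↭ x ∷ x ∷ r)
  word-full-or-repeat c = full-or-repeat _≟ₗ_ alphabet ∈-alphabet (word es c) (ℕₚ.≤-reflexive (trans length-alphabet (sym (length-word c))))

  -- The exchange principle for colouring words: up to the constant `F alphabet`, every
  -- antisymmetric F is the Wick functional. It is applied to the colour-major `A₁` and later to a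
  -- vertex-major product.
  wick-word : ∀ F → AntiSym F → ∀ f → d ℕ.* n ≤ f → ∀ (c : Vec (Fin d) N) → wick f (word es c) * F alphabet ≡ F (word es c)
  wick-word F F-anti f l c =
    trans (anti-unique _≟ₗ_ alphabet ∈-alphabet (wick f) F (wick-anti f) F-anti (word es c) (ℕₚ.≤-reflexive (trans length-alphabet (sym (length-word c)))))
          (trans (cong (F (word es c) *_) (wick-alphabet f l)) (*-identityʳ _))

  moment-words : ∀ f → moment f es ≡ ∑ᵛ (allFin d) N (λ c → wick f (word es c))
  moment-words f = fermi-words (B {n}) B-alt d es (wick f)

∏ₚ-≢0⁻ : {t : A → A → ℤ} (xs : List A) → ∏ₚ t xs ≢ 0ℤ → AllPairs (λ x y → t x y ≢ 0ℤ) xs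
∏ₚ-≢0⁻ []       _  = []
∏ₚ-≢0⁻ {t = t} (x ∷ xs) ≢0 = row xs (≢0-*ˡ ≢0) ∷ ∏ₚ-≢0⁻ xs (≢0-*ʳ {∏ xs (t x)} ≢0)
  where
  row : ∀ ys → ∏ ys (t x) ≢ 0ℤ → All (λ y → t x y ≢ 0ℤ) ys
  row []       _  = []
  row (y ∷ ys) ≢0 = ≢0-*ˡ ≢0 ∷ row ys (≢0-*ʳ {t x y} ≢0)

∏ₚ-allFin-≢0⁻ : ∀ {n} {t : Fin n → Fin n → ℤ} → ∏ₚ t (allFin n) ≢ 0ℤ → ∀ {i j} → i Fin.< j → t i j ≢ 0ℤ
∏ₚ-allFin-≢0⁻ {n} {t} ≢0 {i} {j} i<j = All.lookup (ends (allFin n) (∏ₚ-≢0⁻ (allFin n) ≢0) (allFin-sorted n) (∈-allFin i)) (∈-allFin j) i<j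
  where
  ends : ∀ xs → AllPairs (λ x y → t x y ≢ 0ℤ) xs → AllPairs Fin._<_ xs → ∀ {x} → x ∈ xs → All (λ y → x Fin.< y → t x y ≢ 0ℤ) xs
  ends (x ∷ xs) (r ∷ rs) (l ∷ ls) (here refl) = (λ x<x → ⊥-elim (ℕₚ.<-irrefl refl x<x)) ∷ All.map (λ ne _ → ne) r
  ends (x ∷ xs) (r ∷ rs) (l ∷ ls) (there y∈)  = (λ y<x → ⊥-elim (ℕₚ.<-asym y<x (All.lookup l y∈))) ∷ ends xs rs ls y∈

if-⇔ : {P Q : Set} (P? : Dec P) (Q? : Dec Q) {x y : A} → (P → Q) → (Q → P) → (if does P? then x else y) ≡ (if does Q? then x else y)
if-⇔ (yes p) Q? f g = sym (if-yes Q? (f p))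
if-⇔ (no ¬p) Q? f g = sym (if-no Q? (¬p ∘ g))

-1^-filter : {P : A → Set} (P? : ∀ x → Dec (P x)) (xs : List A) → -1ℤ ^ length (filter P? xs) ≡ ∏ xs (λ x → if does (P? x) then -1ℤ else 1ℤ)
-1^-filter P? []       = refl
-1^-filter P? (x ∷ xs) with P? x
... | yes _ = cong (-1ℤ *_) (-1^-filter P? xs)
... | no _  = trans (-1^-filter P? xs) (sym (*-identityˡ _))

∏-if-Fin : ∀ n (j : Fin n) a → ∏ (allFin n) (λ i → if does (j Fin.≟ i) then a else 1ℤ) ≡ a
∏-if-Fin (suc n) j a = trans (cong (λ l → ∏ l (select j)) (allFin-suc n)) (trans (cong (select j zero *_) (∏-map suc (allFin n) (select j))) (rest j))
  where
  select : Fin (suc n) → Fin (suc n) → ℤ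
  select j i = if does (j Fin.≟ i) then a else 1ℤ
  rest : ∀ j → select j zero * ∏ (allFin n) (select j ∘ suc) ≡ a
  rest zero    = trans (cong (a *_) (∏-one (allFin n) λ _ → refl)) (*-identityʳ a)
  rest (suc j) = trans (*-identityˡ _) (∏-if-Fin n j a)

∏-cartesianProduct : {C : Set} (xs : List A) (ys : List C) (f : A × C → ℤ) → ∏ (cartesianProduct xs ys) f ≡ ∏ xs (λ x → ∏ ys (λ y → f (x , y)))
∏-cartesianProduct []       ys f = refl
∏-cartesianProduct (x ∷ xs) ys f = trans (∏-++ (map (x ,_) ys) _ f) (cong₂ _*_ (∏-map (x ,_) ys f) (∏-cartesianProduct xs ys f))

∏-cartesianProduct-< : ∀ N (g : Fin N → Fin N → ℤ) → (∀ i j → ¬ i Fin.< j → g i j ≡ 1ℤ) →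
                       ∏ (cartesianProduct (allFin N) (allFin N)) (λ (i , j) → g i j) ≡ ∏ₚ g (allFin N)
∏-cartesianProduct-< N g g1 = begin
  ∏ cart (λ (i , j) → g i j)
    ≡⟨ ∏-cong cart (λ (i , j) → restrict i j (i Fin.<? j)) ⟩
  ∏ cart (λ (i , j) → if does (i Fin.<? j) then g i j else 1ℤ)
    ≡⟨ sym (∏-filter (λ (i , j) → i Fin.<? j) cart (λ (i , j) → g i j)) ⟩
  ∏ (filter (λ (i , j) → i Fin.<? j) cart) (λ (i , j) → g i j)
    ≡⟨ cong (λ l → ∏ l (λ (i , j) → g i j)) (filter-cartesianProduct (λ (i , j) → i Fin.<? j) (λ i i<i → ℕₚ.<-irrefl refl i<i) [] (allFin N)
         (AllPairs.map (λ i<j → i<j , ℕₚ.<-asym i<j) (allFin-sorted N))) ⟩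
  ∏ (pairs (allFin N)) (λ (i , j) → g i j)
    ≡⟨ ∏-pairs g (allFin N) ⟩
  ∏ₚ g (allFin N) ∎
  where
  open ≡-Reasoning
  cart : List (Fin N × Fin N)
  cart = cartesianProduct (allFin N) (allFin N)
  restrict : ∀ i j → (i<j? : Dec (i Fin.< j)) → g i j ≡ (if does i<j? then g i j else 1ℤ)
  restrict i j (yes _)   = refl
  restrict i j (no i≮j) = g1 i j i≮j

fiber : ∀ {d N} → Fin d → Vec (Fin d) N → Subset N
fiber i c = Vec.map (λ j → does (i Fin.≟ j)) c

fibers : ∀ {d N} → Vec (Fin d) N → List (Subset N)
fibers {d} c = map (λ i → fiber i c) (allFin d)

∈-fiber⁻ : ∀ {d N} (i : Fin d) (c : Vec (Fin d) N) e → e Subset.∈ fiber i c → Vec.lookup c e ≡ i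
∈-fiber⁻ i c e e∈ = by-cases (i Fin.≟ Vec.lookup c e) (trans (sym (lookup-map e _ c)) ([]=⇒lookup e∈))
  where
  by-cases : (d : Dec (i ≡ Vec.lookup c e)) → does d ≡ true → Vec.lookup c e ≡ i
  by-cases (yes eq) _ = sym eq
  by-cases (no _)   ()

∈-fiber⁺ : ∀ {d N} (c : Vec (Fin d) N) e → e Subset.∈ fiber (Vec.lookup c e) c
∈-fiber⁺ c e = lookup⇒[]= e _ (trans (lookup-map e _ c) (by-cases (Vec.lookup c e Fin.≟ Vec.lookup c e)))
  where
  by-cases : (d : Dec (Vec.lookup c e ≡ Vec.lookup c e)) → does d ≡ true
  by-cases (yes _)  = refl
  by-cases (no neq) = contradiction refl neq

sign<-refl : ∀ {n} (x : Fin n) → sign< x x ≡ 0ℤ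
sign<-refl x = +-inverseʳ (𝟙 (x Fin.<? x))

sign<-square : ∀ {n} {x y : Fin n} → x ≢ y → sign< x y * sign< x y ≡ 1ℤ
sign<-square {x = x} {y} x≢y = by-cases (ℕₚ.<-cmp (toℕ x) (toℕ y))
  where
  by-cases : Tri (x Fin.< y) (toℕ x ≡ toℕ y) (y Fin.< x) → sign< x y * sign< x y ≡ 1ℤ
  by-cases (tri< x<y _ _) = cong₂ _*_ (sign<-1 x<y) (sign<-1 x<y)
  by-cases (tri≈ _ eq _)  = contradiction (Fin.toℕ-injective eq) x≢y
  by-cases (tri> _ _ y<x) = cong₂ _*_ (sign<-neg y<x) (sign<-neg y<x)

-- Crossing signs.

module ColourMajor (n d m : ℕ) (n≡1+d : n ≡ suc d) (n≡2m : n ≡ m ℕ.* 2) where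

  open Letters n d m n≡1+d n≡2m
  open Moments (B {n}) B-alt d using (module Fermi)

  private
    G : Graph n
    G = K n

  -- Lexicographic comparison with the colour first, the order in which `alphabet` lists the
  -- letters. The product over all pairs is therefore the sign of the word relative to `alphabet`.
  t₁ : Fin n × Fin d → Fin n × Fin d → ℤ
  t₁ (u , i) (v , j) = sign< i j + 𝟙 (i Fin.≟ j) * sign< u v

  private
    t₁-anti : ∀ x y → t₁ x y ≡ - t₁ y x
    t₁-anti (u , i) (v , j) =
      trans (cong₂ _+_ (sign<-anti i j) (cong₂ _*_ (𝟙-⇔ (i Fin.≟ j) (j Fin.≟ i) sym sym) (sign<-anti u v)))
            (lemma (sign< j i) (𝟙 (j Fin.≟ i)) (sign< v u))
      where
      lemma : ∀ a b c → - a + b * - c ≡ - (a + b * c)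
      lemma = solve-∀

    t₁-other : ∀ u v {i j} → i ≢ j → t₁ (u , i) (v , j) ≡ sign< i j
    t₁-other u v {i} {j} i≢j = trans (cong (λ e → sign< i j + e * sign< u v) (𝟙-no (i Fin.≟ j) i≢j)) (+-identityʳ (sign< i j))

    t₁-same : ∀ u v {i j} → i ≡ j → t₁ (u , i) (v , j) ≡ sign< u v
    t₁-same u v {i} refl = trans (cong₂ (λ a b → a + b * sign< u v) (sign<-refl i) (𝟙-yes (i Fin.≟ i) refl))
                                     (trans (+-identityˡ (1ℤ * sign< u v)) (*-identityˡ (sign< u v)))

  A₁ : List (Fin n × Fin d) → ℤ
  A₁ = ∏ₚ t₁

  A₁-anti : AntiSym A₁
  A₁-anti = ∏ₚ-anti t₁ t₁-anti

  A₁-alphabet : A₁ alphabet ≡ 1ℤ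
  A₁-alphabet = ∏ₚ-one {t = t₁} (go (allFin d) (allFin-sorted d))
    where
    later : ∀ i is → All (i Fin.<_) is → ∀ u → All (λ y → t₁ (u , i) y ≡ 1ℤ) (letters is)
    later i []       []          u = []
    later i (j ∷ is) (i<j ∷ i<s) u = Allₚ.++⁺ (Allₚ.map⁺ (All.universal (λ v → trans (t₁-other u v {i} {j} (λ { refl → ℕₚ.<-irrefl refl i<j })) (sign<-1 i<j)) (allFin n)))
                                              (later i is i<s u)
    go : ∀ is → AllPairs Fin._<_ is → AllPairs (λ x y → t₁ x y ≡ 1ℤ) (letters is)
    go []       []       = []
    go (i ∷ is) (i< ∷ s) = AllPairsₚ.++⁺ (AllPairsₚ.map⁺ (AllPairs.map (λ {u} {v} u<v → trans (t₁-same u v {i} refl) (sign<-1 u<v)) (allFin-sorted n)))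
                                         (go is s) (Allₚ.map⁺ (All.universal (λ u → later i is i< u) (allFin n)))

  wick-A₁ : ∀ f → d ℕ.* n ≤ f → ∀ c → Fermi.wick f (word es c) ≡ A₁ (word es c)
  wick-A₁ f l c = trans (sym (*-identityʳ _)) (trans (cong (Fermi.wick f (word es c) *_) (sym A₁-alphabet)) (wick-word A₁ A₁-anti f l c))

  es-sorted : AllPairs _<ₑ_ es
  es-sorted = subst (AllPairs _<ₑ_) (sym (edges-K n)) (proj₁ (pairs-sorted (allFin n) (allFin-sorted n)))

  lo<hi : ∀ e → lo G e Fin.< hi G e
  lo<hi e = All-lookup (subst (All _) (sym (edges-K n)) (proj₂ (pairs-sorted (allFin n) (allFin-sorted n)))) e

  edge-order : ∀ {e f : Edge G} → e Fin.< f → (lo G e , hi G e) <ₑ (lo G f , hi G f)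
  edge-order = AllPairs-lookup es-sorted

  crosses⇒< : ∀ e f → Crosses G e f → e Fin.< f
  crosses⇒< e f (lo<lo , _) = by-cases (ℕₚ.<-cmp (toℕ e) (toℕ f))
    where
    by-cases : Tri (e Fin.< f) (toℕ e ≡ toℕ f) (f Fin.< e) → e Fin.< f
    by-cases (tri< e<f _ _) = e<f
    by-cases (tri≈ _ eq _)  = contradiction (subst (λ g → lo G e Fin.< lo G g) (sym (Fin.toℕ-injective eq)) lo<lo) (ℕₚ.<-irrefl refl)
    by-cases (tri> _ _ f<e) = reverse (edge-order f<e)
      where
      reverse : (lo G f , hi G f) <ₑ (lo G e , hi G e) → e Fin.< f
      reverse (inj₁ lt)       = contradiction lt (ℕₚ.<-asym lo<lo)
      reverse (inj₂ (eq , _)) = contradiction (subst (lo G e Fin.<_) eq lo<lo) (ℕₚ.<-irrefl refl)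

  private
    four : Edge G → Edge G → ℤ
    four e f = (sign< (lo G e) (lo G f) * sign< (lo G e) (hi G f)) * (sign< (hi G e) (lo G f) * sign< (hi G e) (hi G f))

    zero₁ : ∀ {a} b c e → a ≡ 0ℤ → (a * b) * (c * e) ≡ 0ℤ
    zero₁ b c e refl = refl
    zero₂ : ∀ a {b} c e → b ≡ 0ℤ → (a * b) * (c * e) ≡ 0ℤ
    zero₂ a c e refl = cong (_* (c * e)) (*-zeroʳ a)
    zero₃ : ∀ a b {c} e → c ≡ 0ℤ → (a * b) * (c * e) ≡ 0ℤ
    zero₃ a b e refl = *-zeroʳ (a * b)
    zero₄ : ∀ a b c {e} → e ≡ 0ℤ → (a * b) * (c * e) ≡ 0ℤ
    zero₄ a b c refl = trans (cong ((a * b) *_) (*-zeroʳ c)) (*-zeroʳ (a * b))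

    sign<-eq : ∀ {x y : Fin n} → x ≡ y → sign< x y ≡ 0ℤ
    sign<-eq {x} refl = sign<-refl x

  four-adjacent : ∀ e f v → Incident G v e → Incident G v f → four e f ≡ 0ℤ
  four-adjacent e f v (inj₁ p) (inj₁ q) = zero₁ _ (sign< (hi G e) (lo G f)) (sign< (hi G e) (hi G f)) (sign<-eq (trans (sym p) q))
  four-adjacent e f v (inj₁ p) (inj₂ q) = zero₂ (sign< (lo G e) (lo G f)) (sign< (hi G e) (lo G f)) (sign< (hi G e) (hi G f)) (sign<-eq (trans (sym p) q))
  four-adjacent e f v (inj₂ p) (inj₁ q) = zero₃ (sign< (lo G e) (lo G f)) (sign< (lo G e) (hi G f)) (sign< (hi G e) (hi G f)) (sign<-eq (trans (sym p) q))
  four-adjacent e f v (inj₂ p) (inj₂ q) = zero₄ (sign< (lo G e) (lo G f)) (sign< (lo G e) (hi G f)) (sign< (hi G e) (lo G f)) (sign<-eq (trans (sym p) q))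

  -- Let e = {a , b} and f = {a′ , b′}. The lower end a lies below both ends of f, so the position
  -- of b decides: below a′ there are no inversions, between a′ and b′ there is one and the edges
  -- cross, above b′ there are two.
  four-disjoint : ∀ e f → e Fin.< f → (∀ v → Incident G v e → ¬ Incident G v f) → four e f ≡ (if does (Crosses? G e f) then -1ℤ else 1ℤ)
  four-disjoint e f e<f disjoint = by-order (edge-order e<f)
    where
    a b a′ b′ : Fin n
    a = lo G e
    b = hi G e
    a′ = lo G f
    b′ = hi G f
    by-order : (a , b) <ₑ (a′ , b′) → four e f ≡ (if does (Crosses? G e f) then -1ℤ else 1ℤ)
    by-order (inj₂ (a≡a′ , _)) = contradiction (inj₁ a≡a′) (disjoint a (inj₁ refl))
    by-order (inj₁ a<a′) = by-hi (ℕₚ.<-cmp (toℕ b) (toℕ a′)) (ℕₚ.<-cmp (toℕ b) (toℕ b′))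
      where
      value : ∀ {x y z} → sign< b a′ ≡ x → sign< b b′ ≡ y → (1ℤ * 1ℤ) * (x * y) ≡ z → four e f ≡ z
      value p q r = trans (cong₂ _*_ (cong₂ _*_ (sign<-1 a<a′) (sign<-1 (ℕₚ.<-trans a<a′ (lo<hi f)))) (cong₂ _*_ p q)) r
      by-hi : Tri (b Fin.< a′) (toℕ b ≡ toℕ a′) (a′ Fin.< b) → Tri (b Fin.< b′) (toℕ b ≡ toℕ b′) (b′ Fin.< b) →
              four e f ≡ (if does (Crosses? G e f) then -1ℤ else 1ℤ)
      by-hi (tri≈ _ b≡a′ _) _ = contradiction (inj₁ (Fin.toℕ-injective b≡a′)) (disjoint b (inj₂ refl))
      by-hi _ (tri≈ _ b≡b′ _) = contradiction (inj₂ (Fin.toℕ-injective b≡b′)) (disjoint b (inj₂ refl))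
      by-hi (tri< b<a′ _ _) _ = trans (value (sign<-1 b<a′) (sign<-1 (ℕₚ.<-trans b<a′ (lo<hi f))) refl)
                                      (sym (if-no (Crosses? G e f) λ (_ , a′<b , _) → ℕₚ.<-asym a′<b b<a′))
      by-hi (tri> _ _ a′<b) (tri< b<b′ _ _) = trans (value (sign<-neg a′<b) (sign<-1 b<b′) refl) (sym (if-yes (Crosses? G e f) (a<a′ , a′<b , b<b′)))
      by-hi (tri> _ _ a′<b) (tri> _ _ b′<b) = trans (value (sign<-neg a′<b) (sign<-neg b′<b) refl)
                                      (sym (if-no (Crosses? G e f) λ (_ , _ , b<b′) → ℕₚ.<-asym b<b′ b′<b))

  module _ (c : Vec (Fin d) N) where

    private
      col : Edge G → Fin d
      col = Vec.lookup c

      T χ : Edge G → Edge G → ℤ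
      T e f = (t₁ (lo G e , col e) (lo G f , col f) * t₁ (lo G e , col e) (hi G f , col f))
            * (t₁ (hi G e , col e) (lo G f , col f) * t₁ (hi G e , col e) (hi G f , col f))
      χ e f = if does (col e Fin.≟ col f ×-dec Crosses? G e f) then -1ℤ else 1ℤ

      -- All four comparisons are decided by the same two colours, so their product is a fourth
      -- power of a sign.
      T-other : ∀ e f → col e ≢ col f → T e f ≡ 1ℤ
      T-other e f neq = trans (cong₂ _*_ (cong₂ _*_ (t₁-other (lo G e) (lo G f) neq) (t₁-other (lo G e) (hi G f) neq)) (cong₂ _*_ (t₁-other (hi G e) (lo G f) neq) (t₁-other (hi G e) (hi G f) neq)))
                              (cong₂ _*_ (sign<-square neq) (sign<-square neq))

      T-same : ∀ e f → col e ≡ col f → T e f ≡ four e f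
      T-same e f eq = cong₂ _*_ (cong₂ _*_ (t₁-same (lo G e) (lo G f) eq) (t₁-same (lo G e) (hi G f) eq)) (cong₂ _*_ (t₁-same (hi G e) (lo G f) eq) (t₁-same (hi G e) (hi G f) eq))

    A₁-word : A₁ (word es c) ≡ ∏ₚ T (allFin N)
    A₁-word = trans (∏ₚ-double t₁ _ _ (allFin N))
                    (trans (cong (_* ∏ₚ T (allFin N)) (∏-one (allFin N) λ e → trans (t₁-same (lo G e) (hi G e) {col e} refl) (sign<-1 (lo<hi e)))) (*-identityˡ _))

    χ-product : ∏ₚ χ (allFin N) ≡ εF G (fibers c)
    χ-product = begin
      ∏ₚ χ (allFin N)
        ≡⟨ sym (∏-cartesianProduct-< N χ λ e f e≮f → if-no (col e Fin.≟ col f ×-dec Crosses? G e f) λ (_ , cross) → e≮f (crosses⇒< e f cross)) ⟩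
      ∏ cart (λ (e , f) → χ e f)
        ≡⟨ ∏-cong cart (λ (e , f) → split e f) ⟩
      ∏ cart (λ (e , f) → ∏ (allFin d) (λ i → if does (in-fiber? i (e , f)) then -1ℤ else 1ℤ))
        ≡⟨ ∏-comm cart (allFin d) _ ⟩
      ∏ (allFin d) (λ i → ∏ cart (λ ef → if does (in-fiber? i ef) then -1ℤ else 1ℤ))
        ≡⟨ ∏-cong (allFin d) (λ i → sym (-1^-filter (in-fiber? i) cart)) ⟩
      ∏ (allFin d) (λ i → ε G (fiber i c))
        ≡⟨ sym (εF-∏ (allFin d)) ⟩
      εF G (fibers c) ∎
      where
      open ≡-Reasoning
      cart : List (Edge G × Edge G)
      cart = cartesianProduct (allFin N) (allFin N)
      in-fiber? : ∀ i ((e , f) : Edge G × Edge G) → Dec (e Subset.∈ fiber i c × f Subset.∈ fiber i c × Crosses G e f)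
      in-fiber? i (e , f) = (e ∈?ˢ fiber i c) ×-dec (f ∈?ˢ fiber i c) ×-dec Crosses? G e f
      εF-∏ : ∀ is → εF G (map (λ i → fiber i c) is) ≡ ∏ is (λ i → ε G (fiber i c))
      εF-∏ []       = refl
      εF-∏ (i ∷ is) = cong (ε G (fiber i c) *_) (εF-∏ is)
      split : ∀ e f → χ e f ≡ ∏ (allFin d) (λ i → if does (in-fiber? i (e , f)) then -1ℤ else 1ℤ)
      split e f = by-cases (col e Fin.≟ col f ×-dec Crosses? G e f)
        where
        by-cases : Dec (col e ≡ col f × Crosses G e f) → χ e f ≡ ∏ (allFin d) (λ i → if does (in-fiber? i (e , f)) then -1ℤ else 1ℤ)
        by-cases (yes q@(eq , cross)) = trans (if-yes (col e Fin.≟ col f ×-dec Crosses? G e f) q)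
          (sym (trans (∏-cong (allFin d) λ i → if-⇔ (in-fiber? i (e , f)) (col e Fin.≟ i) (λ (e∈ , _) → ∈-fiber⁻ i c e e∈)
                        (λ { refl → ∈-fiber⁺ c e , subst (λ j → f Subset.∈ fiber j c) (sym eq) (∈-fiber⁺ c f) , cross }))
                      (∏-if-Fin d (col e) -1ℤ)))
        by-cases (no ¬q) = trans (if-no (col e Fin.≟ col f ×-dec Crosses? G e f) ¬q)
          (sym (∏-one (allFin d) λ i → if-no (in-fiber? i (e , f)) λ (e∈ , f∈ , cross) → ¬q (trans (∈-fiber⁻ i c e e∈) (sym (∈-fiber⁻ i c f f∈)) , cross)))

    private
      one-factorization⇒ : IsOneFactorization G (fibers c) → A₁ (word es c) ≡ εF G (fibers c)
      one-factorization⇒ (perfect , _) = trans A₁-word (trans (∏ₚ-cong (AllPairs.map (λ {e} {f} e<f → T-χ e f e<f) (allFin-sorted N))) χ-product)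
        where
        T-χ : ∀ e f → e Fin.< f → T e f ≡ χ e f
        T-χ e f e<f = by-cases (col e Fin.≟ col f)
          where
          by-cases : Dec (col e ≡ col f) → T e f ≡ χ e f
          by-cases (no neq) = trans (T-other e f neq) (sym (if-no (col e Fin.≟ col f ×-dec Crosses? G e f) (neq ∘ proj₁)))
          by-cases (yes eq) = trans (T-same e f eq) (trans (four-disjoint e f e<f disjoint)
              (if-⇔ (Crosses? G e f) (col e Fin.≟ col f ×-dec Crosses? G e f) (eq ,_) proj₂))
            where
            disjoint : ∀ v → Incident G v e → ¬ Incident G v f
            disjoint v ve vf = proj₁ (All.lookup perfect (∈-map⁺ (λ i → fiber i c) (∈-allFin (col e)))) e f
              (∈-fiber⁺ c e) (subst (λ j → f Subset.∈ fiber j c) (sym eq) (∈-fiber⁺ c f)) ((λ { refl → ℕₚ.<-irrefl refl e<f }) , v , ve , vf)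

    -- A nonzero value excludes repeated letters, so every pair of a vertex and a colour occurs:
    -- each colour class covers all vertices. Two edges of one colour with a common vertex would
    -- contribute a factor 0.
    nonzero⇒ : A₁ (word es c) ≢ 0ℤ → IsOneFactorization G (fibers c)
    nonzero⇒ A≢0 = Allₚ.map⁺ (All.universal perfect (allFin d)) , Allₚ.map⁺ (All.universal nonempty (allFin d)) ,
                   AllPairsₚ.map⁺ (AllPairs.map (λ i≢j (e , e∈) → i≢j (same e (x∈p∩q⁻ _ _ e∈))) (Uniqueₚ.allFin⁺ d)) ,
                   λ e → Anyₚ.map⁺ (Any.map (λ { refl → ∈-fiber⁺ c e }) (∈-allFin (col e)))
      where
      full : word es c ↭ alphabet
      full = by-cases (word-full-or-repeat c)
        where
        by-cases : word es c ↭ alphabet ⊎ (∃ λ x → ∃ λ r → word es c ↭ x ∷ x ∷ r) → word es c ↭ alphabet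
        by-cases (inj₁ p) = p
        by-cases (inj₂ (x , r , p)) = contradiction (anti-repeat A₁ A₁-anti p) A≢0
      T≢0 : ∀ {e f} → e Fin.< f → T e f ≢ 0ℤ
      T≢0 = ∏ₚ-allFin-≢0⁻ (A≢0 ∘ trans A₁-word)
      no-clash : ∀ {e f} → e Fin.< f → col e ≡ col f → ∀ v → Incident G v e → ¬ Incident G v f
      no-clash {e} {f} e<f eq v ve vf = T≢0 e<f (trans (T-same e f eq) (four-adjacent e f v ve vf))
      same : ∀ {i j} e → e Subset.∈ fiber i c × e Subset.∈ fiber j c → i ≡ j
      same {i} {j} e (e∈ , e∈′) = trans (sym (∈-fiber⁻ i c e e∈)) (∈-fiber⁻ j c e e∈′)
      find : ∀ v i xs → (v , i) ∈ double (λ e → lo G e , col e) (λ e → hi G e , col e) xs → ∃ λ e → col e ≡ i × Incident G v e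
      find v i (e ∷ xs) (here refl)         = e , refl , inj₁ refl
      find v i (e ∷ xs) (there (here refl)) = e , refl , inj₂ refl
      find v i (e ∷ xs) (there (there x∈))  = find v i xs x∈
      covered : ∀ i v → ∃ λ e → e Subset.∈ fiber i c × Incident G v e
      covered i v = in-fiber (find v i (allFin N) (Permₚ.∈-resp-↭ (↭-sym full) (∈-alphabet (v , i))))
        where
        in-fiber : (∃ λ e → col e ≡ i × Incident G v e) → ∃ λ e → e Subset.∈ fiber i c × Incident G v e
        in-fiber (e , refl , ve) = e , ∈-fiber⁺ c e , ve
      perfect : ∀ i → IsPerfectMatching G (fiber i c)
      perfect i = matching , covered i
        where
        matching : IsMatching G (fiber i c)
        matching e f e∈ f∈ (e≢f , v , ve , vf) = by-cases (ℕₚ.<-cmp (toℕ e) (toℕ f))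
          where
          eq : col e ≡ col f
          eq = trans (∈-fiber⁻ i c e e∈) (sym (∈-fiber⁻ i c f f∈))
          by-cases : Tri (e Fin.< f) (toℕ e ≡ toℕ f) (f Fin.< e) → ⊥
          by-cases (tri< e<f _ _) = no-clash e<f eq v ve vf
          by-cases (tri≈ _ e≡f _) = e≢f (Fin.toℕ-injective e≡f)
          by-cases (tri> _ _ f<e) = no-clash f<e (sym eq) v vf ve
      nonempty : ∀ i → Subset.Nonempty (fiber i c)
      nonempty i = proj₁ (covered i v₀) , proj₁ (proj₂ (covered i v₀))
        where
        v₀ : Fin n
        v₀ = subst Fin (sym n≡1+d) zero

    A₁-factorization : A₁ (word es c) ≡ 𝟙 (IsOneFactorization? G (fibers c)) * εF G (fibers c)
    A₁-factorization = by-cases (IsOneFactorization? G (fibers c))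
      where
      by-cases : Dec (IsOneFactorization G (fibers c)) → A₁ (word es c) ≡ 𝟙 (IsOneFactorization? G (fibers c)) * εF G (fibers c)
      by-cases (yes F) = trans (one-factorization⇒ F) (sym (trans (cong (_* εF G (fibers c)) (𝟙-yes (IsOneFactorization? G (fibers c)) F)) (*-identityˡ _)))
      by-cases (no ¬F) = trans (vanish (A₁ (word es c) ≟ 0ℤ)) (sym (cong (_* εF G (fibers c)) (𝟙-no (IsOneFactorization? G (fibers c)) ¬F)))
        where
        vanish : Dec (A₁ (word es c) ≡ 0ℤ) → A₁ (word es c) ≡ 0ℤ
        vanish (yes eq) = eq
        vanish (no ≢0) = contradiction (nonzero⇒ ≢0) ¬F

-- Ordered partitions of the edge set.

none one : List Bool → Bool
none []           = true
none (true ∷ _)   = false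
none (false ∷ bs) = none bs
one []           = false
one (true ∷ bs)  = none bs
one (false ∷ bs) = one bs

unit : ∀ {d} → Fin d → List Bool
unit {d} j = map (λ i → does (i Fin.≟ j)) (allFin d)

private
  bits : List Bool
  bits = outside ∷ inside ∷ []

  ∑ʷ-none : ∀ d (Ψ : List Bool → ℤ) → (∀ bs → length bs ≡ d → none bs ≡ false → Ψ bs ≡ 0ℤ) → ∑ʷ bits d Ψ ≡ Ψ (map (λ _ → false) (allFin d))
  ∑ʷ-none zero    Ψ Ψ0 = refl
  ∑ʷ-none (suc d) Ψ Ψ0 =
    trans (cong₂ (λ a b → a + (b + 0ℤ)) (∑ʷ-none d (Ψ ∘ (false ∷_)) λ bs l → Ψ0 (false ∷ bs) (cong suc l))
                                        (trans (∑ʷ-cong bits d λ bs l → Ψ0 (true ∷ bs) (cong suc l) refl) (∑ʷ-zero bits d λ _ → refl)))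
          (trans (+-identityʳ _) (cong Ψ (sym (trans (cong (map (λ _ → false)) (allFin-suc d)) (cong (false ∷_) (sym (map-∘ (allFin d))))))))

  ∑ʷ-one : ∀ d (Ψ : List Bool → ℤ) → (∀ bs → length bs ≡ d → one bs ≡ false → Ψ bs ≡ 0ℤ) → ∑ʷ bits d Ψ ≡ ∑[ j ← allFin d ] Ψ (unit j)
  ∑ʷ-one zero    Ψ Ψ0 = Ψ0 [] refl refl
  ∑ʷ-one (suc d) Ψ Ψ0 = begin
    ∑ʷ bits d (Ψ ∘ (false ∷_)) + (∑ʷ bits d (Ψ ∘ (true ∷_)) + 0ℤ)
      ≡⟨ cong₂ (λ a b → a + (b + 0ℤ)) (∑ʷ-one d (Ψ ∘ (false ∷_)) λ bs l → Ψ0 (false ∷ bs) (cong suc l))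
                                      (∑ʷ-none d (Ψ ∘ (true ∷_)) λ bs l → Ψ0 (true ∷ bs) (cong suc l)) ⟩
    ∑ (allFin d) (λ j → Ψ (false ∷ unit j)) + (Ψ (true ∷ map (λ _ → false) (allFin d)) + 0ℤ)
      ≡⟨ lemma (∑ (allFin d) (λ j → Ψ (false ∷ unit j))) (Ψ (true ∷ map (λ _ → false) (allFin d))) ⟩
    Ψ (true ∷ map (λ _ → false) (allFin d)) + ∑ (allFin d) (λ j → Ψ (false ∷ unit j))
      ≡⟨ cong₂ _+_ (cong Ψ (sym (unit-split zero))) (trans (∑-cong (allFin d) λ j → cong Ψ (sym (unit-split (suc j)))) (sym (∑-map suc (allFin d) (Ψ ∘ unit)))) ⟩
    Ψ (unit zero) + ∑ (map suc (allFin d)) (Ψ ∘ unit)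
      ≡⟨ cong (λ l → ∑ l (Ψ ∘ unit)) (sym (allFin-suc d)) ⟩
    ∑ (allFin (suc d)) (Ψ ∘ unit) ∎
    where
    open ≡-Reasoning
    lemma : ∀ a b → a + (b + 0ℤ) ≡ b + a
    lemma = solve-∀
    unit-split : ∀ j → unit j ≡ does (zero Fin.≟ j) ∷ map (λ i → does (suc i Fin.≟ j)) (allFin d)
    unit-split j = trans (cong (map (λ i → does (i Fin.≟ j))) (allFin-suc d)) (cong (does (zero Fin.≟ j) ∷_) (sym (map-∘ (allFin d))))

  ∑-∑ʷ : (ys : List C) (xs : List A) → ∀ N (F : C → List A → ℤ) → ∑[ y ← ys ] ∑ʷ xs N (F y) ≡ ∑ʷ xs N (λ w → ∑[ y ← ys ] F y w)
  ∑-∑ʷ ys xs zero    F = refl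
  ∑-∑ʷ ys xs (suc N) F = trans (∑-comm ys xs _) (∑-cong xs λ x → ∑-∑ʷ ys xs N _)

  cons : ∀ {N} → List Bool → List (Subset N) → List (Subset (suc N))
  cons []       _        = []
  cons (b ∷ bs) []       = []
  cons (b ∷ bs) (M ∷ Ms) = (b ∷ M) ∷ cons bs Ms

  -- A word of subsets is a word of bits for the first element together with a word of subsets of
  -- the rest; this separates the two sums.
  ∑ʷ-cons : ∀ {N} (Ss : List (Subset N)) d (Φ : List (Subset (suc N)) → ℤ) →
            ∑ʷ (map (outside ∷_) Ss ++ map (inside ∷_) Ss) d Φ ≡ ∑ʷ bits d (λ bs → ∑ʷ Ss d (λ Ms → Φ (cons bs Ms)))
  ∑ʷ-cons Ss zero    Φ = refl
  ∑ʷ-cons Ss (suc d) Φ = begin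
    ∑ (map (outside ∷_) Ss ++ map (inside ∷_) Ss) (λ M → ∑ʷ Ss² d (Φ ∘ (M ∷_)))
      ≡⟨ trans (∑-++ (map (outside ∷_) Ss) _ _) (cong₂ _+_ (part outside) (part inside)) ⟩
    R outside + R inside
      ≡⟨ cong (R outside +_) (sym (+-identityʳ (R inside))) ⟩
    R outside + (R inside + 0ℤ) ∎
    where
    open ≡-Reasoning
    Ss² : List (Subset _)
    Ss² = map (outside ∷_) Ss ++ map (inside ∷_) Ss
    R : Bool → ℤ
    R b = ∑ʷ bits d (λ bs → ∑[ M ← Ss ] ∑ʷ Ss d (λ Ms → Φ ((b ∷ M) ∷ cons bs Ms)))
    part : ∀ b → ∑ (map (b ∷_) Ss) (λ M → ∑ʷ Ss² d (Φ ∘ (M ∷_))) ≡ R b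
    part b = trans (∑-map (b ∷_) Ss _) (trans (∑-cong Ss λ M → ∑ʷ-cons Ss d (Φ ∘ ((b ∷ M) ∷_))) (∑-∑ʷ Ss bits d _))

membership : ∀ {N} → Fin N → List (Subset N) → List Bool
membership e Ms = map (λ M → Vec.lookup M e) Ms

private
  membership-zero : ∀ {N} bs (Ms : List (Subset N)) → length bs ≡ length Ms → membership zero (cons bs Ms) ≡ bs
  membership-zero []       []       _ = refl
  membership-zero (b ∷ bs) (M ∷ Ms) l = cong (b ∷_) (membership-zero bs Ms (ℕₚ.suc-injective l))

  membership-suc : ∀ {N} (e : Fin N) bs (Ms : List (Subset N)) → length bs ≡ length Ms → membership (suc e) (cons bs Ms) ≡ membership e Ms
  membership-suc e []       []       _ = refl
  membership-suc e (b ∷ bs) (M ∷ Ms) l = cong (Vec.lookup M e ∷_) (membership-suc e bs Ms (ℕₚ.suc-injective l))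

  length-cons : ∀ {N} bs (Ms : List (Subset N)) → length bs ≡ length Ms → length (cons bs Ms) ≡ length Ms
  length-cons []       []       _ = refl
  length-cons (b ∷ bs) (M ∷ Ms) l = cong suc (length-cons bs Ms (ℕₚ.suc-injective l))

  cons-fibers : ∀ {d N} (j : Fin d) (c : Vec (Fin d) N) → cons (unit j) (fibers c) ≡ fibers (j ∷ c)
  cons-fibers {d} j c = go (allFin d)
    where
    go : ∀ is → cons (map (λ i → does (i Fin.≟ j)) is) (map (λ i → fiber i c) is) ≡ map (λ i → fiber i (j ∷ c)) is
    go []       = refl
    go (i ∷ is) = cong (_ ∷_) (go is)

-- Ordered partitions of a set into d blocks are functions to Fin d.
∑ʷ-partitions : ∀ N d (Φ : List (Subset N) → ℤ) → (∀ Ms e → length Ms ≡ d → one (membership e Ms) ≡ false → Φ Ms ≡ 0ℤ) →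
                ∑ʷ (subsets N) d Φ ≡ ∑ᵛ (allFin d) N (Φ ∘ fibers)
∑ʷ-partitions zero    d Φ Φ0 = trans (go d Φ) (cong Φ (replicate-map d))
  where
  go : ∀ d (Φ : List (Subset 0) → ℤ) → ∑ʷ (subsets 0) d Φ ≡ Φ (replicate d [])
  go zero    Φ = refl
  go (suc d) Φ = trans (+-identityʳ _) (go d (Φ ∘ ([] ∷_)))
  replicate-map : ∀ d → replicate d [] ≡ map (λ i → fiber i []) (allFin d)
  replicate-map zero    = refl
  replicate-map (suc d) = trans (cong ([] ∷_) (replicate-map d)) (trans (cong ([] ∷_) (map-∘ (allFin d))) (cong (map (λ _ → [])) (sym (allFin-suc d))))
∑ʷ-partitions (suc N) d Φ Φ0 = begin
  ∑ʷ (subsets (suc N)) d Φ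
    ≡⟨ ∑ʷ-cons (subsets N) d Φ ⟩
  ∑ʷ bits d (λ bs → ∑ʷ (subsets N) d (λ Ms → Φ (cons bs Ms)))
    -- The bits of the first element must form a unit vector; the position j of its nonzero bit
    -- becomes the colour of that element.
    ≡⟨ ∑ʷ-one d _ (λ bs lb ¬one → trans (∑ʷ-cong (subsets N) d λ Ms lm → Φ0 (cons bs Ms) zero
          (trans (length-cons bs Ms (trans lb (sym lm))) lm) (trans (cong one (membership-zero bs Ms (trans lb (sym lm)))) ¬one)) (∑ʷ-zero (subsets N) d λ _ → refl)) ⟩
  ∑[ j ← allFin d ] ∑ʷ (subsets N) d (λ Ms → Φ (cons (unit j) Ms))
    ≡⟨ ∑-cong (allFin d) (λ j → begin
         ∑ʷ (subsets N) d (λ Ms → Φ (cons (unit j) Ms))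
           ≡⟨ ∑ʷ-partitions N d (guarded j) (λ Ms e lm ¬one → Φ0 (cons (unit j) Ms) (suc e)
                (trans (length-cons (unit j) Ms (lengths j Ms lm)) lm) (trans (cong one (membership-suc e (unit j) Ms (lengths j Ms lm))) ¬one)) ⟩
         ∑ᵛ (allFin d) N (guarded j ∘ fibers)
           ≡⟨ ∑ᵛ-cong (allFin d) N (λ c → cong Φ (cons-fibers j c)) ⟩
         ∑ᵛ (allFin d) N (λ c → Φ (fibers (j ∷ c))) ∎) ⟩
  ∑ᵛ (allFin d) (suc N) (Φ ∘ fibers) ∎
  where
  open ≡-Reasoning
  guarded : Fin d → List (Subset N) → ℤ
  guarded j Ms = Φ (cons (unit j) Ms)
  lengths : ∀ j Ms → length Ms ≡ d → length (unit j) ≡ length Ms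
  lengths j Ms lm = trans (length-map _ (allFin d)) (trans (length-allFin d) (sym lm))

∑ʷ-filter : {P : A → Set} (P? : ∀ x → Dec (P x)) (xs : List A) → ∀ N (F : List A → ℤ) → (∀ pre x post → ¬ P x → F (pre ++ x ∷ post) ≡ 0ℤ) →
            ∑ʷ (filter P? xs) N F ≡ ∑ʷ xs N F
∑ʷ-filter P? xs zero    F F0 = refl
∑ʷ-filter P? xs (suc N) F F0 =
  trans (∑-filter P? xs _) (∑-cong xs λ x → trans (cong (𝟙 (P? x) *_) (∑ʷ-filter P? xs N (F ∘ (x ∷_)) λ pre → F0 (x ∷ pre))) (by-cases x (P? x)))
  where
  by-cases : ∀ x → (P? : Dec _) → 𝟙 P? * ∑ʷ xs N (F ∘ (x ∷_)) ≡ ∑ʷ xs N (F ∘ (x ∷_))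
  by-cases x (yes _)  = *-identityˡ _
  by-cases x (no ¬p) = sym (∑ʷ-zero xs N λ w → F0 [] x w ¬p)

-- The signed count as a moment.

module SignedCount (n d m : ℕ) (n≡1+d : n ≡ suc d) (n≡2m : n ≡ m ℕ.* 2) where

  open Letters n d m n≡1+d n≡2m
  open ColourMajor n d m n≡1+d n≡2m
  open Moments (B {n}) B-alt d using (module Fermi)

  private
    G : Graph n
    G = K n

    signed : List (EdgeSet G) → ℤ
    signed F = 𝟙 (IsOneFactorization? G F) * εF G F

    signed-0 : ∀ F → ¬ IsOneFactorization G F → signed F ≡ 0ℤ
    signed-0 F ¬F = cong (_* εF G F) (𝟙-no (IsOneFactorization? G F) ¬F)

    one-membership : ∀ e (F : List (EdgeSet G)) → AllPairs (λ M M′ → Subset.Empty (M Subset.∩ M′)) F → Any (e Subset.∈_) F → one (membership e F) ≡ true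
    one-membership e (M ∷ F) (disjoint ∷ ds) e∈F = by-cases (Vec.lookup M e) refl e∈F
      where
      none-membership : ∀ F → All (λ M′ → Subset.Empty (M Subset.∩ M′)) F → e Subset.∈ M → none (membership e F) ≡ true
      none-membership []       []       _  = refl
      none-membership (M′ ∷ F) (em ∷ d) e∈ = by (Vec.lookup M′ e) refl
        where
        by : ∀ b → Vec.lookup M′ e ≡ b → none (membership e (M′ ∷ F)) ≡ true
        by true  eq = contradiction (e , x∈p∩q⁺ (e∈ , lookup⇒[]= e M′ eq)) em
        by false eq = trans (cong (λ b → none (b ∷ membership e F)) eq) (none-membership F d e∈)
      by-cases : ∀ b → Vec.lookup M e ≡ b → Any (e Subset.∈_) (M ∷ F) → one (membership e (M ∷ F)) ≡ true
      by-cases true  eq _            = trans (cong (λ b → one (b ∷ membership e F)) eq) (none-membership F disjoint (lookup⇒[]= e M eq))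
      by-cases false eq (here e∈M)   = contradiction (trans (sym eq) ([]=⇒lookup e∈M)) λ ()
      by-cases false eq (there e∈F) = trans (cong (λ b → one (b ∷ membership e F)) eq) (one-membership e F ds e∈F)

    signed-one : ∀ F e → one (membership e F) ≡ false → signed F ≡ 0ℤ
    signed-one F e ¬one = signed-0 F λ (_ , _ , disjoint , cover) → contradiction (trans (sym ¬one) (one-membership e F disjoint (cover e))) λ ()

    one-factorization-↭ : ∀ {F F′} → F ↭ F′ → IsOneFactorization G F → IsOneFactorization G F′
    one-factorization-↭ p (perfect , nonempty , disjoint , cover) =
      Permₚ.All-resp-↭ p perfect , Permₚ.All-resp-↭ p nonempty ,
      AllPairs-↭ (λ em (e , e∈) → em (e , x∈p∩q⁺ (let (a , b) = x∈p∩q⁻ _ _ e∈ in b , a))) p disjoint ,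
      λ e → Permₚ.Any-resp-↭ p (cover e)

    εF-∏ : ∀ F → εF G F ≡ ∏ F (ε G)
    εF-∏ []      = refl
    εF-∏ (M ∷ F) = cong (ε G M *_) (εF-∏ F)

    signed-symm : Symm signed
    signed-symm {F} {F′} p = cong₂ _*_ (𝟙-⇔ (IsOneFactorization? G F) (IsOneFactorization? G F′) (one-factorization-↭ p) (one-factorization-↭ (↭-sym p)))
                                       (trans (εF-∏ F) (trans (∏-↭ p (ε G)) (sym (εF-∏ F′))))

    signed-repeat : ∀ M F → signed (M ∷ M ∷ F) ≡ 0ℤ
    signed-repeat M F = signed-0 (M ∷ M ∷ F) λ { (_ , (e , e∈) ∷ _ , (em ∷ _) ∷ _ , _) → em (e , x∈p∩q⁺ (e∈ , e∈)) }

    v₀ : Fin n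
    v₀ = subst Fin (sym n≡1+d) zero

    incidence : Edge G → ℤ
    incidence e = fromℕ (ι (v₀ Fin.≟ lo G e) ℕ.+ ι (v₀ Fin.≟ hi G e))

    incidence-yes : ∀ e → Incident G v₀ e → incidence e ≡ 1ℤ
    incidence-yes e (inj₁ eq) = cong fromℕ (cong₂ ℕ._+_ (ι-yes (v₀ Fin.≟ lo G e) eq) (ι-no (v₀ Fin.≟ hi G e) λ eq′ → ℕₚ.<-irrefl (cong toℕ (trans (sym eq) eq′)) (lo<hi e)))
    incidence-yes e (inj₂ eq) = cong fromℕ (cong₂ ℕ._+_ (ι-no (v₀ Fin.≟ lo G e) λ eq′ → ℕₚ.<-irrefl (cong toℕ (trans (sym eq′) eq)) (lo<hi e)) (ι-yes (v₀ Fin.≟ hi G e) eq))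

    incidence-no : ∀ e → ¬ Incident G v₀ e → incidence e ≡ 0ℤ
    incidence-no e ¬inc = cong fromℕ (cong₂ ℕ._+_ (ι-no (v₀ Fin.≟ lo G e) (¬inc ∘ inj₁)) (ι-no (v₀ Fin.≟ hi G e) (¬inc ∘ inj₂)))

    degree : ∑ (allFin N) incidence ≡ fromℕ d
    degree = trans (∑-lookup es (λ (u , v) → fromℕ (ι (v₀ Fin.≟ u) ℕ.+ ι (v₀ Fin.≟ v)))) (trans (deg-∑ es) (cong fromℕ (trans (cong (deg v₀) (edges-K n)) (deg-n n≡1+d v₀))))
      where
      deg-∑ : ∀ es → ∑ es (λ (u , v) → fromℕ (ι (v₀ Fin.≟ u) ℕ.+ ι (v₀ Fin.≟ v))) ≡ fromℕ (deg v₀ es)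
      deg-∑ []             = refl
      deg-∑ ((u , v) ∷ es) = trans (cong (fromℕ (ι (v₀ Fin.≟ u) ℕ.+ ι (v₀ Fin.≟ v)) +_) (deg-∑ es)) (cong fromℕ (ℕₚ.+-assoc (ι (v₀ Fin.≟ u)) (ι (v₀ Fin.≟ v)) (deg v₀ es)))
      deg-n : ∀ {n} → n ≡ suc d → (v : Fin n) → deg v (complete n) ≡ d
      deg-n refl v = deg-complete d v

    indicator : EdgeSet G → Edge G → ℤ
    indicator M e = if Vec.lookup M e then 1ℤ else 0ℤ

    matching-degree : ∀ {M} → IsPerfectMatching G M → ∑ (allFin N) (λ e → indicator M e * incidence e) ≡ 1ℤ
    matching-degree {M} (matching , covers) = from-edge (covers v₀)
      where
      from-edge : (∃ λ e → e Subset.∈ M × Incident G v₀ e) → ∑ (allFin N) (λ e → indicator M e * incidence e) ≡ 1ℤ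
      from-edge (e₀ , e₀∈ , inc₀) = trans (∑-cong (allFin N) λ e → trans (only e (e Fin.≟ e₀)) (sym (*-identityʳ _))) (∑-𝟙-Fin N e₀ (λ _ → 1ℤ))
        where
        only : ∀ e → Dec (e ≡ e₀) → indicator M e * incidence e ≡ 𝟙 (e Fin.≟ e₀)
        only e (yes refl) = trans (cong₂ (λ b i → (if b then 1ℤ else 0ℤ) * i) ([]=⇒lookup e₀∈) (incidence-yes e inc₀)) (sym (𝟙-yes (e Fin.≟ e₀) refl))
        only e (no e≢e₀) = trans (by-member (Vec.lookup M e) refl (Incident? G v₀ e)) (sym (𝟙-no (e Fin.≟ e₀) e≢e₀))
          where
          by-member : ∀ b → Vec.lookup M e ≡ b → Dec (Incident G v₀ e) → indicator M e * incidence e ≡ 0ℤ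
          by-member false eq _         = cong (λ b → (if b then 1ℤ else 0ℤ) * incidence e) eq
          by-member true  eq (yes inc) = contradiction (e≢e₀ , v₀ , inc , inc₀) (matching e e₀ (lookup⇒[]= e M eq) e₀∈)
          by-member true  eq (no ¬inc) = trans (cong (indicator M e *_) (incidence-no e ¬inc)) (*-zeroʳ (indicator M e))

    -- Counted at the vertex v₀: each factor has exactly one of its d edges, and each of these edges
    -- lies in exactly one factor. Needed because `S` ranges over collections of any size, whereas
    -- the word sum fixes the size d.
    factor-count : ∀ F → IsOneFactorization G F → length F ≡ d
    factor-count F (perfect , _ , disjoint , cover) = +-injective (begin
      fromℕ (length F)
        ≡⟨ sym (∑-one F) ⟩
      ∑ F (λ _ → 1ℤ)
        ≡⟨ ∑-congᴬ (All.map (λ pm → sym (matching-degree pm)) perfect) ⟩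
      ∑ F (λ M → ∑ (allFin N) (λ e → indicator M e * incidence e))
        ≡⟨ ∑-comm F (allFin N) _ ⟩
      ∑ (allFin N) (λ e → ∑ F (λ M → indicator M e * incidence e))
        ≡⟨ ∑-cong (allFin N) (λ e → trans (∑-*ʳ F (λ M → indicator M e) (incidence e)) (trans (cong (_* incidence e) (trans (sym (∑-map (λ M → Vec.lookup M e) F _)) (one-∑ (membership e F) (one-membership e F disjoint (cover e))))) (*-identityˡ (incidence e)))) ⟩
      ∑ (allFin N) incidence
        ≡⟨ degree ⟩
      fromℕ d ∎)
      where
      open ≡-Reasoning
      none-∑ : ∀ bs → none bs ≡ true → ∑ bs (λ b → if b then 1ℤ else 0ℤ) ≡ 0ℤ
      none-∑ []           _  = refl
      none-∑ (false ∷ bs) eq = trans (+-identityˡ _) (none-∑ bs eq)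
      one-∑ : ∀ bs → one bs ≡ true → ∑ bs (λ b → if b then 1ℤ else 0ℤ) ≡ 1ℤ
      one-∑ (true ∷ bs)  eq = cong (1ℤ +_) (none-∑ bs eq)
      one-∑ (false ∷ bs) eq = trans (+-identityˡ _) (one-∑ bs eq)

    S-signed : S n ≡ ∑ (sublists (perfectMatchings G)) signed
    S-signed = trans (foldr-∑ (oneFactorizations G)) (∑-filter (IsOneFactorization? G) (sublists (perfectMatchings G)) (εF G))
      where
      foldr-∑ : ∀ xs → foldr _+_ 0ℤ (map (εF G) xs) ≡ ∑ xs (εF G)
      foldr-∑ []       = refl
      foldr-∑ (x ∷ xs) = cong (εF G x +_) (foldr-∑ xs)

  moment-S : ∀ f → d ℕ.* n ≤ f → Fermi.moment f es ≡ fromℕ (d ℕ.!) * S n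
  moment-S f l = begin
    Fermi.moment f es
      ≡⟨ moment-words f ⟩
    ∑ᵛ (allFin d) N (λ c → Fermi.wick f (word es c))
      ≡⟨ ∑ᵛ-cong (allFin d) N (λ c → trans (wick-A₁ f l c) (A₁-factorization c)) ⟩
    ∑ᵛ (allFin d) N (signed ∘ fibers)
      ≡⟨ sym (∑ʷ-partitions N d signed (λ F e _ → signed-one F e)) ⟩
    ∑ʷ (subsets N) d signed
      ≡⟨ sym (∑ʷ-filter (IsPerfectMatching? G) (subsets N) d signed λ pre M post ¬pm → signed-0 (pre ++ M ∷ post) λ (perfect , _) →
           ¬pm (All.lookup perfect (∈-++⁺ʳ pre (here refl)))) ⟩
    ∑ʷ (perfectMatchings G) d signed
      ≡⟨ ∑ʷ-sublists signed-symm signed-repeat (perfectMatchings G) d ⟩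
    fromℕ (d ℕ.!) * ∑ (sublists (perfectMatchings G)) (λ F → 𝟙 (length F ℕₚ.≟ d) * signed F)
      ≡⟨ cong (fromℕ (d ℕ.!) *_) (trans (∑-cong (sublists (perfectMatchings G)) λ F → right-length F (IsOneFactorization? G F)) (sym S-signed)) ⟩
    fromℕ (d ℕ.!) * S n ∎
    where
    open ≡-Reasoning
    right-length : ∀ F → Dec (IsOneFactorization G F) → 𝟙 (length F ℕₚ.≟ d) * signed F ≡ signed F
    right-length F (yes fac) = trans (cong (_* signed F) (𝟙-yes (length F ℕₚ.≟ d) (factor-count F fac))) (*-identityˡ (signed F))
    right-length F (no ¬fac) = trans (cong (𝟙 (length F ℕₚ.≟ d) *_) (signed-0 F ¬fac)) (trans (*-zeroʳ (𝟙 (length F ℕₚ.≟ d))) (sym (signed-0 F ¬fac)))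

-- The painting game

x∈p─q⁻ : ∀ {n} (p q : Subset n) {x} → x Subset.∈ (p Subset.─ q) → x Subset.∈ p × ¬ x Subset.∈ q
x∈p─q⁻ p q x∈ = p─q⊆p p q x∈ , disjoint p q x∈
  where
  disjoint : ∀ {n} (p q : Subset n) {x} → x Subset.∈ (p Subset.─ q) → ¬ x Subset.∈ q
  disjoint (inside  ∷ p) (inside ∷ q) {zero} () Vec.here
  disjoint (outside ∷ p) (inside ∷ q) {zero} () Vec.here
  disjoint (_ ∷ p) (_ ∷ q) (Vec.there x∈) (Vec.there x∈q) = disjoint p q x∈ x∈q

total : ∀ {N} → (Fin N → ℕ) → ℕ
total {zero}  f = 0
total {suc N} f = f zero ℕ.+ total (f ∘ suc)

total-≤ : ∀ {N} {f g : Fin N → ℕ} → (∀ i → f i ≤ g i) → total f ≤ total g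
total-≤ {zero}  f≤g = z≤n
total-≤ {suc N} f≤g = ℕₚ.+-mono-≤ (f≤g zero) (total-≤ (f≤g ∘ suc))

total-< : ∀ {N} {f g : Fin N → ℕ} → (∀ i → f i ≤ g i) → ∀ j → f j < g j → total f < total g
total-< f≤g zero    f<g = ℕₚ.+-mono-<-≤ f<g (total-≤ (f≤g ∘ suc))
total-< f≤g (suc j) f<g = ℕₚ.+-mono-≤-< (f≤g zero) (total-< (f≤g ∘ suc) j f<g)

sumᵛ : ∀ {N} → Vec ℕ N → ℕ
sumᵛ []      = 0
sumᵛ (x ∷ b) = x ℕ.+ sumᵛ b

sum-inc : ∀ {N} (v : Fin N) b → sumᵛ (inc v b) ≡ suc (sumᵛ b)
sum-inc zero    (x ∷ b) = refl
sum-inc (suc v) (x ∷ b) = trans (cong (x ℕ.+_) (sum-inc v b)) (ℕₚ.+-suc x (sumᵛ b))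

lookup≤sum : ∀ {N} (b : Vec ℕ N) i → Vec.lookup b i ≤ sumᵛ b
lookup≤sum (x ∷ b) zero    = ℕₚ.m≤m+n x (sumᵛ b)
lookup≤sum (x ∷ b) (suc i) = ℕₚ.≤-trans (lookup≤sum b i) (ℕₚ.m≤n+m (sumᵛ b) x)

sum-≤ : ∀ {N} (a b : Vec ℕ N) → (∀ i → Vec.lookup a i ≤ Vec.lookup b i) → sumᵛ a ≤ sumᵛ b
sum-≤ []      []      _  = z≤n
sum-≤ (x ∷ a) (y ∷ b) ≤ᵢ = ℕₚ.+-mono-≤ (≤ᵢ zero) (sum-≤ a b (≤ᵢ ∘ suc))

sum-≤-≡ : ∀ {N} (a b : Vec ℕ N) → (∀ i → Vec.lookup a i ≤ Vec.lookup b i) → sumᵛ a ≡ sumᵛ b → a ≡ b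
sum-≤-≡ []      []      _  _  = refl
sum-≤-≡ (x ∷ a) (y ∷ b) ≤ᵢ eq = cong₂ _∷_ x≡y (sum-≤-≡ a b (≤ᵢ ∘ suc) (ℕₚ.+-cancelˡ-≡ x (sumᵛ a) (sumᵛ b) (trans eq (cong (ℕ._+ sumᵛ b) (sym x≡y)))))
  where
  x≡y : x ≡ y
  x≡y = ℕₚ.≤-antisym (≤ᵢ zero) (ℕₚ.+-cancelʳ-≤ (sumᵛ a) y x (ℕₚ.≤-trans (ℕₚ.+-monoʳ-≤ y (sum-≤ a b (≤ᵢ ∘ suc))) (ℕₚ.≤-reflexive (sym eq))))

-- Each edge raises the total degree by one, so only monomials of a single degree are seen. This
-- lets a functional be altered freely in all other degrees.
Li-homogeneous : ∀ {N} (es : List (Fin N × Fin N)) {L M} b → (∀ c → sumᵛ c ≡ length es ℕ.+ sumᵛ b → L c ≡ M c) → Li es L b ≡ Li es M b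
Li-homogeneous []             b eq = eq b refl
Li-homogeneous ((u , v) ∷ es) b eq = cong₂ _-_ (branch v) (branch u)
  where
  branch : ∀ w → Li es _ (inc w b) ≡ Li es _ (inc w b)
  branch w = Li-homogeneous es (inc w b) λ c s → eq c (trans s (trans (cong (length es ℕ.+_) (sum-inc w b)) (ℕₚ.+-suc (length es) (sumᵛ b))))

-- A pure tensor: the functional acts on each variable separately, which allows it to be modified
-- one edge at a time.
prod : ∀ {N} → (Fin N → ℕ → ℤ) → Vec ℕ N → ℤ
prod φ []      = 1ℤ
prod φ (x ∷ b) = φ zero x * prod (φ ∘ suc) b

prod-zero : ∀ {N} (φ : Fin N → ℕ → ℤ) b i → φ i (Vec.lookup b i) ≡ 0ℤ → prod φ b ≡ 0ℤ
prod-zero φ (x ∷ b) zero    eq = cong (_* prod (φ ∘ suc) b) eq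
prod-zero φ (x ∷ b) (suc i) eq = trans (cong (φ zero x *_) (prod-zero (φ ∘ suc) b i eq)) (*-zeroʳ (φ zero x))

prod-one : ∀ {N} (φ : Fin N → ℕ → ℤ) b → (∀ i → φ i (Vec.lookup b i) ≡ 1ℤ) → prod φ b ≡ 1ℤ
prod-one φ []      eq = refl
prod-one φ (x ∷ b) eq = cong₂ _*_ (eq zero) (prod-one (φ ∘ suc) b (eq ∘ suc))

prod-inc : ∀ {N} (φ : Fin N → ℕ → ℤ) v → (∀ x y → φ v x ≡ φ v y) → ∀ b → prod φ (inc v b) ≡ prod φ b
prod-inc φ zero    const (x ∷ b) = cong (_* prod (φ ∘ suc) b) (const (suc x) x)
prod-inc φ (suc v) const (x ∷ b) = cong (φ zero x *_) (prod-inc (φ ∘ suc) v const b)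

prod-∑ : ∀ {N} (xs : List A) (φ : A → Fin N → ℕ → ℤ) b →
         prod (λ i j → ∑[ x ← xs ] φ x i j) b ≡ ∑ᵛ xs N (λ w → prod (λ i → φ (Vec.lookup w i) i) b)
prod-∑ xs φ []      = refl
prod-∑ {N = suc N} xs φ (y ∷ b) =
  trans (cong ((∑[ x ← xs ] φ x zero y) *_) (prod-∑ xs (λ x → φ x ∘ suc) b))
  (trans (sym (∑-*ʳ xs (λ x → φ x zero y) _)) (∑-cong xs λ x → sym (∑ᵛ-*ˡ xs N (φ x zero y) (λ w → prod (λ i → φ (Vec.lookup w i) (suc i)) b))))

module Extraction {N : ℕ} (es : List (Fin N × Fin N)) (L : Vec ℕ N → ℤ) (b₀ : Vec ℕ N) where

  degree : ℕ
  degree = length es ℕ.+ sumᵛ b₀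

  -- A nonzero value must come from some monomial on which both its coefficient and L are nonzero.
  -- Its coefficient functional is returned in product form, ready to be relaxed in single
  -- variables.
  extract : Li es L b₀ ≢ 0ℤ → ∃ λ a → sumᵛ a ≡ degree × L a ≢ 0ℤ × Li es (prod (λ i j → 𝟙 (Vec.lookup a i ℕₚ.≟ j))) b₀ ≢ 0ℤ
  extract ≢0 = from-word (∑ᵛ-nonzero (allFin (suc degree)) N _ (≢0 ∘ trans expanded))
    where
    -- Cutting L down to the relevant degree bounds all exponents, so that the expansion is a finite
    -- sum.
    F : Vec ℕ N → ℤ
    F b = 𝟙 (sumᵛ b ℕₚ.≟ degree) * L b
    δ : Vec (Fin (suc degree)) N → Vec ℕ N → ℤ
    δ w b = 𝟙 (map toℕ (Vec.toList w) ≟ˡ Vec.toList b)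
    expanded : Li es L b₀ ≡ ∑ᵛ (allFin (suc degree)) N (λ w → F (Vec.map toℕ w) * Li es (δ w) b₀)
    expanded =
      trans (Li-homogeneous es b₀ λ c s → sym (trans (cong (_* L c) (𝟙-yes (sumᵛ c ℕₚ.≟ degree) s)) (*-identityˡ (L c))))
      (trans (Li-cong es (λ b → expansion-indicator (suc degree) N F b λ i B≤ → cong (_* L b)
                (𝟙-no (sumᵛ b ℕₚ.≟ degree) λ eq → ℕₚ.<⇒≱ B≤ (ℕₚ.≤-trans (lookup≤sum b i) (ℕₚ.≤-reflexive eq)))) b₀)
      (trans (Li-∑ᵛ es (allFin (suc degree)) N _ b₀) (∑ᵛ-cong (allFin (suc degree)) N λ w → Li-* es (F (Vec.map toℕ w)) (δ w) b₀)))
    from-word : (∃ λ w → F (Vec.map toℕ w) * Li es (δ w) b₀ ≢ 0ℤ) → _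
    from-word (w , ≢0) = a , sum-a (sumᵛ a ℕₚ.≟ degree) , ≢0-*ʳ {𝟙 (sumᵛ a ℕₚ.≟ degree)} (≢0-*ˡ ≢0) ,
                         λ eq → ≢0-*ʳ {F a} ≢0 (trans (Li-cong es (λ b → δ-prod b (map toℕ (Vec.toList w) ≟ˡ Vec.toList b)) b₀) eq)
      where
      a : Vec ℕ N
      a = Vec.map toℕ w
      sum-a : Dec (sumᵛ a ≡ degree) → sumᵛ a ≡ degree
      sum-a (yes eq) = eq
      sum-a (no neq) = contradiction (cong (_* L a) (𝟙-no (sumᵛ a ℕₚ.≟ degree) neq)) (≢0-*ˡ ≢0)
      same : ∀ {n} (a b : Vec ℕ n) → Vec.toList a ≡ Vec.toList b → a ≡ b
      same []      []      _  = refl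
      same (x ∷ a) (y ∷ b) eq = cong₂ _∷_ (∷-injectiveˡ eq) (same a b (∷-injectiveʳ eq))
      δ-prod : ∀ b → Dec (map toℕ (Vec.toList w) ≡ Vec.toList b) → δ w b ≡ prod (λ i j → 𝟙 (Vec.lookup a i ℕₚ.≟ j)) b
      δ-prod b (yes eq) = trans (𝟙-yes (map toℕ (Vec.toList w) ≟ˡ Vec.toList b) eq)
        (sym (prod-one _ b λ i → 𝟙-yes (Vec.lookup a i ℕₚ.≟ Vec.lookup b i) (cong (λ c → Vec.lookup c i) (same a b (trans (toList-map toℕ w) eq)))))
      δ-prod b (no neq) = trans (𝟙-no (map toℕ (Vec.toList w) ≟ˡ Vec.toList b) neq) (sym (differ (Fin.any? λ i → ¬? (Vec.lookup a i ℕₚ.≟ Vec.lookup b i))))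
        where
        pointwise : ∀ {n} (a b : Vec ℕ n) → (∀ i → Vec.lookup a i ≡ Vec.lookup b i) → a ≡ b
        pointwise []      []      _  = refl
        pointwise (x ∷ a) (y ∷ b) eq = cong₂ _∷_ (eq zero) (pointwise a b (eq ∘ suc))
        differ : Dec (∃ λ i → Vec.lookup a i ≢ Vec.lookup b i) → prod (λ i j → 𝟙 (Vec.lookup a i ℕₚ.≟ j)) b ≡ 0ℤ
        differ (yes (i , ne)) = prod-zero _ b i (𝟙-no (Vec.lookup a i ℕₚ.≟ Vec.lookup b i) ne)
        differ (no none) = contradiction (trans (sym (toList-map toℕ w)) (cong Vec.toList (pointwise a b λ i → decide i (Vec.lookup a i ℕₚ.≟ Vec.lookup b i)))) neq
          where
          decide : ∀ i → Dec (Vec.lookup a i ≡ Vec.lookup b i) → Vec.lookup a i ≡ Vec.lookup b i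
          decide i (yes eq) = eq
          decide i (no ne)  = contradiction (i , ne) none

-- Painter's strategy.

module Game {n : ℕ} (G : Graph n) (ps : List (Edge G × Edge G))
            (ps-adjacent : ∀ e f → AdjEdges G e f → (e , f) ∈ ps ⊎ (f , e) ∈ ps) where

  private
    N : ℕ
    N = length (edges G)

    open Subset using () renaming (_∈_ to _∈ˢ_; _⊆_ to _⊆ˢ_)

  Both : EdgeSet G → Edge G × Edge G → Set
  Both U (e , f) = e ∈ˢ U × f ∈ˢ U

  both? : ∀ U ef → Dec (Both U ef)
  both? U (e , f) = (e ∈?ˢ U) ×-dec (f ∈?ˢ U)

  inside-of : EdgeSet G → List (Edge G × Edge G)
  inside-of U = filter (both? U) ps

  -- The graph polynomial of U has a monomial whose exponents are smaller than the numbers of tokens.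
  Favourable : EdgeSet G → (Edge G → ℕ) → Set
  Favourable U t = ∃ λ L → ∃ λ b₀ → Li (inside-of U) L b₀ ≢ 0ℤ × (∀ b → L b ≢ 0ℤ → ∀ e → e ∈ˢ U → Vec.lookup b e < t e)

  private
    difference-≢0 : ∀ {a b} → a - b ≢ 0ℤ → a ≢ 0ℤ ⊎ b ≢ 0ℤ
    difference-≢0 {a} {b} ≢0 = by-cases (a ≟ 0ℤ)
      where
      by-cases : Dec (a ≡ 0ℤ) → a ≢ 0ℤ ⊎ b ≢ 0ℤ
      by-cases (no a≢0)   = inj₁ a≢0
      by-cases (yes refl) = inj₂ λ { refl → ≢0 refl }

  module Drop (U M : EdgeSet G) where

    Ignores : (Vec ℕ N → ℤ) → Set
    Ignores L = ∀ e → e ∈ˢ M → ∀ b → L (inc e b) ≡ L b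

    Outcome : List (Edge G × Edge G) → (Vec ℕ N → ℤ) → Set
    Outcome qs L = (∀ {e f} → (e , f) ∈ qs → e ∈ˢ U → f ∈ˢ U → e ∈ˢ M → f ∈ˢ M → ⊥)
                 × ∃ λ b → Li (filter (both? (U Subset.─ M)) qs) L b ≢ 0ℤ

    -- `Ignores` says that L treats the variables of M as 1. A pair inside M is then a factor 1 - 1,
    -- which a nonzero value excludes. A pair with one end in M splits into two terms, of which a
    -- nonzero one is kept and its variable absorbed into b. A pair outside M stays and is absorbed
    -- into L for the recursion.
    drop : ∀ qs L → Ignores L → ∀ b → Li (filter (both? U) qs) L b ≢ 0ℤ → Outcome qs L
    drop []             L ign b ≢0 = (λ ()) , b , ≢0
    drop ((e , f) ∷ qs) L ign b ≢0 = by-U (both? U (e , f))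
      where
      Goal : Set
      Goal = Outcome ((e , f) ∷ qs) L
      rejected : ¬ Both (U Subset.─ M) (e , f) → (e ∈ˢ U → f ∈ˢ U → e ∈ˢ M → f ∈ˢ M → ⊥) → Outcome qs L → Goal
      rejected ¬both no-clash (clash , b′ , ≢0′) =
        (λ { (here refl) → no-clash ; (there q) → clash q }) ,
        b′ , subst (λ l → Li l L b′ ≢ 0ℤ) (sym (Listₚ.filter-reject (both? (U Subset.─ M)) ¬both)) ≢0′
      module _ (eU : e ∈ˢ U) (fU : f ∈ˢ U) where
        rest : List (Edge G × Edge G)
        rest = filter (both? U) qs
        ≢0₁ : Li rest L (inc f b) - Li rest L (inc e b) ≢ 0ℤ
        ≢0₁ = subst (λ l → Li l L b ≢ 0ℤ) (Listₚ.filter-accept (both? U) (eU , fU)) ≢0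
        by-M : Dec (e ∈ˢ M) → Dec (f ∈ˢ M) → Goal
        by-M (yes eM) (yes fM) = contradiction (trans (cong₂ _-_ (ignored f fM) (ignored e eM)) (+-inverseʳ (Li rest L b))) ≢0₁
          where
          ignored : ∀ g → g ∈ˢ M → Li rest L (inc g b) ≡ Li rest L b
          ignored g gM = trans (Li-inc rest L g b) (Li-cong rest (ign g gM) b)
        by-M (yes eM) (no ¬fM) = rejected (λ (e∈ , _) → proj₂ (x∈p─q⁻ U M e∈) eM) (λ _ _ _ fM → ¬fM fM) (one-of (difference-≢0 ≢0₁))
          where
          one-of : Li rest L (inc f b) ≢ 0ℤ ⊎ Li rest L (inc e b) ≢ 0ℤ → Outcome qs L
          one-of (inj₁ ≢0′) = drop qs L ign (inc f b) ≢0′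
          one-of (inj₂ ≢0′) = drop qs L ign (inc e b) ≢0′
        by-M (no ¬eM) (yes fM) = rejected (λ (_ , f∈) → proj₂ (x∈p─q⁻ U M f∈) fM) (λ _ _ eM _ → ¬eM eM) (one-of (difference-≢0 ≢0₁))
          where
          one-of : Li rest L (inc f b) ≢ 0ℤ ⊎ Li rest L (inc e b) ≢ 0ℤ → Outcome qs L
          one-of (inj₁ ≢0′) = drop qs L ign (inc f b) ≢0′
          one-of (inj₂ ≢0′) = drop qs L ign (inc e b) ≢0′
        by-M (no ¬eM) (no ¬fM) = kept (drop qs L₂ L₂-ignores b λ eq → ≢0₁ (trans (sym (combine rest b)) eq))
          where
          L₂ : Vec ℕ N → ℤ
          L₂ c = L (inc f c) - L (inc e c)
          L₂-ignores : Ignores L₂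
          L₂-ignores g gM c = cong₂ _-_ (trans (cong L (inc-comm f g c)) (ign g gM (inc f c))) (trans (cong L (inc-comm e g c)) (ign g gM (inc e c)))
          combine : ∀ es c → Li es L₂ c ≡ Li es L (inc f c) - Li es L (inc e c)
          combine es c = trans (Li-- es _ _ c) (cong₂ _-_ (sym (Li-inc es L f c)) (sym (Li-inc es L e c)))
          kept : Outcome qs L₂ → Goal
          kept (clash , b′ , ≢0′) =
            (λ { (here refl) _ _ eM _ → ¬eM eM ; (there q) → clash q }) ,
            b′ , subst (λ l → Li l L b′ ≢ 0ℤ) (sym (Listₚ.filter-accept (both? (U Subset.─ M)) (x∈p∧x∉q⇒x∈p─q eU ¬eM , x∈p∧x∉q⇒x∈p─q fU ¬fM)))
                       (λ eq → ≢0′ (trans (combine (filter (both? (U Subset.─ M)) qs) b′) eq))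
      by-U : Dec (Both U (e , f)) → Goal
      by-U (yes (eU , fU)) = by-M eU fU (e ∈?ˢ M) (f ∈?ˢ M)
      by-U (no ¬both) = rejected (λ (e∈ , f∈) → ¬both (proj₁ (x∈p─q⁻ U M e∈) , proj₁ (x∈p─q⁻ U M f∈))) (λ eU fU _ _ → ¬both (eU , fU))
                          (drop qs L ign b (subst (λ l → Li l L b ≢ 0ℤ) (Listₚ.filter-reject (both? U) ¬both) ≢0))

  tokens : EdgeSet G → (Edge G → ℕ) → Edge G → ℕ
  tokens U t e = if does (e ∈?ˢ U) then t e else 0

  module Round (U : EdgeSet G) (t : Edge G → ℕ) (fav : Favourable U t) where

    private
      L : Vec ℕ N → ℤ
      L = proj₁ fav
      b₀ : Vec ℕ N
      b₀ = proj₁ (proj₂ fav)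
      open Extraction (inside-of U) L b₀
      extracted : ∃ λ a → sumᵛ a ≡ degree × L a ≢ 0ℤ × Li (inside-of U) (prod (λ i j → 𝟙 (Vec.lookup a i ℕₚ.≟ j))) b₀ ≢ 0ℤ
      extracted = extract (proj₁ (proj₂ (proj₂ fav)))
      a : Vec ℕ N
      a = proj₁ extracted

    a<t : ∀ e → e ∈ˢ U → Vec.lookup a e < t e
    a<t = proj₂ (proj₂ (proj₂ fav)) a (proj₁ (proj₂ (proj₂ extracted)))

    tokens-left : ∀ e → e ∈ˢ U → 0 < t e
    tokens-left e e∈ = ℕₚ.≤-<-trans z≤n (a<t e e∈)

    module _ (R : EdgeSet G) (R⊆U : R ⊆ˢ U) where

      private
        -- By homogeneity the exponents on R may be allowed to exceed those
        -- of a; then [a ≤ j] = 1 - [j < a] is expanded over the edges of R.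
        choice : Bool → Edge G → ℕ → ℤ
        choice true  e j = 𝟙 (e ∈?ˢ R)
        choice false e j = if does (e ∈?ˢ R) then - 𝟙 (j ℕₚ.<? Vec.lookup a e) else 𝟙 (Vec.lookup a e ℕₚ.≟ j)

        bits₂ : List Bool
        bits₂ = true ∷ false ∷ []

        θ : Edge G → ℕ → ℤ
        θ e j = ∑[ x ← bits₂ ] choice x e j

        θ-in : ∀ e j → e ∈ˢ R → θ e j ≡ 1ℤ - 𝟙 (j ℕₚ.<? Vec.lookup a e)
        θ-in e j e∈ = trans (cong₂ (λ x y → x + (y + 0ℤ)) (𝟙-yes (e ∈?ˢ R) e∈) (if-yes (e ∈?ˢ R) e∈)) (lemma (𝟙 (j ℕₚ.<? Vec.lookup a e)))
          where
          lemma : ∀ x → 1ℤ + (- x + 0ℤ) ≡ 1ℤ - x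
          lemma = solve-∀

        θ-out : ∀ e j → ¬ e ∈ˢ R → θ e j ≡ 𝟙 (Vec.lookup a e ℕₚ.≟ j)
        θ-out e j e∉ = trans (cong₂ (λ x y → x + (y + 0ℤ)) (𝟙-no (e ∈?ˢ R) e∉) (if-no (e ∈?ˢ R) e∉))
                             (trans (+-identityˡ _) (+-identityʳ _))

        θ-≡ : ∀ e → θ e (Vec.lookup a e) ≡ 1ℤ
        θ-≡ e = by-cases (e ∈?ˢ R)
          where
          by-cases : Dec (e ∈ˢ R) → θ e (Vec.lookup a e) ≡ 1ℤ
          by-cases (yes e∈) = trans (θ-in e _ e∈) (cong (λ x → 1ℤ - x) (𝟙-no (Vec.lookup a e ℕₚ.<? Vec.lookup a e) (ℕₚ.<-irrefl refl)))
          by-cases (no e∉) = trans (θ-out e _ e∉) (𝟙-yes (Vec.lookup a e ℕₚ.≟ Vec.lookup a e) refl)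

        θ-< : ∀ e j → j < Vec.lookup a e → θ e j ≡ 0ℤ
        θ-< e j j<a = by-cases (e ∈?ˢ R)
          where
          by-cases : Dec (e ∈ˢ R) → θ e j ≡ 0ℤ
          by-cases (yes e∈) = trans (θ-in e j e∈) (cong (λ x → 1ℤ - x) (𝟙-yes (j ℕₚ.<? Vec.lookup a e) j<a))
          by-cases (no e∉) = trans (θ-out e j e∉) (𝟙-no (Vec.lookup a e ℕₚ.≟ j) λ eq → ℕₚ.<-irrefl (sym eq) j<a)

        -- If some exponent of b is below that of a, both products vanish. Otherwise b dominates a
        -- and has the same sum, so b = a and both are 1.
        relaxed : ∀ b → sumᵛ b ≡ degree → prod (λ i j → 𝟙 (Vec.lookup a i ℕₚ.≟ j)) b ≡ prod θ b
        relaxed b s = by-cases (Fin.any? λ i → Vec.lookup b i ℕₚ.<? Vec.lookup a i)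
          where
          by-cases : Dec (∃ λ i → Vec.lookup b i < Vec.lookup a i) → prod (λ i j → 𝟙 (Vec.lookup a i ℕₚ.≟ j)) b ≡ prod θ b
          by-cases (yes (i , b<a)) = trans (prod-zero _ b i (𝟙-no (Vec.lookup a i ℕₚ.≟ Vec.lookup b i) λ eq → ℕₚ.<-irrefl (sym eq) b<a))
                                           (sym (prod-zero θ b i (θ-< i _ b<a)))
          by-cases (no none) = equal (sum-≤-≡ a b (λ i → ℕₚ.≮⇒≥ λ b<a → none (i , b<a)) (trans (proj₁ (proj₂ extracted)) (sym s)))
            where
            equal : a ≡ b → prod (λ i j → 𝟙 (Vec.lookup a i ℕₚ.≟ j)) b ≡ prod θ b
            equal refl = trans (prod-one _ a λ i → 𝟙-yes (Vec.lookup a i ℕₚ.≟ Vec.lookup a i) refl) (sym (prod-one θ a θ-≡))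

        -- Some term of the expansion is nonzero, and its bits are Painter's move. Bit `true` paints
        -- the edge, whose exponent is no longer constrained; bit `false` on a marked edge forces
        -- the exponent strictly below that of a, which pays for the lost token.
        chosen : ∃ λ (M : EdgeSet G) → Li (inside-of U) (prod (λ i → choice (Vec.lookup M i) i)) b₀ ≢ 0ℤ
        chosen = ∑ᵛ-nonzero bits₂ N _ λ eq → proj₂ (proj₂ (proj₂ extracted))
          (trans (Li-homogeneous (inside-of U) b₀ relaxed)
          (trans (Li-cong (inside-of U) (prod-∑ bits₂ choice) b₀)
          (trans (Li-∑ᵛ (inside-of U) bits₂ N _ b₀) eq)))

      M : EdgeSet G
      M = proj₁ chosen

      private
        Lᴹ : Vec ℕ N → ℤ
        Lᴹ = prod (λ i → choice (Vec.lookup M i) i)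

        ≢0ᴹ : Li (inside-of U) Lᴹ b₀ ≢ 0ℤ
        ≢0ᴹ = proj₂ chosen

        open Drop U M

        ignores : Ignores Lᴹ
        ignores e e∈ b = prod-inc (λ i → choice (Vec.lookup M i) i) e (λ x y → subst (λ s → choice s e x ≡ choice s e y) (sym ([]=⇒lookup e∈)) refl) b

        outcome : Outcome ps Lᴹ
        outcome = drop ps Lᴹ ignores b₀ ≢0ᴹ

      M⊆R : M ⊆ˢ R
      M⊆R {e} e∈ = by-cases (e ∈?ˢ R)
        where
        by-cases : Dec (e ∈ˢ R) → e ∈ˢ R
        by-cases (yes e∈R) = e∈R
        by-cases (no e∉R) = contradiction
          (Li-zero (λ _ → ⊤) (λ _ _ → tt) (inside-of U) (λ b _ → prod-zero (λ i → choice (Vec.lookup M i) i) b e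
            (trans (cong (λ s → choice s e (Vec.lookup b e)) ([]=⇒lookup e∈)) (𝟙-no (e ∈?ˢ R) e∉R))) b₀ tt) ≢0ᴹ

      matching : IsMatching G M
      matching e f e∈ f∈ adj = by-cases (ps-adjacent e f adj)
        where
        eU : e ∈ˢ U
        eU = R⊆U (M⊆R e∈)
        fU : f ∈ˢ U
        fU = R⊆U (M⊆R f∈)
        by-cases : (e , f) ∈ ps ⊎ (f , e) ∈ ps → ⊥
        by-cases (inj₁ q) = proj₁ outcome q eU fU e∈ f∈
        by-cases (inj₂ q) = proj₁ outcome q fU eU f∈ e∈

      next : Favourable (U Subset.─ M) (removeTokens G R t)
      next = Lᴹ , proj₁ (proj₂ outcome) , proj₂ (proj₂ outcome) , support
        where
        support : ∀ b → Lᴹ b ≢ 0ℤ → ∀ e → e ∈ˢ (U Subset.─ M) → Vec.lookup b e < removeTokens G R t e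
        support b ≢0 e e∈ = by-cases (e ∈?ˢ R)
          where
          eU : e ∈ˢ U
          eU = proj₁ (x∈p─q⁻ U M e∈)
          e∉M : Vec.lookup M e ≡ false
          e∉M = outside-of (Vec.lookup M e) refl
            where
            outside-of : ∀ s → Vec.lookup M e ≡ s → s ≡ false
            outside-of false _  = refl
            outside-of true  eq = contradiction (lookup⇒[]= e M eq) (proj₂ (x∈p─q⁻ U M e∈))
          factor : choice false e (Vec.lookup b e) ≢ 0ℤ
          factor eq = ≢0 (prod-zero (λ i → choice (Vec.lookup M i) i) b e (trans (cong (λ s → choice s e (Vec.lookup b e)) e∉M) eq))
          by-cases : Dec (e ∈ˢ R) → Vec.lookup b e < removeTokens G R t e
          by-cases (yes e∈R) = subst (Vec.lookup b e <_) (sym (if-yes (e ∈?ˢ R) e∈R)) (ℕₚ.<-≤-trans (below (Vec.lookup b e ℕₚ.<? Vec.lookup a e)) (ℕₚ.<⇒≤pred (a<t e eU)))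
            where
            below : Dec (Vec.lookup b e < Vec.lookup a e) → Vec.lookup b e < Vec.lookup a e
            below (yes lt) = lt
            below (no ≮)   = contradiction (trans (if-yes (e ∈?ˢ R) e∈R) (cong -_ (𝟙-no (Vec.lookup b e ℕₚ.<? Vec.lookup a e) ≮))) factor
          by-cases (no e∉R) = subst (Vec.lookup b e <_) (sym (if-no (e ∈?ˢ R) e∉R)) (ℕₚ.≤-<-trans (ℕₚ.≤-reflexive (same (Vec.lookup a e ℕₚ.≟ Vec.lookup b e))) (a<t e eU))
            where
            same : Dec (Vec.lookup a e ≡ Vec.lookup b e) → Vec.lookup b e ≡ Vec.lookup a e
            same (yes eq) = sym eq
            same (no neq) = contradiction (trans (if-no (e ∈?ˢ R) e∉R) (𝟙-no (Vec.lookup a e ℕₚ.≟ Vec.lookup b e) neq)) factor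

      -- The measure for termination counts tokens on uncoloured edges only: a marked edge loses a
      -- token if left uncoloured, and all its tokens if painted.
      fewer-tokens : Subset.Nonempty R → total (tokens (U Subset.─ M) (removeTokens G R t)) < total (tokens U t)
      fewer-tokens (r , r∈) = total-< (λ e → at-most e (e ∈?ˢ (U Subset.─ M)) (e ∈?ˢ R)) r
          (strict (r ∈?ˢ (U Subset.─ M)))
        where
        T′ : Edge G → ℕ
        T′ = tokens (U Subset.─ M) (removeTokens G R t)
        at-most : ∀ e → Dec (e ∈ˢ (U Subset.─ M)) → Dec (e ∈ˢ R) → T′ e ≤ tokens U t e
        at-most e (no e∉)  _         = subst (_≤ tokens U t e) (sym (if-no (e ∈?ˢ (U Subset.─ M)) e∉)) z≤n
        at-most e (yes e∈) R?        = subst₂ _≤_ (sym (if-yes (e ∈?ˢ (U Subset.─ M)) e∈)) (sym (if-yes (e ∈?ˢ U) (proj₁ (x∈p─q⁻ U M e∈)))) (removed R?)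
          where
          removed : Dec (e ∈ˢ R) → removeTokens G R t e ≤ t e
          removed (yes e∈R) = subst (_≤ t e) (sym (if-yes (e ∈?ˢ R) e∈R)) (ℕₚ.m∸n≤m (t e) 1)
          removed (no e∉R)  = ℕₚ.≤-reflexive (if-no (e ∈?ˢ R) e∉R)
        rU : r ∈ˢ U
        rU = R⊆U r∈
        strict : Dec (r ∈ˢ (U Subset.─ M)) → T′ r < tokens U t r
        strict (no r∉)  = subst₂ _<_ (sym (if-no (r ∈?ˢ (U Subset.─ M)) r∉)) (sym (if-yes (r ∈?ˢ U) rU)) (tokens-left r rU)
        strict (yes r∈′) = subst₂ _<_ (sym (trans (if-yes (r ∈?ˢ (U Subset.─ M)) r∈′) (if-yes (r ∈?ˢ R) r∈))) (sym (if-yes (r ∈?ˢ U) rU))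
                            (ℕₚ.∸-monoʳ-< (s≤s z≤n) (tokens-left r rU))

  painter-wins : ∀ fuel U t → total (tokens U t) < fuel → Favourable U t → PainterWins G U t
  -- `round` also serves when U is empty: Lister then has no nonempty set to mark.
  painter-wins (suc fuel) U t (s≤s l) fav = round (Round.tokens-left U t fav) λ R R≠∅ R⊆U →
    Round.M U t fav R R⊆U , Round.M⊆R U t fav R R⊆U , Round.matching U t fav R R⊆U ,
    painter-wins fuel _ _ (ℕₚ.<-≤-trans (Round.fewer-tokens U t fav R R⊆U R≠∅) l) (Round.next U t fav R R⊆U)

-- Finite differences.

-- The coefficients of (1 - E)^N, where E is the shift operator.
difference : ℕ → ℕ → ℤ
difference zero    zero    = 1ℤ
difference zero    (suc x) = 0ℤ
difference (suc N) zero    = difference N zero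
difference (suc N) (suc x) = difference N (suc x) - difference N x

private
  pascal : ℕ → ℕ → ℕ
  pascal zero    zero    = 1
  pascal zero    (suc x) = 0
  pascal (suc N) zero    = pascal N zero
  pascal (suc N) (suc x) = pascal N (suc x) ℕ.+ pascal N x

  difference-pascal : ∀ N x → difference N x ≡ -1ℤ ^ x * fromℕ (pascal N x)
  difference-pascal zero    zero    = refl
  difference-pascal zero    (suc x) = sym (*-zeroʳ (-1ℤ ^ suc x))
  difference-pascal (suc N) zero    = difference-pascal N zero
  difference-pascal (suc N) (suc x) =
    trans (cong₂ _-_ (difference-pascal N (suc x)) (difference-pascal N x)) (lemma (-1ℤ ^ x) (fromℕ (pascal N (suc x))) (fromℕ (pascal N x)))
    where
    lemma : ∀ s a b → (-1ℤ * s) * a - s * b ≡ (-1ℤ * s) * (a + b)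
    lemma = solve-∀

  pascal-positive : ∀ N x → x ≤ N → 0 < pascal N x
  pascal-positive zero    zero    _         = s≤s z≤n
  pascal-positive (suc N) zero    _         = pascal-positive N zero z≤n
  pascal-positive (suc N) (suc x) (s≤s x≤N) = ℕₚ.<-≤-trans (pascal-positive N x x≤N) (ℕₚ.m≤n+m (pascal N x) (pascal N (suc x)))

difference-≢0 : ∀ N x → x ≤ N → difference N x ≢ 0ℤ
difference-≢0 N x x≤N eq = *-≢0 (power x) (λ e → ℕₚ.<⇒≢ (pascal-positive N x x≤N) (sym (+-injective e))) (trans (sym (difference-pascal N x)) eq)
  where
  power : ∀ x → -1ℤ ^ x ≢ 0ℤ
  power (suc x) e = power x (trans (sym (neg-involutive (-1ℤ ^ x))) (cong -_ (trans (sym (-1*i≡-i (-1ℤ ^ x))) e)))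

private
  difference-end : ∀ N → difference N (suc N) ≡ 0ℤ
  difference-end zero    = refl
  difference-end (suc N) = cong₂ _-_ (beyond N (suc N) (ℕₚ.≤-refl)) (difference-end N)
    where
    beyond : ∀ N x → N < x → difference N (suc x) ≡ 0ℤ
    beyond zero    x       _         = refl
    beyond (suc N) (suc x) (s≤s N<x) = cong₂ _-_ (beyond N (suc x) (ℕₚ.m≤n⇒m≤1+n N<x)) (beyond N x N<x)

  ∑-allFin-suc : ∀ n (f : ℕ → ℤ) → ∑ (allFin (suc n)) (f ∘ toℕ) ≡ f 0 + ∑ (allFin n) (λ i → f (suc (toℕ i)))
  ∑-allFin-suc n f = trans (cong (λ l → ∑ l (f ∘ toℕ)) (allFin-suc n)) (cong (f 0 +_) (∑-map suc (allFin n) (f ∘ toℕ)))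

  ∑-allFin-last : ∀ n (f : ℕ → ℤ) → ∑ (allFin (suc n)) (f ∘ toℕ) ≡ ∑ (allFin n) (f ∘ toℕ) + f n
  ∑-allFin-last zero    f = +-comm (f 0) 0ℤ
  ∑-allFin-last (suc n) f =
    trans (∑-allFin-suc (suc n) f) (trans (cong (f 0 +_) (∑-allFin-last n (f ∘ suc)))
    (trans (sym (+-assoc (f 0) _ (f (suc n)))) (cong (_+ f (suc n)) (sym (∑-allFin-suc n f)))))

-- Summation by parts: one factor 1 - E is moved from the coefficients to f. The boundary term
-- vanishes by `difference-end`.
difference-step : ∀ N (f : ℕ → ℤ) → ∑ (allFin (suc (suc N))) (λ x → difference (suc N) (toℕ x) * f (toℕ x))
                               ≡ ∑ (allFin (suc N)) (λ x → difference N (toℕ x) * (f (toℕ x) - f (suc (toℕ x))))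
difference-step N f = begin
  ∑ (allFin (suc (suc N))) (λ x → difference (suc N) (toℕ x) * f (toℕ x))
    ≡⟨ ∑-allFin-suc (suc N) (λ x → difference (suc N) x * f x) ⟩
  a 0 + ∑ (allFin (suc N)) (λ i → (difference N (suc (toℕ i)) - difference N (toℕ i)) * f (suc (toℕ i)))
    ≡⟨ cong (a 0 +_) (trans (∑-cong (allFin (suc N)) λ i → lemma (difference N (suc (toℕ i))) (difference N (toℕ i)) (f (suc (toℕ i))))
                            (∑-+ (allFin (suc N)) (λ i → a (suc (toℕ i))) (λ i → - b (toℕ i)))) ⟩
  a 0 + (∑ (allFin (suc N)) (λ i → a (suc (toℕ i))) + ∑ (allFin (suc N)) (λ i → - b (toℕ i)))
    ≡⟨ sym (+-assoc (a 0) _ _) ⟩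
  a 0 + ∑ (allFin (suc N)) (λ i → a (suc (toℕ i))) + ∑ (allFin (suc N)) (λ i → - b (toℕ i))
    ≡⟨ cong (_+ ∑ (allFin (suc N)) (λ i → - b (toℕ i))) (trans (sym (∑-allFin-suc (suc N) a)) (trans (∑-allFin-last (suc N) a)
         (trans (cong (λ e → ∑ (allFin (suc N)) (a ∘ toℕ) + e * f (suc N)) (difference-end N)) (+-identityʳ (∑ (allFin (suc N)) (a ∘ toℕ)))))) ⟩
  ∑ (allFin (suc N)) (a ∘ toℕ) + ∑ (allFin (suc N)) (λ i → - b (toℕ i))
    ≡⟨ sym (∑-+ (allFin (suc N)) (a ∘ toℕ) (λ i → - b (toℕ i))) ⟩
  ∑ (allFin (suc N)) (λ x → a (toℕ x) + - b (toℕ x))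
    ≡⟨ ∑-cong (allFin (suc N)) (λ x → lemma′ (difference N (toℕ x)) (f (toℕ x)) (f (suc (toℕ x)))) ⟩
  ∑ (allFin (suc N)) (λ x → difference N (toℕ x) * (f (toℕ x) - f (suc (toℕ x)))) ∎
  where
  open ≡-Reasoning
  a b : ℕ → ℤ
  a x = difference N x * f x
  b x = difference N x * f (suc x)
  lemma : ∀ p q f → (p - q) * f ≡ p * f + - (q * f)
  lemma = solve-∀
  lemma′ : ∀ p f g → p * f + - (p * g) ≡ p * (f - g)
  lemma′ = solve-∀

private
  Δ : (ℕ → ℤ) → ℕ → ℤ
  Δ f x = f x - f (suc x)

  -- Deg< N f says that f is a polynomial of degree less than N.
  Deg< : ℕ → (ℕ → ℤ) → Set
  Deg< zero    f = ∀ x → f x ≡ 0ℤ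
  Deg< (suc N) f = Deg< N (Δ f)

  Deg-cong : ∀ N f g → (∀ x → f x ≡ g x) → Deg< N f → Deg< N g
  Deg-cong zero    f g eq deg x = trans (sym (eq x)) (deg x)
  Deg-cong (suc N) f g eq deg   = Deg-cong N (Δ f) (Δ g) (λ x → cong₂ _-_ (eq x) (eq (suc x))) deg

  Deg-- : ∀ N f g → Deg< N f → Deg< N g → Deg< N (λ x → f x - g x)
  Deg-- zero    f g df dg x = cong₂ _-_ (df x) (dg x)
  Deg-- (suc N) f g df dg = Deg-cong N (λ x → Δ f x - Δ g x) (Δ (λ x → f x - g x)) (λ x → lemma (f x) (f (suc x)) (g x) (g (suc x))) (Deg-- N (Δ f) (Δ g) df dg)
    where
    lemma : ∀ a b c d → (a - b) - (c - d) ≡ (a - c) - (b - d)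
    lemma = solve-∀

  Deg-shift : ∀ N f → Deg< N f → Deg< N (f ∘ suc)
  Deg-shift zero    f df x = df (suc x)
  Deg-shift (suc N) f df   = Deg-shift N (Δ f) df

  Deg-times : ∀ N f → Deg< N f → Deg< (suc N) (λ x → fromℕ x * f x)
  Deg-times zero    f df x = cong₂ _-_ (trans (cong (fromℕ x *_) (df x)) (*-zeroʳ (fromℕ x))) (trans (cong (fromℕ (suc x) *_) (df (suc x))) (*-zeroʳ (fromℕ (suc x))))
  Deg-times (suc N) f df = Deg-cong (suc N) (λ x → fromℕ x * Δ f x - f (suc x)) (Δ (λ x → fromℕ x * f x)) (λ x → lemma (fromℕ x) (f x) (f (suc x)))
                             (Deg-- (suc N) (λ x → fromℕ x * Δ f x) (f ∘ suc) (Deg-times N (Δ f) df) (Deg-shift (suc N) f df))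
    where
    lemma : ∀ x a b → x * (a - b) - b ≡ x * a - (1ℤ + x) * b
    lemma = solve-∀

  Deg-suc : ∀ N f → Deg< N f → Deg< (suc N) f
  Deg-suc zero    f df x = cong₂ _-_ (df x) (df (suc x))
  Deg-suc (suc N) f df   = Deg-suc N (Δ f) df

  Deg-power : ∀ N j → j < N → Deg< N (λ x → fromℕ x ^ j)
  Deg-power (suc N) zero    _         = constant N
    where
    constant : ∀ N → Deg< (suc N) (λ _ → 1ℤ)
    constant zero    x = refl
    constant (suc N)   = Deg-suc (suc N) (λ _ → 1ℤ) (constant N)
  Deg-power (suc N) (suc j) (s≤s j<N) = Deg-times N (λ x → fromℕ x ^ j) (Deg-power N j j<N)

difference-vanishes : ∀ N (f : ℕ → ℤ) → Deg< N f → ∑ (allFin (suc N)) (λ x → difference N (toℕ x) * f (toℕ x)) ≡ 0ℤ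
difference-vanishes zero    f df = trans (cong (λ e → 1ℤ * e + 0ℤ) (df 0)) refl
difference-vanishes (suc N) f df = trans (difference-step N f) (difference-vanishes N (Δ f) df)

-- An N-th difference annihilates powers below N. Weighting the colours 0, ..., N by these
-- coefficients therefore detects only exponents of at least N.
difference-power : ∀ N j → j < N → ∑ (allFin (suc N)) (λ x → difference N (toℕ x) * fromℕ (toℕ x) ^ j) ≡ 0ℤ
difference-power N j j<N = difference-vanishes N (λ x → fromℕ x ^ j) (Deg-power N j j<N)

-- A functional that is geometric in each exponent is evaluation at the point x, up to a constant.
Li-evaluation : ∀ {N} (x : Fin N → ℤ) (ψ : Fin N → ℕ → ℤ) → (∀ i j → ψ i (suc j) ≡ x i * ψ i j) →
                ∀ es b → Li es (prod ψ) b ≡ ∏ es (λ (u , v) → x v - x u) * prod ψ b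
Li-evaluation x ψ step []             b = sym (*-identityˡ (prod ψ b))
Li-evaluation x ψ step ((u , v) ∷ es) b =
  trans (cong₂ _-_ (branch v) (branch u)) (lemma (∏ es (λ (u , v) → x v - x u)) (x v) (x u) (prod ψ b))
  where
  prod-step : ∀ {N} (x : Fin N → ℤ) (ψ : Fin N → ℕ → ℤ) → (∀ i j → ψ i (suc j) ≡ x i * ψ i j) → ∀ v b → prod ψ (inc v b) ≡ x v * prod ψ b
  prod-step x ψ step zero    (y ∷ b) = trans (cong (_* prod (ψ ∘ suc) b) (step zero y)) (*-assoc (x zero) (ψ zero y) _)
  prod-step x ψ step (suc v) (y ∷ b) = trans (cong (ψ zero y *_) (prod-step (x ∘ suc) (ψ ∘ suc) (step ∘ suc) v b)) (swap-* (ψ zero y) (x (suc v)) _)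
    where
    swap-* : ∀ a b c → a * (b * c) ≡ b * (a * c)
    swap-* = solve-∀
  branch : ∀ w → Li es (prod ψ) (inc w b) ≡ ∏ es (λ (u , v) → x v - x u) * (x w * prod ψ b)
  branch w = trans (Li-evaluation x ψ step es (inc w b)) (cong (∏ es (λ (u , v) → x v - x u) *_) (prod-step x ψ step w b))
  lemma : ∀ e v u p → e * (v * p) - e * (u * p) ≡ ((v - u) * e) * p
  lemma = solve-∀

∈-pairs : ∀ {x y : A} {xs} → x ∈ xs → y ∈ xs → x ≢ y → (x , y) ∈ pairs xs ⊎ (y , x) ∈ pairs xs
∈-pairs (here refl) (here refl) x≢y = contradiction refl x≢y
∈-pairs (here refl) (there y∈)  x≢y = inj₁ (∈-++⁺ˡ (∈-map⁺ (_ ,_) y∈))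
∈-pairs (there x∈)  (here refl) x≢y = inj₂ (∈-++⁺ˡ (∈-map⁺ (_ ,_) x∈))
∈-pairs {xs = z ∷ xs} (there x∈) (there y∈) x≢y with ∈-pairs x∈ y∈ x≢y
... | inj₁ q = inj₁ (∈-++⁺ʳ (map (z ,_) xs) q)
... | inj₂ q = inj₂ (∈-++⁺ʳ (map (z ,_) xs) q)

∑-double : (f g : A → C) (xs : List A) (t : C → ℤ) → ∑ (double f g xs) t ≡ ∑ xs (λ x → t (f x) + t (g x))
∑-double f g []       t = refl
∑-double f g (x ∷ xs) t = trans (cong (λ e → t (f x) + (t (g x) + e)) (∑-double f g xs t)) (sym (+-assoc (t (f x)) (t (g x)) _))

∑ₚ-double : (t : C → C → ℤ) (f g : A → C) (xs : List A) →
  ∑ₚ t (double f g xs) ≡ ∑ xs (λ x → t (f x) (g x)) + ∑ₚ (λ x y → (t (f x) (f y) + t (f x) (g y)) + (t (g x) (f y) + t (g x) (g y))) xs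
∑ₚ-double t f g []       = refl
∑ₚ-double t f g (x ∷ xs) =
  trans (cong₂ _+_ (cong (t (f x) (g x) +_) (∑-double f g xs (t (f x)))) (cong₂ _+_ (∑-double f g xs (t (g x))) (∑ₚ-double t f g xs)))
  (trans (lemma (t (f x) (g x)) (∑ xs (λ y → t (f x) (f y) + t (f x) (g y))) (∑ xs (λ y → t (g x) (f y) + t (g x) (g y))) (∑ xs (λ x → t (f x) (g x))) _)
         (cong (λ e → t (f x) (g x) + ∑ xs (λ x → t (f x) (g x)) + (e + _)) (sym (∑-+ xs (λ y → t (f x) (f y) + t (f x) (g y)) (λ y → t (g x) (f y) + t (g x) (g y))))))
  where
  lemma : ∀ a f g p r → (a + f) + (g + (p + r)) ≡ (a + p) + ((f + g) + r)
  lemma = solve-∀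

∑ₚ-++ : (t : A → A → ℤ) (xs ys : List A) → ∑ₚ t (xs ++ ys) ≡ ∑ₚ t xs + (∑ xs (λ x → ∑ ys (t x)) + ∑ₚ t ys)
∑ₚ-++ t []       ys = sym (trans (+-identityˡ _) (+-identityˡ _))
∑ₚ-++ t (x ∷ xs) ys = trans (cong₂ _+_ (∑-++ xs ys (t x)) (∑ₚ-++ t xs ys)) (lemma (∑ xs (t x)) (∑ ys (t x)) (∑ₚ t xs) (∑ xs (λ x → ∑ ys (t x))) (∑ₚ t ys))
  where
  lemma : ∀ a b c d e → (a + b) + (c + (d + e)) ≡ (a + c) + ((b + d) + e)
  lemma = solve-∀

∏-colours : ∀ {d} (w : Fin d → ℤ) (xs : List (Fin d)) → ∏ xs w ≡ ∏ (allFin d) (λ j → w j ^ # Fin._≟_ j xs)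
∏-colours {d} w []   = sym (∏-one (allFin d) λ _ → refl)
∏-colours {d} w (x ∷ xs) = sym (begin
  ∏ (allFin d) (λ j → w j ^ (ι (j Fin.≟ x) ℕ.+ # Fin._≟_ j xs))
    ≡⟨ ∏-cong (allFin d) (λ j → ^-distribˡ-+-* (w j) (ι (j Fin.≟ x)) (# Fin._≟_ j xs)) ⟩
  ∏ (allFin d) (λ j → w j ^ ι (j Fin.≟ x) * w j ^ # Fin._≟_ j xs)
    ≡⟨ ∏-* (allFin d) (λ j → w j ^ ι (j Fin.≟ x)) (λ j → w j ^ # Fin._≟_ j xs) ⟩
  ∏ (allFin d) (λ j → w j ^ ι (j Fin.≟ x)) * ∏ (allFin d) (λ j → w j ^ # Fin._≟_ j xs)
    ≡⟨ cong₂ _*_ (trans (∏-cong (allFin d) λ j → select j (x Fin.≟ j)) (∏-if-Fin d x (w x))) (sym (∏-colours w xs)) ⟩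
  w x * ∏ xs w ∎)
  where
  open ≡-Reasoning
  select : ∀ j → Dec (x ≡ j) → w j ^ ι (j Fin.≟ x) ≡ (if does (x Fin.≟ j) then w x else 1ℤ)
  select j (yes refl) = trans (cong (w j ^_) (ι-yes (j Fin.≟ j) refl)) (trans (*-identityʳ (w j)) (sym (if-yes (j Fin.≟ j) refl)))
  select j (no neq)   = trans (cong (w j ^_) (ι-no (j Fin.≟ x) (neq ∘ sym))) (sym (if-no (x Fin.≟ j) neq))

#-∑ : ∀ {d} (j : Fin d) xs → fromℕ (# Fin._≟_ j xs) ≡ ∑ xs (λ x → 𝟙 (j Fin.≟ x))
#-∑ j []       = refl
#-∑ j (x ∷ xs) = cong₂ _+_ (ι-𝟙 (j Fin.≟ x)) (#-∑ j xs)
  where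
  ι-𝟙 : {P : Set} (P? : Dec P) → fromℕ (ι P?) ≡ 𝟙 P?
  ι-𝟙 (yes _) = refl
  ι-𝟙 (no _)  = refl

-- The initial position

module Start (n D m : ℕ) (n≡2+D : n ≡ suc (suc D)) (n≡2m : n ≡ m ℕ.* 2) where

  private
    d : ℕ
    d = suc D

    G : Graph n
    G = K n

  open Letters n d m n≡2+D n≡2m
  open ColourMajor n d m n≡2+D n≡2m
  open Moments (B {n}) B-alt d using (module Fermi)

  -- For e listed before f, `lo e` cannot be `hi f`, and two distinct edges share at most one
  -- vertex; three coincidences remain.
  data Meet (e f : Edge G) : Set where
    apart : lo G e ≢ lo G f → lo G e ≢ hi G f → hi G e ≢ lo G f → hi G e ≢ hi G f → Meet e f
    lo-lo : lo G e ≡ lo G f → lo G e ≢ hi G f → hi G e ≢ lo G f → hi G e ≢ hi G f → Meet e f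
    hi-lo : lo G e ≢ lo G f → lo G e ≢ hi G f → hi G e ≡ lo G f → hi G e ≢ hi G f → Meet e f
    hi-hi : lo G e ≢ lo G f → lo G e ≢ hi G f → hi G e ≢ lo G f → hi G e ≡ hi G f → Meet e f

  private
    <ᶠ⇒≢ : ∀ {u v : Fin n} → u Fin.< v → u ≢ v
    <ᶠ⇒≢ u<v refl = ℕₚ.<-irrefl refl u<v

  meet : ∀ {e f} → e Fin.< f → Meet e f
  meet {e} {f} e<f = by-order (edge-order e<f)
    where
    by-order : (lo G e , hi G e) <ₑ (lo G f , hi G f) → Meet e f
    by-order (inj₂ (a≡a′ , b<b′)) = lo-lo a≡a′ (λ a≡b′ → <ᶠ⇒≢ (lo<hi f) (trans (sym a≡a′) a≡b′)) (λ b≡a′ → <ᶠ⇒≢ (lo<hi e) (trans a≡a′ (sym b≡a′))) (<ᶠ⇒≢ b<b′)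
    by-order (inj₁ a<a′) = by-hi (hi G e Fin.≟ lo G f) (hi G e Fin.≟ hi G f)
      where
      a≢a′ : lo G e ≢ lo G f
      a≢a′ = <ᶠ⇒≢ a<a′
      a≢b′ : lo G e ≢ hi G f
      a≢b′ = <ᶠ⇒≢ (ℕₚ.<-trans a<a′ (lo<hi f))
      by-hi : Dec (hi G e ≡ lo G f) → Dec (hi G e ≡ hi G f) → Meet e f
      by-hi (yes b≡a′) _          = hi-lo a≢a′ a≢b′ b≡a′ (λ b≡b′ → <ᶠ⇒≢ (lo<hi f) (trans (sym b≡a′) b≡b′))
      by-hi (no b≢a′)  (yes b≡b′) = hi-hi a≢a′ a≢b′ b≢a′ b≡b′
      by-hi (no b≢a′)  (no b≢b′)  = apart a≢a′ a≢b′ b≢a′ b≢b′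

  adjacent? : (ef : Edge G × Edge G) → Dec (AdjEdges G (proj₁ ef) (proj₂ ef))
  adjacent? (e , f) = AdjEdges? G e f

  ps : List (Edge G × Edge G)
  ps = filter adjacent? (pairs (allFin N))

  ps-adjacent : ∀ e f → AdjEdges G e f → (e , f) ∈ ps ⊎ (f , e) ∈ ps
  ps-adjacent e f adj@(e≢f , v , ve , vf) = by-cases (∈-pairs (∈-allFin e) (∈-allFin f) e≢f)
    where
    by-cases : (e , f) ∈ pairs (allFin N) ⊎ (f , e) ∈ pairs (allFin N) → (e , f) ∈ ps ⊎ (f , e) ∈ ps
    by-cases (inj₁ q) = inj₁ (∈-filter⁺ adjacent? q adj)
    by-cases (inj₂ q) = inj₂ (∈-filter⁺ adjacent? q (e≢f ∘ sym , v , vf , ve))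

  private
    adjacent-if : ∀ {e f} → e Fin.< f → ∀ v → Incident G v e → Incident G v f → AdjEdges G e f
    adjacent-if e<f v ve vf = (λ { refl → ℕₚ.<-irrefl refl e<f }) , v , ve , vf

    not-adjacent : ∀ {e f} → lo G e ≢ lo G f → lo G e ≢ hi G f → hi G e ≢ lo G f → hi G e ≢ hi G f → ¬ AdjEdges G e f
    not-adjacent p q r s (_ , v , inj₁ ve , inj₁ vf) = p (trans (sym ve) vf)
    not-adjacent p q r s (_ , v , inj₁ ve , inj₂ vf) = q (trans (sym ve) vf)
    not-adjacent p q r s (_ , v , inj₂ ve , inj₁ vf) = r (trans (sym ve) vf)
    not-adjacent p q r s (_ , v , inj₂ ve , inj₂ vf) = s (trans (sym ve) vf)

    adjacent-sum : ∀ e f → e Fin.< f →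
      (𝟙 (lo G e Fin.≟ lo G f) + 𝟙 (lo G e Fin.≟ hi G f)) + (𝟙 (hi G e Fin.≟ lo G f) + 𝟙 (hi G e Fin.≟ hi G f)) ≡ 𝟙 (AdjEdges? G e f)
    adjacent-sum e f e<f = by-cases (meet e<f)
      where
      collect : ∀ {w x y z} → 𝟙 (lo G e Fin.≟ lo G f) ≡ w → 𝟙 (lo G e Fin.≟ hi G f) ≡ x → 𝟙 (hi G e Fin.≟ lo G f) ≡ y → 𝟙 (hi G e Fin.≟ hi G f) ≡ z →
        (𝟙 (lo G e Fin.≟ lo G f) + 𝟙 (lo G e Fin.≟ hi G f)) + (𝟙 (hi G e Fin.≟ lo G f) + 𝟙 (hi G e Fin.≟ hi G f)) ≡ (w + x) + (y + z)
      collect p q r s = cong₂ _+_ (cong₂ _+_ p q) (cong₂ _+_ r s)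
      by-cases : Meet e f → _ ≡ 𝟙 (AdjEdges? G e f)
      by-cases (apart p q r s) = trans (collect (𝟙-no (_ Fin.≟ _) p) (𝟙-no (_ Fin.≟ _) q) (𝟙-no (_ Fin.≟ _) r) (𝟙-no (_ Fin.≟ _) s)) (sym (𝟙-no (AdjEdges? G e f) (not-adjacent p q r s)))
      by-cases (lo-lo p q r s) = trans (collect (𝟙-yes (_ Fin.≟ _) p) (𝟙-no (_ Fin.≟ _) q) (𝟙-no (_ Fin.≟ _) r) (𝟙-no (_ Fin.≟ _) s)) (sym (𝟙-yes (AdjEdges? G e f) (adjacent-if e<f (lo G e) (inj₁ refl) (inj₁ p))))
      by-cases (hi-lo p q r s) = trans (collect (𝟙-no (_ Fin.≟ _) p) (𝟙-no (_ Fin.≟ _) q) (𝟙-yes (_ Fin.≟ _) r) (𝟙-no (_ Fin.≟ _) s)) (sym (𝟙-yes (AdjEdges? G e f) (adjacent-if e<f (hi G e) (inj₂ refl) (inj₁ r))))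
      by-cases (hi-hi p q r s) = trans (collect (𝟙-no (_ Fin.≟ _) p) (𝟙-no (_ Fin.≟ _) q) (𝟙-no (_ Fin.≟ _) r) (𝟙-yes (_ Fin.≟ _) s)) (sym (𝟙-yes (AdjEdges? G e f) (adjacent-if e<f (hi G e) (inj₂ refl) (inj₂ s))))

    same-vertex : Fin n × Fin d → Fin n × Fin d → ℤ
    same-vertex x y = 𝟙 (proj₁ x Fin.≟ proj₁ y)

    letters-vertex : ∀ u is → ∑ (letters is) (λ y → 𝟙 (u Fin.≟ proj₁ y)) ≡ fromℕ (length is)
    letters-vertex u []       = refl
    letters-vertex u (i ∷ is) = trans (∑-++ (map (_, i) (allFin n)) (letters is) _) (cong₂ _+_ (trans (∑-map (_, i) (allFin n) _)
      (trans (∑-cong (allFin n) λ v → trans (𝟙-⇔ (u Fin.≟ v) (v Fin.≟ u) sym sym) (sym (*-identityʳ (𝟙 (v Fin.≟ u))))) (∑-𝟙-Fin n u (λ _ → 1ℤ)))) (letters-vertex u is))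

    same-vertex-count : ∀ is → ℤ.+ 2 * ∑ₚ same-vertex (letters is) ≡ fromℕ n * (fromℕ (length is) * fromℕ (length is) - fromℕ (length is))
    same-vertex-count []       = sym (*-zeroʳ (fromℕ n))
    same-vertex-count (i ∷ is) = begin
      ℤ.+ 2 * ∑ₚ same-vertex (map (_, i) (allFin n) ++ letters is)
        ≡⟨ cong (ℤ.+ 2 *_) (trans (∑ₚ-++ same-vertex (map (_, i) (allFin n)) (letters is)) (cong₂ _+_ block (cong (_+ ∑ₚ same-vertex (letters is)) cross))) ⟩
      ℤ.+ 2 * (0ℤ + (fromℕ n * l + ∑ₚ same-vertex (letters is)))
        ≡⟨ lemma (fromℕ n) l (∑ₚ same-vertex (letters is)) ⟩
      ℤ.+ 2 * (fromℕ n * l) + ℤ.+ 2 * ∑ₚ same-vertex (letters is)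
        ≡⟨ cong (ℤ.+ 2 * (fromℕ n * l) +_) (same-vertex-count is) ⟩
      ℤ.+ 2 * (fromℕ n * l) + fromℕ n * (l * l - l)
        ≡⟨ lemma′ (fromℕ n) l ⟩
      fromℕ n * ((1ℤ + l) * (1ℤ + l) - (1ℤ + l)) ∎
      where
      open ≡-Reasoning
      l : ℤ
      l = fromℕ (length is)
      lemma : ∀ n l s → ℤ.+ 2 * (0ℤ + (n * l + s)) ≡ ℤ.+ 2 * (n * l) + ℤ.+ 2 * s
      lemma = solve-∀
      lemma′ : ∀ n l → ℤ.+ 2 * (n * l) + n * (l * l - l) ≡ n * ((1ℤ + l) * (1ℤ + l) - (1ℤ + l))
      lemma′ = solve-∀
      ∑ₚ-zero : (xs : List (Fin n)) → ∑ₚ (λ _ _ → 0ℤ) xs ≡ 0ℤ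
      ∑ₚ-zero []       = refl
      ∑ₚ-zero (x ∷ xs) = cong₂ _+_ (∑-zero xs λ _ → refl) (∑ₚ-zero xs)
      block : ∑ₚ same-vertex (map (_, i) (allFin n)) ≡ 0ℤ
      block = trans (∑ₚ-map same-vertex (_, i) (allFin n)) (trans (∑ₚ-cong (AllPairs.map (λ {u} {v} u<v → 𝟙-no (u Fin.≟ v) (<ᶠ⇒≢ u<v)) (allFin-sorted n))) (∑ₚ-zero (allFin n)))
      cross : ∑ (map (_, i) (allFin n)) (λ x → ∑ (letters is) (same-vertex x)) ≡ fromℕ n * l
      cross = trans (∑-map (_, i) (allFin n) _) (trans (∑-cong (allFin n) λ u → trans (letters-vertex u is) (sym (*-identityˡ l)))
              (trans (∑-*ʳ (allFin n) (λ _ → 1ℤ) l) (cong (_* l) (trans (∑-one (allFin n)) (cong fromℕ (length-allFin n))))))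

    word-adjacency : ∀ (c : Vec (Fin d) N) → ∑ₚ same-vertex (word es c) ≡ fromℕ (length ps)
    word-adjacency c = begin
      ∑ₚ same-vertex (word es c)
        ≡⟨ ∑ₚ-double same-vertex _ _ (allFin N) ⟩
      ∑ (allFin N) (λ e → 𝟙 (lo G e Fin.≟ hi G e)) + ∑ₚ q₄ (allFin N)
        ≡⟨ cong₂ _+_ (∑-zero (allFin N) λ e → 𝟙-no (lo G e Fin.≟ hi G e) (<ᶠ⇒≢ (lo<hi e))) (∑ₚ-cong (AllPairs.map (λ {e} {f} → adjacent-sum e f) (allFin-sorted N))) ⟩
      0ℤ + ∑ₚ (λ e f → 𝟙 (AdjEdges? G e f)) (allFin N)
        ≡⟨ trans (+-identityˡ _) (sym (∑-pairs (λ e f → 𝟙 (AdjEdges? G e f)) (allFin N))) ⟩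
      ∑ (pairs (allFin N)) (λ ef → 𝟙 (adjacent? ef))
        ≡⟨ ∑-cong (pairs (allFin N)) (λ ef → sym (*-identityʳ (𝟙 (adjacent? ef)))) ⟩
      ∑ (pairs (allFin N)) (λ ef → 𝟙 (adjacent? ef) * 1ℤ)
        ≡⟨ sym (∑-filter adjacent? (pairs (allFin N)) (λ _ → 1ℤ)) ⟩
      ∑ ps (λ _ → 1ℤ)
        ≡⟨ ∑-one ps ⟩
      fromℕ (length ps) ∎
      where
      open ≡-Reasoning
      q₄ : Edge G → Edge G → ℤ
      q₄ e f = (𝟙 (lo G e Fin.≟ lo G f) + 𝟙 (lo G e Fin.≟ hi G f)) + (𝟙 (hi G e Fin.≟ lo G f) + 𝟙 (hi G e Fin.≟ hi G f))

  -- Adjacent pairs of edges correspond to pairs of letters at one vertex, a count that ignores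
  -- order and may be made on `alphabet`: n vertices with d letters each. The calculation is doubled
  -- to avoid division. It shows that exponent D at every edge has exactly the degree of the graph
  -- polynomial.
  length-ps : ∀ (c : Vec (Fin d) N) → word es c ↭ alphabet → length ps ≡ N ℕ.* D
  length-ps c full = ℕₚ.*-cancelʳ-≡ (length ps) (N ℕ.* D) 2 (trans (+-injective (begin
    fromℕ (length ps ℕ.* 2)
      ≡⟨ trans (cong fromℕ (ℕₚ.*-comm (length ps) 2)) (pos-* 2 (length ps)) ⟩
    ℤ.+ 2 * fromℕ (length ps)
      ≡⟨ cong (ℤ.+ 2 *_) (trans (sym (word-adjacency c)) (∑ₚ-↭ same-vertex (λ x y → 𝟙-⇔ (proj₁ x Fin.≟ proj₁ y) (proj₁ y Fin.≟ proj₁ x) sym sym) full)) ⟩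
    ℤ.+ 2 * ∑ₚ same-vertex alphabet
      ≡⟨ trans (same-vertex-count (allFin d)) (cong (λ l → fromℕ n * (fromℕ l * fromℕ l - fromℕ l)) (length-allFin d)) ⟩
    fromℕ n * (fromℕ d * fromℕ d - fromℕ d)
      ≡⟨ lemma (fromℕ n) (fromℕ D) ⟩
    fromℕ d * fromℕ n * fromℕ D
      ≡⟨ trans (cong (_* fromℕ D) (sym (pos-* d n))) (sym (pos-* (d ℕ.* n) D)) ⟩
    fromℕ (d ℕ.* n ℕ.* D) ∎))
    (trans (cong (ℕ._* D) (sym 2N)) (rearrange N D)))
    where
    open ≡-Reasoning
    lemma : ∀ n D → n * ((1ℤ + D) * (1ℤ + D) - (1ℤ + D)) ≡ (1ℤ + D) * n * D
    lemma = solve-∀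
    rearrange : ∀ N D → N ℕ.* 2 ℕ.* D ≡ N ℕ.* D ℕ.* 2
    rearrange = ℕ-solve-∀

  private
    value : Fin d → ℤ
    value i = fromℕ (toℕ i)

    -- Comparison with the vertex first, except that two letters at one vertex contribute the
    -- difference of their colours instead of its sign. On a colouring word this produces one factor
    -- of the graph polynomial for each adjacent pair.
    t₂ : Fin n × Fin d → Fin n × Fin d → ℤ
    t₂ (u , i) (v , j) = sign< u v + 𝟙 (u Fin.≟ v) * (value j - value i)

    t₂-anti : ∀ x y → t₂ x y ≡ - t₂ y x
    t₂-anti (u , i) (v , j) = trans (cong₂ (λ a b → a + b * (value j - value i)) (sign<-anti u v) (𝟙-⇔ (u Fin.≟ v) (v Fin.≟ u) sym sym))
                                    (lemma (sign< v u) (𝟙 (v Fin.≟ u)) (value i) (value j))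
      where
      lemma : ∀ s b i j → - s + b * (j - i) ≡ - (s + b * (i - j))
      lemma = solve-∀

    t₂-other : ∀ u v i j → u ≢ v → t₂ (u , i) (v , j) ≡ sign< u v
    t₂-other u v i j u≢v = trans (cong (λ b → sign< u v + b * (value j - value i)) (𝟙-no (u Fin.≟ v) u≢v)) (+-identityʳ (sign< u v))

    t₂-same : ∀ u v i j → u ≡ v → t₂ (u , i) (v , j) ≡ value j - value i
    t₂-same u v i j refl = trans (cong₂ (λ a b → a + b * (value j - value i)) (sign<-refl u) (𝟙-yes (u Fin.≟ u) refl))
                                 (trans (+-identityˡ _) (*-identityˡ (value j - value i)))

    sign<-≢0 : ∀ {u v : Fin n} → u ≢ v → sign< u v ≢ 0ℤ
    sign<-≢0 {u} {v} u≢v eq = contradiction (trans (sym (sign<-square u≢v)) (cong (_* sign< u v) eq)) λ ()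

    A₂ : List (Fin n × Fin d) → ℤ
    A₂ = ∏ₚ t₂

    A₂-alphabet : A₂ alphabet ≢ 0ℤ
    A₂-alphabet = ∏ₚ-≢0 (AllPairs.map (λ {x} {y} → distinct x y) alphabet-unique)
      where
      distinct : ∀ x y → x ≢ y → t₂ x y ≢ 0ℤ
      distinct (u , i) (v , j) x≢y = by-cases (u Fin.≟ v)
        where
        by-cases : Dec (u ≡ v) → t₂ (u , i) (v , j) ≢ 0ℤ
        by-cases (no u≢v)   eq = sign<-≢0 u≢v (trans (sym (t₂-other u v i j u≢v)) eq)
        by-cases (yes refl) eq = x≢y (cong (u ,_) (sym (Fin.toℕ-injective (+-injective (i-j≡0⇒i≡j (value j) (value i) (trans (sym (t₂-same u u i j refl)) eq))))))
      letters-unique : ∀ is → Unique is → Unique (letters is)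
      letters-unique []       []        = []
      letters-unique (i ∷ is) (i∉ ∷ un) = Uniqueₚ.++⁺ (Uniqueₚ.map⁺ (cong proj₁) (Uniqueₚ.allFin⁺ n)) (letters-unique is un) disjoint
        where
        colour-∈ : ∀ {x} js → x ∈ letters js → proj₂ x ∈ js
        colour-∈ (j ∷ js) x∈ with ∈-++⁻ (map (_, j) (allFin n)) x∈
        ... | inj₂ x∈′ = there (colour-∈ js x∈′)
        ... | inj₁ x∈′ with ∈-map⁻ (_, j) {xs = allFin n} x∈′
        ...   | _ , _ , refl = here refl
        disjoint : ∀ {x} → ¬ (x ∈ map (_, i) (allFin n) × x ∈ letters is)
        disjoint (x∈ , x∈′) with ∈-map⁻ (_, i) {xs = allFin n} x∈
        ... | _ , _ , refl = All¬⇒¬Any i∉ (colour-∈ is x∈′)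
      alphabet-unique : Unique alphabet
      alphabet-unique = letters-unique (allFin d) (Uniqueₚ.allFin⁺ d)

    -- What is left of `t₂` once the colour differences are split off: coinciding vertices count 1.
    -- Its products do not depend on the colouring.
    s′ : Fin n → Fin n → ℤ
    s′ u v = sign< u v + 𝟙 (u Fin.≟ v)

    s′-other : ∀ u v → u ≢ v → s′ u v ≡ sign< u v
    s′-other u v u≢v = trans (cong (sign< u v +_) (𝟙-no (u Fin.≟ v) u≢v)) (+-identityʳ (sign< u v))

    s′-same : ∀ u v → u ≡ v → s′ u v ≡ 1ℤ
    s′-same u v refl = cong₂ _+_ (sign<-refl u) (𝟙-yes (u Fin.≟ u) refl)

    κ : Edge G → Edge G → ℤ
    κ e f = (s′ (lo G e) (lo G f) * s′ (lo G e) (hi G f)) * (s′ (hi G e) (lo G f) * s′ (hi G e) (hi G f))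

    κ-product : ℤ
    κ-product = ∏ₚ κ (allFin N)

  module _ (c : Vec (Fin d) N) where

    private
      col : Edge G → Fin d
      col = Vec.lookup c

      δ : Edge G → Edge G → ℤ
      δ e f = value (col f) - value (col e)

      T₂ : Edge G → Edge G → ℤ
      T₂ e f = (t₂ (lo G e , col e) (lo G f , col f) * t₂ (lo G e , col e) (hi G f , col f))
             * (t₂ (hi G e , col e) (lo G f , col f) * t₂ (hi G e , col e) (hi G f , col f))

      factor : Edge G → Edge G → ℤ
      factor e f = if does (AdjEdges? G e f) then δ e f else 1ℤ

    graph-polynomial : ℤ
    graph-polynomial = ∏ ps (λ (e , f) → value (Vec.lookup c f) - value (Vec.lookup c e))

    private
      T₂-split : ∀ e f → e Fin.< f → T₂ e f ≡ κ e f * factor e f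
      T₂-split e f e<f = by-cases (meet e<f)
        where
        a b a′ b′ : Fin n
        a = lo G e
        b = hi G e
        a′ = lo G f
        b′ = hi G f
        same : ∀ u v → u ≡ v → t₂ (u , col e) (v , col f) ≡ s′ u v * δ e f
        same u v u≡v = trans (t₂-same u v (col e) (col f) u≡v) (sym (trans (cong (_* δ e f) (s′-same u v u≡v)) (*-identityˡ (δ e f))))
        other : ∀ u v → u ≢ v → t₂ (u , col e) (v , col f) ≡ s′ u v
        other u v u≢v = trans (t₂-other u v (col e) (col f) u≢v) (sym (s′-other u v u≢v))
        adjacent : ∀ v → Incident G v e → Incident G v f → κ e f * δ e f ≡ κ e f * factor e f
        adjacent v ve vf = cong (κ e f *_) (sym (if-yes (AdjEdges? G e f) (adjacent-if e<f v ve vf)))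
        r₁ : ∀ p q r s x → ((p * x) * q) * (r * s) ≡ ((p * q) * (r * s)) * x
        r₁ = solve-∀
        r₃ : ∀ p q r s x → (p * q) * ((r * x) * s) ≡ ((p * q) * (r * s)) * x
        r₃ = solve-∀
        r₄ : ∀ p q r s x → (p * q) * (r * (s * x)) ≡ ((p * q) * (r * s)) * x
        r₄ = solve-∀
        by-cases : Meet e f → T₂ e f ≡ κ e f * factor e f
        by-cases (apart p q r s) = trans (cong₂ _*_ (cong₂ _*_ (other a a′ p) (other a b′ q)) (cong₂ _*_ (other b a′ r) (other b b′ s)))
          (sym (trans (cong (κ e f *_) (if-no (AdjEdges? G e f) (not-adjacent p q r s))) (*-identityʳ (κ e f))))
        by-cases (lo-lo p q r s) = trans (cong₂ _*_ (cong₂ _*_ (same a a′ p) (other a b′ q)) (cong₂ _*_ (other b a′ r) (other b b′ s)))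
          (trans (r₁ (s′ a a′) (s′ a b′) (s′ b a′) (s′ b b′) (δ e f)) (adjacent a (inj₁ refl) (inj₁ p)))
        by-cases (hi-lo p q r s) = trans (cong₂ _*_ (cong₂ _*_ (other a a′ p) (other a b′ q)) (cong₂ _*_ (same b a′ r) (other b b′ s)))
          (trans (r₃ (s′ a a′) (s′ a b′) (s′ b a′) (s′ b b′) (δ e f)) (adjacent b (inj₂ refl) (inj₁ r)))
        by-cases (hi-hi p q r s) = trans (cong₂ _*_ (cong₂ _*_ (other a a′ p) (other a b′ q)) (cong₂ _*_ (other b a′ r) (same b b′ s)))
          (trans (r₄ (s′ a a′) (s′ a b′) (s′ b a′) (s′ b b′) (δ e f)) (adjacent b (inj₂ refl) (inj₂ s)))

    A₂-word : A₂ (word es c) ≡ κ-product * graph-polynomial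
    A₂-word = begin
      A₂ (word es c)
        ≡⟨ ∏ₚ-double t₂ _ _ (allFin N) ⟩
      ∏ (allFin N) (λ e → t₂ (lo G e , col e) (hi G e , col e)) * ∏ₚ T₂ (allFin N)
        ≡⟨ cong₂ _*_ (∏-one (allFin N) λ e → trans (t₂-other (lo G e) (hi G e) (col e) (col e) (<ᶠ⇒≢ (lo<hi e))) (sign<-1 (lo<hi e)))
                     (∏ₚ-cong (AllPairs.map (λ {e} {f} → T₂-split e f) (allFin-sorted N))) ⟩
      1ℤ * ∏ₚ (λ e f → κ e f * factor e f) (allFin N)
        ≡⟨ trans (*-identityˡ _) (∏ₚ-* κ factor (allFin N)) ⟩
      κ-product * ∏ₚ factor (allFin N)
        ≡⟨ cong (κ-product *_) (trans (sym (∏-pairs factor (allFin N))) (sym (∏-filter adjacent? (pairs (allFin N)) (λ (e , f) → δ e f)))) ⟩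
      κ-product * graph-polynomial ∎
      where open ≡-Reasoning

    colour-count : word es c ↭ alphabet → ∀ j → # Fin._≟_ j (map col (allFin N)) ≡ m
    colour-count full j = ℕₚ.*-cancelʳ-≡ (# Fin._≟_ j (map col (allFin N))) m 2 (trans (+-injective (begin
      fromℕ (# Fin._≟_ j (map col (allFin N)) ℕ.* 2)
        ≡⟨ trans (pos-* (# Fin._≟_ j (map col (allFin N))) 2) (cong (_* ℤ.+ 2) (trans (#-∑ j (map col (allFin N))) (∑-map col (allFin N) _))) ⟩
      ∑ (allFin N) (λ e → 𝟙 (j Fin.≟ col e)) * ℤ.+ 2
        ≡⟨ sym (trans (∑-cong (allFin N) λ e → twice (𝟙 (j Fin.≟ col e))) (∑-*ʳ (allFin N) (λ e → 𝟙 (j Fin.≟ col e)) (ℤ.+ 2))) ⟩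
      ∑ (allFin N) (λ e → 𝟙 (j Fin.≟ col e) + 𝟙 (j Fin.≟ col e))
        ≡⟨ sym (∑-double _ _ (allFin N) (λ z → 𝟙 (j Fin.≟ proj₂ z))) ⟩
      ∑ (word es c) (λ z → 𝟙 (j Fin.≟ proj₂ z))
        ≡⟨ ∑-↭ full _ ⟩
      ∑ alphabet (λ z → 𝟙 (j Fin.≟ proj₂ z))
        ≡⟨ trans (letters-colour (allFin d)) (trans (cong (_* fromℕ n) (sym (#-∑ j (allFin d)))) (trans (cong (λ k → fromℕ k * fromℕ n) (#-allFin d j)) (*-identityˡ (fromℕ n)))) ⟩
      fromℕ n ∎)) n≡2m)
      where
      open ≡-Reasoning
      twice : ∀ a → a + a ≡ a * ℤ.+ 2
      twice = solve-∀
      letters-colour : ∀ is → ∑ (letters is) (λ z → 𝟙 (j Fin.≟ proj₂ z)) ≡ ∑ is (λ i → 𝟙 (j Fin.≟ i)) * fromℕ n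
      letters-colour []       = refl
      letters-colour (i ∷ is) = trans (∑-++ (map (_, i) (allFin n)) (letters is) _)
        (trans (cong₂ _+_ (trans (∑-map (_, i) (allFin n) _) (trans (∑-cong (allFin n) λ _ → sym (*-identityʳ (𝟙 (j Fin.≟ i))))
                  (trans (∑-*ˡ (allFin n) (𝟙 (j Fin.≟ i)) (λ _ → 1ℤ)) (cong (𝟙 (j Fin.≟ i) *_) (trans (∑-one (allFin n)) (cong fromℕ (length-allFin n))))))) (letters-colour is))
               (sym (*-distribʳ-+ (fromℕ n) (𝟙 (j Fin.≟ i)) _)))

  private
    weight : Fin d → ℤ
    weight x = difference D (toℕ x)

    ψ : Fin d → Edge G → ℕ → ℤ
    ψ x _ j = weight x * value x ^ j

    -- Read in two ways. Exponent by exponent it is a D-th difference at every edge and kills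
    -- monomials with an exponent below D; expanded over colourings it is an alternating sum of
    -- evaluations, which leads to the moment.
    L₀ : Vec ℕ N → ℤ
    L₀ = prod (λ e j → ∑[ x ← allFin d ] ψ x e j)

    0s : Vec ℕ N
    0s = Vec.replicate N 0

    W₀ : ℤ
    W₀ = ∏ (allFin d) (λ j → weight j ^ m)

    W₀-≢0 : W₀ ≢ 0ℤ
    W₀-≢0 = ∏-≢0 (allFin d) λ j → power m (difference-≢0 D (toℕ j) (ℕ.s≤s⁻¹ (Fin.toℕ<n j)))
      where
      power : ∀ k {a} → a ≢ 0ℤ → a ^ k ≢ 0ℤ
      power zero    a≢0 ()
      power (suc k) a≢0 = *-≢0 a≢0 (power k a≢0)

    W : Vec (Fin d) N → ℤ
    W c = prod (λ e → ψ (Vec.lookup c e) e) 0s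

    W-full : ∀ c → word es c ↭ alphabet → W c ≡ W₀
    W-full c full = begin
      W c
        ≡⟨ prod-zeros (λ e → ψ (Vec.lookup c e) e) ⟩
      ∏ (allFin N) (λ e → weight (Vec.lookup c e) * 1ℤ)
        ≡⟨ trans (∏-cong (allFin N) λ e → *-identityʳ (weight (Vec.lookup c e))) (sym (∏-map (Vec.lookup c) (allFin N) weight)) ⟩
      ∏ (map (Vec.lookup c) (allFin N)) weight
        ≡⟨ ∏-colours weight (map (Vec.lookup c) (allFin N)) ⟩
      ∏ (allFin d) (λ j → weight j ^ # Fin._≟_ j (map (Vec.lookup c) (allFin N)))
        ≡⟨ ∏-cong (allFin d) (λ j → cong (weight j ^_) (colour-count c full j)) ⟩
      W₀ ∎
      where
      open ≡-Reasoning
      prod-zeros : ∀ {N} (φ : Fin N → ℕ → ℤ) → prod φ (Vec.replicate N 0) ≡ ∏ (allFin N) (λ e → φ e 0)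
      prod-zeros {zero}  φ = refl
      prod-zeros {suc N} φ = trans (cong (φ zero 0 *_) (trans (prod-zeros (φ ∘ suc)) (sym (∏-map suc (allFin N) (λ e → φ e 0)))))
                                   (cong (λ l → ∏ l (λ e → φ e 0)) (sym (allFin-suc N)))

    Li-L₀ : Li ps L₀ 0s ≡ ∑ᵛ (allFin d) N (λ c → graph-polynomial c * W c)
    Li-L₀ = trans (Li-cong ps (prod-∑ (allFin d) ψ) 0s)
            (trans (Li-∑ᵛ ps (allFin d) N (λ c → prod (λ e → ψ (Vec.lookup c e) e)) 0s)
                   (∑ᵛ-cong (allFin d) N λ c → Li-evaluation (λ e → value (Vec.lookup c e)) (λ e → ψ (Vec.lookup c e) e)
                      (λ e j → swap-* (weight (Vec.lookup c e)) (value (Vec.lookup c e)) (value (Vec.lookup c e) ^ j)) ps 0s))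
      where
      swap-* : ∀ a b c → a * (b * c) ≡ b * (a * c)
      swap-* = solve-∀

    f₀ : ℕ
    f₀ = d ℕ.* n

    -- The alternating evaluation of the graph polynomial of the line graph
    -- is a nonzero multiple of the fermionic moment.
    Li-moment : κ-product * Li ps L₀ 0s ≡ (A₂ alphabet * W₀) * Fermi.moment f₀ es
    Li-moment = begin
      κ-product * Li ps L₀ 0s
        ≡⟨ cong (κ-product *_) Li-L₀ ⟩
      κ-product * ∑ᵛ (allFin d) N (λ c → graph-polynomial c * W c)
        ≡⟨ sym (∑ᵛ-*ˡ (allFin d) N κ-product (λ c → graph-polynomial c * W c)) ⟩
      ∑ᵛ (allFin d) N (λ c → κ-product * (graph-polynomial c * W c))
        ≡⟨ ∑ᵛ-cong (allFin d) N (λ c → trans (sym (*-assoc κ-product (graph-polynomial c) (W c))) (trans (cong (_* W c) (sym (A₂-word c))) (pointwise c))) ⟩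
      ∑ᵛ (allFin d) N (λ c → (A₂ alphabet * W₀) * Fermi.wick f₀ (word es c))
        ≡⟨ ∑ᵛ-*ˡ (allFin d) N (A₂ alphabet * W₀) (λ c → Fermi.wick f₀ (word es c)) ⟩
      (A₂ alphabet * W₀) * ∑ᵛ (allFin d) N (λ c → Fermi.wick f₀ (word es c))
        ≡⟨ cong ((A₂ alphabet * W₀) *_) (sym (moment-words f₀)) ⟩
      (A₂ alphabet * W₀) * Fermi.moment f₀ es ∎
      where
      open ≡-Reasoning
      pointwise : ∀ c → A₂ (word es c) * W c ≡ (A₂ alphabet * W₀) * Fermi.wick f₀ (word es c)
      pointwise c = trans (cong (_* W c) (sym (wick-word A₂ (∏ₚ-anti t₂ t₂-anti) f₀ ℕₚ.≤-refl c))) (by-cases (word-full-or-repeat c))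
        where
        lemma : ∀ w a x → (w * a) * x ≡ (a * x) * w
        lemma = solve-∀
        by-cases : word es c ↭ alphabet ⊎ (∃ λ x → ∃ λ r → word es c ↭ x ∷ x ∷ r) →
                   Fermi.wick f₀ (word es c) * A₂ alphabet * W c ≡ (A₂ alphabet * W₀) * Fermi.wick f₀ (word es c)
        by-cases (inj₁ full) = trans (cong (Fermi.wick f₀ (word es c) * A₂ alphabet *_) (W-full c full)) (lemma (Fermi.wick f₀ (word es c)) (A₂ alphabet) W₀)
        by-cases (inj₂ (x , r , p)) = trans (cong (λ e → e * A₂ alphabet * W c) wick0) (sym (trans (cong ((A₂ alphabet * W₀) *_) wick0) (*-zeroʳ (A₂ alphabet * W₀))))
          where
          wick0 : Fermi.wick f₀ (word es c) ≡ 0ℤ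
          wick0 = anti-repeat (Fermi.wick f₀) (wick-anti f₀) p

  open Game G ps ps-adjacent

  -- The extracted monomial has every exponent at least D, since L₀ does not vanish on it, while its
  -- degree is N D. So every exponent equals D, one less than the number of tokens.
  favourable : Fermi.moment f₀ es ≢ 0ℤ → Favourable Subset.⊤ (λ _ → d)
  favourable moment≢0 = from-extract (extract Li≢0)
    where
    Li≢0 : Li ps L₀ 0s ≢ 0ℤ
    Li≢0 eq = *-≢0 (*-≢0 A₂-alphabet W₀-≢0) moment≢0 (trans (sym Li-moment) (trans (cong (κ-product *_) eq) (*-zeroʳ κ-product)))
    open Extraction ps L₀ 0s
    full : ∃ λ c → word es c ↭ alphabet
    full = found (∑ᵛ-nonzero (allFin d) N (λ c → Fermi.wick f₀ (word es c)) (λ eq → moment≢0 (trans (moment-words f₀) eq)))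
      where
      found : (∃ λ c → Fermi.wick f₀ (word es c) ≢ 0ℤ) → ∃ λ c → word es c ↭ alphabet
      found (c , ≢0) = c , by-cases (word-full-or-repeat c)
        where
        by-cases : word es c ↭ alphabet ⊎ (∃ λ x → ∃ λ r → word es c ↭ x ∷ x ∷ r) → word es c ↭ alphabet
        by-cases (inj₁ p) = p
        by-cases (inj₂ (x , r , p)) = contradiction (anti-repeat (Fermi.wick f₀) (wick-anti f₀) p) ≢0
    all-inside : inside-of Subset.⊤ ≡ ps
    all-inside = Listₚ.filter-all (both? Subset.⊤) (All.universal (λ _ → ∈⊤ , ∈⊤) ps)
    from-extract : (∃ λ a → sumᵛ a ≡ degree × L₀ a ≢ 0ℤ × Li ps (prod (λ i j → 𝟙 (Vec.lookup a i ℕₚ.≟ j))) 0s ≢ 0ℤ) → Favourable Subset.⊤ (λ _ → d)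
    from-extract (a , sum-a , L₀a≢0 , Li-a≢0) =
      prod (λ i j → 𝟙 (Vec.lookup a i ℕₚ.≟ j)) , 0s ,
      subst (λ l → Li l (prod (λ i j → 𝟙 (Vec.lookup a i ℕₚ.≟ j))) 0s ≢ 0ℤ) (sym all-inside) Li-a≢0 ,
      λ b ≢0 e _ → bounded b e ≢0 (Vec.lookup a e ℕₚ.≟ Vec.lookup b e)
      where
      D≤a : ∀ e → D ≤ Vec.lookup a e
      D≤a e = ℕₚ.≮⇒≥ λ a<D → L₀a≢0 (prod-zero (λ e j → ∑[ x ← allFin d ] ψ x e j) a e (difference-power D (Vec.lookup a e) a<D))
      sum-replicate : ∀ N → sumᵛ (Vec.replicate N D) ≡ N ℕ.* D
      sum-replicate zero    = refl
      sum-replicate (suc N) = cong (D ℕ.+_) (sum-replicate N)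
      sum-zeros : ∀ N → sumᵛ (Vec.replicate N 0) ≡ 0
      sum-zeros zero    = refl
      sum-zeros (suc N) = sum-zeros N
      a≡D : Vec.replicate N D ≡ a
      a≡D = sum-≤-≡ (Vec.replicate N D) a (λ i → subst (_≤ Vec.lookup a i) (sym (lookup-replicate i D)) (D≤a i))
        (trans (sum-replicate N) (sym (trans sum-a (trans (cong₂ ℕ._+_ (length-ps (proj₁ full) (proj₂ full)) (sum-zeros N)) (ℕₚ.+-identityʳ (N ℕ.* D))))))
      bounded : ∀ b e → prod (λ i j → 𝟙 (Vec.lookup a i ℕₚ.≟ j)) b ≢ 0ℤ → Dec (Vec.lookup a e ≡ Vec.lookup b e) → Vec.lookup b e < d
      bounded b e _  (yes eq) = s≤s (ℕₚ.≤-reflexive (trans (sym eq) (trans (cong (λ v → Vec.lookup v e) (sym a≡D)) (lookup-replicate e D))))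
      bounded b e ≢0 (no neq) = contradiction (prod-zero (λ i j → 𝟙 (Vec.lookup a i ℕₚ.≟ j)) b e (𝟙-no (Vec.lookup a e ℕₚ.≟ Vec.lookup b e) neq)) ≢0

  paintable : Fermi.moment f₀ es ≢ 0ℤ → EdgePaintable G d
  paintable moment≢0 = painter-wins _ Subset.⊤ (λ _ → d) ℕₚ.≤-refl (favourable moment≢0)

-- Chromatic indices

private
  does⁻ : {P : Set} (P? : Dec P) → does P? ≡ true → P
  does⁻ (yes p) _ = p

  length-filter-≢ : ∀ c xs → Unique xs → length xs ≤ suc (length (filter (λ x → ¬? (x ℕₚ.≟ c)) xs))
  length-filter-≢ c []       []        = z≤n
  length-filter-≢ c (x ∷ xs) (x∉ ∷ un) = by-cases (x ℕₚ.≟ c)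
    where
    ≢c? : ∀ y → Dec (y ≢ c)
    ≢c? y = ¬? (y ℕₚ.≟ c)
    by-cases : Dec (x ≡ c) → suc (length xs) ≤ suc (length (filter ≢c? (x ∷ xs)))
    by-cases (yes refl) = s≤s (ℕₚ.≤-reflexive (cong length (sym (trans (Listₚ.filter-reject ≢c? (λ c≢c → c≢c refl))
                                                                       (Listₚ.filter-all ≢c? (All.map (λ x≢y y≡x → x≢y (sym y≡x)) x∉))))))
    by-cases (no x≢c)   = s≤s (subst (λ l → length xs ≤ length l) (sym (Listₚ.filter-accept ≢c? x≢c)) (length-filter-≢ c xs un))

module _ {n : ℕ} (G : Graph n) where

  private
    open Subset using () renaming (_∈_ to _∈ˢ_)

    Colouring : EdgeSet G → (Edge G → List ℕ) → Set
    Colouring U L = Σ (Edge G → ℕ) λ c → (∀ e → e ∈ˢ U → c e ∈ L e) × (∀ e f → e ∈ˢ U → f ∈ˢ U → AdjEdges G e f → c e ≢ c f)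

    -- Lister marks the edges whose list contains a given colour; painting a matching means giving it that colour.
    colour : ∀ {U t} → PainterWins G U t → (L : Edge G → List ℕ) → (∀ e → Unique (L e)) → (∀ e → e ∈ˢ U → t e ≤ length (L e)) → Colouring U L
    colour (finished ∅) L un t≤L = (λ _ → 0) , (λ e e∈ → contradiction (e , e∈) ∅) , (λ e f e∈ _ _ → contradiction (e , e∈) ∅)
    colour {U} {t} (round 0<t strategy) L un t≤L = by-cases (nonempty? U)
      where
      mark : ∀ e → e ∈ˢ U → ∀ c → c ∈ L e → Colouring U L
      mark e e∈U c c∈ = extend (strategy R (e , R⁺ e∈U c∈) (proj₁ ∘ R⁻))
        where
        Marked? : ∀ f → Dec (f ∈ˢ U × c ∈ L f)
        Marked? f = (f ∈?ˢ U) ×-dec Any.any? (c ℕₚ.≟_) (L f)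
        R : EdgeSet G
        R = Vec.tabulate λ f → does (Marked? f)
        R⁺ : ∀ {f} → f ∈ˢ U → c ∈ L f → f ∈ˢ R
        R⁺ {f} f∈ c∈ = lookup⇒[]= f R (trans (lookup∘tabulate _ f) (dec-true (Marked? f) (f∈ , c∈)))
        R⁻ : ∀ {f} → f ∈ˢ R → f ∈ˢ U × c ∈ L f
        R⁻ {f} f∈ = does⁻ (Marked? f) (trans (sym (lookup∘tabulate _ f)) ([]=⇒lookup f∈))
        L′ : Edge G → List ℕ
        L′ f = filter (λ x → ¬? (x ℕₚ.≟ c)) (L f)
        extend : (∃ λ M → M Subset.⊆ R × IsMatching G M × PainterWins G (U Subset.─ M) (removeTokens G R t)) → Colouring U L
        extend (M , M⊆R , matching , win) = combine (colour win L′ (λ f → Uniqueₚ.filter⁺ _ (un f)) λ f f∈ → enough f (p─q⊆p U M f∈) (f ∈?ˢ R))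
          where
          enough : ∀ f → f ∈ˢ U → Dec (f ∈ˢ R) → removeTokens G R t f ≤ length (L′ f)
          enough f f∈ (yes f∈R) = subst (_≤ length (L′ f)) (sym (if-yes (f ∈?ˢ R) f∈R)) (ℕₚ.∸-monoˡ-≤ 1 (ℕₚ.≤-trans (t≤L f f∈) (length-filter-≢ c (L f) (un f))))
          enough f f∈ (no f∉R)  = subst₂ _≤_ (sym (if-no (f ∈?ˢ R) f∉R)) (cong length (sym (Listₚ.filter-all _ unmarked))) (t≤L f f∈)
            where
            unmarked : All (λ x → x ≢ c) (L f)
            unmarked = All.tabulate λ x∈ x≡c → f∉R (R⁺ f∈ (subst (_∈ L f) x≡c x∈))
          combine : Colouring (U Subset.─ M) L′ → Colouring U L
          combine (c′ , c′∈ , proper) = paint , (λ f f∈ → paint-∈ f f∈ (f ∈?ˢ M)) , (λ f g f∈ g∈ adj → paint-proper f g f∈ g∈ adj (f ∈?ˢ M) (g ∈?ˢ M))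
            where
            paint : Edge G → ℕ
            paint f = if does (f ∈?ˢ M) then c else c′ f
            old : ∀ f → f ∈ˢ U → ¬ f ∈ˢ M → c′ f ∈ L f × c′ f ≢ c
            old f f∈ f∉M = ∈-filter⁻ _ {xs = L f} (c′∈ f (x∈p∧x∉q⇒x∈p─q f∈ f∉M))
            paint-M : ∀ {f} → f ∈ˢ M → paint f ≡ c
            paint-M {f} f∈M = if-yes (f ∈?ˢ M) f∈M
            paint-old : ∀ {f} → ¬ f ∈ˢ M → paint f ≡ c′ f
            paint-old {f} f∉M = if-no (f ∈?ˢ M) f∉M
            paint-∈ : ∀ f → f ∈ˢ U → Dec (f ∈ˢ M) → paint f ∈ L f
            paint-∈ f f∈ (yes f∈M) = subst (_∈ L f) (sym (paint-M f∈M)) (proj₂ (R⁻ (M⊆R f∈M)))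
            paint-∈ f f∈ (no f∉M)  = subst (_∈ L f) (sym (paint-old f∉M)) (proj₁ (old f f∈ f∉M))
            paint-proper : ∀ f g → f ∈ˢ U → g ∈ˢ U → AdjEdges G f g → Dec (f ∈ˢ M) → Dec (g ∈ˢ M) → paint f ≢ paint g
            paint-proper f g f∈ g∈ adj (yes f∈M) (yes g∈M) eq = matching f g f∈M g∈M adj
            paint-proper f g f∈ g∈ adj (yes f∈M) (no g∉M)  eq = proj₂ (old g g∈ g∉M) (trans (sym (paint-old g∉M)) (trans (sym eq) (paint-M f∈M)))
            paint-proper f g f∈ g∈ adj (no f∉M)  (yes g∈M) eq = proj₂ (old f f∈ f∉M) (trans (sym (paint-old f∉M)) (trans eq (paint-M g∈M)))
            paint-proper f g f∈ g∈ adj (no f∉M)  (no g∉M)  eq =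
              proper f g (x∈p∧x∉q⇒x∈p─q f∈ f∉M) (x∈p∧x∉q⇒x∈p─q g∈ g∉M) adj (trans (sym (paint-old f∉M)) (trans eq (paint-old g∉M)))
      by-cases : Dec (Subset.Nonempty U) → Colouring U L
      -- A `round` position may have every edge coloured, and then nothing can be marked.
      by-cases (no ∅)          = colour (finished ∅) L un t≤L
      by-cases (yes (e , e∈U)) = some-colour (L e) refl
        where
        some-colour : ∀ cs → L e ≡ cs → Colouring U L
        some-colour []       eq = contradiction (ℕₚ.<-≤-trans (0<t e e∈U) (ℕₚ.≤-trans (t≤L e e∈U) (ℕₚ.≤-reflexive (cong length eq)))) λ ()
        -- The recursion follows the winning derivation, so any colour left at any uncoloured edge
        -- may be played next.
        some-colour (c ∷ cs) eq = mark e e∈U c (subst (c ∈_) (sym eq) (here refl))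

  paintable⇒choosable : ∀ {k} → EdgePaintable G k → EdgeChoosable G k
  paintable⇒choosable win L lists = everywhere (colour win L (proj₁ ∘ lists) λ e _ → ℕₚ.≤-reflexive (sym (proj₂ (lists e))))
    where
    everywhere : Colouring Subset.⊤ L → Σ (Edge G → ℕ) λ c → (∀ e → c e ∈ L e) × Proper G c
    everywhere (c , c∈ , proper) = c , (λ e → c∈ e ∈⊤) , (λ e f → proper e f ∈⊤ ∈⊤)

  choosable⇒colourable : ∀ {k} → EdgeChoosable G k → EdgeColorable G k
  choosable⇒colourable {k} choose = bounded (choose (λ _ → upTo k) λ _ → Uniqueₚ.upTo⁺ k , Listₚ.length-upTo k)
    where
    bounded : (Σ (Edge G → ℕ) λ c → (∀ e → c e ∈ upTo k) × Proper G c) → EdgeColorable G k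
    bounded (c , c∈ , proper) = (λ e → Fin.fromℕ< (∈-upTo⁻ (c∈ e))) , λ e f adj eq → proper e f adj (Fin.fromℕ<-injective _ _ _ _ eq)

K-colourable⇒≥ : ∀ {d j} → EdgeColorable (K (suc d)) j → d ≤ j
K-colourable⇒≥ {d} {j} (c , proper) = Fin.injective⇒≤ {f = c ∘ spoke} λ {x} {y} eq → by-cases x y eq (x Fin.≟ y)
  where
  G : Graph (suc d)
  G = K (suc d)
  spoke-∈ : ∀ i → (zero , suc i) ∈ edges G
  spoke-∈ i = ∈-filter⁺ (λ (u , v) → (u Fin.<? v) ×-dec Graph.adj? G u v) (∈-cartesianProduct⁺ (∈-allFin zero) (∈-allFin (suc i))) (s≤s z≤n , λ ())
  spoke : Fin d → Edge G
  spoke i = Any.index (spoke-∈ i)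
  ends : ∀ i → (zero , suc i) ≡ lookup (edges G) (spoke i)
  ends i = Anyₚ.lookup-index (spoke-∈ i)
  by-cases : ∀ x y → c (spoke x) ≡ c (spoke y) → Dec (x ≡ y) → x ≡ y
  by-cases x y eq (yes x≡y) = x≡y
  by-cases x y eq (no x≢y)  = contradiction eq (proper (spoke x) (spoke y)
    ((λ same → x≢y (Fin.suc-injective (cong proj₂ (trans (ends x) (trans (cong (lookup (edges G)) same) (sym (ends y))))))) ,
     zero , inj₁ (cong proj₁ (ends x)) , inj₁ (cong proj₁ (ends y))))

chromatic-indices : ∀ {n d} → n ≡ suc d → EdgePaintable (K n) d → χ′≡ (K n) d × χ′ℓ≡ (K n) d × χ′P≡ (K n) d
chromatic-indices {n} {d} refl paintable =
  (choosable⇒colourable G choosable , λ _ → K-colourable⇒≥) ,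
  (choosable , λ _ → K-colourable⇒≥ ∘ choosable⇒colourable G) ,
  (paintable , λ _ → K-colourable⇒≥ ∘ choosable⇒colourable G ∘ paintable⇒choosable G)
  where
  G : Graph n
  G = K n
  choosable : EdgeChoosable G d
  choosable = paintable⇒choosable G paintable

-- The case of an odd prime.

private
  parity : ∀ n → ∃ λ q → n ≡ q ℕ.* 2 ⊎ n ≡ suc (q ℕ.* 2)
  parity zero    = 0 , inj₁ refl
  parity (suc n) with parity n
  ... | q , inj₁ eq = q , inj₂ (cong suc eq)
  ... | q , inj₂ eq = suc q , inj₁ (cong suc eq)

odd-prime : ∀ {p} → Prime p → p ≢ 2 → ∃ λ k → p ≡ suc (suc k ℕ.* 2)
odd-prime {p} p-prime p≢2 with parity p
... | zero  , inj₂ refl = contradiction p-prime ¬prime[1]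
... | suc k , inj₂ p≡   = k , p≡
... | q     , inj₁ p≡   with prime⇒irreducible p-prime (ℕ∣.divides q p≡)
...   | inj₁ ()
...   | inj₂ 2≡p = contradiction (sym 2≡p) p≢2

-- Here n and d stand for p - 1 and p - 2, truncated differences that do not compute for a variable
-- p; hence the equations.
module Result (p : ℕ) (p-prime : Prime p) (k : ℕ) (p≡ : p ≡ suc (suc k ℕ.* 2))
              (n D : ℕ) (n≡2m : n ≡ suc k ℕ.* 2) (n≡2+D : n ≡ suc (suc D)) where

  private
    d : ℕ
    d = suc D

    d≡ : d ≡ suc (k ℕ.* 2)
    d≡ = ℕₚ.suc-injective (trans (sym n≡2+D) n≡2m)

  open Mod p
  open Letters n d (suc k) n≡2+D n≡2m using (es; 2N)
  open Moments (B {n}) B-alt d using (module Fermi)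

  private
    fermi-legendre : ∀ {n d} → n ≡ suc k ℕ.* 2 → d ≡ suc (k ℕ.* 2) → ∀ f → length (complete n) ℕ.* 2 ≤ f →
      Moments.Fermi.moment (B {n}) B-alt d f (complete n) ≈ legendre -[1+ 1 ] p
    fermi-legendre refl refl = Evaluation.fermi≈legendre k p p-prime p≡

    factorial≈1 : ∀ {d} → d ≡ suc (k ℕ.* 2) → fromℕ (d ℕ.!) ≈ 1ℤ
    factorial≈1 refl = Evaluation.d!≈1 k p p-prime p≡

    moment≈legendre : Fermi.moment (d ℕ.* n) es ≈ legendre -[1+ 1 ] p
    moment≈legendre = ≈-trans (≡⇒≈ (cong (Fermi.moment (d ℕ.* n)) (edges-K n)))
      (fermi-legendre n≡2m d≡ (d ℕ.* n) (ℕₚ.≤-reflexive (trans (cong (λ l → length l ℕ.* 2) (sym (edges-K n))) 2N)))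

  S≈legendre : S n ≈ legendre -[1+ 1 ] p
  S≈legendre = ≈-trans (≡⇒≈ (sym (*-identityˡ (S n))))
    (≈-trans (≈-* (≈-sym (factorial≈1 d≡)) (≈-refl {S n}))
    (≈-trans (≡⇒≈ (sym (SignedCount.moment-S n d (suc k) n≡2+D n≡2m (d ℕ.* n) ℕₚ.≤-refl))) moment≈legendre))

  paintable : EdgePaintable (K n) d
  paintable = Start.paintable n D (suc k) n≡2+D n≡2m λ moment≡0 →
    Evaluation.legendre≉0 k p p-prime p≡ (≈-trans (≈-sym moment≈legendre) (≡⇒≈ moment≡0))

theorem1p1 : (p : ℕ) → Prime p → p ≢ 2 →
    (S (p ∸ 1) ≡ legendre -[1+ 1 ] p [mod p ])
    × χ′≡ (K (p ∸ 1)) (p ∸ 2)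
    × χ′ℓ≡ (K (p ∸ 1)) (p ∸ 2)
    × χ′P≡ (K (p ∸ 1)) (p ∸ 2)
theorem1p1 p p-prime p≢2 = from-half (odd-prime p-prime p≢2)
  where
  Claim : ℕ → ℕ → Set
  Claim n d = (S n ≡ legendre -[1+ 1 ] p [mod p ]) × χ′≡ (K n) d × χ′ℓ≡ (K n) d × χ′P≡ (K n) d
  result : ∀ k n d D → p ≡ suc (suc k ℕ.* 2) → n ≡ suc k ℕ.* 2 → n ≡ suc (suc D) → d ≡ suc D → Claim n d
  result k n d D p≡ n≡2m n≡2+D refl = Mod.unmod S≈legendre , chromatic-indices n≡2+D paintable
    where open Result p p-prime k p≡ n D n≡2m n≡2+D using (S≈legendre; paintable)
  from-half : (∃ λ k → p ≡ suc (suc k ℕ.* 2)) → Claim (p ∸ 1) (p ∸ 2)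
  from-half (k , p≡) = result k (p ∸ 1) (p ∸ 2) (k ℕ.* 2) p≡ (cong (_∸ 1) p≡) (cong (_∸ 1) p≡) (cong (_∸ 2) p≡)
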